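{- Let $\mathcal{A}$ be a free arrangement in $V$ and $H\in\mathcal{A}$. If $\mathcal{A}^H$ is free, then $$J_{\mathcal{A}}^H=\bigcap_{X\in\Xi_3(\mathcal{A},H)}J_{\mathcal{A}_X}^H$$ and each $J_{\mathcal{A}_X}^H$ with $X\in\Xi_3(\mathcal{A},H)$ is a height two complete intersection.
   Context: Let $\mathbb{K}$ be a field, $V$ an $\ell$-dimensional $\mathbb{K}$-vector space, $x_1,\dots,x_\ell$ a basis of $V^*$ and $S=\mathrm{Sym}(V^*)=\mathbb{K}[x_1,\dots,x_\ell]$. An arrangement in $V$ is a finite set $\mathcal{A}$ of linear hyperplanes (through the origin) of $V$. For a hyperplane $H$, $\alpha_H\in V^*$ denotes a fixed defining linear form, and $Q(\mathcal{A})=\prod_{H\in\mathcal{A}}\alpha_H$. Let $\Omega_V^1=\bigoplus_i S\,dx_i$, $\Omega_V^2=\bigwedge^2\Omega_V^1$, and for $\alpha=\sum c_ix_i$ let $d\alpha=\sum c_i\,dx_i$. Define $$\Omega^1(\mathcal{A})=\{\omega\in \tfrac{1}{Q(\mathcal{A})}\Omega^1_V \mid Q(\mathcal{A})\,\omega\wedge d\alpha_L\in\alpha_L\Omega_V^2\ \text{for all } L\in\mathcal{A}\}.$$ $\mathcal{A}$ is free if $\Omega^1(\mathcal{A})$ is a free $S$-module (equivalently, if $D(\mathcal{A})=\{\theta\in\bigoplus_i S\,\partial_{x_i}\mid \theta(\alpha_L)\in(\alpha_L)\ \forall L\in\mathcal{A}\}$ is free). For $H\in\mathcal{A}$, the restriction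 is $\mathcal{A}^H=\{H\cap L\mid L\in\mathcal{A},L\ne H\}$, an arrangement in $H$ with coordinate ring $\overline S=S/(\alpha_H)=\mathrm{Sym}(H^*)$ (freeness of $\mathcal{A}^H$ is over $\overline S$); $\overline g$ is the image in $\overline S$ of $g\in S$. The residue map $\mathrm{res}^H_{\mathcal{A}}:\Omega^1(\mathcal{A})\to\overline S$ is $$\mathrm{res}^H_{\mathcal{A}}\big(f\,d\alpha_H+f_2\,d\alpha_2+\cdots+f_\ell\,d\alpha_\ell\big)=\frac{1}{Q(\mathcal{A}^H)}\,\overline{Q(\mathcal{A})f},$$ where $\alpha_H,\alpha_2,\dots,\alpha_\ell$ is any basis of $V^*$ (well defined, independent of the choice of $\alpha_2,\dots,\alpha_\ell$, with values in $\overline S$). The residue ideal $J_{\mathcal{A}}^H\subset\overline S$ is the image of $\mathrm{res}^H_{\mathcal{A}}$. $L(\mathcal{A}^H)$ is the set of all subspaces of $H$ that are intersections of hyperplanes of $\mathcal{A}^H$ (including $H$ as the empty intersection). For a subspace $X$, $\mathcal{A}_X=\{L\in\mathcal{A}\mid X\subseteq L\}$. Define $\Xi(\mathcal{A},H)=\{X\in L(\mathcal{A}^H)\mid J_{\mathcal{A}_X}^H\ne\overline S\}$ and $\Xi_3(\mathcal{A},H)=\{X\in\Xi(\mathcal{A},H)\mid\dim X=\ell-3\}$. An ideal $J\subset\overline S$ is a complete intersection if, for some $k$, it is generated by $k$ elements and $\overline S/J$ has Krull dimension $\ell-1-k$. An empty intersection of ideals of $\overline S$ is $\overline S$. -}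

module Defs where

open import Level using (_⊔_) renaming (suc to lsuc)
open import Algebra.Bundles using (CommutativeRing)
open import Algebra.Apartness using (HeytingField; HeytingCommutativeRing)
open import Axiom.ExcludedMiddle using (ExcludedMiddle)
open import Data.Fin.Base as Fin using (Fin; zero; suc)
open import Data.List.Base using (List; map; filter; deduplicate; foldr)
open import Data.List.Relation.Unary.All as All using (All)
import Data.List.Relation.Unary.All.Properties as All
open import Data.List.Relation.Unary.AllPairs using (AllPairs)
import Data.List.Relation.Unary.AllPairs.Properties as AllPairs
open import Data.List.Relation.Binary.Subset.Propositional using () renaming (_⊆_ to _⊆ₗ_)
open import Data.List.Relation.Unary.Unique.DecSetoid.Properties using (deduplicate-!)
open import Data.Nat.Base as ℕ using (ℕ; suc)
open import Data.Product.Base using (∃; Σ-syntax; _×_; _,_; proj₁; proj₂)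
open import Data.Sum.Base using (_⊎_)
open import Data.Unit.Base using (tt)
open import Data.Vec.Functional as Vector using (Vector)
open import Function.Base using (_∘_)
open import Function.Bundles using (_⇔_; mk⇔; Equivalence)
open import Relation.Binary.Bundles using (DecSetoid)
import Relation.Binary.Reasoning.Setoid as SetoidReasoning
open import Relation.Binary.PropositionalEquality.Core using (_≡_)
open import Relation.Nullary using (¬_; Dec)
open import Relation.Nullary.Decidable using (¬?; decidable-stable)
open import Relation.Unary using (Pred; _∈_; _⊆_; _⊂_; _≐_; U)

module LinearAlgebra {c ℓ} (R : CommutativeRing c ℓ) where
  open CommutativeRing R
  open import Algebra.Properties.Semiring.Sum semiring public
  open SetoidReasoning setoid

  infix 4 _≋_

  _≋_ : ∀ {n} → Vector Carrier n → Vector Carrier n → Set ℓ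
  v ≋ w = ∀ i → v i ≈ w i

  lincomb : ∀ {k n} → Vector Carrier k → Vector (Vector Carrier n) k → Vector Carrier n
  lincomb a b j = sum (λ i → a i * b i j)

  record IsBasis {p n k} (P : Pred (Vector Carrier n) p) (b : Vector (Vector Carrier n) k) :
                 Set (c ⊔ ℓ ⊔ p) where
    field
      inside      : ∀ i → P (b i)
      independent : ∀ a → lincomb a b ≋ (λ _ → 0#) → ∀ i → a i ≈ 0#
      spanning    : ∀ v → P v → ∃ λ a → v ≋ lincomb a b

  δ : ∀ {n} → Fin n → Fin n → Carrier
  δ zero    zero    = 1#
  δ zero    (suc j) = 0#
  δ (suc i) zero    = 0#
  δ (suc i) (suc j) = δ i j

  -- Explicit arguments, as unification cannot invert sum.
  sum-cong : ∀ {n} (v w : Vector Carrier n) → v ≋ w → sum v ≈ sum w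
  sum-cong _ _ = sum-cong-≋

  sum-0 : ∀ {n} (v : Vector Carrier n) → v ≋ (λ _ → 0#) → sum v ≈ 0#
  sum-0 {n} v v≋0 = trans (sum-cong v _ v≋0) (sum-replicate-zero n)

  sum-δˡ : ∀ {n} (i : Fin n) (v : Vector Carrier n) → sum (λ j → δ i j * v j) ≈ v i
  sum-δˡ zero v = trans (+-cong (*-identityˡ _) (sum-0 (λ j → 0# * v (suc j)) (λ _ → zeroˡ _))) (+-identityʳ _)
  sum-δˡ (suc i) v = trans (+-cong (zeroˡ _) (sum-δˡ i (v ∘ suc))) (+-identityˡ _)

  δ-sym : ∀ {n} (i j : Fin n) → δ i j ≈ δ j i
  δ-sym zero    zero    = refl
  δ-sym zero    (suc j) = refl
  δ-sym (suc i) zero    = refl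
  δ-sym (suc i) (suc j) = δ-sym i j

  sum-δʳ : ∀ {n} (i : Fin n) (v : Vector Carrier n) → sum (λ j → v j * δ j i) ≈ v i
  sum-δʳ i v = trans
    (sum-cong (λ j → v j * δ j i) (λ j → δ i j * v j) (λ j → trans (*-comm _ _) (*-congʳ (δ-sym j i))))
    (sum-δˡ i v)

  lincomb-+ : ∀ {k n} (a a′ : Vector Carrier k) (b : Vector (Vector Carrier n) k) →
              lincomb (λ i → a i + a′ i) b ≋ (λ j → lincomb a b j + lincomb a′ b j)
  lincomb-+ a a′ b j = trans
    (sum-cong (λ i → (a i + a′ i) * b i j) (λ i → a i * b i j + a′ i * b i j) (λ i → distribʳ _ _ _))
    (∑-distrib-+ (λ i → a i * b i j) (λ i → a′ i * b i j))

  lincomb-* : ∀ {k n} s (a : Vector Carrier k) (b : Vector (Vector Carrier n) k) →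
              lincomb (λ i → s * a i) b ≋ (λ j → s * lincomb a b j)
  lincomb-* s a b j = trans
    (sum-cong (λ i → (s * a i) * b i j) (λ i → s * (a i * b i j)) (λ i → *-assoc _ _ _))
    (sym (*-distribˡ-sum s (λ i → a i * b i j)))

  lincomb-congˡ : ∀ {k n} (a a′ : Vector Carrier k) (b : Vector (Vector Carrier n) k) →
                  a ≋ a′ → lincomb a b ≋ lincomb a′ b
  lincomb-congˡ a a′ b eq j = sum-cong (λ i → a i * b i j) (λ i → a′ i * b i j) (λ i → *-congʳ (eq i))

  lincomb-congʳ : ∀ {k n} (a : Vector Carrier k) (b b′ : Vector (Vector Carrier n) k) →
                  (∀ i → b i ≋ b′ i) → lincomb a b ≋ lincomb a b′
  lincomb-congʳ a b b′ eq j = sum-cong (λ i → a i * b i j) (λ i → a i * b′ i j) (λ i → *-congˡ (eq i j))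

  lincomb-0 : ∀ {k n} (a : Vector Carrier k) (b : Vector (Vector Carrier n) k) →
              a ≋ (λ _ → 0#) → lincomb a b ≋ (λ _ → 0#)
  lincomb-0 a b eq j = sum-0 (λ i → a i * b i j) (λ i → trans (*-congʳ (eq i)) (zeroˡ _))

  lincomb-assoc : ∀ {k l n} (a : Vector Carrier k) (d : Vector (Vector Carrier l) k)
                  (b : Vector (Vector Carrier n) l) →
                  lincomb a (λ i → lincomb (d i) b) ≋ lincomb (lincomb a d) b
  lincomb-assoc {k} {l} a d b j = begin
    sum (λ i → a i * sum (λ k → d i k * b k j))
      ≈⟨ sum-cong _ (λ i → sum (λ k → f i k)) (λ i → *-distribˡ-sum (a i) (λ k → d i k * b k j)) ⟩
    sum (λ i → sum (λ k → f i k))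
      ≈⟨ ∑-comm f ⟩
    sum (λ k → sum (λ i → f i k))
      ≈⟨ sum-cong _ (λ k → sum (λ i → g i k)) (λ k →
           sum-cong (λ i → f i k) (λ i → g i k) (λ i → sym (*-assoc _ _ _))) ⟩
    sum (λ k → sum (λ i → g i k))
      ≈⟨ sum-cong (λ k → sum (λ i → g i k)) (λ k → lincomb a d k * b k j)
           (λ k → sym (*-distribʳ-sum (b k j) (λ i → a i * d i k))) ⟩
    lincomb (lincomb a d) b j ∎
    where
    f g : Fin k → Fin l → Carrier
    f i k = a i * (d i k * b k j)
    g i k = (a i * d i k) * b k j

  coordinates-unique : ∀ {p n k} {P : Pred (Vector Carrier n) p} {b : Vector (Vector Carrier n) k} →
                       IsBasis P b → ∀ a a′ → lincomb a b ≋ lincomb a′ b → a ≋ a′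
  coordinates-unique {b = b} B a a′ eq i = begin
    a i                      ≈⟨ sym (+-identityʳ _) ⟩
    a i + 0#                 ≈⟨ +-congˡ (sym (-‿inverseˡ _)) ⟩
    a i + (- a′ i + a′ i)    ≈⟨ sym (+-assoc _ _ _) ⟩
    (a i + - a′ i) + a′ i    ≈⟨ +-congʳ (IsBasis.independent B (λ i → a i + - a′ i) diff i) ⟩
    0# + a′ i                ≈⟨ +-identityˡ _ ⟩
    a′ i                     ∎
    where
    diff : lincomb (λ i → a i + - a′ i) b ≋ (λ _ → 0#)
    diff j = begin
      lincomb (λ i → a i + - a′ i) b j
        ≈⟨ lincomb-+ a (λ i → - a′ i) b j ⟩
      lincomb a b j + lincomb (λ i → - a′ i) b j
        ≈⟨ +-congʳ (eq j) ⟩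
      lincomb a′ b j + lincomb (λ i → - a′ i) b j
        ≈⟨ sym (lincomb-+ a′ (λ i → - a′ i) b j) ⟩
      lincomb (λ i → a′ i + - a′ i) b j
        ≈⟨ lincomb-0 (λ i → a′ i + - a′ i) b (λ i → -‿inverseʳ _) j ⟩
      0# ∎

record Ideal {c ℓ} (R : CommutativeRing c ℓ) p : Set (c ⊔ ℓ ⊔ lsuc p) where
  open CommutativeRing R
  field
    member   : Pred Carrier p
    resp     : ∀ {x y} → x ≈ y → member x → member y
    0-closed : member 0#
    +-closed : ∀ {x y} → member x → member y → member (x + y)
    *-closed : ∀ s {x} → member x → member (s * x)

open Ideal public using (member)

module _ {c ℓ p} (R : CommutativeRing c ℓ) (I : Ideal R p) where
  open CommutativeRing R
  open Ideal I hiding (member)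
  open import Algebra.Properties.Ring ring
  open import Algebra.Properties.AbelianGroup +-abelianGroup using (⁻¹-∙-comm)
  open import Algebra.Properties.CommutativeSemigroup +-commutativeSemigroup using (interchange)

  private
    infix 4 _~_
    _~_ : Carrier → Carrier → Set p
    x ~ y = member I (x - y)

    ≈⇒~ : ∀ {x y} → x ≈ y → x ~ y
    ≈⇒~ eq = resp (sym (trans (+-congʳ eq) (-‿inverseʳ _))) 0-closed

    neg : ∀ {x} → member I x → member I (- x)
    neg x∈I = resp (-1*x≈-x _) (*-closed (- 1#) x∈I)

    -‿-‿+ : ∀ x y → - (x - y) ≈ y - x
    -‿-‿+ x y = trans (sym (⁻¹-∙-comm x (- y))) (trans (+-comm _ _) (+-congʳ (-‿involutive y)))

    ~-sym : ∀ {x y} → x ~ y → y ~ x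
    ~-sym {x} {y} p = resp (-‿-‿+ x y) (neg p)

    telescope : ∀ x y z → (x - y) + (y - z) ≈ x - z
    telescope x y z = trans (+-assoc _ _ _) (+-congˡ (trans (sym (+-assoc _ _ _))
      (trans (+-congʳ (-‿inverseˡ y)) (+-identityˡ _))))

    ~-trans : ∀ {x y z} → x ~ y → y ~ z → x ~ z
    ~-trans {x} {y} {z} p q = resp (telescope x y z) (+-closed p q)

    +-~ : ∀ {x y u v} → x ~ y → u ~ v → x + u ~ y + v
    +-~ {x} {y} {u} {v} p q =
      resp (trans (interchange x (- y) u (- v)) (+-congˡ (⁻¹-∙-comm y v))) (+-closed p q)

    *-~ˡ : ∀ s {x y} → x ~ y → s * x ~ s * y
    *-~ˡ s {x} {y} p =
      resp (trans (distribˡ s x (- y)) (+-congˡ (sym (-‿distribʳ-* s y)))) (*-closed s p)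

    *-~ : ∀ {x y u v} → x ~ y → u ~ v → x * u ~ y * v
    *-~ {x} {y} {u} {v} p q = ~-trans (*-~ˡ x q)
      (~-trans (≈⇒~ (*-comm x v)) (~-trans (*-~ˡ v p) (≈⇒~ (*-comm v y))))

  quotientRing : CommutativeRing c p
  quotientRing = record
    { Carrier = Carrier
    ; _≈_ = _~_
    ; _+_ = _+_
    ; _*_ = _*_
    ; -_ = -_
    ; 0# = 0#
    ; 1# = 1#
    ; isCommutativeRing = record
      { isRing = record
        { +-isAbelianGroup = record
          { isGroup = record
            { isMonoid = record
              { isSemigroup = record
                { isMagma = record
                  { isEquivalence = record { refl = ≈⇒~ refl ; sym = ~-sym ; trans = ~-trans }
                  ; ∙-cong = +-~ }
                ; assoc = λ x y z → ≈⇒~ (+-assoc x y z) }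
              ; identity = (λ x → ≈⇒~ (+-identityˡ x)) , (λ x → ≈⇒~ (+-identityʳ x)) }
            ; inverse = (λ x → ≈⇒~ (-‿inverseˡ x)) , (λ x → ≈⇒~ (-‿inverseʳ x))
            ; ⁻¹-cong = λ {x} {y} p → resp (sym (⁻¹-∙-comm x (- y))) (neg p) }
          ; comm = λ x y → ≈⇒~ (+-comm x y) }
        ; *-cong = *-~
        ; *-assoc = λ x y z → ≈⇒~ (*-assoc x y z)
        ; *-identity = (λ x → ≈⇒~ (*-identityˡ x)) , (λ x → ≈⇒~ (*-identityʳ x))
        ; distrib = (λ x y z → ≈⇒~ (distribˡ x y z)) , (λ x y z → ≈⇒~ (distribʳ x y z)) }
      ; *-comm = λ x y → ≈⇒~ (*-comm x y) } }

module Dimension {c ℓ} (R : CommutativeRing c ℓ) where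
  open CommutativeRing R
  open LinearAlgebra R using (sum)

  record PrimeIdeal : Set (lsuc (c ⊔ ℓ)) where
    field
      ideal  : Ideal R (c ⊔ ℓ)
      proper : ¬ member ideal 1#
      prime  : ∀ x y → member ideal (x * y) → member ideal x ⊎ member ideal y

    carrier : Pred Carrier (c ⊔ ℓ)
    carrier = member ideal

  open PrimeIdeal using (carrier)

  PrimeChain : ℕ → Set (lsuc (c ⊔ ℓ))
  PrimeChain n = Σ[ P ∈ (Fin (suc n) → PrimeIdeal) ] (∀ i j → i Fin.< j → carrier (P i) ⊂ carrier (P j))

  HasKrullDimension : ℕ → Set (lsuc (c ⊔ ℓ))
  HasKrullDimension n = PrimeChain n × (∀ k → PrimeChain k → k ℕ.≤ n)

  PrimeChainBelow : PrimeIdeal → ℕ → Set (lsuc (c ⊔ ℓ))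
  PrimeChainBelow Q n = Σ[ P ∈ PrimeChain n ] carrier (proj₁ P (Fin.fromℕ n)) ≐ carrier Q

  PrimeHasHeight : PrimeIdeal → ℕ → Set (lsuc (c ⊔ ℓ))
  PrimeHasHeight Q n = PrimeChainBelow Q n × (∀ k → PrimeChainBelow Q k → k ℕ.≤ n)

  HasHeight : ∀ {p} → Ideal R p → ℕ → Set (lsuc (c ⊔ ℓ) ⊔ p)
  HasHeight I n =
    (Σ[ Q ∈ PrimeIdeal ] member I ⊆ carrier Q × PrimeHasHeight Q n) ×
    (∀ Q k → member I ⊆ carrier Q → PrimeHasHeight Q k → n ℕ.≤ k)

  GeneratedBy : ∀ {p k} → Ideal R p → Vector Carrier k → Set (c ⊔ ℓ ⊔ p)
  GeneratedBy {k = k} I g = member I ≐ (λ x → ∃ λ (a : Vector Carrier k) → x ≈ sum (λ i → a i * g i))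

-- The polynomial ring K[x₁,…,xₙ], presented as the free commutative
-- K-algebra on n generators: polynomial expressions modulo the smallest
-- congruence that contains the commutative ring laws and for which con is
-- a ring homomorphism.
module Polynomials {c ℓ} (K : CommutativeRing c ℓ) where
  private module K = CommutativeRing K

  infixl 7 _⊗_
  infixl 6 _⊕_
  infix  8 ⊝_

  data Poly (n : ℕ) : Set c where
    con     : K.Carrier → Poly n
    var     : Fin n → Poly n
    _⊕_ _⊗_ : Poly n → Poly n → Poly n
    ⊝_      : Poly n → Poly n

  infix 4 _≈ₚ_

  data _≈ₚ_ {n : ℕ} : Poly n → Poly n → Set (c ⊔ ℓ) where
    ≈-refl      : ∀ {f} → f ≈ₚ f
    ≈-sym       : ∀ {f g} → f ≈ₚ g → g ≈ₚ f
    ≈-trans     : ∀ {f g h} → f ≈ₚ g → g ≈ₚ h → f ≈ₚ h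
    ⊕-cong      : ∀ {f f′ g g′} → f ≈ₚ f′ → g ≈ₚ g′ → f ⊕ g ≈ₚ f′ ⊕ g′
    ⊗-cong      : ∀ {f f′ g g′} → f ≈ₚ f′ → g ≈ₚ g′ → f ⊗ g ≈ₚ f′ ⊗ g′
    ⊝-cong      : ∀ {f f′} → f ≈ₚ f′ → ⊝ f ≈ₚ ⊝ f′
    con-cong    : ∀ {a b} → a K.≈ b → con a ≈ₚ con b
    con-+       : ∀ a b → con (a K.+ b) ≈ₚ con a ⊕ con b
    con-*       : ∀ a b → con (a K.* b) ≈ₚ con a ⊗ con b
    ⊕-assoc     : ∀ f g h → (f ⊕ g) ⊕ h ≈ₚ f ⊕ (g ⊕ h)
    ⊕-comm      : ∀ f g → f ⊕ g ≈ₚ g ⊕ f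
    ⊕-identityˡ : ∀ f → con K.0# ⊕ f ≈ₚ f
    ⊝-inverseˡ  : ∀ f → ⊝ f ⊕ f ≈ₚ con K.0#
    ⊗-assoc     : ∀ f g h → (f ⊗ g) ⊗ h ≈ₚ f ⊗ (g ⊗ h)
    ⊗-comm      : ∀ f g → f ⊗ g ≈ₚ g ⊗ f
    ⊗-identityˡ : ∀ f → con K.1# ⊗ f ≈ₚ f
    distribˡ    : ∀ f g h → f ⊗ (g ⊕ h) ≈ₚ (f ⊗ g) ⊕ (f ⊗ h)

  polyRing : ℕ → CommutativeRing c (c ⊔ ℓ)
  polyRing n = record
    { Carrier = Poly n
    ; _≈_ = _≈ₚ_
    ; _+_ = _⊕_
    ; _*_ = _⊗_
    ; -_ = ⊝_
    ; 0# = con K.0#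
    ; 1# = con K.1#
    ; isCommutativeRing = record
      { isRing = record
        { +-isAbelianGroup = record
          { isGroup = record
            { isMonoid = record
              { isSemigroup = record
                { isMagma = record
                  { isEquivalence = record { refl = ≈-refl ; sym = ≈-sym ; trans = ≈-trans }
                  ; ∙-cong = ⊕-cong }
                ; assoc = ⊕-assoc }
              ; identity = ⊕-identityˡ , (λ f → ≈-trans (⊕-comm _ _) (⊕-identityˡ f)) }
            ; inverse = ⊝-inverseˡ , (λ f → ≈-trans (⊕-comm _ _) (⊝-inverseˡ f))
            ; ⁻¹-cong = ⊝-cong }
          ; comm = ⊕-comm }
        ; *-cong = ⊗-cong
        ; *-assoc = ⊗-assoc
        ; *-identity = ⊗-identityˡ , (λ f → ≈-trans (⊗-comm _ _) (⊗-identityˡ f))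
        ; distrib = distribˡ , (λ f g h → ≈-trans (⊗-comm _ _)
            (≈-trans (distribˡ f g h) (⊕-cong (⊗-comm _ _) (⊗-comm _ _)))) }
      ; *-comm = ⊗-comm } }

  substitute : ∀ {n m} → (Fin n → Poly m) → Poly n → Poly m
  substitute σ (con a) = con a
  substitute σ (var i) = σ i
  substitute σ (f ⊕ g) = substitute σ f ⊕ substitute σ g
  substitute σ (f ⊗ g) = substitute σ f ⊗ substitute σ g
  substitute σ (⊝ f)   = ⊝ substitute σ f

  substitute-cong : ∀ {n m} (σ : Fin n → Poly m) {f g : Poly n} →
                    f ≈ₚ g → substitute σ f ≈ₚ substitute σ g
  substitute-cong σ ≈-refl = ≈-refl
  substitute-cong σ (≈-sym p) = ≈-sym (substitute-cong σ p)
  substitute-cong σ (≈-trans p q) = ≈-trans (substitute-cong σ p) (substitute-cong σ q)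
  substitute-cong σ (⊕-cong p q) = ⊕-cong (substitute-cong σ p) (substitute-cong σ q)
  substitute-cong σ (⊗-cong p q) = ⊗-cong (substitute-cong σ p) (substitute-cong σ q)
  substitute-cong σ (⊝-cong p) = ⊝-cong (substitute-cong σ p)
  substitute-cong σ (con-cong p) = con-cong p
  substitute-cong σ (con-+ a b) = con-+ a b
  substitute-cong σ (con-* a b) = con-* a b
  substitute-cong σ (⊕-assoc f g h) = ⊕-assoc _ _ _
  substitute-cong σ (⊕-comm f g) = ⊕-comm _ _
  substitute-cong σ (⊕-identityˡ f) = ⊕-identityˡ _
  substitute-cong σ (⊝-inverseˡ f) = ⊝-inverseˡ _
  substitute-cong σ (⊗-assoc f g h) = ⊗-assoc _ _ _
  substitute-cong σ (⊗-comm f g) = ⊗-comm _ _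
  substitute-cong σ (⊗-identityˡ f) = ⊗-identityˡ _
  substitute-cong σ (distribˡ f g h) = distribˡ _ _ _

  open module Sums {n} = LinearAlgebra (polyRing n) using () renaming (sum to sumₚ)

  linear : ∀ {n} → Vector K.Carrier n → Poly n
  linear α = sumₚ (λ i → con (α i) ⊗ var i)

  substitute-sum : ∀ {k n m} (σ : Fin n → Poly m) (f : Vector (Poly n) k) →
                   substitute σ (sumₚ f) ≈ₚ sumₚ (λ i → substitute σ (f i))
  substitute-sum {ℕ.zero} σ f = ≈-refl
  substitute-sum {suc k}  σ f = ⊕-cong ≈-refl (substitute-sum σ (f ∘ suc))

-- Excluded middle is the classical metatheory; given it, a Heyting field is
-- exactly a field in the usual sense.
module Arrangements {c ℓ₁ ℓ₂} (em : ∀ {a} → ExcludedMiddle a) (𝕂 : HeytingField c ℓ₁ ℓ₂) where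
  open HeytingField 𝕂 using (heytingCommutativeRing; tight; #⇒invertible)

  K : CommutativeRing c ℓ₁
  K = HeytingCommutativeRing.commutativeRing heytingCommutativeRing

  private module K = CommutativeRing K
  open Polynomials K public

  S : ℕ → CommutativeRing c (c ⊔ ℓ₁)
  S = polyRing

  module KLin = LinearAlgebra K
  module SLin {n} = LinearAlgebra (S n)
  open KLin using (δ) renaming (_≋_ to _≋ₖ_)
  open SLin using () renaming (_≋_ to _≋ₛ_)

  -- V = Kⁿ with its coordinate functions x₁,…,xₙ as the basis of V*.
  Point Form : ℕ → Set c
  Point n = Vector K.Carrier n
  Form  n = Vector K.Carrier n

  infix 7 _·_

  _·_ : ∀ {n} → Form n → Point n → K.Carrier
  α · v = KLin.sum (λ i → α i K.* v i)

  hyperplane : ∀ {n} → Form n → Pred (Point n) ℓ₁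
  hyperplane α v = α · v K.≈ K.0#

  SameHyperplane : ∀ {n} → Form n → Form n → Set (c ⊔ ℓ₁)
  SameHyperplane α β = ∀ v → v ∈ hyperplane α ⇔ v ∈ hyperplane β

  NonZero : ∀ {n} → Form n → Set ℓ₁
  NonZero α = ¬ (α ≋ₖ λ _ → K.0#)

  sameHyperplane? : ∀ {n} (α β : Form n) → Dec (SameHyperplane α β)
  sameHyperplane? α β = em

  -- The hyperplanes are listed through their fixed defining forms.
  record Arrangement (n : ℕ) : Set (c ⊔ ℓ₁) where
    field
      forms    : List (Form n)
      nonZero  : All NonZero forms
      distinct : AllPairs (λ α β → ¬ SameHyperplane α β) forms

  open Arrangement public

  Q : ∀ {n} → Arrangement n → Poly n
  Q A = foldr (λ α f → linear α ⊗ f) (con K.1#) (forms A)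

  -- Coefficients with respect to the dxᵢ, and to the dxᵢ ∧ dxⱼ with i < j.
  Ω¹V Ω²V : ℕ → Set c
  Ω¹V n = Vector (Poly n) n
  Ω²V n = (i j : Fin n) → i Fin.< j → Poly n

  d : ∀ {n} → Form n → Ω¹V n
  d α i = con (α i)

  _∧_ : ∀ {n} → Ω¹V n → Ω¹V n → Ω²V n
  (η ∧ ζ) i j _ = (η i ⊗ ζ j) ⊕ (⊝ (η j ⊗ ζ i))

  infix 4 _∈_Ω²

  _∈_Ω² : ∀ {n} → Ω²V n → Poly n → Set (c ⊔ ℓ₁)
  _∈_Ω² {n} ω f = ∃ λ (τ : Ω²V n) → ∀ i j i<j → ω i j i<j ≈ₚ f ⊗ τ i j i<j

  -- A form ω ∈ (1/Q)Ω¹V is represented by its numerator η = Qω, so this is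
  -- the S-module Q·Ω¹(A), isomorphic to Ω¹(A) by multiplication with Q.
  Ω¹ : ∀ {n} → Arrangement n → Pred (Ω¹V n) (c ⊔ ℓ₁)
  Ω¹ A η = All (λ α → (η ∧ d α) ∈ linear α Ω²) (forms A)

  -- A basis of a submodule of the finite free module Ω¹V is finite.
  IsFree : ∀ {n} → Arrangement n → Set (c ⊔ ℓ₁)
  IsFree {n} A = ∃ λ k → ∃ λ (b : Vector (Ω¹V n) k) → SLin.IsBasis (Ω¹ A) b

  intersection : ∀ {n} → List (Form n) → Pred (Point n) (c ⊔ ℓ₁)
  intersection B v = All (λ α → v ∈ hyperplane α) B

  L : ∀ {n} → Arrangement n → Pred (Pred (Point n) (c ⊔ ℓ₁)) (c ⊔ ℓ₁)
  L A X = ∃ λ B → B ⊆ₗ forms A × X ≐ intersection B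

  HasDimension : ∀ {n p} → Pred (Point n) p → ℕ → Set (c ⊔ ℓ₁ ⊔ p)
  HasDimension {n} X r = ∃ λ (b : Vector (Point n) r) → KLin.IsBasis X b

  -- Here S̄ = K[y₁,…,yₘ] with m = ℓ − 1.
  IsCompleteIntersection : ∀ {m} → Ideal (S m) (c ⊔ ℓ₁) → Set (lsuc (c ⊔ ℓ₁))
  IsCompleteIntersection {m} J = ∃ λ k → ∃ λ r →
    (∃ λ (g : Vector (Poly m) k) → Dimension.GeneratedBy (S m) J g) ×
    Dimension.HasKrullDimension (quotientRing (S m) J) r ×
    r ℕ.+ k ≡ m

  -- Coordinates on H: for a basis α_H, α₂, …, α_ℓ of V*, the restrictions
  -- y₁,…,yₘ of α₂,…,α_ℓ are a basis of H*.  They identify H with Kᵐ and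
  -- S̄ = S/(α_H) = Sym(H*) with K[y₁,…,yₘ].
  module Restriction {m} (αH : Form (suc m)) (α′ : Vector (Form (suc m)) m)
                     (basis : KLin.IsBasis U (αH Vector.∷ α′)) where

    β : Vector (Form (suc m)) (suc m)
    β = αH Vector.∷ α′

    S̄ : CommutativeRing c (c ⊔ ℓ₁)
    S̄ = S m

    coordinates : Form (suc m) → Vector K.Carrier (suc m)
    coordinates α = proj₁ (KLin.IsBasis.spanning basis α tt)

    restrict : Form (suc m) → Form m
    restrict α = coordinates α ∘ suc

    bar : Poly (suc m) → Poly m
    bar = substitute (λ i → linear (restrict (δ i)))

    private
      open module KR {n : ℕ} = SetoidReasoning (CommutativeRing.setoid (S n))

      coordinates-spec : ∀ α → α ≋ₖ KLin.lincomb (coordinates α) β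
      coordinates-spec α = proj₂ (KLin.IsBasis.spanning basis α tt)

      coordinates-β : ∀ k → KLin.lincomb (β k) (λ i → coordinates (δ i)) ≋ₖ δ k
      coordinates-β k = KLin.coordinates-unique basis _ _ λ j →
        K.trans (K.sym (KLin.lincomb-assoc (β k) (λ i → coordinates (δ i)) β j))
        (K.trans (KLin.lincomb-congʳ (β k) _ δ (λ i j → K.sym (coordinates-spec (δ i) j)) j)
        (K.trans (KLin.sum-δʳ j (β k))
        (K.sym (KLin.sum-δˡ k (λ i → β i j)))))

      con-lincomb : ∀ {k n p} (a : Vector K.Carrier k) (b : Vector (Vector K.Carrier n) k) j →
                    SLin.lincomb (con ∘ a) (λ i → con {p} ∘ b i) j ≈ₚ con (KLin.lincomb a b j)
      con-lincomb {ℕ.zero} a b j = ≈-refl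
      con-lincomb {suc k}  a b j = ≈-sym (≈-trans (con-+ _ _)
        (⊕-cong (con-* _ _) (≈-sym (con-lincomb (a ∘ suc) (b ∘ suc) j))))

      linear-δ : ∀ {n} (j : Fin n) → linear (δ j) ≈ₚ var j
      linear-δ {n} j = ≈-trans (SLin.sum-cong (λ i → con (δ j i) ⊗ var i) (λ i → SLin.δ j i ⊗ var i) (λ i → ⊗-cong (con-δ j i) ≈-refl)) (SLin.sum-δˡ j var)
        where
        con-δ : ∀ {k} (i j : Fin k) → con {n} (δ i j) ≈ₚ SLin.δ i j
        con-δ zero    zero    = ≈-refl
        con-δ zero    (suc j) = ≈-refl
        con-δ (suc i) zero    = ≈-refl
        con-δ (suc i) (suc j) = con-δ i j

    bar-α′ : ∀ j → bar (linear (α′ j)) ≈ₚ var j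
    bar-α′ j = begin
      bar (linear (α′ j))
        ≈⟨ substitute-sum (λ i → linear (r i)) (λ i → con (α′ j i) ⊗ var i) ⟩
      SLin.lincomb (con ∘ α′ j) (λ i → SLin.lincomb (con ∘ r i) y) zero
        ≈⟨ SLin.lincomb-assoc (con ∘ α′ j) (λ i → con ∘ r i) y zero ⟩
      SLin.lincomb (SLin.lincomb (con ∘ α′ j) (λ i → con ∘ r i)) y zero
        ≈⟨ SLin.lincomb-congˡ (SLin.lincomb (con ∘ α′ j) (λ i → con ∘ r i)) (con ∘ δ j) y (λ k →
             ≈-trans (con-lincomb (α′ j) r k) (con-cong (coordinates-β (suc j) (suc k)))) zero ⟩
      linear (δ j)
        ≈⟨ linear-δ j ⟩
      var j ∎
      where
      r : Fin (suc m) → Form m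
      r i = restrict (δ i)
      y : Vector (Vector (Poly m) 1) m
      y k _ = var k

    lift : Poly m → Poly (suc m)
    lift = substitute (λ j → linear (α′ j))

    bar-lift : ∀ f → bar (lift f) ≈ₚ f
    bar-lift (con a) = ≈-refl
    bar-lift (var j) = bar-α′ j
    bar-lift (f ⊕ g) = ⊕-cong (bar-lift f) (bar-lift g)
    bar-lift (f ⊗ g) = ⊗-cong (bar-lift f) (bar-lift g)
    bar-lift (⊝ f)   = ⊝-cong (bar-lift f)

    private
      sameHyperplaneSetoid : DecSetoid c (c ⊔ ℓ₁)
      sameHyperplaneSetoid = record
        { Carrier = Form m
        ; _≈_ = SameHyperplane
        ; isDecEquivalence = record
          { isEquivalence = record
            { refl = λ v → mk⇔ (λ p → p) (λ p → p)
            ; sym = λ e v → mk⇔ (Equivalence.from (e v)) (Equivalence.to (e v))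
            ; trans = λ e e′ v → mk⇔ (Equivalence.to (e′ v) ∘ Equivalence.to (e v))
                                     (Equivalence.from (e v) ∘ Equivalence.from (e′ v)) }
          ; _≟_ = sameHyperplane? } }

      cancel : ∀ {a b} → ¬ a K.≈ K.0# → a K.* b K.≈ K.0# → b K.≈ K.0#
      cancel {a} {b} a≉0 ab≈0 with #⇒invertible
        (decidable-stable em (λ ¬a#0 → a≉0 (proj₁ (tight a K.0#) ¬a#0)))
      ... | a⁻¹ , inv , _ =
        K.trans (K.sym (K.*-identityˡ b))
        (K.trans (K.*-congʳ (K.sym inv))
        (K.trans (K.*-assoc _ _ _)
        (K.trans (K.*-congˡ (K.trans (K.*-congʳ a-0≈a) ab≈0)) (K.zeroʳ _))))
        where
        open import Algebra.Properties.Ring K.ring using (-0#≈0#)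
        a-0≈a : a K.- K.0# K.≈ a
        a-0≈a = K.trans (K.+-congˡ -0#≈0#) (K.+-identityʳ a)

    restrict-nonZero : ∀ {α} → NonZero α → ¬ SameHyperplane α αH → NonZero (restrict α)
    restrict-nonZero {α} α≉0 α≁αH r≈0 = α≁αH λ v → mk⇔
      (λ αv≈0 → cancel a₀≉0 (K.trans (K.sym (α·v v)) αv≈0))
      (λ Hv≈0 → K.trans (α·v v) (K.trans (K.*-congˡ Hv≈0) (K.zeroʳ _)))
      where
      a₀ = coordinates α zero

      α≋ : ∀ i → α i K.≈ a₀ K.* αH i
      α≋ i = K.trans (coordinates-spec α i) (K.trans
        (K.+-congˡ (KLin.lincomb-0 (restrict α) α′ r≈0 i)) (K.+-identityʳ _))

      α·v : ∀ v → α · v K.≈ a₀ K.* (αH · v)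
      α·v v = K.trans (KLin.sum-cong _ (λ i → a₀ K.* (αH i K.* v i)) (λ i → K.trans (K.*-congʳ (α≋ i)) (K.*-assoc _ _ _)))
        (K.sym (KLin.*-distribˡ-sum a₀ (λ i → αH i K.* v i)))

      a₀≉0 : ¬ a₀ K.≈ K.0#
      a₀≉0 a₀≈0 = α≉0 (λ i → K.trans (α≋ i) (K.trans (K.*-congʳ a₀≈0) (K.zeroˡ _)))

    restriction : Arrangement (suc m) → Arrangement m
    restriction A = record
      { forms    = deduplicate sameHyperplane? restricted
      ; nonZero  = All.deduplicate⁺ sameHyperplane? (All.map⁺ (All.map
                     (λ (α≉0 , α≁αH) → restrict-nonZero α≉0 α≁αH)
                     (All.zip (All.filter⁺ other? (nonZero A) , All.all-filter other? (forms A)))))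
      ; distinct = deduplicate-! sameHyperplaneSetoid restricted
      }
      where
      other? : ∀ α → Dec (¬ SameHyperplane α αH)
      other? α = ¬? (sameHyperplane? α αH)
      restricted = map restrict (filter other? (forms A))

    -- The arrangement A_X for a subset X of H, given in the coordinates y:
    -- at the point y of H the form α takes the value restrict α · y.
    localization : Arrangement (suc m) → Pred (Point m) (c ⊔ ℓ₁) → Arrangement (suc m)
    localization A X = record
      { forms    = filter contains? (forms A)
      ; nonZero  = All.filter⁺ contains? (nonZero A)
      ; distinct = AllPairs.filter⁺ contains? (distinct A)
      }
      where
      contains? : ∀ α → Dec (X ⊆ hyperplane (restrict α))
      contains? α = em

    -- For ω = η/Q(A) and η = g₀ dα_H + g₁ dα₂ + ⋯, the coefficient f of dα_H
    -- in ω is g₀/Q(A), so the residue r is the quotient of bar g₀ by Q(A^H);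
    -- it is unique since S̄ is a domain and Q(A^H) is nonzero.
    Residue : Arrangement (suc m) → Ω¹V (suc m) → Poly m → Set (c ⊔ ℓ₁)
    Residue A η r = ∃ λ g →
      η ≋ₛ SLin.lincomb g (λ j → d (β j)) ×
      Q (restriction A) ⊗ r ≈ₚ bar (g zero)

    residueIdeal : Arrangement (suc m) → Ideal S̄ (c ⊔ ℓ₁)
    residueIdeal A = record
      { member = λ r → ∃ λ η → η ∈ Ω¹ A × Residue A η r
      ; resp = λ { r≈s (η , η∈Ω , g , eq , res) →
          η , η∈Ω , g , eq , ≈-trans (⊗-cong ≈-refl (≈-sym r≈s)) res }
      ; 0-closed =
          (λ _ → con K.0#) , All.universal 0-wedge (forms A) ,
          (λ _ → con K.0#) , (λ j → ≈-sym (SLin.lincomb-0 (λ _ → con K.0#) dβ (λ _ → ≈-refl) j)) , SB.zeroʳ _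
      ; +-closed = λ { (η , η∈Ω , g , eq , res) (η′ , η′∈Ω , g′ , eq′ , res′) →
          (λ i → η i ⊕ η′ i) , All.zipWith (λ {α} (p , p′) → +-wedge η η′ α p p′) (η∈Ω , η′∈Ω) ,
          (λ i → g i ⊕ g′ i) ,
          (λ j → ≈-trans (⊕-cong (eq j) (eq′ j)) (≈-sym (SLin.lincomb-+ g g′ dβ j))) ,
          ≈-trans (distribˡ _ _ _) (⊕-cong res res′) }
      ; *-closed = λ { s (η , η∈Ω , g , eq , res) →
          (λ i → lift s ⊗ η i) , All.map (λ {α} → *-wedge (lift s) η α) η∈Ω ,
          (λ i → lift s ⊗ g i) ,
          (λ j → ≈-trans (⊗-cong ≈-refl (eq j)) (≈-sym (SLin.lincomb-* (lift s) g dβ j))) ,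
          ≈-trans (CB.x∙yz≈y∙xz _ _ _) (⊗-cong (≈-sym (bar-lift s)) res) }
      }
      where
      module SM = CommutativeRing (S (suc m))
      module SB = CommutativeRing S̄
      open import Algebra.Properties.Ring SM.ring using (-‿distribʳ-*)
      open import Algebra.Properties.AbelianGroup SM.+-abelianGroup using (⁻¹-∙-comm)
      import Algebra.Properties.CommutativeSemigroup SM.+-commutativeSemigroup as CA
      import Algebra.Properties.CommutativeSemigroup SM.*-commutativeSemigroup as CM
      import Algebra.Properties.CommutativeSemigroup SB.*-commutativeSemigroup as CB

      dβ : Vector (Ω¹V (suc m)) (suc m)
      dβ j = d (β j)

      0-wedge : ∀ α → ((λ _ → con K.0#) ∧ d α) ∈ linear α Ω²
      0-wedge α = (λ _ _ _ → con K.0#) , λ i j _ →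
        ≈-trans (⊕-cong (SM.zeroˡ _) (⊝-cong (SM.zeroˡ _)))
        (≈-trans (SM.-‿inverseʳ _) (≈-sym (SM.zeroʳ _)))

      +-wedge : ∀ η η′ α → (η ∧ d α) ∈ linear α Ω² → (η′ ∧ d α) ∈ linear α Ω² →
                ((λ i → η i ⊕ η′ i) ∧ d α) ∈ linear α Ω²
      +-wedge η η′ α (τ , p) (τ′ , p′) = (λ i j q → τ i j q ⊕ τ′ i j q) , λ i j q →
        ≈-trans (⊕-cong (SM.distribʳ _ _ _) (≈-trans (⊝-cong (SM.distribʳ _ _ _)) (≈-sym (⁻¹-∙-comm _ _))))
        (≈-trans (CA.interchange _ _ _ _)
        (≈-trans (⊕-cong (p i j q) (p′ i j q)) (≈-sym (distribˡ _ _ _))))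

      *-wedge : ∀ s η α → (η ∧ d α) ∈ linear α Ω² → ((λ i → s ⊗ η i) ∧ d α) ∈ linear α Ω²
      *-wedge s η α (τ , p) = (λ i j q → s ⊗ τ i j q) , λ i j q →
        ≈-trans (⊕-cong (⊗-assoc _ _ _) (≈-trans (⊝-cong (⊗-assoc _ _ _)) (-‿distribʳ-* _ _)))
        (≈-trans (≈-sym (distribˡ _ _ _))
        (≈-trans (⊗-cong ≈-refl (p i j q)) (CM.x∙yz≈y∙xz _ _ _)))

    Ξ : Arrangement (suc m) → Pred (Pred (Point m) (c ⊔ ℓ₁)) (c ⊔ ℓ₁)
    Ξ A X = X ∈ L (restriction A) × ¬ (member (residueIdeal (localization A X)) ≐ U)

    -- dim X = ℓ − 3 with ℓ = m + 1.
    Ξ₃ : Arrangement (suc m) → Pred (Pred (Point m) (c ⊔ ℓ₁)) (c ⊔ ℓ₁)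
    Ξ₃ A X = X ∈ Ξ A × ∃ λ r → HasDimension X r × r ℕ.+ 3 ≡ suc m

-- In coordinates with H : x₀ = 0, a residue is the coefficient of dx₀ of a logarithmic form
-- restricted to H.  Since A is free, every logarithmic form of A^H extends to a logarithmic form
-- of A without a pole along H; as A^H is free too, the ideal J of residues then has a free
-- resolution of length one.  Hence J is unmixed of codimension two: if three independent linear
-- forms multiply r into J, then r ∈ J.
--
-- Suppose that r lies in J_X for all X of codimension two in H, but not in J.  An element s ∉ (J : r)
-- annihilated modulo (J : r) by as many traces as possible is annihilated by two different traces,
-- because J contains products of traces, among them the numerators of the residues of
-- dx₀/x₀ − da/a.  Let X be the intersection of the two.  A multiple of r by traces that do not
-- contain X lies in J, so s is annihilated by a third trace, independent of the first two, and
-- s r ∈ J, a contradiction.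
--
-- For X of codimension two in H with J_X ≠ (1), homogeneity and invariance under translation
-- along X put J_X into the ideal I(X).  Exchanging elements of a basis of Ω¹(A) for dα/α and for
-- the differentials of coordinates on X shows that J_X is generated by two elements at the generic
-- point of X, hence everywhere by Nakayama's lemma and the two invariances.  A prime containing
-- J_X contains two independent linear forms of I(X), hence I(X), which gives the height and the
-- dimension, as the transcendence degree bounds the lengths of chains of primes.

module Submission where

open import Defs
open import Level using (_⊔_; 0ℓ; Lift; lift)
open import Algebra.Apartness using (HeytingField)
open import Algebra.Bundles using (CommutativeRing; RawRing)
import Algebra.Solver.Ring
open import Algebra.Structures using (IsCommutativeRing)
open import Algebra.Solver.Ring.AlmostCommutativeRing using (fromCommutativeRing; _-Raw-AlmostCommutative⟶_)
open import Axiom.ExcludedMiddle using (ExcludedMiddle)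
open import Data.Empty using (⊥)
open import Data.Fin.Base as Fin using (Fin; zero; suc; punchIn)
import Data.Fin.Properties as Fin
open import Data.List.Base using (List; map; filter; foldr; length)
open import Data.List.Membership.Propositional using (find; lose) renaming (_∈_ to _∈ₗ_)
open import Data.List.Membership.Propositional.Properties using (∈-filter⁺; ∈-filter⁻; ∈-map⁺; ∈-map⁻; ∈-deduplicate⁻)
open import Data.List.Properties using (filter-notAll)
open import Data.List.Relation.Unary.All as All using (All)
import Data.List.Relation.Unary.All.Properties as All
open import Data.List.Relation.Unary.AllPairs as AllPairs using (AllPairs)
import Data.List.Relation.Unary.AllPairs.Properties as AllPairs
open import Data.List.Relation.Unary.Any using (here; there)
import Data.List.Relation.Unary.Any.Properties as Any
open import Data.Maybe.Base using (just; nothing)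
open import Data.Nat.Base as ℕ using (ℕ; zero; suc)
import Data.Nat.Properties as ℕ
open import Data.Product.Base using (∃; ∃₂; _×_; _,_; proj₁; proj₂)
open import Data.Sum.Base using (_⊎_; inj₁; inj₂; [_,_]′)
open import Data.Unit.Base using (⊤; tt)
open import Data.Vec.Functional as Vector using (Vector) renaming (_∷_ to _◂_)
open import Data.Vec.Functional.Properties using (insertAt-lookup; insertAt-punchIn)
open import Function.Base using (_∘_; id)
open import Function.Bundles using (mk⇔; Equivalence)
open import Relation.Binary.Definitions using (WeaklyDecidable; Tri; tri<; tri≈; tri>)
open import Relation.Binary.PropositionalEquality.Core as ≡ using (_≡_)
import Relation.Binary.Reasoning.Setoid as SetoidReasoning
open import Relation.Nullary using (¬_; Dec; yes; no; contradiction)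
open import Relation.Nullary.Decidable using (decidable-stable; ¬?)
open import Relation.Unary using (Pred; _∈_; _⊆_; _⊂_; _≐_; ⋂; U; Decidable)
open import Relation.Unary.Properties using (⊂-trans)

-- The coefficient a − b of the solver is encoded by the pair (a , b).
module IntegerSolver {c ℓ} (R : CommutativeRing c ℓ) where
  open CommutativeRing R
  open import Algebra.Properties.Semiring.Mult semiring using (×-homo-+; ×1-homo-*) renaming (_×_ to _×ₙ_)
  open import Algebra.Properties.AbelianGroup +-abelianGroup using (⁻¹-∙-comm)
  open import Algebra.Properties.Ring ring using (-‿distribˡ-*; -‿distribʳ-*; -‿involutive; -0#≈0#)
  open import Algebra.Properties.CommutativeSemigroup +-commutativeSemigroup using (interchange)
  open SetoidReasoning setoid

  private
    normalise : ℕ × ℕ → ℕ × ℕ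
    normalise (a , b) = a ℕ.∸ b , b ℕ.∸ a

    coefficients : RawRing 0ℓ 0ℓ
    coefficients = record
      { Carrier = ℕ × ℕ
      ; _≈_ = _≡_
      ; _+_ = λ (a , b) (c , d) → normalise (a ℕ.+ c , b ℕ.+ d)
      ; _*_ = λ (a , b) (c , d) → normalise (a ℕ.* c ℕ.+ b ℕ.* d , a ℕ.* d ℕ.+ b ℕ.* c)
      ; -_ = λ (a , b) → b , a
      ; 0# = 0 , 0
      ; 1# = 1 , 0
      }

    ι : ℕ → Carrier
    ι n = n ×ₙ 1#

    ⟦_⟧ : ℕ × ℕ → Carrier
    ⟦ a , b ⟧ = ι a - ι b

    ⟦normalise⟧ : ∀ p → ⟦ normalise p ⟧ ≈ ⟦ p ⟧
    ⟦normalise⟧ (zero  , zero)  = refl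
    ⟦normalise⟧ (zero  , suc b) = refl
    ⟦normalise⟧ (suc a , zero)  = refl
    ⟦normalise⟧ (suc a , suc b) = begin
      ⟦ normalise (a , b) ⟧        ≈⟨ ⟦normalise⟧ (a , b) ⟩
      ι a - ι b                    ≈⟨ +-identityˡ _ ⟨
      0# + (ι a - ι b)             ≈⟨ +-congʳ (-‿inverseʳ 1#) ⟨
      (1# - 1#) + (ι a - ι b)      ≈⟨ interchange _ _ _ _ ⟩
      (1# + ι a) + (- 1# - ι b)    ≈⟨ +-congˡ (⁻¹-∙-comm _ _) ⟩
      ι (suc a) - ι (suc b)        ∎

    ⟦-⟧ : ∀ p → ⟦ proj₂ p , proj₁ p ⟧ ≈ - ⟦ p ⟧
    ⟦-⟧ (a , b) = begin
      ι b - ι a          ≈⟨ +-congʳ (-‿involutive _) ⟨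
      - - ι b - ι a      ≈⟨ +-comm _ _ ⟩
      - ι a + - - ι b    ≈⟨ ⁻¹-∙-comm _ _ ⟩
      - (ι a - ι b)      ∎

    ⟦+⟧ : ∀ a b c d → ⟦ a ℕ.+ c , b ℕ.+ d ⟧ ≈ ⟦ a , b ⟧ + ⟦ c , d ⟧
    ⟦+⟧ a b c d = begin
      ι (a ℕ.+ c) - ι (b ℕ.+ d)      ≈⟨ +-cong (×-homo-+ 1# a c) (-‿cong (×-homo-+ 1# b d)) ⟩
      (ι a + ι c) - (ι b + ι d)      ≈⟨ +-congˡ (⁻¹-∙-comm _ _) ⟨
      (ι a + ι c) + (- ι b - ι d)    ≈⟨ interchange _ _ _ _ ⟩
      ⟦ a , b ⟧ + ⟦ c , d ⟧          ∎

    ⟦*⟧ : ∀ a b c d → ⟦ a ℕ.* c ℕ.+ b ℕ.* d , a ℕ.* d ℕ.+ b ℕ.* c ⟧ ≈ ⟦ a , b ⟧ * ⟦ c , d ⟧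
    ⟦*⟧ a b c d = begin
      ι (a ℕ.* c ℕ.+ b ℕ.* d) - ι (a ℕ.* d ℕ.+ b ℕ.* c)
        ≈⟨ ⟦+⟧ (a ℕ.* c) (a ℕ.* d) (b ℕ.* d) (b ℕ.* c) ⟩
      (ι (a ℕ.* c) - ι (a ℕ.* d)) + (ι (b ℕ.* d) - ι (b ℕ.* c))
        ≈⟨ +-cong (expand a c d) (expand b d c) ⟩
      ι a * (ι c - ι d) + ι b * (ι d - ι c)
        ≈⟨ +-congˡ (*-congˡ (⟦-⟧ (c , d))) ⟩
      ι a * (ι c - ι d) + ι b * - (ι c - ι d)
        ≈⟨ +-congˡ (-‿distribʳ-* _ _) ⟨
      ι a * (ι c - ι d) + - (ι b * (ι c - ι d))
        ≈⟨ +-congˡ (-‿distribˡ-* _ _) ⟩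
      ι a * (ι c - ι d) + - ι b * (ι c - ι d)
        ≈⟨ distribʳ _ _ _ ⟨
      ⟦ a , b ⟧ * ⟦ c , d ⟧ ∎
      where
      expand : ∀ a c d → ι (a ℕ.* c) - ι (a ℕ.* d) ≈ ι a * (ι c - ι d)
      expand a c d = begin
        ι (a ℕ.* c) - ι (a ℕ.* d)      ≈⟨ +-cong (×1-homo-* a c) (-‿cong (×1-homo-* a d)) ⟩
        ι a * ι c - ι a * ι d          ≈⟨ +-congˡ (-‿distribʳ-* _ _) ⟩
        ι a * ι c + ι a * - ι d        ≈⟨ distribˡ _ _ _ ⟨
        ι a * (ι c - ι d)              ∎

    -- Unlike ⟦_⟧, sends 0 and 1 to 0# and 1# on the nose.
    ⟪_⟫ : ℕ × ℕ → Carrier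
    ⟪ 0 , 0 ⟫ = 0#
    ⟪ 1 , 0 ⟫ = 1#
    ⟪ p ⟫     = ⟦ p ⟧

    ι-0≈ : ∀ n → ⟦ n , 0 ⟧ ≈ ι n
    ι-0≈ n = trans (+-congˡ -0#≈0#) (+-identityʳ _)

    ⟪⟫≈⟦⟧ : ∀ p → ⟪ p ⟫ ≈ ⟦ p ⟧
    ⟪⟫≈⟦⟧ (0 , 0)                     = sym (ι-0≈ 0)
    ⟪⟫≈⟦⟧ (0 , suc b)                 = refl
    ⟪⟫≈⟦⟧ (1 , 0)                     = sym (trans (ι-0≈ 1) (+-identityʳ _))
    ⟪⟫≈⟦⟧ (1 , suc b)                 = refl
    ⟪⟫≈⟦⟧ (suc (suc a) , b)           = refl

    morphism : coefficients -Raw-AlmostCommutative⟶ fromCommutativeRing R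
    morphism = record
      { ⟦_⟧    = ⟪_⟫
      ; +-homo = λ p@(a , b) q@(c , d) → let r = a ℕ.+ c , b ℕ.+ d in
          trans (⟪⟫≈⟦⟧ (normalise r)) (trans (⟦normalise⟧ r) (trans (⟦+⟧ a b c d) (sym (+-cong (⟪⟫≈⟦⟧ p) (⟪⟫≈⟦⟧ q)))))
      ; *-homo = λ p@(a , b) q@(c , d) → let r = a ℕ.* c ℕ.+ b ℕ.* d , a ℕ.* d ℕ.+ b ℕ.* c in
          trans (⟪⟫≈⟦⟧ (normalise r)) (trans (⟦normalise⟧ r) (trans (⟦*⟧ a b c d) (sym (*-cong (⟪⟫≈⟦⟧ p) (⟪⟫≈⟦⟧ q)))))
      ; -‿homo = λ p@(a , b) → trans (⟪⟫≈⟦⟧ (b , a)) (trans (⟦-⟧ p) (-‿cong (sym (⟪⟫≈⟦⟧ p))))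
      ; 0-homo = refl
      ; 1-homo = refl
      }

    weak-dec : WeaklyDecidable (λ p q → ⟪ p ⟫ ≈ ⟪ q ⟫)
    weak-dec (a , b) (c , d) with a ℕ.≟ c | b ℕ.≟ d
    ... | yes ≡.refl | yes ≡.refl = just refl
    ... | _ | _ = nothing

  open Algebra.Solver.Ring coefficients (fromCommutativeRing R) morphism weak-dec public
    using (solve; _:=_; _:+_; _:*_; _:-_; :-_; con)

  :0 :1 : ∀ {n} → Algebra.Solver.Ring.Polynomial coefficients (fromCommutativeRing R) morphism weak-dec n
  :0 = con (0 , 0)
  :1 = con (1 , 0)

module PowerSeries {c ℓ} (R : CommutativeRing c ℓ) where
  open CommutativeRing R
  open IntegerSolver R
  open SetoidReasoning setoid

  infixl 6 _+ˢ_
  infixl 7 _*ˢ_ _·ˢ_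
  infix  4 _≈ˢ_
  infix  8 -ˢ_

  Series : Set c
  Series = ℕ → Carrier

  _≈ˢ_ : Series → Series → Set ℓ
  p ≈ˢ q = ∀ n → p n ≈ q n

  tail : Series → Series
  tail p n = p (suc n)

  const : Carrier → Series
  const a zero    = a
  const a (suc n) = 0#

  indeterminate : Carrier → Series
  indeterminate a zero    = 0#
  indeterminate a (suc n) = const a n

  _+ˢ_ _*ˢ_ : Series → Series → Series
  (p +ˢ q) n = p n + q n
  (p *ˢ q) zero    = p 0 * q 0
  (p *ˢ q) (suc n) = p 0 * q (suc n) + (tail p *ˢ q) n

  -ˢ_ : Series → Series
  (-ˢ p) n = - p n

  _·ˢ_ : Carrier → Series → Series
  (a ·ˢ p) n = a * p n

  *ˢ-cong : ∀ {p p′ q q′} → p ≈ˢ p′ → q ≈ˢ q′ → (p *ˢ q) ≈ˢ (p′ *ˢ q′)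
  *ˢ-cong e f zero    = *-cong (e 0) (f 0)
  *ˢ-cong e f (suc n) = +-cong (*-cong (e 0) (f (suc n))) (*ˢ-cong (λ i → e (suc i)) f n)

  *ˢ-distribʳ : ∀ r p q → ((p +ˢ q) *ˢ r) ≈ˢ (p *ˢ r +ˢ q *ˢ r)
  *ˢ-distribʳ r p q zero    = distribʳ _ _ _
  *ˢ-distribʳ r p q (suc n) = trans (+-congˡ (*ˢ-distribʳ r (tail p) (tail q) n))
    (solve 5 (λ a b c x y → (a :+ b) :* c :+ (x :+ y) := (a :* c :+ x) :+ (b :* c :+ y)) refl _ _ _ _ _)

  *ˢ-sucʳ : ∀ p q n → (p *ˢ q) (suc n) ≈ (p *ˢ tail q) n + p (suc n) * q 0
  *ˢ-sucʳ p q zero    = refl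
  *ˢ-sucʳ p q (suc n) = trans (+-congˡ (*ˢ-sucʳ (tail p) q n)) (sym (+-assoc _ _ _))

  *ˢ-comm : ∀ p q → (p *ˢ q) ≈ˢ (q *ˢ p)
  *ˢ-comm p q zero    = *-comm _ _
  *ˢ-comm p q (suc n) = begin
    p 0 * q (suc n) + (tail p *ˢ q) n    ≈⟨ +-cong (*-comm _ _) (*ˢ-comm (tail p) q n) ⟩
    q (suc n) * p 0 + (q *ˢ tail p) n    ≈⟨ +-comm _ _ ⟩
    (q *ˢ tail p) n + q (suc n) * p 0    ≈⟨ *ˢ-sucʳ q p n ⟨
    (q *ˢ p) (suc n)                     ∎

  ·ˢ-*ˢ : ∀ a p q → ((a ·ˢ p) *ˢ q) ≈ˢ (a ·ˢ (p *ˢ q))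
  ·ˢ-*ˢ a p q zero    = *-assoc _ _ _
  ·ˢ-*ˢ a p q (suc n) = trans (+-cong (*-assoc _ _ _) (·ˢ-*ˢ a (tail p) q n)) (sym (distribˡ _ _ _))

  *ˢ-zeroˡ : ∀ {p} q → (∀ n → p n ≈ 0#) → ∀ n → (p *ˢ q) n ≈ 0#
  *ˢ-zeroˡ q p≈0 zero    = trans (*-congʳ (p≈0 0)) (zeroˡ _)
  *ˢ-zeroˡ q p≈0 (suc n) = trans (+-cong (trans (*-congʳ (p≈0 0)) (zeroˡ _)) (*ˢ-zeroˡ q (λ i → p≈0 (suc i)) n)) (+-identityˡ _)

  const-*ˢ : ∀ a q → (const a *ˢ q) ≈ˢ (a ·ˢ q)
  const-*ˢ a q zero    = refl
  const-*ˢ a q (suc n) = trans (+-congˡ (*ˢ-zeroˡ q (λ _ → refl) n)) (+-identityʳ _)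

  *ˢ-assoc : ∀ p q r → ((p *ˢ q) *ˢ r) ≈ˢ (p *ˢ (q *ˢ r))
  *ˢ-assoc p q r zero    = *-assoc _ _ _
  *ˢ-assoc p q r (suc n) = begin
    p 0 * q 0 * r (suc n) + (((p 0 ·ˢ tail q) +ˢ (tail p *ˢ q)) *ˢ r) n
      ≈⟨ +-congˡ (*ˢ-distribʳ r (p 0 ·ˢ tail q) (tail p *ˢ q) n) ⟩
    p 0 * q 0 * r (suc n) + (((p 0 ·ˢ tail q) *ˢ r) n + ((tail p *ˢ q) *ˢ r) n)
      ≈⟨ +-congˡ (+-cong (·ˢ-*ˢ (p 0) (tail q) r n) (*ˢ-assoc (tail p) q r n)) ⟩
    p 0 * q 0 * r (suc n) + (p 0 * (tail q *ˢ r) n + (tail p *ˢ (q *ˢ r)) n)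
      ≈⟨ solve 5 (λ a b c x y → a :* b :* c :+ (a :* x :+ y) := a :* (b :* c :+ x) :+ y) refl _ _ _ _ _ ⟩
    p 0 * (q *ˢ r) (suc n) + (tail p *ˢ (q *ˢ r)) n ∎

  const-+ : ∀ a b → const (a + b) ≈ˢ (const a +ˢ const b)
  const-+ a b zero    = refl
  const-+ a b (suc n) = sym (+-identityˡ _)

  const-* : ∀ a b → const (a * b) ≈ˢ (const a *ˢ const b)
  const-* a b zero    = refl
  const-* a b (suc n) = sym (trans (const-*ˢ a (const b) (suc n)) (zeroʳ _))

  const-cong : ∀ {a b} → a ≈ b → const a ≈ˢ const b
  const-cong e zero    = e
  const-cong e (suc n) = refl

  NoZeroDivisors : Set (c ⊔ ℓ)
  NoZeroDivisors = ∀ x y → x * y ≈ 0# → ¬ x ≈ 0# → y ≈ 0#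

  *ˢ-nonZero : (∀ x → Dec (x ≈ 0#)) → NoZeroDivisors → ∀ i j p q → ¬ p i ≈ 0# → ¬ q j ≈ 0# →
               ¬ (∀ n → (p *ˢ q) n ≈ 0#)
  *ˢ-nonZero 0? domain i j p q pᵢ≉0 qⱼ≉0 pq≈0 with 0? (p 0) | 0? (q 0)
  *ˢ-nonZero 0? domain zero j p q pᵢ≉0 qⱼ≉0 pq≈0 | yes p₀≈0 | _ = pᵢ≉0 p₀≈0
  *ˢ-nonZero 0? domain (suc i) j p q pᵢ≉0 qⱼ≉0 pq≈0 | yes p₀≈0 | _ =
    *ˢ-nonZero 0? domain i j (tail p) q pᵢ≉0 qⱼ≉0 λ n →
      trans (sym (trans (+-congʳ (trans (*-congʳ p₀≈0) (zeroˡ _))) (+-identityˡ _))) (pq≈0 (suc n))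
  *ˢ-nonZero 0? domain i zero p q pᵢ≉0 qⱼ≉0 pq≈0 | no p₀≉0 | yes q₀≈0 = qⱼ≉0 q₀≈0
  *ˢ-nonZero 0? domain i (suc j) p q pᵢ≉0 qⱼ≉0 pq≈0 | no p₀≉0 | yes q₀≈0 =
    *ˢ-nonZero 0? domain i j p (tail q) pᵢ≉0 qⱼ≉0 λ n →
      trans (sym (trans (+-congˡ (trans (*-congˡ q₀≈0) (zeroʳ _))) (+-identityʳ _)))
        (trans (sym (*ˢ-sucʳ p q n)) (pq≈0 (suc n)))
  *ˢ-nonZero 0? domain i j p q pᵢ≉0 qⱼ≉0 pq≈0 | no p₀≉0 | no q₀≉0 =
    q₀≉0 (domain (p 0) (q 0) (pq≈0 0) p₀≉0)

  Bounded : ℕ → Series → Set ℓ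
  Bounded N p = ∀ d → p (N ℕ.+ d) ≈ 0#

  Bounded-≤ : ∀ {N M p} → N ℕ.≤ M → Bounded N p → Bounded M p
  Bounded-≤ {N} {M} {p} N≤M b d = ≡.subst (λ k → p k ≈ 0#)
    (≡.trans (≡.sym (ℕ.+-assoc N (M ℕ.∸ N) d)) (≡.cong (ℕ._+ d) (ℕ.m+[n∸m]≡n N≤M))) (b (M ℕ.∸ N ℕ.+ d))

  Bounded-* : ∀ N M p q → Bounded N p → Bounded M q → Bounded (N ℕ.+ M) (p *ˢ q)
  Bounded-* zero    M p q b b′ d = *ˢ-zeroˡ q b (M ℕ.+ d)
  Bounded-* (suc N) M p q b b′ d = trans
    (+-cong (trans (*-congˡ (Bounded-≤ {p = q} (ℕ.m≤n⇒m≤1+n (ℕ.m≤n+m M N)) b′ d)) (zeroʳ _))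
            (Bounded-* N M (tail p) q b b′ d)) (+-identityˡ _)

  seriesRing : CommutativeRing c ℓ
  seriesRing = record
    { Carrier = Series
    ; _≈_ = _≈ˢ_
    ; _+_ = _+ˢ_
    ; _*_ = _*ˢ_
    ; -_ = -ˢ_
    ; 0# = λ _ → 0#
    ; 1# = const 1#
    ; isCommutativeRing = record
      { isRing = record
        { +-isAbelianGroup = record
          { isGroup = record
            { isMonoid = record
              { isSemigroup = record
                { isMagma = record
                  { isEquivalence = record
                    { refl = λ _ → refl ; sym = λ e n → sym (e n) ; trans = λ e f n → trans (e n) (f n) }
                  ; ∙-cong = λ e f n → +-cong (e n) (f n) }
                ; assoc = λ p q r n → +-assoc _ _ _ }
              ; identity = (λ p n → +-identityˡ _) , (λ p n → +-identityʳ _) }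
            ; inverse = (λ p n → -‿inverseˡ _) , (λ p n → -‿inverseʳ _)
            ; ⁻¹-cong = λ e n → -‿cong (e n) }
          ; comm = λ p q n → +-comm _ _ }
        ; *-cong = *ˢ-cong
        ; *-assoc = *ˢ-assoc
        ; *-identity = identityˡ , (λ p n → trans (*ˢ-comm p (const 1#) n) (identityˡ p n))
        ; distrib = (λ p q r n → trans (*ˢ-comm p (q +ˢ r) n)
                        (trans (*ˢ-distribʳ p q r n) (+-cong (*ˢ-comm q p n) (*ˢ-comm r p n)))) , *ˢ-distribʳ }
      ; *-comm = *ˢ-comm } }
    where
    identityˡ : ∀ p → (const 1# *ˢ p) ≈ˢ p
    identityˡ p n = trans (const-*ˢ 1# p n) (*-identityˡ _)

module DomainLinearAlgebra {c ℓ} (em : ∀ {a} → ExcludedMiddle a) (R : CommutativeRing c ℓ)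
  (1≉0 : ¬ CommutativeRing._≈_ R (CommutativeRing.1# R) (CommutativeRing.0# R))
  (domain : PowerSeries.NoZeroDivisors R) where
  open CommutativeRing R hiding (zero)
  open LinearAlgebra R
  open IntegerSolver R
  open SetoidReasoning setoid

  -- Fraction-free elimination of the coordinate zero, as R is only a domain.
  dependent : ∀ {n k} → n ℕ.< k → (v : Vector (Vector Carrier n) k) →
              ∃ λ a → lincomb a v ≋ (λ _ → 0#) × ∃ λ i → ¬ a i ≈ 0#
  dependent {zero}  {suc k} n<k v = (λ _ → 1#) , (λ ()) , zero , 1≉0
  dependent {suc n} {suc k} (ℕ.s≤s n<k) v with em {P = ∃ λ p → ¬ v p zero ≈ 0#}
  ... | no all≈0 with dependent {n} {suc k} (ℕ.m≤n⇒m≤1+n n<k) (λ i → v i ∘ suc)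
  ... | a , eq , nz = a , rel , nz
    where
    rel : lincomb a v ≋ (λ _ → 0#)
    rel zero    = sum-0 (λ i → a i * v i zero)
      λ i → trans (*-congˡ (decidable-stable em λ ≉0 → all≈0 (i , ≉0))) (zeroʳ _)
    rel (suc t) = eq t
  dependent {suc n} {suc k} (ℕ.s≤s n<k) v | yes (p , vₚ≉0)
    with dependent {n} {k} n<k (λ j t → v p zero * v (punchIn p j) (suc t) - v (punchIn p j) zero * v p (suc t))
  ... | a , eq , i , aᵢ≉0 = b , rel , punchIn p i ,
    λ bᵢ≈0 → aᵢ≉0 (domain _ _ (trans (*-comm _ _) (trans (sym (b-punchIn i)) bᵢ≈0)) vₚ≉0)
    where
    x : Vector Carrier (suc k)
    x j = v j zero
    s = sum (λ j → a j * x (punchIn p j))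
    b : Vector Carrier (suc k)
    b = Vector.insertAt (λ j → a j * x p) p (- s)
    b-punchIn : ∀ j → b (punchIn p j) ≈ a j * x p
    b-punchIn j = reflexive (insertAt-punchIn (λ j → a j * x p) p (- s) j)
    expand : ∀ t → lincomb b v t ≈ sum (λ j → a j * (x p * v (punchIn p j) t - x (punchIn p j) * v p t))
    expand t = begin
      sum (λ i → b i * v i t)
        ≈⟨ sum-remove {i = p} (λ i → b i * v i t) ⟩
      b p * v p t + sum (λ j → b (punchIn p j) * v (punchIn p j) t)
        ≈⟨ +-cong (*-congʳ (reflexive (insertAt-lookup (λ j → a j * x p) p (- s))))
                  (sum-cong _ (λ j → a j * x p * v (punchIn p j) t) (λ j → *-congʳ (b-punchIn j))) ⟩
      - s * v p t + sum (λ j → a j * x p * v (punchIn p j) t)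
        ≈⟨ +-congʳ (trans (solve 2 (λ s y → (:- s) :* y := s :* (:- y)) refl s (v p t))
             (*-distribʳ-sum (- v p t) (λ j → a j * x (punchIn p j)))) ⟩
      sum (λ j → a j * x (punchIn p j) * - v p t) + sum (λ j → a j * x p * v (punchIn p j) t)
        ≈⟨ ∑-distrib-+ (λ j → a j * x (punchIn p j) * - v p t) _ ⟨
      sum (λ j → a j * x (punchIn p j) * - v p t + a j * x p * v (punchIn p j) t)
        ≈⟨ sum-cong _ (λ j → a j * (x p * v (punchIn p j) t - x (punchIn p j) * v p t)) (λ j →
             solve 5 (λ a x y u w → a :* x :* (:- y) :+ a :* u :* w := a :* (u :* w :- x :* y)) refl
               (a j) (x (punchIn p j)) (v p t) (x p) (v (punchIn p j) t)) ⟩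
      sum (λ j → a j * (x p * v (punchIn p j) t - x (punchIn p j) * v p t)) ∎
    rel : lincomb b v ≋ (λ _ → 0#)
    rel zero    = trans (expand zero) (sum-0 _ λ j →
      solve 3 (λ a x y → a :* (x :* y :- y :* x) := :0) refl (a j) (x p) (x (punchIn p j)))
    rel (suc t) = trans (expand (suc t)) (eq t)

module Residues {c ℓ₁ ℓ₂} (em : ∀ {a} → ExcludedMiddle a) (𝕂 : HeytingField c ℓ₁ ℓ₂) where
  open import Data.List.Base using ([]; _∷_)
  open import Data.List.Relation.Unary.All using ([]; _∷_)
  open import Data.List.Relation.Unary.AllPairs using ([]; _∷_)

  open Arrangements em 𝕂 public
  open KLin using (δ) renaming (_≋_ to _≋ₖ_) public
  open SLin using (sum) renaming (_≋_ to _≋ₛ_) public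
  module K = CommutativeRing K
  module SR {n} = CommutativeRing (S n)
  module _ {n : ℕ} where
    open IntegerSolver (S n) public
    open import Algebra.Properties.Ring (SR.ring {n}) public using (-0#≈0#; -‿distribˡ-*; -‿distribʳ-*)
    open SetoidReasoning (CommutativeRing.setoid (S n)) public
  open IntegerSolver K using () public renaming
    (solve to solveᴷ; _:=_ to _≔_; _:+_ to _⊞_; _:*_ to _⊠_; _:-_ to _⊟_; :-_ to ⊟_; :0 to 0ᴷ; :1 to 1ᴷ)
  private module Ser {n} = PowerSeries (S n)

  0ₚ 1ₚ : ∀ {n} → Poly n
  0ₚ = con K.0#
  1ₚ = con K.1#

  dne : ∀ {a} {A : Set a} → ¬ ¬ A → A
  dne = decidable-stable em

  inverse : ∀ {a} → ¬ a K.≈ K.0# → ∃ λ b → b K.* a K.≈ K.1#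
  inverse {a} a≉0 with HeytingField.#⇒invertible 𝕂 (dne λ ¬a#0 → a≉0 (proj₁ (HeytingField.tight 𝕂 a K.0#) ¬a#0))
  ... | b , inv , _ = b , K.trans (K.*-congˡ (solveᴷ 1 (λ x → x ≔ x ⊟ 0ᴷ) K.refl a)) inv

  1≉0 : ¬ K.1# K.≈ K.0#
  1≉0 1≈0 = HeytingField.#-irrefl 𝕂 1≈0 (HeytingField.invertible⇒# 𝕂 (K.1# ,
    K.trans (K.*-identityˡ _) (solveᴷ 1 (λ x → x ⊟ 0ᴷ ≔ x) K.refl K.1#) ,
    K.trans (K.*-identityʳ _) (solveᴷ 1 (λ x → x ⊟ 0ᴷ ≔ x) K.refl K.1#)))

  K-domain : ∀ a b → a K.* b K.≈ K.0# → ¬ a K.≈ K.0# → b K.≈ K.0#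
  K-domain a b ab≈0 a≉0 with inverse a≉0
  ... | a⁻¹ , inv = K.trans (K.sym (K.*-identityˡ b)) (K.trans (K.*-congʳ (K.sym inv))
    (K.trans (K.*-assoc _ _ _) (K.trans (K.*-congˡ ab≈0) (K.zeroʳ _))))

  -- Polynomials

  module Evaluation {r s} (T : CommutativeRing r s) (φ : K.Carrier → CommutativeRing.Carrier T) where
    open CommutativeRing T

    record IsRingMap : Set (c ⊔ ℓ₁ ⊔ s) where
      field
        φ-cong : ∀ {a b} → a K.≈ b → φ a ≈ φ b
        φ-+    : ∀ a b → φ (a K.+ b) ≈ φ a + φ b
        φ-*    : ∀ a b → φ (a K.* b) ≈ φ a * φ b
        φ-0    : φ K.0# ≈ 0#
        φ-1    : φ K.1# ≈ 1#

    module _ {n} (ρ : Fin n → Carrier) where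
      evaluate : Poly n → Carrier
      evaluate (con a) = φ a
      evaluate (var i) = ρ i
      evaluate (f ⊕ g) = evaluate f + evaluate g
      evaluate (f ⊗ g) = evaluate f * evaluate g
      evaluate (⊝ f)   = - evaluate f

      module _ (φ-ring : IsRingMap) where
        open IsRingMap φ-ring

        evaluate-cong : ∀ {f g} → f ≈ₚ g → evaluate f ≈ evaluate g
        evaluate-cong ≈-refl = refl
        evaluate-cong (≈-sym p) = sym (evaluate-cong p)
        evaluate-cong (≈-trans p q) = trans (evaluate-cong p) (evaluate-cong q)
        evaluate-cong (⊕-cong p q) = +-cong (evaluate-cong p) (evaluate-cong q)
        evaluate-cong (⊗-cong p q) = *-cong (evaluate-cong p) (evaluate-cong q)
        evaluate-cong (⊝-cong p) = -‿cong (evaluate-cong p)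
        evaluate-cong (con-cong p) = φ-cong p
        evaluate-cong (con-+ a b) = φ-+ a b
        evaluate-cong (con-* a b) = φ-* a b
        evaluate-cong (⊕-assoc f g h) = +-assoc _ _ _
        evaluate-cong (⊕-comm f g) = +-comm _ _
        evaluate-cong (⊕-identityˡ f) = trans (+-congʳ φ-0) (+-identityˡ _)
        evaluate-cong (⊝-inverseˡ f) = trans (-‿inverseˡ _) (sym φ-0)
        evaluate-cong (⊗-assoc f g h) = *-assoc _ _ _
        evaluate-cong (⊗-comm f g) = *-comm _ _
        evaluate-cong (⊗-identityˡ f) = trans (*-congʳ φ-1) (*-identityˡ _)
        evaluate-cong (Polynomials.distribˡ f g h) = CommutativeRing.distribˡ T _ _ _

  module _ {n} (v : Point n) where
    open Evaluation K id

    value : Poly n → K.Carrier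
    value = evaluate v

    value-cong : ∀ {f g} → f ≈ₚ g → value f K.≈ value g
    value-cong = evaluate-cong v record
      { φ-cong = id ; φ-+ = λ _ _ → K.refl ; φ-* = λ _ _ → K.refl ; φ-0 = K.refl ; φ-1 = K.refl }

  con-injective : ∀ {n a b} → con {n} a ≈ₚ con b → a K.≈ b
  con-injective = value-cong (λ _ → K.0#)

  con≉0 : ∀ {n a} → ¬ a K.≈ K.0# → ¬ con {n} a ≈ₚ 0ₚ
  con≉0 a≉0 = a≉0 ∘ con-injective

  con-⊝ : ∀ {n} a → con {n} (K.- a) ≈ₚ ⊝ con a
  con-⊝ a = begin
    con (K.- a)                       ≈⟨ solve 2 (λ x y → x := x :+ y :- y) ≈-refl _ (con a) ⟩
    (con (K.- a) ⊕ con a) ⊕ ⊝ con a   ≈⟨ ⊕-cong (≈-trans (≈-sym (con-+ _ _)) (con-cong (K.-‿inverseˡ a))) ≈-refl ⟩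
    0ₚ ⊕ ⊝ con a                      ≈⟨ ⊕-identityˡ _ ⟩
    ⊝ con a                           ∎

  substitute-substitute : ∀ {n m k} (σ : Fin m → Poly k) (τ : Fin n → Poly m) f →
                          substitute σ (substitute τ f) ≈ₚ substitute (substitute σ ∘ τ) f
  substitute-substitute σ τ (con a) = ≈-refl
  substitute-substitute σ τ (var i) = ≈-refl
  substitute-substitute σ τ (f ⊕ g) = ⊕-cong (substitute-substitute σ τ f) (substitute-substitute σ τ g)
  substitute-substitute σ τ (f ⊗ g) = ⊗-cong (substitute-substitute σ τ f) (substitute-substitute σ τ g)
  substitute-substitute σ τ (⊝ f)   = ⊝-cong (substitute-substitute σ τ f)

  substitute-≈ : ∀ {n m} {σ τ : Fin n → Poly m} → (∀ i → σ i ≈ₚ τ i) → ∀ f → substitute σ f ≈ₚ substitute τ f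
  substitute-≈ e (con a) = ≈-refl
  substitute-≈ e (var i) = e i
  substitute-≈ e (f ⊕ g) = ⊕-cong (substitute-≈ e f) (substitute-≈ e g)
  substitute-≈ e (f ⊗ g) = ⊗-cong (substitute-≈ e f) (substitute-≈ e g)
  substitute-≈ e (⊝ f)   = ⊝-cong (substitute-≈ e f)

  substitute-var : ∀ {n} (f : Poly n) → substitute var f ≈ₚ f
  substitute-var (con a) = ≈-refl
  substitute-var (var i) = ≈-refl
  substitute-var (f ⊕ g) = ⊕-cong (substitute-var f) (substitute-var g)
  substitute-var (f ⊗ g) = ⊗-cong (substitute-var f) (substitute-var g)
  substitute-var (⊝ f)   = ⊝-cong (substitute-var f)

  substitute-agree : ∀ {n m m′ k} (σ : Fin m → Poly k) (τ : Fin n → Poly m)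
                     (σ′ : Fin m′ → Poly k) (τ′ : Fin n → Poly m′) →
                     (∀ i → substitute σ (τ i) ≈ₚ substitute σ′ (τ′ i)) →
                     ∀ f → substitute σ (substitute τ f) ≈ₚ substitute σ′ (substitute τ′ f)
  substitute-agree σ τ σ′ τ′ e f = ≈-trans (substitute-substitute σ τ f)
    (≈-trans (substitute-≈ e f) (≈-sym (substitute-substitute σ′ τ′ f)))

  weaken : ∀ {n} → Poly n → Poly (suc n)
  weaken = substitute (var ∘ suc)

  _[_] : ∀ {n} → Poly (suc n) → Poly n → Poly n
  f [ a ] = substitute (a ◂ var) f

  weaken-[] : ∀ {n} (f a : Poly n) → weaken f [ a ] ≈ₚ f
  weaken-[] f a = ≈-trans (substitute-substitute (a ◂ var) (var ∘ suc) f) (substitute-var f)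

  weaken-cong : ∀ {n} {f g : Poly n} → f ≈ₚ g → weaken f ≈ₚ weaken g
  weaken-cong = substitute-cong (var ∘ suc)

  module _ {n : ℕ} where
    open PowerSeries (S n) public using (_*ˢ_; const; Bounded; Bounded-≤)

  -- coeff d f is the coefficient of the d-th power of var zero.
  module _ {n : ℕ} where
    open Evaluation (Ser.seriesRing {n}) (Ser.const ∘ con)
    open Ser {n} using (indeterminate; const-cong; const-+; const-*)

    private
      ρ : Fin (suc n) → ℕ → Poly n
      ρ zero    = indeterminate 1ₚ
      ρ (suc i) = const (var i)

    series : Poly (suc n) → ℕ → Poly n
    series = evaluate ρ

    coeff : ℕ → Poly (suc n) → Poly n
    coeff d f = series f d

    coeff-cong : ∀ d {f g} → f ≈ₚ g → coeff d f ≈ₚ coeff d g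
    coeff-cong d eq = evaluate-cong ρ record
      { φ-cong = λ e → const-cong (con-cong e)
      ; φ-+ = λ a b i → ≈-trans (const-cong (con-+ a b) i) (const-+ _ _ i)
      ; φ-* = λ a b i → ≈-trans (const-cong (con-* a b) i) (const-* _ _ i)
      ; φ-0 = λ { zero → ≈-refl ; (suc i) → ≈-refl }
      ; φ-1 = λ _ → ≈-refl } eq d

    open Ser {n} using (const-*ˢ; *ˢ-cong; *ˢ-sucʳ; *ˢ-zeroˡ; tail; _·ˢ_; ·ˢ-*ˢ; *ˢ-comm)

    series-weaken : ∀ f d → coeff d (weaken f) ≈ₚ const f d
    series-weaken (con a) d = ≈-refl
    series-weaken (var i) d = ≈-refl
    series-weaken (f ⊕ g) d = ≈-trans (⊕-cong (series-weaken f d) (series-weaken g d)) (≈-sym (const-+ f g d))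
    series-weaken (f ⊗ g) d = ≈-trans (*ˢ-cong (series-weaken f) (series-weaken g) d) (≈-sym (const-* f g d))
    series-weaken (⊝ f) zero    = ⊝-cong (series-weaken f zero)
    series-weaken (⊝ f) (suc d) = ≈-trans (⊝-cong (series-weaken f (suc d))) -0#≈0#

    coeff-weaken-⊗ : ∀ d g f → coeff d (weaken g ⊗ f) ≈ₚ g ⊗ coeff d f
    coeff-weaken-⊗ d g f = ≈-trans (*ˢ-cong {q = series f} {q′ = series f} (series-weaken g) (λ _ → ≈-refl) d)
      (const-*ˢ g (series f) d)

    coeff-con-⊗ : ∀ d a f → coeff d (con a ⊗ f) ≈ₚ con a ⊗ coeff d f
    coeff-con-⊗ d a f = const-*ˢ (con a) (series f) d

    coeff-zero-⊗ : ∀ f → coeff 0 (var zero ⊗ f) ≈ₚ 0ₚ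
    coeff-zero-⊗ f = SR.zeroˡ _

    coeff-suc-⊗ : ∀ d f → coeff (suc d) (var zero ⊗ f) ≈ₚ coeff d f
    coeff-suc-⊗ d f = ≈-trans (⊕-cong (SR.zeroˡ _) (const-*ˢ 1ₚ (series f) d))
      (≈-trans (⊕-identityˡ _) (⊗-identityˡ _))

    horner : ℕ → (ℕ → Poly n) → Poly (suc n)
    horner zero    p = 0ₚ
    horner (suc N) p = weaken (p 0) ⊕ var zero ⊗ horner N (tail p)

    horner-cong : ∀ N {p q} → (∀ d → p d ≈ₚ q d) → horner N p ≈ₚ horner N q
    horner-cong zero    e = ≈-refl
    horner-cong (suc N) e = ⊕-cong (weaken-cong (e 0)) (⊗-cong ≈-refl (horner-cong N (e ∘ suc)))

    horner-0 : ∀ N {p} → (∀ d → p d ≈ₚ 0ₚ) → horner N p ≈ₚ 0ₚ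
    horner-0 zero    e = ≈-refl
    horner-0 (suc N) e = ≈-trans (⊕-cong (weaken-cong (e 0))
      (≈-trans (⊗-cong ≈-refl (horner-0 N (e ∘ suc))) (SR.zeroʳ _))) (⊕-identityˡ _)

    horner-⊕ : ∀ N p q → horner N (λ d → p d ⊕ q d) ≈ₚ horner N p ⊕ horner N q
    horner-⊕ zero    p q = ≈-sym (⊕-identityˡ _)
    horner-⊕ (suc N) p q = ≈-trans (⊕-cong ≈-refl (⊗-cong ≈-refl (horner-⊕ N (tail p) (tail q))))
      (solve 5 (λ a b x u v → (a :+ b) :+ x :* (u :+ v) := (a :+ x :* u) :+ (b :+ x :* v)) ≈-refl _ _ _ _ _)

    horner-⊗ : ∀ N g p → horner N (λ d → g ⊗ p d) ≈ₚ weaken g ⊗ horner N p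
    horner-⊗ zero    g p = ≈-sym (SR.zeroʳ _)
    horner-⊗ (suc N) g p = ≈-trans (⊕-cong ≈-refl (⊗-cong ≈-refl (horner-⊗ N g (tail p))))
      (solve 4 (λ g a x u → g :* a :+ x :* (g :* u) := g :* (a :+ x :* u)) ≈-refl _ _ _ _)

    horner-bounded : ∀ N M {p} → N ℕ.≤ M → Bounded N p → horner M p ≈ₚ horner N p
    horner-bounded zero    M       N≤M       b = horner-0 M b
    horner-bounded (suc N) (suc M) (ℕ.s≤s N≤M) b = ⊕-cong ≈-refl (⊗-cong ≈-refl (horner-bounded N M N≤M b))

    horner-*ˢ : ∀ N M p q → Bounded N p → Bounded M q → horner (N ℕ.+ M) (p *ˢ q) ≈ₚ horner N p ⊗ horner M q
    horner-*ˢ zero    M p q b b′ = ≈-trans (horner-0 M (*ˢ-zeroˡ q b)) (≈-sym (SR.zeroˡ _))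
    horner-*ˢ (suc N) M p q b b′ = begin
      weaken (p 0 ⊗ q 0) ⊕ x ⊗ horner NM (λ d → p 0 ⊗ q (suc d) ⊕ (tail p *ˢ q) d)
        ≈⟨ ⊕-cong ≈-refl (⊗-cong ≈-refl (horner-⊕ NM (λ d → p 0 ⊗ q (suc d)) (tail p *ˢ q))) ⟩
      weaken (p 0 ⊗ q 0) ⊕ x ⊗ (horner NM (λ d → p 0 ⊗ q (suc d)) ⊕ horner NM (tail p *ˢ q))
        ≈⟨ ⊕-cong ≈-refl (⊗-cong ≈-refl (⊕-cong (horner-⊗ NM (p 0) (tail q)) (horner-*ˢ N M (tail p) q b b′))) ⟩
      weaken (p 0) ⊗ weaken (q 0) ⊕ x ⊗ (weaken (p 0) ⊗ horner NM (tail q) ⊕ horner N (tail p) ⊗ horner M q)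
        ≈⟨ solve 6 (λ p q x u v w → p :* q :+ x :* (p :* u :+ v :* w) := p :* (q :+ x :* u) :+ x :* v :* w) ≈-refl _ _ _ _ _ _ ⟩
      weaken (p 0) ⊗ horner (suc NM) q ⊕ x ⊗ horner N (tail p) ⊗ horner M q
        ≈⟨ ⊕-cong (⊗-cong ≈-refl (horner-bounded M (suc NM) (ℕ.m≤n⇒m≤1+n (ℕ.m≤n+m M N)) b′)) ≈-refl ⟩
      weaken (p 0) ⊗ horner M q ⊕ x ⊗ horner N (tail p) ⊗ horner M q
        ≈⟨ SR.distribʳ _ _ _ ⟨
      horner (suc N) p ⊗ horner M q ∎
      where
      NM = N ℕ.+ M
      x = var zero

    expansion : ∀ f → ∃ λ N → Bounded N (series f) × f ≈ₚ horner N (series f)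
    expansion (con a) = 1 , (λ d → ≈-refl) , ≈-sym (≈-trans (⊕-cong ≈-refl (SR.zeroʳ _)) (SR.+-identityʳ _))
    expansion (var zero) = 2 , (λ d → ≈-refl) , solve 1 (λ x → x := :0 :+ x :* (:1 :+ x :* :0)) ≈-refl (var zero)
    expansion (var (suc i)) = 1 , (λ d → ≈-refl) , ≈-sym (≈-trans (⊕-cong ≈-refl (SR.zeroʳ _)) (SR.+-identityʳ _))
    expansion (f ⊕ g) with expansion f | expansion g
    ... | N , b , e | M , b′ , e′ = N ℕ.+ M ,
      (λ d → ≈-trans (⊕-cong (Bounded-≤ {p = series f} (ℕ.m≤m+n N M) b d) (Bounded-≤ {p = series g} (ℕ.m≤n+m M N) b′ d))
        (⊕-identityˡ _)) ,
      ≈-trans (⊕-cong (≈-trans e (≈-sym (horner-bounded N (N ℕ.+ M) (ℕ.m≤m+n N M) b)))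
                      (≈-trans e′ (≈-sym (horner-bounded M (N ℕ.+ M) (ℕ.m≤n+m M N) b′))))
        (≈-sym (horner-⊕ (N ℕ.+ M) (series f) (series g)))
    expansion (f ⊗ g) with expansion f | expansion g
    ... | N , b , e | M , b′ , e′ = N ℕ.+ M , Ser.Bounded-* N M (series f) (series g) b b′ ,
      ≈-trans (⊗-cong e e′) (≈-sym (horner-*ˢ N M (series f) (series g) b b′))
    expansion (⊝ f) with expansion f
    ... | N , b , e = N , (λ d → ≈-trans (⊝-cong (b d)) -0#≈0#) , (begin
      ⊝ f                                     ≈⟨ ⊝-cong e ⟩
      ⊝ horner N (series f)                   ≈⟨ solve 1 (λ x → :- x := (:- :1) :* x) ≈-refl _ ⟩
      ⊝ 1ₚ ⊗ horner N (series f)              ≈⟨ horner-⊗ N (⊝ 1ₚ) (series f) ⟨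
      horner N (λ d → ⊝ 1ₚ ⊗ series f d)      ≈⟨ horner-cong N (λ d → solve 1 (λ x → (:- :1) :* x := :- x) ≈-refl _) ⟩
      horner N (λ d → ⊝ series f d)           ∎)

    coeff-injective : ∀ f → (∀ d → coeff d f ≈ₚ 0ₚ) → f ≈ₚ 0ₚ
    coeff-injective f e with expansion f
    ... | N , _ , eq = ≈-trans eq (horner-0 N e)

  con-value : ∀ (v : Point 0) f → f ≈ₚ con (value v f)
  con-value v (con a) = ≈-refl
  con-value v (f ⊕ g) = ≈-trans (⊕-cong (con-value v f) (con-value v g)) (≈-sym (con-+ _ _))
  con-value v (f ⊗ g) = ≈-trans (⊗-cong (con-value v f) (con-value v g)) (≈-sym (con-* _ _))
  con-value v (⊝ f)   = ≈-trans (⊝-cong (con-value v f)) (≈-sym (con-⊝ _))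

  domain : ∀ {n} (f g : Poly n) → f ⊗ g ≈ₚ 0ₚ → ¬ f ≈ₚ 0ₚ → g ≈ₚ 0ₚ
  domain {zero} f g fg≈0 f≉0 = ≈-trans (con-value (λ ()) g) (con-cong
    (K-domain (value (λ ()) f) (value (λ ()) g) (value-cong (λ ()) fg≈0)
      λ f≈0 → f≉0 (≈-trans (con-value (λ ()) f) (con-cong f≈0))))
  domain {suc n} f g fg≈0 f≉0 = coeff-injective g λ j → dne λ gⱼ≉0 → f≉0 (coeff-injective f λ i → dne λ fᵢ≉0 →
    Ser.*ˢ-nonZero (λ _ → em) domain i j (series f) (series g) fᵢ≉0 gⱼ≉0
      (λ d → ≈-trans (coeff-cong d {f ⊗ g} {0ₚ} fg≈0) (0-series d)))
    where
    0-series : ∀ d → const {n} 0ₚ d ≈ₚ 0ₚ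
    0-series zero    = ≈-refl
    0-series (suc d) = ≈-refl

  cancelˡ : ∀ {n} (f : Poly n) {g h} → ¬ f ≈ₚ 0ₚ → f ⊗ g ≈ₚ f ⊗ h → g ≈ₚ h
  cancelˡ f {g} {h} f≉0 eq = begin
    g                    ≈⟨ solve 2 (λ g h → g := (g :- h) :+ h) ≈-refl g h ⟩
    (g ⊕ ⊝ h) ⊕ h        ≈⟨ ⊕-cong (domain f (g ⊕ ⊝ h) (begin
        f ⊗ (g ⊕ ⊝ h)        ≈⟨ solve 3 (λ f g h → f :* (g :- h) := f :* g :- f :* h) ≈-refl f g h ⟩
        f ⊗ g ⊕ ⊝ (f ⊗ h)    ≈⟨ ⊕-cong eq ≈-refl ⟩
        f ⊗ h ⊕ ⊝ (f ⊗ h)    ≈⟨ SR.-‿inverseʳ _ ⟩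
        0ₚ                   ∎) f≉0) ≈-refl ⟩
    0ₚ ⊕ h               ≈⟨ ⊕-identityˡ h ⟩
    h                    ∎

  private
    module KS = SetoidReasoning K.setoid

  1ₚ≉0ₚ : ∀ {n} → ¬ 1ₚ {n} ≈ₚ 0ₚ
  1ₚ≉0ₚ = con≉0 1≉0

  -- Linear forms

  ·-congˡ : ∀ {n} {α β : Form n} v → α ≋ₖ β → α · v K.≈ β · v
  ·-congˡ {α = α} {β} v e = KLin.sum-cong _ (λ i → β i K.* v i) (λ i → K.*-congʳ (e i))

  ·-comm : ∀ {n} (α v : Vector K.Carrier n) → α · v K.≈ v · α
  ·-comm α v = KLin.sum-cong _ (λ i → v i K.* α i) (λ i → K.*-comm _ _)

  ·-lincombˡ : ∀ {k n} (a : Vector K.Carrier k) (b : Vector (Form n) k) v →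
               KLin.lincomb a b · v K.≈ a · (λ j → b j · v)
  ·-lincombˡ a b v = K.sym (KLin.lincomb-assoc a b (λ k (_ : Fin 1) → v k) zero)

  ·-lincombʳ : ∀ {k n} (α : Form n) (a : Vector K.Carrier k) (b : Vector (Point n) k) →
               α · KLin.lincomb a b K.≈ (λ j → α · b j) · a
  ·-lincombʳ α a b = K.trans (·-comm α _) (K.trans (·-lincombˡ a b α)
    (K.trans (·-comm a _) (·-congˡ a (λ j → ·-comm (b j) α))))

  ·-scaleˡ : ∀ {n} a (α : Form n) v → (λ i → a K.* α i) · v K.≈ a K.* (α · v)
  ·-scaleˡ a α v = KLin.lincomb-* a α (λ k (_ : Fin 1) → v k) zero

  ·-+ˡ : ∀ {n} (α β : Form n) v → (λ i → α i K.+ β i) · v K.≈ α · v K.+ β · v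
  ·-+ˡ α β v = KLin.lincomb-+ α β (λ k (_ : Fin 1) → v k) zero

  ·-combineˡ : ∀ {n} a (α : Form n) b β v →
               (λ i → a K.* α i K.+ b K.* β i) · v K.≈ a K.* (α · v) K.+ b K.* (β · v)
  ·-combineˡ a α b β v = K.trans (·-+ˡ _ _ v) (K.+-cong (·-scaleˡ a α v) (·-scaleˡ b β v))

  ·-combineʳ : ∀ {n} (α : Form n) a v b w →
               α · (λ i → a K.* v i K.+ b K.* w i) K.≈ a K.* (α · v) K.+ b K.* (α · w)
  ·-combineʳ α a v b w = K.trans (·-comm α _) (K.trans (·-combineˡ a v b w α)
    (K.+-cong (K.*-congˡ (·-comm v α)) (K.*-congˡ (·-comm w α))))

  ·-δ : ∀ {n} (α : Form n) i → α · δ i K.≈ α i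
  ·-δ α i = K.trans (·-comm α (δ i)) (KLin.sum-δˡ i α)

  nonZero-coordinate : ∀ {n} {α : Form n} → NonZero α → ∃ λ p → ¬ α p K.≈ K.0#
  nonZero-coordinate α≉0 = dne λ none → α≉0 λ p → dne λ αₚ≉0 → none (p , αₚ≉0)

  proportional : ∀ {n} {α β : Form n} → NonZero α → hyperplane α ⊆ hyperplane β → ∃ λ a → β ≋ₖ (λ i → a K.* α i)
  proportional {α = α} {β} α≉0 α⊆β with nonZero-coordinate α≉0
  ... | p , αₚ≉0 with inverse αₚ≉0
  ... | b , inv = b K.* β p , λ j → KS.begin
    β j                                  KS.≈⟨ solveᴷ 3 (λ b a x → x ≔ b ⊠ a ⊠ x ⊞ (1ᴷ ⊟ b ⊠ a) ⊠ x) K.refl b (α p) (β j) ⟩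
    b K.* α p K.* β j K.+ (K.1# K.- b K.* α p) K.* β j
                                         KS.≈⟨ K.+-congˡ (K.trans (K.*-congʳ (K.trans (K.+-congˡ (K.-‿cong inv)) (K.-‿inverseʳ _))) (K.zeroˡ _)) ⟩
    b K.* α p K.* β j K.+ K.0#           KS.≈⟨ K.+-congˡ (K.zeroʳ b) ⟨
    b K.* α p K.* β j K.+ b K.* K.0#     KS.≈⟨ K.+-congˡ (K.*-congˡ (zero-at j)) ⟨
    b K.* α p K.* β j K.+ b K.* (α j K.* β p K.+ K.- α p K.* β j)
                                         KS.≈⟨ solveᴷ 5 (λ b a x y z → b ⊠ a ⊠ x ⊞ b ⊠ (y ⊠ z ⊞ (⊟ a) ⊠ x) ≔ b ⊠ z ⊠ y) K.refl b (α p) (β j) (α j) (β p) ⟩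
    b K.* β p K.* α j                    KS.∎
    where
    zero-at : ∀ j → α j K.* β p K.+ K.- α p K.* β j K.≈ K.0#
    zero-at j = K.trans (K.sym (K.trans (·-combineʳ β (α j) (δ p) (K.- α p) (δ j))
      (K.+-cong (K.*-congˡ (·-δ β p)) (K.*-congˡ (·-δ β j)))))
      (α⊆β (K.trans (·-combineʳ α (α j) (δ p) (K.- α p) (δ j))
      (K.trans (K.+-cong (K.*-congˡ (·-δ α p)) (K.*-congˡ (·-δ α j)))
        (solveᴷ 2 (λ x y → x ⊠ y ⊞ (⊟ y) ⊠ x ≔ 0ᴷ) K.refl (α j) (α p)))))

  ⊆⇒same : ∀ {n} {α β : Form n} → NonZero α → NonZero β → hyperplane α ⊆ hyperplane β → SameHyperplane α β
  ⊆⇒same {α = α} {β} α≉0 β≉0 α⊆β v = mk⇔ α⊆β λ βv≈0 →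
    K-domain a _ (K.trans (K.sym (K.trans (·-congˡ v e) (·-scaleˡ a α v))) βv≈0)
      (λ a≈0 → β≉0 λ i → K.trans (e i) (K.trans (K.*-congʳ a≈0) (K.zeroˡ _)))
    where
    a = proj₁ (proportional α≉0 α⊆β)
    e = proj₂ (proportional α≉0 α⊆β)

  same-refl : ∀ {n} {α : Form n} → SameHyperplane α α
  same-refl v = mk⇔ id id

  same-sym : ∀ {n} {α β : Form n} → SameHyperplane α β → SameHyperplane β α
  same-sym e v = mk⇔ (Equivalence.from (e v)) (Equivalence.to (e v))

  same-trans : ∀ {n} {α β γ : Form n} → SameHyperplane α β → SameHyperplane β γ → SameHyperplane α γ
  same-trans e f v = mk⇔ (Equivalence.to (f v) ∘ Equivalence.to (e v)) (Equivalence.from (e v) ∘ Equivalence.from (f v))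

  Independent : ∀ {k n} → Vector (Vector K.Carrier n) k → Set (c ⊔ ℓ₁)
  Independent b = ∀ a → KLin.lincomb a b ≋ₖ (λ _ → K.0#) → ∀ i → a i K.≈ K.0#

  independent⇒spanning : ∀ {n} (b : Vector (Vector K.Carrier n) n) → Independent b →
                         ∀ v → ∃ λ a → v ≋ₖ KLin.lincomb a b
  independent⇒spanning {n} b ind v with DomainLinearAlgebra.dependent em K 1≉0 K-domain (ℕ.n<1+n n) (v ◂ b)
  ... | a , rel , nz with em {P = a zero K.≈ K.0#}
  ... | yes a₀≈0 = contradiction (all-zero (proj₁ nz)) (proj₂ nz)
    where
    all-zero : ∀ i → a i K.≈ K.0#
    all-zero zero    = a₀≈0
    all-zero (suc i) = ind (a ∘ suc) (λ j → K.trans (K.sym (K.+-identityˡ _))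
      (K.trans (K.+-congʳ (K.sym (K.trans (K.*-congʳ a₀≈0) (K.zeroˡ _)))) (rel j))) i
  ... | no a₀≉0 with inverse a₀≉0
  ... | s , inv = (λ i → K.- s K.* a (suc i)) , λ j → KS.begin
    v j                                          KS.≈⟨ K.*-identityˡ _ ⟨
    K.1# K.* v j                                 KS.≈⟨ K.*-congʳ inv ⟨
    s K.* a zero K.* v j                         KS.≈⟨ solveᴷ 4 (λ s a v l → s ⊠ a ⊠ v ≔ s ⊠ (a ⊠ v ⊞ l) ⊞ (⊟ s) ⊠ l) K.refl s (a zero) (v j) (KLin.lincomb (a ∘ suc) b j) ⟩
    s K.* KLin.lincomb a (v ◂ b) j K.+ K.- s K.* KLin.lincomb (a ∘ suc) b j
                                                 KS.≈⟨ K.+-congʳ (K.trans (K.*-congˡ (rel j)) (K.zeroʳ s)) ⟩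
    K.0# K.+ K.- s K.* KLin.lincomb (a ∘ suc) b j KS.≈⟨ K.+-identityˡ _ ⟩
    K.- s K.* KLin.lincomb (a ∘ suc) b j         KS.≈⟨ KLin.lincomb-* (K.- s) (a ∘ suc) b j ⟨
    KLin.lincomb (λ i → K.- s K.* a (suc i)) b j KS.∎

  independent-tail : ∀ {k n} (b : Vector (Vector K.Carrier n) (suc k)) → Independent b → Independent (b ∘ suc)
  independent-tail b ind a rel i = ind (K.0# ◂ a)
    (λ j → K.trans (K.+-congʳ (K.zeroˡ _)) (K.trans (K.+-identityˡ _) (rel j))) (suc i)

  dualForms : ∀ {r n} (b : Vector (Point n) r) → Independent b → ∃ λ (x : Vector (Form n) r) → ∀ i j → x i · b j K.≈ δ i j
  dualForms {zero} b ind = (λ ()) , λ ()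
  dualForms {suc r} {n} b ind = y , dual-y
    where
    IH = dualForms (b ∘ suc) (independent-tail b ind)
    x = proj₁ IH
    dual = proj₂ IH
    u-coefficients : Vector K.Carrier (suc r)
    u-coefficients = K.1# ◂ (λ j → K.- (x j · b zero))
    u : Point n
    u = KLin.lincomb u-coefficients b
    u≉0 : NonZero u
    u≉0 u≈0 = 1≉0 (ind u-coefficients u≈0 zero)
    p = proj₁ (nonZero-coordinate u≉0)
    s = proj₁ (inverse (proj₂ (nonZero-coordinate u≉0)))
    ψ : Form n
    ψ i = K.1# K.* δ p i K.+ K.- K.1# K.* KLin.lincomb (λ j → b (suc j) p) x i
    ψ· : ∀ v → ψ · v K.≈ v p K.- (λ j → b (suc j) p) · (λ j → x j · v)
    ψ· v = K.trans (·-combineˡ K.1# (δ p) (K.- K.1#) _ v)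
      (K.trans (K.+-cong (K.*-congˡ (KLin.sum-δˡ p v)) (K.*-congˡ (·-lincombˡ (λ j → b (suc j) p) x v)))
        (solveᴷ 2 (λ x y → 1ᴷ ⊠ x ⊞ (⊟ 1ᴷ) ⊠ y ≔ x ⊟ y) K.refl _ _))
    ψ·b₀ : ψ · b zero K.≈ u p
    ψ·b₀ = K.trans (ψ· (b zero)) (K.+-cong (K.sym (K.*-identityˡ _))
      (K.trans (K.trans (solveᴷ 1 (λ x → ⊟ x ≔ (⊟ 1ᴷ) ⊠ x) K.refl _) (KLin.*-distribˡ-sum (K.- K.1#) (λ j → b (suc j) p K.* (x j · b zero))))
        (KLin.sum-cong (λ j → K.- K.1# K.* (b (suc j) p K.* (x j · b zero))) (λ j → K.- (x j · b zero) K.* b (suc j) p) (λ j →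
          solveᴷ 2 (λ x y → (⊟ 1ᴷ) ⊠ (x ⊠ y) ≔ (⊟ y) ⊠ x) K.refl _ _))))
    ψ·b : ∀ k → ψ · b (suc k) K.≈ K.0#
    ψ·b k = K.trans (ψ· (b (suc k))) (K.trans (K.+-congˡ (K.-‿cong
      (K.trans (KLin.sum-cong _ (λ j → b (suc j) p K.* δ j k) (λ j → K.*-congˡ (dual j k))) (KLin.sum-δʳ k (λ j → b (suc j) p)))))
      (K.-‿inverseʳ _))
    z : Form n
    z i = s K.* ψ i
    y : Vector (Form n) (suc r)
    y = z ◂ λ j i → K.1# K.* x j i K.+ K.- (x j · b zero) K.* z i
    y₀ : ∀ v → z · v K.≈ s K.* (ψ · v)
    y₀ = ·-scaleˡ s ψ
    y₀·b₀ : z · b zero K.≈ K.1#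
    y₀·b₀ = K.trans (y₀ (b zero)) (K.trans (K.*-congˡ ψ·b₀) (proj₂ (inverse (proj₂ (nonZero-coordinate u≉0)))))
    y₀·b : ∀ k → z · b (suc k) K.≈ K.0#
    y₀·b k = K.trans (y₀ (b (suc k))) (K.trans (K.*-congˡ (ψ·b k)) (K.zeroʳ s))
    dual-y : ∀ i j → y i · b j K.≈ δ i j
    dual-y zero    zero    = y₀·b₀
    dual-y zero    (suc k) = y₀·b k
    dual-y (suc j) zero    = K.trans (·-combineˡ K.1# (x j) _ z (b zero))
      (K.trans (K.+-congˡ (K.*-congˡ y₀·b₀)) (solveᴷ 1 (λ x → 1ᴷ ⊠ x ⊞ (⊟ x) ⊠ 1ᴷ ≔ 0ᴷ) K.refl _))
    dual-y (suc j) (suc k) = K.trans (·-combineˡ K.1# (x j) _ z (b (suc k)))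
      (K.trans (K.+-cong (K.*-congˡ (dual j k)) (K.*-congˡ (y₀·b k)))
        (solveᴷ 2 (λ x y → 1ᴷ ⊠ y ⊞ x ⊠ 0ᴷ ≔ y) K.refl _ _))

  con-sum : ∀ {k n} (a : Vector K.Carrier k) → con {n} (KLin.sum a) ≈ₚ sum (con ∘ a)
  con-sum {zero}  a = ≈-refl
  con-sum {suc k} a = ≈-trans (con-+ _ _) (⊕-cong ≈-refl (con-sum (a ∘ suc)))

  linear-cong : ∀ {n} {α β : Form n} → α ≋ₖ β → linear α ≈ₚ linear β
  linear-cong {α = α} {β} e = SLin.sum-cong (λ i → con (α i) ⊗ var i) (λ i → con (β i) ⊗ var i) (λ i → ⊗-cong (con-cong (e i)) ≈-refl)

  linear-lincomb : ∀ {k n} (a : Vector K.Carrier k) (b : Vector (Form n) k) →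
                   sum (λ j → con (a j) ⊗ linear (b j)) ≈ₚ linear (KLin.lincomb a b)
  linear-lincomb a b = begin
    sum (λ j → con (a j) ⊗ linear (b j))
      ≈⟨ SLin.lincomb-assoc (con ∘ a) (λ j → con ∘ b j) (λ i (_ : Fin 1) → var i) zero ⟩
    sum (λ i → SLin.lincomb (con ∘ a) (λ j → con ∘ b j) i ⊗ var i)
      ≈⟨ SLin.lincomb-congˡ _ (λ i → con (KLin.lincomb a b i)) (λ i (_ : Fin 1) → var i) (λ i → ≈-sym (≈-trans
           (con-sum (λ j → a j K.* b j i))
           (SLin.sum-cong (λ j → con (a j K.* b j i)) (λ j → con (a j) ⊗ con (b j i)) (λ j → con-* _ _)))) zero ⟩
    linear (KLin.lincomb a b) ∎

  linear-scale : ∀ {n} a (α : Form n) → linear (λ i → a K.* α i) ≈ₚ con a ⊗ linear α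
  linear-scale a α = ≈-trans (linear-cong (λ i → K.sym (K.+-identityʳ _)))
    (≈-trans (≈-sym (linear-lincomb (λ (_ : Fin 1) → a) (λ _ → α))) (SR.+-identityʳ _))

  linear-combine : ∀ {n} a (α : Form n) b β →
                   linear (λ i → a K.* α i K.+ b K.* β i) ≈ₚ con a ⊗ linear α ⊕ con b ⊗ linear β
  linear-combine a α b β = ≈-trans (linear-cong (λ i → K.+-congˡ (K.sym (K.+-identityʳ _))))
    (≈-trans (≈-sym (linear-lincomb (a ◂ λ (_ : Fin 1) → b) (α ◂ λ _ → β))) (⊕-cong ≈-refl (SR.+-identityʳ _)))

  linear-δ : ∀ {n} (j : Fin n) → linear (δ j) ≈ₚ var j
  linear-δ {n} j = ≈-trans
    (SLin.sum-cong (λ i → con (δ j i) ⊗ var i) (λ i → SLin.δ j i ⊗ var i) (λ i → ⊗-cong (con-δ j i) ≈-refl))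
    (SLin.sum-δˡ j var)
    where
    con-δ : ∀ {k} (i j : Fin k) → con {n} (δ i j) ≈ₚ SLin.δ i j
    con-δ zero    zero    = ≈-refl
    con-δ zero    (suc j) = ≈-refl
    con-δ (suc i) zero    = ≈-refl
    con-δ (suc i) (suc j) = con-δ i j

  substitute-linear : ∀ {n m} (σ : Fin n → Poly m) (α : Form n) →
                      substitute σ (linear α) ≈ₚ sum (λ i → con (α i) ⊗ σ i)
  substitute-linear σ α = substitute-sum σ (λ i → con (α i) ⊗ var i)

  substitute-linear-linear : ∀ {n m} (σ : Fin n → Poly m) (s : Vector (Form m) n) → (∀ i → σ i ≈ₚ linear (s i)) →
                             ∀ α → substitute σ (linear α) ≈ₚ linear (KLin.lincomb α s)
  substitute-linear-linear σ s e α = ≈-trans (substitute-linear σ α)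
    (≈-trans (SLin.sum-cong (λ i → con (α i) ⊗ σ i) (λ i → con (α i) ⊗ linear (s i)) (λ i → ⊗-cong ≈-refl (e i)))
      (linear-lincomb α s))

  value-linear : ∀ {n} (α : Form n) v → value v (linear α) K.≈ α · v
  value-linear α v = value-sum (λ i → con (α i) ⊗ var i)
    where
    value-sum : ∀ {k} (f : Vector _ k) → value v (sum f) K.≈ KLin.sum (value v ∘ f)
    value-sum {zero}  f = K.refl
    value-sum {suc k} f = K.+-congˡ (value-sum (f ∘ suc))

  linear-nonZero : ∀ {n} {α : Form n} → NonZero α → ¬ linear α ≈ₚ 0ₚ
  linear-nonZero {α = α} α≉0 α≈0 = α≉0 λ i → K.trans (K.sym (·-δ α i))
    (K.trans (K.sym (value-linear α (δ i))) (value-cong (δ i) α≈0))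

  -- Divisibility

  infix 4 _∣_
  record _∣_ {n} (f g : Poly n) : Set (c ⊔ ℓ₁) where
    constructor _,_
    field
      quotient : Poly n
      equality : g ≈ₚ f ⊗ quotient

  open _∣_ public

  ∣-resp : ∀ {n} {f g h : Poly n} → g ≈ₚ h → f ∣ g → f ∣ h
  ∣-resp e (q , eq) = q , ≈-trans (≈-sym e) eq

  ∣-respˡ : ∀ {n} {f g h : Poly n} → f ≈ₚ g → f ∣ h → g ∣ h
  ∣-respˡ e (q , eq) = q , ≈-trans eq (⊗-cong e ≈-refl)

  ∣-trans : ∀ {n} {f g h : Poly n} → f ∣ g → g ∣ h → f ∣ h
  ∣-trans (q , eq) (r , eq′) = q ⊗ r , ≈-trans eq′ (≈-trans (⊗-cong eq ≈-refl) (⊗-assoc _ _ _))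

  ∣-0 : ∀ {n} {f g : Poly n} → g ≈ₚ 0ₚ → f ∣ g
  ∣-0 e = 0ₚ , ≈-trans e (≈-sym (SR.zeroʳ _))

  ∣-⊕ : ∀ {n} {f g h : Poly n} → f ∣ g → f ∣ h → f ∣ g ⊕ h
  ∣-⊕ (q , eq) (r , eq′) = q ⊕ r , ≈-trans (⊕-cong eq eq′) (≈-sym (distribˡ _ _ _))

  ∣-⊗ˡ : ∀ {n} {f g : Poly n} h → f ∣ g → f ∣ h ⊗ g
  ∣-⊗ˡ h (q , eq) = h ⊗ q , ≈-trans (⊗-cong ≈-refl eq)
    (solve 3 (λ h f q → h :* (f :* q) := f :* (h :* q)) ≈-refl h _ q)

  ∣-⊗ʳ : ∀ {n} {f g : Poly n} h → f ∣ g → f ∣ g ⊗ h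
  ∣-⊗ʳ h (q , eq) = q ⊗ h , ≈-trans (⊗-cong eq ≈-refl) (⊗-assoc _ _ _)

  ∣-factorˡ : ∀ {n} (f g : Poly n) → f ∣ f ⊗ g
  ∣-factorˡ f g = g , ≈-refl

  ∣-⊖ : ∀ {n} {f g h : Poly n} → f ∣ g → f ∣ h → f ∣ g ⊕ ⊝ h
  ∣-⊖ (q , eq) (r , eq′) = q ⊕ ⊝ r , ≈-trans (⊕-cong eq (⊝-cong eq′))
    (solve 3 (λ f q r → f :* q :- f :* r := f :* (q :- r)) ≈-refl _ q r)

  ∣-sum : ∀ {k n} {f : Poly n} (g : Vector (Poly n) k) → (∀ i → f ∣ g i) → f ∣ sum g
  ∣-sum {zero}  g d = ∣-0 ≈-refl
  ∣-sum {suc k} g d = ∣-⊕ (d zero) (∣-sum (g ∘ suc) (d ∘ suc))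

  ∣-substitute : ∀ {n m} (σ : Fin n → Poly m) {f g} → f ∣ g → substitute σ f ∣ substitute σ g
  ∣-substitute σ (q , eq) = substitute σ q , substitute-cong σ eq

  ∣-con⊗ : ∀ {n} {f g : Poly n} {a} → ¬ a K.≈ K.0# → f ∣ con a ⊗ g → f ∣ g
  ∣-con⊗ {g = g} {a} a≉0 f∣ag with inverse a≉0
  ... | b , inv = ∣-resp (begin
    con b ⊗ (con a ⊗ g)   ≈⟨ ⊗-assoc _ _ _ ⟨
    con b ⊗ con a ⊗ g     ≈⟨ ⊗-cong (≈-trans (≈-sym (con-* b a)) (con-cong inv)) ≈-refl ⟩
    1ₚ ⊗ g                ≈⟨ ⊗-identityˡ g ⟩
    g                     ∎) (∣-⊗ˡ (con b) f∣ag)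

  module _ {n} (I : Ideal (S n) (c ⊔ ℓ₁)) where
    open Ideal I renaming (member to _∈I)

    ideal-sum : ∀ {k} (f : Vector (Poly n) k) → (∀ i → f i ∈I) → sum f ∈I
    ideal-sum {zero}  f p = 0-closed
    ideal-sum {suc k} f p = +-closed (p zero) (ideal-sum (f ∘ suc) (p ∘ suc))

    ideal-⊖ : ∀ {f g} → f ∈I → g ∈I → (f ⊕ ⊝ g) ∈I
    ideal-⊖ {f} {g} p q = +-closed p (resp (solve 1 (λ x → (:- :1) :* x := :- x) ≈-refl g) (*-closed (⊝ 1ₚ) q))

    ideal-*ʳ : ∀ {f} g → f ∈I → (f ⊗ g) ∈I
    ideal-*ʳ g p = resp (⊗-comm _ _) (*-closed g p)

    module _ {m} (σ τ : Fin m → Poly n) (e : ∀ i → (σ i ⊕ ⊝ τ i) ∈I) where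
      private module Quot = CommutativeRing (quotientRing (S n) I)

      substitute-mod : ∀ f → (substitute σ f ⊕ ⊝ substitute τ f) ∈I
      substitute-mod (con a) = Quot.refl {con a}
      substitute-mod (var i) = e i
      substitute-mod (f ⊕ g) = Quot.+-cong (substitute-mod f) (substitute-mod g)
      substitute-mod (f ⊗ g) = Quot.*-cong (substitute-mod f) (substitute-mod g)
      substitute-mod (⊝ f)   = Quot.-‿cong (substitute-mod f)

    coeffs-in-ideal : ∀ a f → (∀ d → coeff d f ∈I) → (f [ a ]) ∈I
    coeffs-in-ideal a f p with expansion f
    ... | N , _ , eq = resp (≈-sym (substitute-cong (a ◂ var) eq)) (horner-in-ideal N (series f) p)
      where
      horner-in-ideal : ∀ N (q : ℕ → Poly n) → (∀ d → q d ∈I) → (horner N q [ a ]) ∈I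
      horner-in-ideal zero    q p = 0-closed
      horner-in-ideal (suc N) q p = +-closed (resp (≈-sym (weaken-[] (q 0) a)) (p 0))
        (*-closed a (horner-in-ideal N (q ∘ suc) (p ∘ suc)))

  ⟨_⟩ : ∀ {n} → Poly n → Ideal (S n) (c ⊔ ℓ₁)
  ⟨ f ⟩ = record
    { member = f ∣_ ; resp = ∣-resp ; 0-closed = ∣-0 ≈-refl ; +-closed = ∣-⊕ ; *-closed = λ s → ∣-⊗ˡ s }

  ⟪_,_⟫ : ∀ {n} → Poly n → Poly n → Ideal (S n) (c ⊔ ℓ₁)
  ⟪ f , g ⟫ = record
    { member = λ h → ∃₂ λ a b → h ≈ₚ a ⊗ f ⊕ b ⊗ g
    ; resp = λ { e (a , b , eq) → a , b , ≈-trans (≈-sym e) eq }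
    ; 0-closed = 0ₚ , 0ₚ , solve 2 (λ f g → :0 := :0 :* f :+ :0 :* g) ≈-refl f g
    ; +-closed = λ { (a , b , eq) (a′ , b′ , eq′) → a ⊕ a′ , b ⊕ b′ , ≈-trans (⊕-cong eq eq′)
        (solve 6 (λ a b c d f g → a :* f :+ b :* g :+ (c :* f :+ d :* g) := (a :+ c) :* f :+ (b :+ d) :* g) ≈-refl a b a′ b′ f g) }
    ; *-closed = λ { s (a , b , eq) → s ⊗ a , s ⊗ b , ≈-trans (⊗-cong ≈-refl eq)
        (solve 5 (λ s a b f g → s :* (a :* f :+ b :* g) := s :* a :* f :+ s :* b :* g) ≈-refl s a b f g) } }

  -- The quotient by α is realized by substituting a parametrization of α = 0 by Kⁿ.
  module HyperplaneRestriction {n} (α : Form (suc n)) (α≉0 : NonZero α) where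
    private
      p = proj₁ (nonZero-coordinate α≉0)
      b = proj₁ (inverse (proj₂ (nonZero-coordinate α≉0)))
      b-inv : b K.* α p K.≈ K.1#
      b-inv = proj₂ (inverse (proj₂ (nonZero-coordinate α≉0)))

    basis : Vector (Point (suc n)) n
    basis j i = K.1# K.* δ (punchIn p j) i K.+ K.- (b K.* α (punchIn p j)) K.* δ p i

    private
      α·basis : ∀ j → α · basis j K.≈ K.0#
      α·basis j = K.trans (·-combineʳ α K.1# (δ (punchIn p j)) _ (δ p))
        (K.trans (K.+-cong (K.*-congˡ (·-δ α (punchIn p j))) (K.*-congˡ (·-δ α p)))
        (K.trans (solveᴷ 3 (λ x b a → 1ᴷ ⊠ x ⊞ (⊟ (b ⊠ x)) ⊠ a ≔ x ⊟ (b ⊠ a) ⊠ x) K.refl (α (punchIn p j)) b (α p))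
        (K.trans (K.+-congˡ (K.-‿cong (K.*-congʳ b-inv)))
          (solveᴷ 1 (λ x → x ⊟ 1ᴷ ⊠ x ≔ 0ᴷ) K.refl _))))

      δ-≢ : ∀ {k} {i j : Fin k} → ¬ i ≡ j → δ i j K.≈ K.0#
      δ-≢ {i = zero}  {zero}  ne = contradiction ≡.refl ne
      δ-≢ {i = zero}  {suc j} ne = K.refl
      δ-≢ {i = suc i} {zero}  ne = K.refl
      δ-≢ {i = suc i} {suc j} ne = δ-≢ (ne ∘ ≡.cong suc)

      δ-punchIn : ∀ {k} (p : Fin (suc k)) i j → δ (punchIn p i) (punchIn p j) K.≈ δ i j
      δ-punchIn zero    i       j       = K.refl
      δ-punchIn (suc p) zero    zero    = K.refl
      δ-punchIn (suc p) zero    (suc j) = K.refl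
      δ-punchIn (suc p) (suc i) zero    = K.refl
      δ-punchIn (suc p) (suc i) (suc j) = δ-punchIn p i j

    basis-punchIn : ∀ j k → basis j (punchIn p k) K.≈ δ j k
    basis-punchIn j k = K.trans (K.+-cong (K.*-congˡ (δ-punchIn p j k)) (K.*-congˡ (δ-≢ (Fin.punchInᵢ≢i p k ∘ ≡.sym))))
      (solveᴷ 2 (λ x y → 1ᴷ ⊠ x ⊞ y ⊠ 0ᴷ ≔ x) K.refl _ _)

    coordinate : Point (suc n) → Point n
    coordinate v = v ∘ punchIn p

    private
      split : ∀ (v : Vector K.Carrier (suc n)) i → v i K.≈ KLin.lincomb (coordinate v) basis i K.+ (b K.* (α · v)) K.* δ p i
      split v i = K.sym (K.trans (K.+-congʳ expand) (K.trans (K.+-congˡ (K.*-congʳ (K.*-congˡ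
        (KLin.sum-remove {i = p} (λ i → α i K.* v i))))) (K.trans (solveᴷ 6 (λ b a x s d y →
          (y ⊟ b ⊠ s ⊠ d) ⊞ b ⊠ (a ⊠ x ⊞ s) ⊠ d ≔ y ⊞ (b ⊠ a) ⊠ (x ⊠ d)) K.refl b (α p) (v p) s (δ p i) (KLin.sum (λ j → v (punchIn p j) K.* δ (punchIn p j) i)))
        (K.trans (K.+-congˡ (K.trans (K.*-congʳ b-inv) (K.*-identityˡ _))) (K.trans (K.+-comm _ _)
        (K.trans (K.sym (KLin.sum-remove {i = p} (λ k → v k K.* δ k i))) (KLin.sum-δʳ i v)))))))
        where
        s = KLin.sum (λ j → α (punchIn p j) K.* v (punchIn p j))
        expand : KLin.lincomb (coordinate v) basis i K.≈ KLin.sum (λ j → v (punchIn p j) K.* δ (punchIn p j) i) K.- b K.* s K.* δ p i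
        expand = K.trans (KLin.sum-cong _ (λ j → v (punchIn p j) K.* δ (punchIn p j) i K.+ (α (punchIn p j) K.* v (punchIn p j)) K.* (K.- (b K.* δ p i))) (λ j →
            solveᴷ 5 (λ v d b a e → v ⊠ (1ᴷ ⊠ d ⊞ (⊟ (b ⊠ a)) ⊠ e) ≔ v ⊠ d ⊞ (a ⊠ v) ⊠ (⊟ (b ⊠ e))) K.refl (v (punchIn p j)) (δ (punchIn p j) i) b (α (punchIn p j)) (δ p i)))
          (K.trans (KLin.∑-distrib-+ (λ j → v (punchIn p j) K.* δ (punchIn p j) i) (λ j → (α (punchIn p j) K.* v (punchIn p j)) K.* (K.- (b K.* δ p i))))
          (K.+-congˡ (K.trans (K.sym (KLin.*-distribʳ-sum (K.- (b K.* δ p i)) (λ j → α (punchIn p j) K.* v (punchIn p j))))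
            (solveᴷ 3 (λ s b e → s ⊠ (⊟ (b ⊠ e)) ≔ ⊟ (b ⊠ s ⊠ e)) K.refl s b (δ p i)))))

    isBasis : KLin.IsBasis (hyperplane α) basis
    isBasis = record
      { inside      = α·basis
      ; independent = λ a rel i → K.trans (K.sym (KLin.sum-δʳ i a))
          (K.trans (KLin.sum-cong (λ j → a j K.* δ j i) (λ j → a j K.* basis j (punchIn p i)) (λ j → K.*-congˡ (K.sym (basis-punchIn j i))))
            (rel (punchIn p i)))
      ; spanning    = λ v αv≈0 → coordinate v , λ i → K.trans (split v i) (K.trans (K.+-congˡ
          (K.trans (K.*-congʳ (K.trans (K.*-congˡ αv≈0) (K.zeroʳ _))) (K.zeroˡ _))) (K.+-identityʳ _))
      }

    pull : Form (suc n) → Form n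
    pull β j = β · basis j

    private
      π : Fin (suc n) → Poly n
      π i = linear (λ j → basis j i)
      σ : Fin n → Poly (suc n)
      σ j = var (punchIn p j)

    project : Poly (suc n) → Poly n
    project = substitute π

    section : Poly n → Poly (suc n)
    section = substitute σ

    project-cong : ∀ {f g} → f ≈ₚ g → project f ≈ₚ project g
    project-cong = substitute-cong π

    project-linear : ∀ β → project (linear β) ≈ₚ linear (pull β)
    project-linear = substitute-linear-linear π (λ i j → basis j i) (λ _ → ≈-refl)

    project-section : ∀ f → project (section f) ≈ₚ f
    project-section f = ≈-trans (substitute-substitute π σ f) (≈-trans (substitute-≈ (λ j →
      ≈-trans (linear-cong (λ k → K.trans (basis-punchIn k j) (KLin.δ-sym k j))) (linear-δ j)) f) (substitute-var f))

    project-α : project (linear α) ≈ₚ 0ₚ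
    project-α = ≈-trans (project-linear α) (≈-trans (linear-cong α·basis)
      (SLin.sum-0 (λ i → con K.0# ⊗ var i) (λ i → SR.zeroˡ _)))

    section-project : ∀ f → linear α ∣ f ⊕ ⊝ section (project f)
    section-project f = ∣-resp (⊕-cong (substitute-var f) (⊝-cong (≈-sym (substitute-substitute σ π f))))
      (substitute-mod ⟨ linear α ⟩ var (section ∘ π) step f)
      where
      step : ∀ i → linear α ∣ var i ⊕ ⊝ section (π i)
      step i = con (b K.* δ p i) , (begin
        var i ⊕ ⊝ section (π i)
          ≈⟨ ⊕-cong (≈-sym (linear-δ i)) (⊝-cong (substitute-linear-linear σ (λ j → δ (punchIn p j)) (λ j → ≈-sym (linear-δ (punchIn p j))) (λ j → basis j i))) ⟩
        linear (δ i) ⊕ ⊝ linear ρ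
          ≈⟨ solve 2 (λ x y → x :- y := x :+ (:- :1) :* y) ≈-refl _ _ ⟩
        linear (δ i) ⊕ ⊝ 1ₚ ⊗ linear ρ
          ≈⟨ ⊕-cong (≈-sym (⊗-identityˡ _)) (⊗-cong (≈-sym (con-⊝ K.1#)) ≈-refl) ⟩
        1ₚ ⊗ linear (δ i) ⊕ con (K.- K.1#) ⊗ linear ρ
          ≈⟨ linear-combine K.1# (δ i) (K.- K.1#) ρ ⟨
        linear (λ k → K.1# K.* δ i k K.+ K.- K.1# K.* ρ k)
          ≈⟨ linear-cong diff ⟩
        linear (λ k → (b K.* δ p i) K.* α k)
          ≈⟨ linear-scale (b K.* δ p i) α ⟩
        con (b K.* δ p i) ⊗ linear α
          ≈⟨ ⊗-comm _ _ ⟩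
        linear α ⊗ con (b K.* δ p i) ∎)
        where
        ρ : Form (suc n)
        ρ = KLin.lincomb (λ j → basis j i) (λ j → δ (punchIn p j))
        ρ≈ : ∀ k → ρ k K.≈ δ k i K.- (b K.* α k) K.* δ p i
        ρ≈ k = K.trans (KLin.sum-cong (λ j → basis j i K.* δ (punchIn p j) k) (λ j → δ k (punchIn p j) K.* basis j i) (λ j →
            K.trans (K.*-comm _ _) (K.*-congʳ (KLin.δ-sym (punchIn p j) k))))
          (K.trans (solveᴷ 2 (λ x y → x ≔ (x ⊞ y) ⊟ y) K.refl _ _)
          (K.trans (K.+-congʳ (K.sym (split (δ k) i)))
            (K.+-cong K.refl (K.-‿cong (K.*-congʳ (K.*-congˡ (·-δ α k)))))))
        diff : ∀ k → K.1# K.* δ i k K.+ K.- K.1# K.* ρ k K.≈ (b K.* δ p i) K.* α k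
        diff k = K.trans (K.+-cong (K.*-congˡ (KLin.δ-sym i k)) (K.*-congˡ (ρ≈ k)))
          (solveᴷ 4 (λ x b a d → 1ᴷ ⊠ x ⊞ (⊟ 1ᴷ) ⊠ (x ⊟ (b ⊠ a) ⊠ d) ≔ (b ⊠ d) ⊠ a) K.refl (δ k i) b (α k) (δ p i))

    project-0 : ∀ {f} → project f ≈ₚ 0ₚ → linear α ∣ f
    project-0 {f} πf≈0 = ∣-resp (≈-trans (⊕-cong ≈-refl (⊝-cong (substitute-cong σ πf≈0)))
      (solve 1 (λ x → x :- :0 := x) ≈-refl f)) (section-project f)

    0-project : ∀ {f} → linear α ∣ f → project f ≈ₚ 0ₚ
    0-project (q , eq) = ≈-trans (project-cong eq) (≈-trans (⊗-cong project-α ≈-refl) (SR.zeroˡ _))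

  linear-prime : ∀ {n} {α : Form n} {f g} → NonZero α → ¬ linear α ∣ f → linear α ∣ f ⊗ g → linear α ∣ g
  linear-prime {zero}      α≉0 _   _    = contradiction (λ ()) α≉0
  linear-prime {suc n} {α} α≉0 α∤f α∣fg = project-0 (domain _ _ (0-project α∣fg) (α∤f ∘ project-0))
    where open HyperplaneRestriction α α≉0

  ∣⇒⊆ : ∀ {n} {α β : Form n} → linear α ∣ linear β → hyperplane α ⊆ hyperplane β
  ∣⇒⊆ {α = α} {β} (q , eq) {v} αv≈0 = K.trans (K.sym (value-linear β v)) (K.trans (value-cong v eq)
    (K.trans (K.*-congʳ (K.trans (value-linear α v) αv≈0)) (K.zeroˡ _)))

  ∣⇒same : ∀ {n} {α β : Form n} → NonZero α → NonZero β → linear α ∣ linear β → SameHyperplane α β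
  ∣⇒same {α = α} {β} α≉0 β≉0 α∣β = ⊆⇒same {α = α} {β} α≉0 β≉0 (∣⇒⊆ {α = α} {β} α∣β)

  ⊆⇒∣ : ∀ {n} {α β : Form n} → NonZero α → hyperplane α ⊆ hyperplane β → linear α ∣ linear β
  ⊆⇒∣ {α = α} {β} α≉0 α⊆β = con (proj₁ multiple) , ≈-trans (linear-cong (proj₂ multiple))
    (≈-trans (linear-scale (proj₁ multiple) α) (⊗-comm _ _))
    where
    multiple : ∃ λ a → β ≋ₖ (λ i → a K.* α i)
    multiple = proportional {α = α} {β} α≉0 α⊆β

  same⇒∣ : ∀ {n} {α β : Form n} → NonZero α → SameHyperplane α β → linear α ∣ linear β
  same⇒∣ {α = α} {β} α≉0 e = ⊆⇒∣ {α = α} {β} α≉0 (λ {v} → Equivalence.to (e v))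

  product : ∀ {n} → List (Form n) → Poly n
  product = foldr (λ α f → linear α ⊗ f) 1ₚ

  product-nonZero : ∀ {n} {xs : List (Form n)} → All NonZero xs → ¬ product xs ≈ₚ 0ₚ
  product-nonZero []           = 1ₚ≉0ₚ
  product-nonZero (x≉0 ∷ xs≉0) P≈0 = product-nonZero xs≉0 (domain _ _ P≈0 (linear-nonZero x≉0))

  ∈⇒∣product : ∀ {n} {xs : List (Form n)} {x} → x ∈ₗ xs → linear x ∣ product xs
  ∈⇒∣product (here ≡.refl) = ∣-factorˡ _ _
  ∈⇒∣product (there x∈xs)  = ∣-⊗ˡ _ (∈⇒∣product x∈xs)

  prime∣product : ∀ {n} {xs : List (Form n)} {z} → NonZero z → linear z ∣ product xs → ∃ λ x → x ∈ₗ xs × linear z ∣ linear x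
  prime∣product {xs = []} {z} z≉0 (q , eq) = contradiction
    (K.trans (value-cong (λ _ → K.0#) eq) (K.trans (K.*-congʳ (K.trans (value-linear z (λ _ → K.0#)) (K.trans (·-comm z (λ _ → K.0#)) (KLin.sum-0 (λ i → K.0# K.* z i) (λ i → K.zeroˡ _))))) (K.zeroˡ _))) 1≉0
  prime∣product {xs = x ∷ xs} {z} z≉0 z∣P with em {P = linear z ∣ linear x}
  ... | yes z∣x = x , here ≡.refl , z∣x
  ... | no  z∤x with prime∣product z≉0 (linear-prime z≉0 z∤x z∣P)
  ... | y , y∈xs , z∣y = y , there y∈xs , z∣y

  coprime-cancel : ∀ {n} (xs : List (Form n)) {g h} → All NonZero xs → (∀ x → x ∈ₗ xs → ¬ linear x ∣ g) →
                   product xs ∣ g ⊗ h → product xs ∣ h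
  coprime-cancel [] {h = h} _ coprime _ = h , ≈-sym (⊗-identityˡ h)
  coprime-cancel (x ∷ xs) {g} {h} (x≉0 ∷ xs≉0) coprime (q , eq) =
    quotient IH , ≈-trans (equality x∣h) (≈-trans (⊗-cong ≈-refl (equality IH)) (≈-sym (⊗-assoc _ _ _)))
    where
    x∣h : linear x ∣ h
    x∣h = linear-prime {α = x} {g} {h} x≉0 (coprime x (here ≡.refl)) (product xs ⊗ q , ≈-trans eq (⊗-assoc _ _ _))
    h′ = quotient x∣h
    IH : product xs ∣ h′
    IH = coprime-cancel xs {g} {h′} xs≉0 (λ y y∈ → coprime y (there y∈)) (q , cancelˡ (linear x) (linear-nonZero x≉0) (begin
      linear x ⊗ (g ⊗ h′)             ≈⟨ solve 3 (λ x g h → x :* (g :* h) := g :* (x :* h)) ≈-refl (linear x) g h′ ⟩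
      g ⊗ (linear x ⊗ h′)             ≈⟨ ⊗-cong ≈-refl (equality x∣h) ⟨
      g ⊗ h                           ≈⟨ eq ⟩
      linear x ⊗ product xs ⊗ q       ≈⟨ ⊗-assoc (linear x) (product xs) q ⟩
      linear x ⊗ (product xs ⊗ q)     ∎))

  product-∣ : ∀ {n} (xs : List (Form n)) {f} → All NonZero xs → AllPairs (λ α β → ¬ SameHyperplane α β) xs →
              (∀ x → x ∈ₗ xs → linear x ∣ f) → product xs ∣ f
  product-∣ [] _ _ _ = _ , ≈-sym (⊗-identityˡ _)
  product-∣ (x ∷ xs) {f} (x≉0 ∷ xs≉0) (x≁xs ∷ distinct) each = q , ≈-trans f≈xh (≈-trans (⊗-cong ≈-refl h≈) (≈-sym (⊗-assoc _ _ _)))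
    where
    h : Poly _
    h = quotient (each x (here ≡.refl))
    f≈xh : f ≈ₚ linear x ⊗ h
    f≈xh = equality (each x (here ≡.refl))
    x-coprime : ∀ y → y ∈ₗ xs → ¬ linear y ∣ linear x
    x-coprime y y∈xs y∣x = All.lookup x≁xs y∈xs (same-sym {α = y} {x} (∣⇒same {α = y} {x} (All.lookup xs≉0 y∈xs) x≉0 y∣x))
    rest : ∀ y → y ∈ₗ xs → linear y ∣ h
    rest y y∈xs = linear-prime {α = y} {linear x} {h} (All.lookup xs≉0 y∈xs) (x-coprime y y∈xs) (∣-resp f≈xh (each y (there y∈xs)))
    q : Poly _
    q = quotient (product-∣ xs {h} xs≉0 distinct rest)
    h≈ : h ≈ₚ product xs ⊗ q
    h≈ = equality (product-∣ xs {h} xs≉0 distinct rest)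

  module _ {n p} {P : Pred (Form n) p} (P? : Decidable P) where
    product-filter : ∀ xs → product xs ≈ₚ product (filter P? xs) ⊗ product (filter (¬? ∘ P?) xs)
    product-filter [] = ≈-sym (⊗-identityˡ _)
    product-filter (x ∷ xs) with P? x
    ... | yes _ = ≈-trans (⊗-cong ≈-refl (product-filter xs)) (≈-sym (⊗-assoc _ _ _))
    ... | no  _ = ≈-trans (⊗-cong ≈-refl (product-filter xs))
                    (solve 3 (λ x y z → x :* (y :* z) := y :* (x :* z)) ≈-refl _ _ _)

    product-filter-filter : ∀ {q} {Q : Pred (Form n) q} (Q? : Decidable Q) xs →
                            product (filter Q? (filter P? xs)) ∣ product (filter Q? xs)
    product-filter-filter Q? [] = _ , ≈-sym (⊗-identityˡ _)
    product-filter-filter Q? (x ∷ xs) with P? x | product-filter-filter Q? xs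
    product-filter-filter Q? (x ∷ xs) | yes _ | q , eq with Q? x
    ... | yes _ = q , ≈-trans (⊗-cong ≈-refl eq) (≈-sym (⊗-assoc _ _ _))
    ... | no  _ = q , eq
    product-filter-filter Q? (x ∷ xs) | no _ | d with Q? x
    ... | yes _ = ∣-⊗ˡ _ d
    ... | no  _ = d

  product-∣-classwise : ∀ {n} (xs : List (Form n)) {f} → All NonZero xs →
                        (∀ {x} → x ∈ₗ xs → product (filter (sameHyperplane? x) xs) ∣ f) → product xs ∣ f
  product-∣-classwise {n} xs = go (length xs) xs ℕ.≤-refl
    where
    go : ∀ k (xs : List (Form n)) {f} → length xs ℕ.≤ k → All NonZero xs →
         (∀ {x} → x ∈ₗ xs → product (filter (sameHyperplane? x) xs) ∣ f) → product xs ∣ f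
    go k [] _ _ _ = _ , ≈-sym (⊗-identityˡ _)
    go (suc k) xs@(x ∷ xs′) {f} (ℕ.s≤s len) xs≉0 each = combine (each (here ≡.refl))
      where
      class = filter (sameHyperplane? x) xs
      rest = filter (¬? ∘ sameHyperplane? x) xs
      rest≉0 : All NonZero rest
      rest≉0 = All.tabulate (λ y∈ → All.lookup xs≉0 (proj₁ (∈-filter⁻ (¬? ∘ sameHyperplane? x) y∈)))
      rest-length : length rest ℕ.≤ k
      rest-length = ℕ.≤-pred (ℕ.≤-trans (filter-notAll (¬? ∘ sameHyperplane? x) xs (here (λ x≁x → x≁x (same-refl {α = x})))) (ℕ.s≤s len))
      each-rest : ∀ {h y} → f ≈ₚ product class ⊗ h → y ∈ₗ rest → product (filter (sameHyperplane? y) rest) ∣ h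
      each-rest {h} {y} f≈ y∈rest = coprime-cancel (filter (sameHyperplane? y) rest)
        (All.tabulate (λ z∈ → All.lookup rest≉0 (proj₁ (∈-filter⁻ (sameHyperplane? y) z∈))))
        coprime
        (∣-trans (product-filter-filter (¬? ∘ sameHyperplane? x) (sameHyperplane? y) xs)
          (∣-resp f≈ (each (proj₁ y∈xs))))
        where
        y∈xs = ∈-filter⁻ (¬? ∘ sameHyperplane? x) y∈rest
        coprime : ∀ z → z ∈ₗ filter (sameHyperplane? y) rest → ¬ linear z ∣ product class
        coprime z z∈ z∣class with ∈-filter⁻ (sameHyperplane? y) z∈
        ... | z∈rest , y~z with prime∣product (All.lookup rest≉0 z∈rest) z∣class
        ... | w , w∈class , z∣w with ∈-filter⁻ (sameHyperplane? x) w∈class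
        ... | w∈xs , x~w = proj₂ y∈xs (same-trans {α = x} {w} {y} x~w (same-trans {α = w} {z} {y}
          (same-sym {α = z} {w} (∣⇒same {α = z} {w} (All.lookup rest≉0 z∈rest) (All.lookup xs≉0 w∈xs) z∣w)) (same-sym {α = y} {z} y~z)))
      combine : product class ∣ f → product xs ∣ f
      combine (h , f≈) = q , (begin
        f                                    ≈⟨ f≈ ⟩
        product class ⊗ h                    ≈⟨ ⊗-cong ≈-refl (equality IH) ⟩
        product class ⊗ (product rest ⊗ q)   ≈⟨ ⊗-assoc (product class) (product rest) q ⟨
        product class ⊗ product rest ⊗ q     ≈⟨ ⊗-cong (product-filter (sameHyperplane? x) xs) ≈-refl ⟨
        product xs ⊗ q                       ∎)
        where
        IH : product rest ∣ h
        IH = go k rest {h} rest-length rest≉0 (each-rest f≈)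
        q = quotient IH

  -- η is congruent to a multiple of dα modulo α; for α ≠ 0 this is the condition η ∧ dα ∈ α Ω².
  record Parallel {n} (α : Form n) (η : Vector (Poly n) n) : Set (c ⊔ ℓ₁) where
    constructor parallel
    field
      multiplier : Poly n
      remainder  : Vector (Poly n) n
      congruence : ∀ j → η j ≈ₚ multiplier ⊗ con (α j) ⊕ linear α ⊗ remainder j

  minor : ∀ {n} → Form n → Vector (Poly n) n → Fin n → Fin n → Poly n
  minor α η p j = con (α p) ⊗ η j ⊕ ⊝ (con (α j) ⊗ η p)

  module _ {n} (α : Form n) where
    parallel-resp : ∀ {η ζ} → η ≋ₛ ζ → Parallel α η → Parallel α ζ
    parallel-resp e (parallel c z eq) = parallel c z λ j → ≈-trans (≈-sym (e j)) (eq j)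

    parallel-∣ : ∀ {η} → (∀ j → linear α ∣ η j) → Parallel α η
    parallel-∣ d = parallel 0ₚ (λ j → quotient (d j)) λ j → ≈-trans (equality (d j))
      (solve 3 (λ x y z → x :* y := :0 :* z :+ x :* y) ≈-refl (linear α) (quotient (d j)) (con (α j)))

    parallel-⊕ : ∀ {η ζ} → Parallel α η → Parallel α ζ → Parallel α (λ j → η j ⊕ ζ j)
    parallel-⊕ (parallel c z eq) (parallel c′ z′ eq′) = parallel (c ⊕ c′) (λ j → z j ⊕ z′ j) λ j →
      ≈-trans (⊕-cong (eq j) (eq′ j)) (solve 6 (λ c d a l z w → c :* a :+ l :* z :+ (d :* a :+ l :* w) := (c :+ d) :* a :+ l :* (z :+ w))
        ≈-refl c c′ (con (α j)) (linear α) (z j) (z′ j))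

    parallel-⊗ : ∀ {η} s → Parallel α η → Parallel α (λ j → s ⊗ η j)
    parallel-⊗ s (parallel c z eq) = parallel (s ⊗ c) (λ j → s ⊗ z j) λ j →
      ≈-trans (⊗-cong ≈-refl (eq j)) (solve 5 (λ s c a l z → s :* (c :* a :+ l :* z) := s :* c :* a :+ l :* (s :* z))
        ≈-refl s c (con (α j)) (linear α) (z j))

    parallel-minor : ∀ {η} → Parallel α η → ∀ p j → linear α ∣ minor α η p j
    parallel-minor {η} (parallel c z eq) p j = con (α p) ⊗ z j ⊕ ⊝ (con (α j) ⊗ z p) ,
      ≈-trans (⊕-cong (⊗-cong ≈-refl (eq j)) (⊝-cong (⊗-cong ≈-refl (eq p))))
        (solve 6 (λ a b c l z w → a :* (c :* b :+ l :* z) :- b :* (c :* a :+ l :* w) := l :* (a :* z :- b :* w))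
          ≈-refl (con (α p)) (con (α j)) c (linear α) (z j) (z p))

    minor-parallel : ∀ {η} p → ¬ α p K.≈ K.0# → (∀ j → linear α ∣ minor α η p j) → Parallel α η
    minor-parallel {η} p αₚ≉0 d = parallel (con b ⊗ η p) (λ j → con b ⊗ quotient (d j)) λ j → begin
      η j                              ≈⟨ ⊗-identityˡ _ ⟨
      1ₚ ⊗ η j                         ≈⟨ ⊗-cong (≈-trans (con-cong (K.sym (proj₂ (inverse αₚ≉0)))) (con-* b (α p))) ≈-refl ⟩
      con b ⊗ con (α p) ⊗ η j          ≈⟨ solve 5 (λ b a x y z → b :* a :* x := b :* y :* z :+ b :* (a :* x :- z :* y)) ≈-refl (con b) (con (α p)) (η j) (η p) (con (α j)) ⟩
      con b ⊗ η p ⊗ con (α j) ⊕ con b ⊗ minor α η p j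
                                       ≈⟨ ⊕-cong ≈-refl (≈-trans (⊗-cong ≈-refl (equality (d j)))
                                            (solve 3 (λ b l q → b :* (l :* q) := l :* (b :* q)) ≈-refl (con b) (linear α) (quotient (d j)))) ⟩
      con b ⊗ η p ⊗ con (α j) ⊕ linear α ⊗ (con b ⊗ quotient (d j)) ∎
      where
      b = proj₁ (inverse αₚ≉0)

    parallel-cancel : ∀ {f η} → NonZero α → ¬ linear α ∣ f → Parallel α (λ j → f ⊗ η j) → Parallel α η
    parallel-cancel {f} {η} α≉0 α∤f fη∥α = minor-parallel p αₚ≉0 λ j → linear-prime {α = α} {f} {minor α η p j} α≉0 α∤f
      (∣-resp (solve 5 (λ a b f x y → a :* (f :* x) :- b :* (f :* y) := f :* (a :* x :- b :* y)) ≈-refl (con (α p)) (con (α j)) f (η j) (η p))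
        (parallel-minor fη∥α p j))
      where
      p = proj₁ (nonZero-coordinate {α = α} α≉0)
      αₚ≉0 = proj₂ (nonZero-coordinate {α = α} α≉0)

    parallel-contract : ∀ {η} (v : Vector (Poly n) n) → linear α ∣ sum (λ j → con (α j) ⊗ v j) → Parallel α η →
                        linear α ∣ sum (λ j → η j ⊗ v j)
    parallel-contract {η} v α∣αv (parallel c z eq) = ∣-resp (≈-sym (begin
      sum (λ j → η j ⊗ v j)
        ≈⟨ SLin.sum-cong _ (λ j → c ⊗ (con (α j) ⊗ v j) ⊕ linear α ⊗ (z j ⊗ v j)) (λ j → ≈-trans (⊗-cong (eq j) ≈-refl)
             (solve 5 (λ c a l z v → (c :* a :+ l :* z) :* v := c :* (a :* v) :+ l :* (z :* v)) ≈-refl c (con (α j)) (linear α) (z j) (v j))) ⟩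
      sum (λ j → c ⊗ (con (α j) ⊗ v j) ⊕ linear α ⊗ (z j ⊗ v j))
        ≈⟨ SLin.∑-distrib-+ (λ j → c ⊗ (con (α j) ⊗ v j)) (λ j → linear α ⊗ (z j ⊗ v j)) ⟩
      sum (λ j → c ⊗ (con (α j) ⊗ v j)) ⊕ sum (λ j → linear α ⊗ (z j ⊗ v j))
        ≈⟨ ⊕-cong (SLin.*-distribˡ-sum c (λ j → con (α j) ⊗ v j)) (SLin.*-distribˡ-sum (linear α) (λ j → z j ⊗ v j)) ⟨
      c ⊗ sum (λ j → con (α j) ⊗ v j) ⊕ linear α ⊗ sum (λ j → z j ⊗ v j) ∎))
      (∣-⊕ (∣-⊗ˡ c α∣αv) (∣-factorˡ _ _))

  euler : ∀ {n} → Vector (Poly n) n → Poly n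
  euler η = sum (λ j → η j ⊗ var j)

  parallel-euler : ∀ {n} (α : Form n) {η} → Parallel α η → linear α ∣ euler η
  parallel-euler α = parallel-contract α var (1ₚ , solve 1 (λ x → x := x :* :1) ≈-refl _)

  -- Associated primes without noetherianity: choose s ∉ D annihilated modulo D
  -- by as many forms of the list as possible; the others are then non-zero-divisors
  -- on the multiples of s.
  module _ {n} (D : Ideal (S n) (c ⊔ ℓ₁)) (1∉D : ¬ member D 1ₚ) where
    open Ideal D using () renaming (member to _∈D)

    private
      Dichotomy : Poly n → Form n → Set (c ⊔ ℓ₁)
      Dichotomy s α = (linear α ⊗ s) ∈D ⊎ (∀ u → (linear α ⊗ (u ⊗ s)) ∈D → (u ⊗ s) ∈D)

      dichotomy : ∀ (xs : List (Form n)) → ∃ λ s → ¬ s ∈D × (∀ x → x ∈ₗ xs → Dichotomy s x)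
      dichotomy [] = 1ₚ , 1∉D , λ _ ()
      dichotomy (x ∷ xs) with dichotomy xs
      ... | s , s∉D , dich with em {P = ∃ λ u → (linear x ⊗ (u ⊗ s)) ∈D × ¬ (u ⊗ s) ∈D}
      ... | no none = s , s∉D , λ
        { y (here ≡.refl) → inj₂ λ u xus∈D → dne λ us∉D → none (u , xus∈D , us∉D)
        ; y (there y∈xs)  → dich y y∈xs }
      ... | yes (u , xus∈D , us∉D) = u ⊗ s , us∉D , λ
        { y (here ≡.refl) → inj₁ xus∈D
        ; y (there y∈xs)  → step y (dich y y∈xs) }
        where
        step : ∀ y → Dichotomy s y → Dichotomy (u ⊗ s) y
        step y (inj₁ ys∈D) = inj₁ (Ideal.resp D
          (solve 3 (λ u y s → u :* (y :* s) := y :* (u :* s)) ≈-refl u (linear y) s) (Ideal.*-closed D u ys∈D))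
        step y (inj₂ reg) = inj₂ λ v yvus∈D → Ideal.resp D (⊗-assoc v u s)
          (reg (v ⊗ u) (Ideal.resp D (⊗-cong ≈-refl (≈-sym (⊗-assoc v u s))) yvus∈D))

    annihilators : ∀ (xs : List (Form n)) → ∃ λ s → ¬ s ∈D ×
      (∀ ys → (∀ y → y ∈ₗ ys → y ∈ₗ xs) → product ys ∈D → ∃ λ y → y ∈ₗ ys × (linear y ⊗ s) ∈D)
    annihilators xs with dichotomy xs
    ... | s , s∉D , dich = s , s∉D , λ ys ys⊆xs P∈D → dne λ none → s∉D (Ideal.resp D (⊗-identityˡ s)
      (regular ys (λ y y∈ys → [ (λ ys∈D → contradiction (y , y∈ys , ys∈D) none) , id ]′ (dich y (ys⊆xs y y∈ys))) 1ₚ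
        (Ideal.resp D (solve 2 (λ s P → s :* P := P :* (:1 :* s)) ≈-refl s (product ys)) (Ideal.*-closed D s P∈D))))
      where
      regular : ∀ ys → (∀ y → y ∈ₗ ys → ∀ u → (linear y ⊗ (u ⊗ s)) ∈D → (u ⊗ s) ∈D) →
                ∀ u → (product ys ⊗ (u ⊗ s)) ∈D → (u ⊗ s) ∈D
      regular []       reg u Pus∈D = Ideal.resp D (⊗-identityˡ _) Pus∈D
      regular (y ∷ ys) reg u Pus∈D = regular ys (λ z z∈ → reg z (there z∈)) u (Ideal.resp D (⊗-assoc _ _ _)
        (reg y (here ≡.refl) (product ys ⊗ u) (Ideal.resp D
          (solve 4 (λ y P u s → y :* P :* (u :* s) := y :* (P :* u :* s)) ≈-refl (linear y) (product ys) u s) Pus∈D)))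

  extract : ∀ {n} (xs : List (Form n)) → AllPairs (λ α β → ¬ SameHyperplane α β) xs → ∀ x → x ∈ₗ xs → ∃ λ ys →
    product xs ≈ₚ linear x ⊗ product ys ×
    (∀ y → y ∈ₗ ys → y ∈ₗ xs × ¬ SameHyperplane x y) ×
    (∀ y → y ∈ₗ xs → y ≡ x ⊎ y ∈ₗ ys)
  extract (x ∷ xs) (x≁xs ∷ distinct) .x (here ≡.refl) =
    xs , ≈-refl , (λ y y∈ → there y∈ , All.lookup x≁xs y∈) , λ { y (here e) → inj₁ e ; y (there y∈) → inj₂ y∈ }
  extract (z ∷ xs) (z≁xs ∷ distinct) x (there x∈xs) with extract xs distinct x x∈xs
  ... | ys , eq , sub , cover = z ∷ ys ,
    ≈-trans (⊗-cong ≈-refl eq) (solve 3 (λ z x P → z :* (x :* P) := x :* (z :* P)) ≈-refl (linear z) (linear x) (product ys)) ,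
    (λ { y (here ≡.refl) → here ≡.refl , λ x~z → All.lookup z≁xs x∈xs (same-sym {α = x} {z} x~z)
       ; y (there y∈)    → there (proj₁ (sub y y∈)) , proj₂ (sub y y∈) }) ,
    (λ { y (here e) → inj₂ (here e)
       ; y (there y∈) → [ inj₁ , (λ y∈ys → inj₂ (there y∈ys)) ]′ (cover y y∈) })

  -- Logarithmic forms and residues

  tail : ∀ {m} → Form (suc m) → Form m
  tail α = α ∘ suc

  bar : ∀ {m} → Poly (suc m) → Poly m
  bar f = f [ 0ₚ ]

  bar-cong : ∀ {m} {f g : Poly (suc m)} → f ≈ₚ g → bar f ≈ₚ bar g
  bar-cong = substitute-cong (0ₚ ◂ var)

  bar-linear : ∀ {m} (α : Form (suc m)) → bar (linear α) ≈ₚ linear (tail α)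
  bar-linear α = ≈-trans (⊕-cong (SR.zeroʳ _) (substitute-sum (0ₚ ◂ var) (λ i → con (α (suc i)) ⊗ var (suc i)))) (⊕-identityˡ _)

  bar-weaken : ∀ {m} (f : Poly m) → bar (weaken f) ≈ₚ f
  bar-weaken f = weaken-[] f 0ₚ

  bar-kernel : ∀ {m} (f : Poly (suc m)) → var zero ∣ f ⊕ ⊝ weaken (bar f)
  bar-kernel f = ∣-resp (⊕-cong (substitute-var f) (⊝-cong (≈-sym (substitute-substitute (var ∘ suc) (0ₚ ◂ var) f))))
    (substitute-mod ⟨ var zero ⟩ var (weaken ∘ (0ₚ ◂ var)) step f)
    where
    step : ∀ i → var zero ∣ var i ⊕ ⊝ weaken ((0ₚ ◂ var) i)
    step zero    = 1ₚ , solve 1 (λ x → x :- :0 := x :* :1) ≈-refl (var zero)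
    step (suc i) = ∣-0 (SR.-‿inverseʳ _)

  bar-0⇒∣ : ∀ {m} {f : Poly (suc m)} → bar f ≈ₚ 0ₚ → var zero ∣ f
  bar-0⇒∣ {f = f} e = ∣-resp (≈-trans (⊕-cong ≈-refl (⊝-cong (weaken-cong e))) (solve 1 (λ x → x :- :0 := x) ≈-refl f)) (bar-kernel f)

  ∣⇒bar-0 : ∀ {m} {f : Poly (suc m)} → var zero ∣ f → bar f ≈ₚ 0ₚ
  ∣⇒bar-0 (q , eq) = ≈-trans (bar-cong eq) (SR.zeroˡ (bar q))

  bar-sum : ∀ {m k} (f : Vector (Poly (suc m)) k) → bar (sum f) ≈ₚ sum (λ i → bar (f i))
  bar-sum = substitute-sum (0ₚ ◂ var)

  bar-∣ : ∀ {m} {f g : Poly (suc m)} → f ∣ g → bar f ∣ bar g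
  bar-∣ = ∣-substitute (0ₚ ◂ var)

  bar-product : ∀ {m} (xs : List (Form (suc m))) → bar (product xs) ≈ₚ product (map tail xs)
  bar-product []       = ≈-refl
  bar-product (x ∷ xs) = ⊗-cong (bar-linear x) (bar-product xs)

  map-tail-filter : ∀ {m p} {X : Pred (Form m) p} (X? : Decidable X) xs →
                    map tail (filter (X? ∘ tail) xs) ≡ filter X? (map tail xs)
  map-tail-filter X? [] = ≡.refl
  map-tail-filter X? (x ∷ xs) with X? (tail x)
  ... | yes _ = ≡.cong (tail x ∷_) (map-tail-filter X? xs)
  ... | no  _ = map-tail-filter X? xs

  bar-product-filter : ∀ {m p} {X : Pred (Form m) p} (X? : Decidable X) xs →
                       bar (product (filter (X? ∘ tail) xs)) ≈ₚ product (filter X? (map tail xs))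
  bar-product-filter X? xs = ≈-trans (bar-product (filter (X? ∘ tail) xs)) (SR.reflexive (≡.cong product (map-tail-filter X? xs)))

  var≉0 : ∀ {n} (i : Fin n) → ¬ var i ≈ₚ 0ₚ
  var≉0 i e = 1≉0 (value-cong (λ _ → K.1#) e)

  ∤var : ∀ {m} {α : Form (suc m)} → NonZero (tail α) → ¬ linear α ∣ var zero
  ∤var {α = α} tα≉0 α∣x = 1≉0 (K.trans (e zero) (K.trans (K.*-congʳ
    (K-domain (α (suc p)) a (K.trans (K.*-comm _ _) (K.sym (e (suc p)))) αₚ≉0)) (K.zeroˡ _)))
    where
    multiple : ∃ λ a → δ zero ≋ₖ (λ i → a K.* α i)
    multiple = proportional {α = α} {δ zero} (λ e → tα≉0 (e ∘ suc)) (λ {v} → ∣⇒⊆ {α = α} {δ zero} (∣-resp (≈-sym (linear-δ zero)) α∣x) {v})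
    a = proj₁ multiple
    e = proj₂ multiple
    p = proj₁ (nonZero-coordinate {α = tail α} tα≉0)
    αₚ≉0 = proj₂ (nonZero-coordinate {α = tail α} tα≉0)

  lincomb-combine : ∀ {k n m} (p : Poly n) (a : Vector (Poly n) k) q b (G : Vector (Vector (Poly n) m) k) →
    SLin.lincomb (λ i → p ⊗ a i ⊕ q ⊗ b i) G ≋ₛ (λ j → p ⊗ SLin.lincomb a G j ⊕ q ⊗ SLin.lincomb b G j)
  lincomb-combine p a q b G j = ≈-trans (SLin.lincomb-+ (λ i → p ⊗ a i) (λ i → q ⊗ b i) G j)
    (⊕-cong (SLin.lincomb-* p a G j) (SLin.lincomb-* q b G j))

  -- An arrangement in K × Kᵐ that contains the hyperplane x₀ = 0, together
  -- with its restriction to that hyperplane.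
  record Configuration (m : ℕ) : Set (c ⊔ ℓ₁) where
    field
      hyperplanes          : List (Form (suc m))
      transversal          : ∀ a → a ∈ₗ hyperplanes → NonZero (tail a)
      hyperplanes-distinct    : AllPairs (λ α β → ¬ SameHyperplane α β) hyperplanes
      traces      : List (Form m)
      traces-distinct : AllPairs (λ α β → ¬ SameHyperplane α β) traces
      trace-form  : ∀ λ′ → λ′ ∈ₗ traces → ∃ λ a → a ∈ₗ hyperplanes × λ′ ≡ tail a
      form-trace  : ∀ a → a ∈ₗ hyperplanes → ∃ λ λ′ → λ′ ∈ₗ traces × SameHyperplane λ′ (tail a)

  module Configurations {m} (A : Configuration m) where
    open Configuration A public

    P P̄ Q̄ : Poly _
    P = product hyperplanes
    P̄ = bar P
    Q̄ = product traces

    form-nonZero : ∀ a → a ∈ₗ hyperplanes → NonZero a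
    form-nonZero a a∈ a≈0 = transversal a a∈ (a≈0 ∘ suc)

    forms-nonZero : All NonZero hyperplanes
    forms-nonZero = All.tabulate (λ {a} → form-nonZero a)

    tails = map tail hyperplanes

    tails-nonZero : All NonZero tails
    tails-nonZero = All.map⁺ (All.tabulate (λ {a} → transversal a))

    trace-nonZero : ∀ λ′ → λ′ ∈ₗ traces → NonZero λ′
    trace-nonZero λ′ λ∈ with trace-form λ′ λ∈
    ... | a , a∈ , ≡.refl = transversal a a∈

    traces-nonZero : All NonZero traces
    traces-nonZero = All.tabulate (λ {λ′} → trace-nonZero λ′)

    P̄≉0 : ¬ P̄ ≈ₚ 0ₚ
    P̄≉0 e = product-nonZero tails-nonZero (≈-trans (≈-sym (bar-product hyperplanes)) e)

    Q̄≉0 : ¬ Q̄ ≈ₚ 0ₚ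
    Q̄≉0 = product-nonZero traces-nonZero

    -- η / (x₀ P) is a logarithmic form of the arrangement, and below, η / P one without a pole along x₀ = 0 for η in Log′.
    record Log (η : Vector (Poly (suc m)) (suc m)) : Set (c ⊔ ℓ₁) where
      constructor log
      field
        at-H   : ∀ j → var zero ∣ η (suc j)
        at     : ∀ a → a ∈ₗ hyperplanes → Parallel a η

    Log′ : Vector (Poly (suc m)) (suc m) → Set (c ⊔ ℓ₁)
    Log′ ζ = ∀ a → a ∈ₗ hyperplanes → Parallel a ζ

    LogH : Vector (Poly m) m → Set (c ⊔ ℓ₁)
    LogH ξ = ∀ λ′ → λ′ ∈ₗ traces → Parallel λ′ ξ

    open Log public

    Log-resp : ∀ {η ζ} → η ≋ₛ ζ → Log η → Log ζ
    Log-resp e (log h l) = log (λ j → ∣-resp (e (suc j)) (h j)) (λ a a∈ → parallel-resp a e (l a a∈))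

    Log-⊕ : ∀ {η ζ} → Log η → Log ζ → Log (λ j → η j ⊕ ζ j)
    Log-⊕ (log h l) (log h′ l′) = log (λ j → ∣-⊕ (h j) (h′ j)) (λ a a∈ → parallel-⊕ a (l a a∈) (l′ a a∈))

    Log-⊗ : ∀ s {η} → Log η → Log (λ j → s ⊗ η j)
    Log-⊗ s (log h l) = log (λ j → ∣-⊗ˡ s (h j)) (λ a a∈ → parallel-⊗ a s (l a a∈))

    Log′-⊕ : ∀ {η ζ} → Log′ η → Log′ ζ → Log′ (λ j → η j ⊕ ζ j)
    Log′-⊕ l l′ a a∈ = parallel-⊕ a (l a a∈) (l′ a a∈)

    Log′-⊗ : ∀ s {η} → Log′ η → Log′ (λ j → s ⊗ η j)
    Log′-⊗ s l a a∈ = parallel-⊗ a s (l a a∈)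

    LogH-lincomb : ∀ {k} (s : Vector (Poly m) k) F → (∀ i → LogH (F i)) → LogH (SLin.lincomb s F)
    LogH-lincomb {zero}  s F l λ′ λ∈ = parallel-∣ λ′ (λ j → ∣-0 ≈-refl)
    LogH-lincomb {suc k} s F l λ′ λ∈ =
      parallel-⊕ λ′ (parallel-⊗ λ′ (s zero) (l zero λ′ λ∈)) (LogH-lincomb (s ∘ suc) (F ∘ suc) (l ∘ suc) λ′ λ∈)

    Log-lincomb : ∀ {k} (s : Vector (Poly (suc m)) k) G → (∀ i → Log (G i)) → Log (SLin.lincomb s G)
    Log-lincomb {zero}  s G l = log (λ j → ∣-0 ≈-refl) (λ a a∈ → parallel-∣ a (λ j → ∣-0 ≈-refl))
    Log-lincomb {suc k} s G l = Log-⊕ (Log-⊗ (s zero) (l zero)) (Log-lincomb (s ∘ suc) (G ∘ suc) (l ∘ suc))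

    Log′⇒Log : ∀ {ζ} → Log′ ζ → Log (λ j → var zero ⊗ ζ j)
    Log′⇒Log l = log (λ j → ∣-factorˡ _ _) (Log′-⊗ (var zero) l)

    Log⇒Log′ : ∀ {η} → Log η → bar (η zero) ≈ₚ 0ₚ → ∃ λ ζ → Log′ ζ × (∀ j → η j ≈ₚ var zero ⊗ ζ j)
    Log⇒Log′ {η} (log h l) e = ζ , (λ a a∈ → parallel-cancel a (form-nonZero a a∈) (∤var {α = a} (transversal a a∈))
      (parallel-resp a eq (l a a∈))) , eq
      where
      x∣η : ∀ j → var zero ∣ η j
      x∣η zero    = bar-0⇒∣ e
      x∣η (suc j) = h j
      ζ : Vector (Poly (suc m)) (suc m)
      ζ j = quotient (x∣η j)
      eq : ∀ j → η j ≈ₚ var zero ⊗ ζ j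
      eq j = equality (x∣η j)

    residue-exists : ∀ {η} → Log η → Q̄ ∣ bar (η zero)
    residue-exists {η} (log h l) = product-∣ traces traces-nonZero traces-distinct λ λ′ λ∈ → at-trace λ′ (trace-form λ′ λ∈)
      where
      at-trace : ∀ λ′ → (∃ λ a → a ∈ₗ hyperplanes × λ′ ≡ tail a) → linear λ′ ∣ bar (η zero)
      at-trace λ′ (a , a∈ , ≡.refl) = ∣-resp (≈-sym (bar-congruence zero))
        (∣-⊕ (∣-⊗ʳ (con (a zero)) λ∣c) (∣-factorˡ _ _))
        where
        open Parallel (l a a∈) renaming (multiplier to k; remainder to z)
        p = proj₁ (nonZero-coordinate {α = tail a} (transversal a a∈))
        aₚ≉0 = proj₂ (nonZero-coordinate {α = tail a} (transversal a a∈))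
        bar-congruence : ∀ j → bar (η j) ≈ₚ bar k ⊗ con (a j) ⊕ linear (tail a) ⊗ bar (z j)
        bar-congruence j = ≈-trans (bar-cong (congruence j)) (⊕-cong ≈-refl (⊗-cong (bar-linear a) ≈-refl))
        λ∣c : linear (tail a) ∣ bar k
        λ∣c = ∣-con⊗ aₚ≉0 (⊝ bar (z (suc p)) , (begin
          con (a (suc p)) ⊗ bar k
            ≈⟨ solve 4 (λ a k l z → a :* k := (k :* a :+ l :* z) :+ l :* (:- z)) ≈-refl (con (a (suc p))) (bar k) (linear (tail a)) (bar (z (suc p))) ⟩
          (bar k ⊗ con (a (suc p)) ⊕ linear (tail a) ⊗ bar (z (suc p))) ⊕ linear (tail a) ⊗ ⊝ bar (z (suc p))
            ≈⟨ ⊕-cong (≈-trans (≈-sym (bar-congruence (suc p))) (∣⇒bar-0 (h p))) ≈-refl ⟩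
          0ₚ ⊕ linear (tail a) ⊗ ⊝ bar (z (suc p))
            ≈⟨ ⊕-identityˡ _ ⟩
          linear (tail a) ⊗ ⊝ bar (z (suc p)) ∎))

    record InResidueIdeal (r : Poly m) : Set (c ⊔ ℓ₁) where
      constructor in-residue-ideal
      field
        form      : Vector (Poly (suc m)) (suc m)
        form-log  : Log form
        residue   : Q̄ ⊗ r ≈ₚ bar (form zero)

    J : Ideal (S m) (c ⊔ ℓ₁)
    J = record
      { member = InResidueIdeal
      ; resp = λ { e (in-residue-ideal η l r) → in-residue-ideal η l (≈-trans (⊗-cong ≈-refl (≈-sym e)) r) }
      ; 0-closed = in-residue-ideal (λ _ → 0ₚ) (log (λ j → ∣-0 ≈-refl) (λ a a∈ → parallel-∣ a (λ j → ∣-0 ≈-refl))) (SR.zeroʳ _)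
      ; +-closed = λ { (in-residue-ideal η l r) (in-residue-ideal η′ l′ r′) →
          in-residue-ideal (λ j → η j ⊕ η′ j) (Log-⊕ l l′) (≈-trans (distribˡ _ _ _) (⊕-cong r r′)) }
      ; *-closed = λ { s {x} (in-residue-ideal η l r) → in-residue-ideal (λ j → weaken s ⊗ η j) (Log-⊗ (weaken s) l)
          (≈-trans (solve 3 (λ q s x → q :* (s :* x) := s :* (q :* x)) ≈-refl Q̄ s x)
            (⊗-cong (≈-sym (bar-weaken s)) r)) } }

    residue∈J : ∀ {η} (l : Log η) → InResidueIdeal (quotient (residue-exists l))
    residue∈J l = in-residue-ideal _ l (≈-sym (equality (residue-exists l)))

    -- ξ / Q̄ is the restriction of ζ / P to x₀ = 0.
    Restricts : Vector (Poly (suc m)) (suc m) → Vector (Poly m) m → Set (c ⊔ ℓ₁)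
    Restricts ζ ξ = ∀ j → P̄ ⊗ ξ j ≈ₚ Q̄ ⊗ bar (ζ (suc j))

    module _ {ζ ζ′ ξ ξ′} (s s′ : Poly m) (R : Restricts ζ ξ) (R′ : Restricts ζ′ ξ′) where
      Restricts-combine : Restricts (λ j → weaken s ⊗ ζ j ⊕ weaken s′ ⊗ ζ′ j) (λ j → s ⊗ ξ j ⊕ s′ ⊗ ξ′ j)
      Restricts-combine j = begin
        P̄ ⊗ (s ⊗ ξ j ⊕ s′ ⊗ ξ′ j)
          ≈⟨ solve 5 (λ p s x t y → p :* (s :* x :+ t :* y) := s :* (p :* x) :+ t :* (p :* y)) ≈-refl P̄ s (ξ j) s′ (ξ′ j) ⟩
        s ⊗ (P̄ ⊗ ξ j) ⊕ s′ ⊗ (P̄ ⊗ ξ′ j)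
          ≈⟨ ⊕-cong (⊗-cong (≈-sym (bar-weaken s)) (R j)) (⊗-cong (≈-sym (bar-weaken s′)) (R′ j)) ⟩
        bar (weaken s) ⊗ (Q̄ ⊗ bar (ζ (suc j))) ⊕ bar (weaken s′) ⊗ (Q̄ ⊗ bar (ζ′ (suc j)))
          ≈⟨ solve 5 (λ q s x t y → s :* (q :* x) :+ t :* (q :* y) := q :* (s :* x :+ t :* y)) ≈-refl Q̄ (bar (weaken s)) (bar (ζ (suc j))) (bar (weaken s′)) (bar (ζ′ (suc j))) ⟩
        Q̄ ⊗ bar (weaken s ⊗ ζ (suc j) ⊕ weaken s′ ⊗ ζ′ (suc j)) ∎

    Restricts-0 : ∀ {ζ ξ} → Restricts ζ ξ → (∀ j → ξ j ≈ₚ 0ₚ) → ∀ j → var zero ∣ ζ (suc j)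
    Restricts-0 {ζ} {ξ} R ξ≈0 j = bar-0⇒∣ (domain Q̄ _
      (≈-trans (≈-sym (R j)) (≈-trans (⊗-cong ≈-refl (ξ≈0 j)) (SR.zeroʳ _))) Q̄≉0)

    module Class (x : Form m) (x≉0 : NonZero x) where
      same? : ∀ (a : Form (suc m)) → Dec (SameHyperplane x (tail a))
      same? a = sameHyperplane? x (tail a)

      class : List (Form (suc m))
      class = filter same? hyperplanes

      class̄ others̄ : List (Form m)
      class̄ = filter (sameHyperplane? x) tails
      others̄ = filter (¬? ∘ sameHyperplane? x) tails

      bar-class : bar (product class) ≈ₚ product class̄
      bar-class = bar-product-filter (sameHyperplane? x) hyperplanes

      P̄-class : P̄ ≈ₚ product class̄ ⊗ product others̄
      P̄-class = ≈-trans (bar-product hyperplanes) (product-filter (sameHyperplane? x) tails)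

      class-minor : ∀ {ζ} → Log′ ζ → ∀ p j → product class̄ ∣ minor x (λ j → bar (ζ (suc j))) p j
      class-minor {ζ} l p j = ∣-respˡ bar-class (bar-∣ {f = product class} {g = D} (product-∣ class
        (All.tabulate (λ {a} a∈ → form-nonZero a (proj₁ (∈-filter⁻ same? a∈))))
        (AllPairs.filter⁺ same? hyperplanes-distinct) each))
        where
        D : Poly (suc m)
        D = con (x p) ⊗ ζ (suc j) ⊕ ⊝ (con (x j) ⊗ ζ (suc p))
        each : ∀ a → a ∈ₗ class → linear a ∣ D
        each a a∈class = ∣-resp (begin
          con k ⊗ (con (a (suc p)) ⊗ ζ (suc j) ⊕ ⊝ (con (a (suc j)) ⊗ ζ (suc p)))
            ≈⟨ solve 5 (λ k a b x y → k :* (a :* x :- b :* y) := k :* a :* x :- k :* b :* y) ≈-refl (con k) (con (a (suc p))) (con (a (suc j))) (ζ (suc j)) (ζ (suc p)) ⟩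
          con k ⊗ con (a (suc p)) ⊗ ζ (suc j) ⊕ ⊝ (con k ⊗ con (a (suc j)) ⊗ ζ (suc p))
            ≈⟨ ⊕-cong (⊗-cong (scale p) ≈-refl) (⊝-cong (⊗-cong (scale j) ≈-refl)) ⟩
          D ∎) (∣-⊗ˡ (con k) (parallel-minor a (l a a∈) (suc p) (suc j)))
          where
          a∈ = proj₁ (∈-filter⁻ same? a∈class)
          multiple : ∃ λ k → x ≋ₖ (λ i → k K.* tail a i)
          multiple = proportional {α = tail a} {x} (transversal a a∈)
            (λ {v} → Equivalence.from (proj₂ (∈-filter⁻ same? {xs = hyperplanes} a∈class) v))
          k = proj₁ multiple
          e = proj₂ multiple
          scale : ∀ i → con k ⊗ con (a (suc i)) ≈ₚ con (x i)
          scale i = ≈-trans (≈-sym (con-* _ _)) (con-cong (K.sym (e i)))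

      class-euler : ∀ {ζ} → Log′ ζ → product class̄ ∣ euler (λ j → bar (ζ (suc j)))
      class-euler {ζ} l = ∣-trans (∣-resp (≈-sym P̄-class) (∣-factorˡ _ _))
        (∣-resp (≈-trans (⊕-cong (SR.zeroʳ _) (bar-sum (λ j → ζ (suc j) ⊗ var (suc j)))) (⊕-identityˡ _))
          (bar-∣ {f = P} {g = euler ζ} (product-∣ hyperplanes forms-nonZero hyperplanes-distinct (λ a a∈ → parallel-euler a (l a a∈)))))

      -- Contraction with the Euler field turns the congruences for the minors into one for the coefficients.
      class-coefficient : ∀ {ζ} → Log′ ζ → ∀ j → product class̄ ∣ linear x ⊗ bar (ζ (suc j))
      class-coefficient {ζ} l j = ∣-con⊗ xₚ≉0 (∣-resp (begin
        linear x ⊗ D j ⊕ con (x j) ⊗ (linear x ⊗ z p)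
          ≈⟨ solve 5 (λ l a b u v → l :* (a :* u :- b :* v) :+ b :* (l :* v) := a :* (l :* u)) ≈-refl (linear x) (con (x p)) (con (x j)) (z j) (z p) ⟩
        con (x p) ⊗ (linear x ⊗ z j) ∎) (∣-⊕ (∣-⊗ˡ (linear x) (class-minor l p j)) (∣-⊗ˡ (con (x j)) at-p)))
        where
        z : Vector (Poly m) m
        z i = bar (ζ (suc i))
        p = proj₁ (nonZero-coordinate {α = x} x≉0)
        xₚ≉0 = proj₂ (nonZero-coordinate {α = x} x≉0)
        D : Vector (Poly m) m
        D = minor x z p
        at-p : product class̄ ∣ linear x ⊗ z p
        at-p = ∣-resp (begin
          con (x p) ⊗ euler z ⊕ ⊝ sum (λ i → D i ⊗ var i)
            ≈⟨ ⊕-cong (SLin.*-distribˡ-sum (con (x p)) (λ i → z i ⊗ var i)) ≈-refl ⟩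
          sum (λ i → con (x p) ⊗ (z i ⊗ var i)) ⊕ ⊝ sum (λ i → D i ⊗ var i)
            ≈⟨ ⊕-cong (SLin.sum-cong _ (λ i → D i ⊗ var i ⊕ z p ⊗ (con (x i) ⊗ var i)) (λ i →
                 solve 5 (λ a b u v y → a :* (u :* y) := (a :* u :- b :* v) :* y :+ v :* (b :* y)) ≈-refl (con (x p)) (con (x i)) (z i) (z p) (var i))) ≈-refl ⟩
          sum (λ i → D i ⊗ var i ⊕ z p ⊗ (con (x i) ⊗ var i)) ⊕ ⊝ sum (λ i → D i ⊗ var i)
            ≈⟨ ⊕-cong (≈-trans (SLin.∑-distrib-+ (λ i → D i ⊗ var i) (λ i → z p ⊗ (con (x i) ⊗ var i)))
                 (⊕-cong ≈-refl (≈-sym (SLin.*-distribˡ-sum (z p) (λ i → con (x i) ⊗ var i))))) ≈-refl ⟩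
          (sum (λ i → D i ⊗ var i) ⊕ z p ⊗ linear x) ⊕ ⊝ sum (λ i → D i ⊗ var i)
            ≈⟨ solve 3 (λ s z l → (s :+ z :* l) :- s := l :* z) ≈-refl (sum (λ i → D i ⊗ var i)) (z p) (linear x) ⟩
          linear x ⊗ z p ∎)
          (∣-⊖ (∣-⊗ˡ (con (x p)) (class-euler l)) (∣-sum (λ i → D i ⊗ var i) (λ i → ∣-⊗ʳ (var i) (class-minor l p i))))

    restriction-exists : ∀ {ζ} → Log′ ζ → ∃ λ ξ → Restricts ζ ξ × LogH ξ
    restriction-exists {ζ} l = ξ , (λ j → ≈-sym (equality (P̄∣ j))) , λ λ′ λ∈ → at-trace λ′ λ∈
      where
      z : Vector (Poly m) m
      z i = bar (ζ (suc i))
      P̄∣ : ∀ j → P̄ ∣ Q̄ ⊗ z j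
      P̄∣ j = ∣-respˡ (≈-sym (bar-product hyperplanes)) (product-∣-classwise tails tails-nonZero (λ {x} x∈ → each x (∈-map⁻ tail x∈)))
        where
        each : ∀ x → (∃ λ a → a ∈ₗ hyperplanes × x ≡ tail a) → product (filter (sameHyperplane? x) tails) ∣ Q̄ ⊗ z j
        each x (a , a∈ , ≡.refl) = ∣-trans (Class.class-coefficient x (transversal a a∈) l j) (∣-resp (⊗-comm _ _) (∣-resp (⊗-cong ≈-refl (≈-sym (equality x∣Q̄)))
            (quotient x∣Q̄ , solve 3 (λ l z q → z :* (l :* q) := l :* z :* q) ≈-refl (linear x) (z j) (quotient x∣Q̄))))
          where
          λ′ = proj₁ (form-trace a a∈)
          x∣Q̄ : linear x ∣ Q̄
          x∣Q̄ = ∣-trans (same⇒∣ {α = x} {λ′} (transversal a a∈) (same-sym {α = λ′} {x} (proj₂ (proj₂ (form-trace a a∈)))))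
            (∈⇒∣product (proj₁ (proj₂ (form-trace a a∈))))
      ξ : Vector (Poly m) m
      ξ j = quotient (P̄∣ j)
      at-trace : ∀ λ′ → λ′ ∈ₗ traces → Parallel λ′ ξ
      at-trace λ′ λ∈ = minor-parallel λ′ p λₚ≉0 λ j → linear-prime {α = λ′} {product others̄} {minor λ′ ξ p j} λ≉0 λ∤others
          (q ⊗ quotient (class-minor l p j) , cancelˡ (product class̄) class̄≉0 (begin
            product class̄ ⊗ (product others̄ ⊗ minor λ′ ξ p j)
              ≈⟨ ⊗-assoc _ _ _ ⟨
            product class̄ ⊗ product others̄ ⊗ minor λ′ ξ p j
              ≈⟨ ⊗-cong P̄-class ≈-refl ⟨
            P̄ ⊗ minor λ′ ξ p j
              ≈⟨ solve 5 (λ P a b x y → P :* (a :* x :- b :* y) := a :* (P :* x) :- b :* (P :* y)) ≈-refl P̄ (con (λ′ p)) (con (λ′ j)) (ξ j) (ξ p) ⟩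
            con (λ′ p) ⊗ (P̄ ⊗ ξ j) ⊕ ⊝ (con (λ′ j) ⊗ (P̄ ⊗ ξ p))
              ≈⟨ ⊕-cong (⊗-cong ≈-refl (equality (P̄∣ j))) (⊝-cong (⊗-cong ≈-refl (equality (P̄∣ p)))) ⟨
            con (λ′ p) ⊗ (Q̄ ⊗ z j) ⊕ ⊝ (con (λ′ j) ⊗ (Q̄ ⊗ z p))
              ≈⟨ solve 5 (λ P a b x y → a :* (P :* x) :- b :* (P :* y) := P :* (a :* x :- b :* y)) ≈-refl Q̄ (con (λ′ p)) (con (λ′ j)) (z j) (z p) ⟩
            Q̄ ⊗ minor λ′ z p j
              ≈⟨ ⊗-cong (equality (∈⇒∣product λ∈)) (equality (class-minor l p j)) ⟩
            (linear λ′ ⊗ q) ⊗ (product class̄ ⊗ quotient (class-minor l p j))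
              ≈⟨ solve 4 (λ l q P h → l :* q :* (P :* h) := P :* (l :* (q :* h))) ≈-refl (linear λ′) q (product class̄) (quotient (class-minor l p j)) ⟩
            product class̄ ⊗ (linear λ′ ⊗ (q ⊗ quotient (class-minor l p j))) ∎))
        where
        λ≉0 = trace-nonZero λ′ λ∈
        open Class λ′ λ≉0
        q = quotient (∈⇒∣product λ∈)
        p = proj₁ (nonZero-coordinate {α = λ′} λ≉0)
        λₚ≉0 = proj₂ (nonZero-coordinate {α = λ′} λ≉0)
        class̄≉0 : ¬ product class̄ ≈ₚ 0ₚ
        class̄≉0 = product-nonZero (All.filter⁺ (sameHyperplane? λ′) tails-nonZero)
        λ∤others : ¬ linear λ′ ∣ product others̄
        λ∤others λ∣others = y≁ (prime∣product {xs = others̄} {λ′} λ≉0 λ∣others)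
          where
          y≁ : ¬ (∃ λ y → y ∈ₗ others̄ × linear λ′ ∣ linear y)
          y≁ (y , y∈ , λ∣y) = proj₂ (∈-filter⁻ (¬? ∘ sameHyperplane? λ′) {xs = tails} y∈)
            (∣⇒same {α = λ′} {y} λ≉0 (All.lookup tails-nonZero (proj₁ (∈-filter⁻ (¬? ∘ sameHyperplane? λ′) y∈))) λ∣y)

  _̃ : ∀ {m} → Form m → Poly (suc m)
  α ̃ = weaken (linear α)

  bar-̃ : ∀ {m} (α : Form m) → bar (α ̃) ≈ₚ linear α
  bar-̃ α = bar-weaken (linear α)

  regular-sequence : ∀ {m} (α β γ : Form m) → NonZero α → ¬ linear α ∣ linear β →
                     ∀ v → α · v K.≈ K.0# → β · v K.≈ K.0# → ¬ γ · v K.≈ K.0# →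
                     ∀ f g h → linear γ ⊗ f ≈ₚ g ⊗ linear α ⊕ h ⊗ linear β → member ⟪ linear α , linear β ⟫ f
  regular-sequence {zero} α β γ α≉0 = contradiction (λ ()) α≉0
  regular-sequence {suc m} α β γ α≉0 α∤β v αv≈0 βv≈0 γv≉0 f g h eq =
    quotient α∣ , section q , (begin
      f                                            ≈⟨ solve 2 (λ f x → f := (f :- x) :+ x) ≈-refl f (linear β ⊗ section q) ⟩
      (f ⊕ ⊝ (linear β ⊗ section q)) ⊕ linear β ⊗ section q
                                                   ≈⟨ ⊕-cong (equality α∣) ≈-refl ⟩
      linear α ⊗ quotient α∣ ⊕ linear β ⊗ section q
                                                   ≈⟨ ⊕-cong (⊗-comm _ _) (⊗-comm _ _) ⟩
      quotient α∣ ⊗ linear α ⊕ section q ⊗ linear β ∎)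
    where
    open HyperplaneRestriction α α≉0
    a = coordinate v
    pull· : ∀ δ′ → pull δ′ · a K.≈ δ′ · v
    pull· δ′ = K.trans (K.sym (·-lincombʳ δ′ a basis)) (K.trans (·-comm δ′ (KLin.lincomb a basis))
      (K.trans (·-congˡ {α = KLin.lincomb a basis} {v} δ′ (λ i → K.sym (proj₂ (KLin.IsBasis.spanning isBasis v αv≈0) i))) (·-comm v δ′)))
    pullβ≉0 : NonZero (pull β)
    pullβ≉0 e = α∤β (project-0 (≈-trans (project-linear β) (≈-trans (linear-cong e)
      (SLin.sum-0 (λ i → con K.0# ⊗ var i) (λ i → SR.zeroˡ _)))))
    pullβ∤pullγ : ¬ linear (pull β) ∣ linear (pull γ)
    pullβ∤pullγ d = γv≉0 (K.trans (K.sym (pull· γ)) (∣⇒⊆ {α = pull β} {pull γ} d (K.trans (pull· β) βv≈0)))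
    pullβ∣ : linear (pull β) ∣ project f
    pullβ∣ = linear-prime {α = pull β} {linear (pull γ)} {project f} pullβ≉0 pullβ∤pullγ (project h , (begin
      linear (pull γ) ⊗ project f
        ≈⟨ ⊗-cong (project-linear γ) ≈-refl ⟨
      project (linear γ ⊗ f)
        ≈⟨ project-cong eq ⟩
      project g ⊗ project (linear α) ⊕ project h ⊗ project (linear β)
        ≈⟨ ⊕-cong (⊗-cong ≈-refl project-α) (⊗-cong ≈-refl (project-linear β)) ⟩
      project g ⊗ 0ₚ ⊕ project h ⊗ linear (pull β)
        ≈⟨ solve 3 (λ g h b → g :* :0 :+ h :* b := b :* h) ≈-refl (project g) (project h) (linear (pull β)) ⟩
      linear (pull β) ⊗ project h ∎))
    q = quotient pullβ∣
    α∣ : linear α ∣ f ⊕ ⊝ (linear β ⊗ section q)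
    α∣ = project-0 (≈-trans (⊕-cong (equality pullβ∣) (⊝-cong (⊗-cong (project-linear β) (project-section q)))) (SR.-‿inverseʳ _))

  -- Residue ideals of free arrangements

  module ResidueElements {m} (A : Configuration m) where
    open Configurations A

    P̄∈J : InResidueIdeal P̄
    P̄∈J = Ideal.resp J (≈-sym (equality (residue-exists l))) (Ideal.*-closed J Q̄ (residue∈J l))
      where
      l : Log (P ◂ λ _ → 0ₚ)
      l = log (λ j → ∣-0 ≈-refl) λ a a∈ → parallel-∣ a λ { zero → ∈⇒∣product a∈ ; (suc j) → ∣-0 ≈-refl }

    -- Comes from the residue of dx₀/x₀ − da/a, multiplied by the hyperplanes with another trace than a.
    pair∈J : ∀ a → a ∈ₗ hyperplanes → InResidueIdeal (product (filter (¬? ∘ sameHyperplane? (tail a)) tails))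
    pair∈J a a∈ = Ideal.resp J (cancelˡ (linear (tail a)) (linear-nonZero (transversal a a∈)) (begin
        linear (tail a) ⊗ (quotient a∣Q̄ ⊗ r)
          ≈⟨ ⊗-assoc _ _ _ ⟨
        linear (tail a) ⊗ quotient a∣Q̄ ⊗ r
          ≈⟨ ⊗-cong (equality a∣Q̄) ≈-refl ⟨
        Q̄ ⊗ r
          ≈⟨ equality (residue-exists l) ⟨
        bar G ⊗ (bar (linear a) ⊗ 1ₚ ⊕ ⊝ (0ₚ ⊗ con (a zero)))
          ≈⟨ ⊗-cong (bar-product-filter (¬? ∘ sameHyperplane? (tail a)) hyperplanes)
               (⊕-cong (⊗-cong (bar-linear a) ≈-refl) ≈-refl) ⟩
        product others̄ ⊗ (linear (tail a) ⊗ 1ₚ ⊕ ⊝ (0ₚ ⊗ con (a zero)))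
          ≈⟨ solve 3 (λ o l x → o :* (l :* :1 :- :0 :* x) := l :* o) ≈-refl (product others̄) (linear (tail a)) (con (a zero)) ⟩
        linear (tail a) ⊗ product others̄ ∎))
        (Ideal.*-closed J (quotient a∣Q̄) (residue∈J l))
      where
      others̄ = filter (¬? ∘ sameHyperplane? (tail a)) tails
      others : List (Form (suc m))
      others = filter (¬? ∘ sameHyperplane? (tail a) ∘ tail) hyperplanes
      G = product others
      η : Vector (Poly (suc m)) (suc m)
      η j = G ⊗ (linear a ⊗ con (δ zero j) ⊕ ⊝ (var zero ⊗ con (a j)))
      at-a′ : ∀ a′ → a′ ∈ₗ hyperplanes → Dec (SameHyperplane (tail a) (tail a′)) → Parallel a′ η
      at-a′ a′ a′∈ (no a≁a′) = parallel-∣ a′ (λ j → ∣-⊗ʳ _ (∈⇒∣product (∈-filter⁺ (¬? ∘ sameHyperplane? (tail a) ∘ tail) a′∈ a≁a′)))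
      at-a′ a′ a′∈ (yes a~a′) = parallel (⊝ (G ⊗ con k ⊗ var zero)) (λ j → G ⊗ con k ⊗ con (δ zero j)) λ j → begin
        G ⊗ (linear a ⊗ con (δ zero j) ⊕ ⊝ (var zero ⊗ con (a j)))
          ≈⟨ ⊗-cong ≈-refl (⊕-cong (⊗-cong linear-a ≈-refl) (⊝-cong (⊗-cong ≈-refl (con-a j)))) ⟩
        G ⊗ ((con k ⊗ linear a′ ⊕ con t ⊗ var zero) ⊗ con (δ zero j) ⊕ ⊝ (var zero ⊗ (con k ⊗ con (a′ j) ⊕ con t ⊗ con (δ zero j))))
          ≈⟨ solve 7 (λ G k l t x d a → G :* ((k :* l :+ t :* x) :* d :- x :* (k :* a :+ t :* d)) := (:- (G :* k :* x)) :* a :+ l :* (G :* k :* d)) ≈-refl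
               G (con k) (linear a′) (con t) (var zero) (con (δ zero j)) (con (a′ j)) ⟩
        ⊝ (G ⊗ con k ⊗ var zero) ⊗ con (a′ j) ⊕ linear a′ ⊗ (G ⊗ con k ⊗ con (δ zero j)) ∎
        where
        multiple : ∃ λ k → tail a ≋ₖ (λ i → k K.* tail a′ i)
        multiple = proportional {α = tail a′} {tail a} (transversal a′ a′∈) (λ {v} → Equivalence.from (a~a′ v))
        k = proj₁ multiple
        t = a zero K.- k K.* a′ zero
        a≈ : ∀ j → a j K.≈ k K.* a′ j K.+ t K.* δ zero j
        a≈ zero    = solveᴷ 3 (λ a k b → a ≔ k ⊠ b ⊞ (a ⊟ k ⊠ b) ⊠ 1ᴷ) K.refl (a zero) k (a′ zero)
        a≈ (suc j) = K.trans (proj₂ multiple j) (solveᴷ 2 (λ x t → x ≔ x ⊞ t ⊠ 0ᴷ) K.refl _ t)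
        con-a : ∀ j → con (a j) ≈ₚ con k ⊗ con (a′ j) ⊕ con t ⊗ con (δ zero j)
        con-a j = ≈-trans (con-cong (a≈ j)) (≈-trans (con-+ _ _) (⊕-cong (con-* _ _) (con-* _ _)))
        linear-a : linear a ≈ₚ con k ⊗ linear a′ ⊕ con t ⊗ var zero
        linear-a = ≈-trans (linear-cong a≈) (≈-trans (linear-combine k a′ t (δ zero)) (⊕-cong ≈-refl (⊗-cong ≈-refl (linear-δ zero))))
      l : Log η
      l = log (λ j → ∣-⊗ˡ G (⊝ con (a (suc j)) , solve 3 (λ l x a → l :* :0 :- x :* a := x :* (:- a)) ≈-refl (linear a) (var zero) (con (a (suc j)))))
        (λ a′ a′∈ → at-a′ a′ a′∈ em)
      r = quotient (residue-exists l)
      a∣Q̄ : linear (tail a) ∣ Q̄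
      a∣Q̄ = ∣-trans (same⇒∣ {α = tail a} {proj₁ (form-trace a a∈)} (transversal a a∈) (same-sym {α = proj₁ (form-trace a a∈)} {tail a} (proj₂ (proj₂ (form-trace a a∈)))))
        (∈⇒∣product (proj₁ (proj₂ (form-trace a a∈))))

  module FreeConfigurations {m} (A : Configuration m) {k} (G : Vector (Vector (Poly (suc m)) (suc m)) k)
                            (G-basis : SLin.IsBasis (Configurations.Log A) G) where
    open Configurations A
    open SLin.IsBasis G-basis

    -- Exactness of u ↦ (α u, β u), (u₁, u₂) ↦ β u₁ − α u₂ on the free module Log / x₀ Log.
    divide : ∀ α β → NonZero α → ¬ linear α ∣ linear β → ∀ u₁ u₂ n → Log u₁ → Log u₂ → Log n →
             (∀ j → (β ̃) ⊗ u₁ j ⊕ ⊝ (α ̃) ⊗ u₂ j ≈ₚ var zero ⊗ n j) →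
             ∃₂ λ u v → Log u × Log v × (∀ j → u₁ j ≈ₚ (α ̃) ⊗ u j ⊕ var zero ⊗ v j)
    divide α β α≉0 α∤β u₁ u₂ n l₁ l₂ lₙ eq =
      SLin.lincomb (λ i → weaken (q i)) G , SLin.lincomb e G ,
      Log-lincomb (λ i → weaken (q i)) G inside , Log-lincomb e G inside , λ j → begin
        u₁ j
          ≈⟨ proj₂ (spanning u₁ l₁) j ⟩
        SLin.lincomb c₁ G j
          ≈⟨ SLin.lincomb-congˡ c₁ (λ i → (α ̃) ⊗ weaken (q i) ⊕ var zero ⊗ e i) G c₁≈ j ⟩
        SLin.lincomb (λ i → (α ̃) ⊗ weaken (q i) ⊕ var zero ⊗ e i) G j
          ≈⟨ lincomb-combine (α ̃) (λ i → weaken (q i)) (var zero) e G j ⟩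
        (α ̃) ⊗ SLin.lincomb (λ i → weaken (q i)) G j ⊕ var zero ⊗ SLin.lincomb e G j ∎
      where
      c₁ c₂ cₙ : Vector (Poly (suc m)) k
      c₁ = proj₁ (spanning u₁ l₁)
      c₂ = proj₁ (spanning u₂ l₂)
      cₙ = proj₁ (spanning n lₙ)
      relation : ∀ i → ((β ̃) ⊗ c₁ i ⊕ ⊝ (α ̃) ⊗ c₂ i) ⊕ ⊝ var zero ⊗ cₙ i ≈ₚ 0ₚ
      relation = independent (λ i → ((β ̃) ⊗ c₁ i ⊕ ⊝ (α ̃) ⊗ c₂ i) ⊕ ⊝ var zero ⊗ cₙ i) λ j → begin
        SLin.lincomb (λ i → ((β ̃) ⊗ c₁ i ⊕ ⊝ (α ̃) ⊗ c₂ i) ⊕ ⊝ var zero ⊗ cₙ i) G j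
          ≈⟨ SLin.lincomb-+ (λ i → (β ̃) ⊗ c₁ i ⊕ ⊝ (α ̃) ⊗ c₂ i) (λ i → ⊝ var zero ⊗ cₙ i) G j ⟩
        SLin.lincomb (λ i → (β ̃) ⊗ c₁ i ⊕ ⊝ (α ̃) ⊗ c₂ i) G j ⊕ SLin.lincomb (λ i → ⊝ var zero ⊗ cₙ i) G j
          ≈⟨ ⊕-cong (lincomb-combine (β ̃) c₁ (⊝ (α ̃)) c₂ G j) (SLin.lincomb-* (⊝ var zero) cₙ G j) ⟩
        ((β ̃) ⊗ SLin.lincomb c₁ G j ⊕ ⊝ (α ̃) ⊗ SLin.lincomb c₂ G j) ⊕ ⊝ var zero ⊗ SLin.lincomb cₙ G j
          ≈⟨ ⊕-cong (⊕-cong (⊗-cong ≈-refl (≈-sym (proj₂ (spanning u₁ l₁) j))) (⊗-cong ≈-refl (≈-sym (proj₂ (spanning u₂ l₂) j))))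
               (⊗-cong ≈-refl (≈-sym (proj₂ (spanning n lₙ) j))) ⟩
        ((β ̃) ⊗ u₁ j ⊕ ⊝ (α ̃) ⊗ u₂ j) ⊕ ⊝ var zero ⊗ n j
          ≈⟨ ⊕-cong (eq j) ≈-refl ⟩
        var zero ⊗ n j ⊕ ⊝ var zero ⊗ n j
          ≈⟨ solve 2 (λ x n → x :* n :+ (:- x) :* n := :0) ≈-refl (var zero) (n j) ⟩
        0ₚ ∎
      α∣ : ∀ i → linear α ∣ bar (c₁ i)
      α∣ i = linear-prime {α = α} {linear β} {bar (c₁ i)} α≉0 α∤β (bar (c₂ i) , (begin
        linear β ⊗ bar (c₁ i)
          ≈⟨ ⊗-cong (bar-̃ β) ≈-refl ⟨
        bar (β ̃) ⊗ bar (c₁ i)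
          ≈⟨ solve 5 (λ b c a d n → b :* c := (b :* c :+ (:- a) :* d :+ (:- :0) :* n) :+ a :* d) ≈-refl (bar (β ̃)) (bar (c₁ i)) (bar (α ̃)) (bar (c₂ i)) (bar (cₙ i)) ⟩
        bar (((β ̃) ⊗ c₁ i ⊕ ⊝ (α ̃) ⊗ c₂ i) ⊕ ⊝ var zero ⊗ cₙ i) ⊕ bar (α ̃) ⊗ bar (c₂ i)
          ≈⟨ ⊕-cong (bar-cong (relation i)) (⊗-cong (bar-̃ α) ≈-refl) ⟩
        0ₚ ⊕ linear α ⊗ bar (c₂ i)
          ≈⟨ ⊕-identityˡ _ ⟩
        linear α ⊗ bar (c₂ i) ∎))
      q : Vector (Poly m) k
      q i = quotient (α∣ i)
      e : Vector (Poly (suc m)) k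
      e i = quotient (bar-kernel (c₁ i))
      c₁≈ : ∀ i → c₁ i ≈ₚ (α ̃) ⊗ weaken (q i) ⊕ var zero ⊗ e i
      c₁≈ i = begin
        c₁ i
          ≈⟨ solve 2 (λ c w → c := w :+ (c :- w)) ≈-refl (c₁ i) (weaken (bar (c₁ i))) ⟩
        weaken (bar (c₁ i)) ⊕ (c₁ i ⊕ ⊝ weaken (bar (c₁ i)))
          ≈⟨ ⊕-cong (weaken-cong (equality (α∣ i))) (equality (bar-kernel (c₁ i))) ⟩
        (α ̃) ⊗ weaken (q i) ⊕ var zero ⊗ e i ∎

    private
      Image : Vector (Poly m) m → Poly m → Set (c ⊔ ℓ₁)
      Image ξ s = ∃ λ ζ → Log′ ζ × Restricts ζ (λ j → s ⊗ ξ j)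

      image : Vector (Poly m) m → Ideal (S m) (c ⊔ ℓ₁)
      image ξ = record
        { member   = Image ξ
        ; resp     = λ { e (ζ , l , R) → ζ , l , λ j → ≈-trans (⊗-cong ≈-refl (⊗-cong (≈-sym e) ≈-refl)) (R j) }
        ; 0-closed = (λ _ → 0ₚ) , (λ a a∈ → parallel-∣ a (λ j → ∣-0 ≈-refl)) ,
            λ j → solve 3 (λ p q x → p :* (:0 :* x) := q :* :0) ≈-refl P̄ Q̄ (ξ j)
        ; +-closed = λ { {s} {t} (ζ , l , R) (ζ′ , l′ , R′) → (λ j → ζ j ⊕ ζ′ j) , Log′-⊕ l l′ , λ j →
            ≈-trans (solve 4 (λ p s t x → p :* ((s :+ t) :* x) := p :* (s :* x) :+ p :* (t :* x)) ≈-refl P̄ s t (ξ j))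
            (≈-trans (⊕-cong (R j) (R′ j)) (≈-sym (distribˡ _ _ _))) }
        ; *-closed = λ { s {t} (ζ , l , R) → (λ j → weaken s ⊗ ζ j) , Log′-⊗ (weaken s) l , λ j →
            ≈-trans (solve 4 (λ p s t x → p :* (s :* t :* x) := s :* (p :* (t :* x))) ≈-refl P̄ s t (ξ j))
            (≈-trans (⊗-cong (≈-sym (bar-weaken s)) (R j))
              (solve 3 (λ s q z → s :* (q :* z) := q :* (s :* z)) ≈-refl (bar (weaken s)) Q̄ (bar (ζ (suc j))))) }
        }

    module _ (ξ : Vector (Poly m) m) (ξ-log : LogH ξ) where
      private
        Q̄∈image : Image ξ Q̄
        Q̄∈image = ζ , (λ a a∈ → parallel-∣ a λ { zero → ∣-0 ≈-refl ; (suc j) → ∣-⊗ʳ (weaken (ξ j)) (∈⇒∣product a∈) }) , λ j → begin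
          P̄ ⊗ (Q̄ ⊗ ξ j)                 ≈⟨ solve 3 (λ p q x → p :* (q :* x) := q :* (p :* x)) ≈-refl P̄ Q̄ (ξ j) ⟩
          Q̄ ⊗ (P̄ ⊗ ξ j)                 ≈⟨ ⊗-cong ≈-refl (⊗-cong ≈-refl (bar-weaken (ξ j))) ⟨
          Q̄ ⊗ (P̄ ⊗ bar (weaken (ξ j)))  ∎
          where
          ζ : Vector (Poly (suc m)) (suc m)
          ζ = 0ₚ ◂ λ j → P ⊗ weaken (ξ j)

        -- ξ has a simple pole along the given trace only, and dλ/λ lifts to da/a.
        cofactor∈image : ∀ λ′ → λ′ ∈ₗ traces → (∃ λ a → a ∈ₗ hyperplanes × λ′ ≡ tail a) →
                         ∀ ys → Q̄ ≈ₚ linear λ′ ⊗ product ys → Image ξ (product ys)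
        cofactor∈image λ′ λ∈ (a , a∈ , ≡.refl) ys Q̄≈ = ζ , (λ a′ a′∈ → at-a′ a′ (proj₂ (proj₂ (proj₂ ext)) a′ a′∈)) , λ j → begin
          P̄ ⊗ (product ys ⊗ ξ j)
            ≈⟨ ⊗-cong P̄≈ (⊗-cong ≈-refl (congruence j)) ⟩
          linear (tail a) ⊗ bar C ⊗ (product ys ⊗ (κ ⊗ con (a (suc j)) ⊕ linear (tail a) ⊗ z j))
            ≈⟨ solve 6 (λ l c y k a z → l :* c :* (y :* (k :* a :+ l :* z)) := l :* y :* (c :* k :* a :+ l :* c :* z)) ≈-refl
                 (linear (tail a)) (bar C) (product ys) κ (con (a (suc j))) (z j) ⟩
          linear (tail a) ⊗ product ys ⊗ (bar C ⊗ κ ⊗ con (a (suc j)) ⊕ linear (tail a) ⊗ bar C ⊗ z j)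
            ≈⟨ ⊗-cong Q̄≈ (⊕-cong (⊗-cong (⊗-cong ≈-refl (bar-weaken κ)) ≈-refl) (⊗-cong P̄≈ (bar-weaken (z j)))) ⟨
          Q̄ ⊗ bar (ζ (suc j)) ∎
          where
          open Parallel (ξ-log (tail a) λ∈) renaming (multiplier to κ; remainder to z)
          ext = extract hyperplanes hyperplanes-distinct a a∈
          ws = proj₁ ext
          C = product ws
          P̄≈ : P̄ ≈ₚ linear (tail a) ⊗ bar C
          P̄≈ = ≈-trans (bar-cong (proj₁ (proj₂ ext))) (⊗-cong (bar-linear a) ≈-refl)
          z̃ : Vector (Poly (suc m)) (suc m)
          z̃ = 0ₚ ◂ λ j → weaken (z j)
          ζ : Vector (Poly (suc m)) (suc m)
          ζ j = C ⊗ weaken κ ⊗ con (a j) ⊕ P ⊗ z̃ j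
          at-a′ : ∀ a′ → a′ ≡ a ⊎ a′ ∈ₗ ws → Parallel a′ ζ
          at-a′ .a (inj₁ ≡.refl) = parallel-⊕ a
            (parallel (C ⊗ weaken κ) (λ _ → 0ₚ) (λ j → solve 2 (λ x l → x := x :+ l :* :0) ≈-refl (C ⊗ weaken κ ⊗ con (a j)) (linear a)))
            (parallel-∣ a (λ j → ∣-⊗ʳ (z̃ j) (∈⇒∣product a∈)))
          at-a′ a′ (inj₂ a′∈) = parallel-∣ a′ (λ j → ∣-⊕ (∣-⊗ʳ (con (a j)) (∣-⊗ʳ (weaken κ) (∈⇒∣product a′∈)))
            (∣-⊗ʳ (z̃ j) (∈⇒∣product (proj₁ (proj₁ (proj₂ (proj₂ ext)) a′ a′∈)))))

        two-traces : ∀ α β s → NonZero α → ¬ linear α ∣ linear β → Image ξ (linear α ⊗ s) → Image ξ (linear β ⊗ s) → Image ξ s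
        two-traces α β s α≉0 α∤β (ζ₁ , l₁ , R₁) (ζ₂ , l₂ , R₂) = ζ , proj₁ (proj₂ u-log′) , λ j →
          cancelˡ (linear α) (linear-nonZero α≉0) (begin
            linear α ⊗ (P̄ ⊗ (s ⊗ ξ j))       ≈⟨ solve 4 (λ a p s x → a :* (p :* (s :* x)) := p :* (a :* s :* x)) ≈-refl (linear α) P̄ s (ξ j) ⟩
            P̄ ⊗ (linear α ⊗ s ⊗ ξ j)         ≈⟨ R₁ j ⟩
            Q̄ ⊗ bar (ζ₁ (suc j))             ≈⟨ ⊗-cong ≈-refl (bar-cong (ζ₁≈ (suc j))) ⟩
            Q̄ ⊗ (bar (α ̃) ⊗ bar (ζ (suc j)) ⊕ bar (v (suc j)))
                                             ≈⟨ ⊗-cong ≈-refl (⊕-cong (⊗-cong (bar-̃ α) ≈-refl) (∣⇒bar-0 (at-H v-log j))) ⟩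
            Q̄ ⊗ (linear α ⊗ bar (ζ (suc j)) ⊕ 0ₚ)
                                             ≈⟨ solve 3 (λ q a z → q :* (a :* z :+ :0) := a :* (q :* z)) ≈-refl Q̄ (linear α) (bar (ζ (suc j))) ⟩
            linear α ⊗ (Q̄ ⊗ bar (ζ (suc j))) ∎)
          where
          y : Vector (Poly (suc m)) (suc m)
          y j = (β ̃) ⊗ ζ₁ j ⊕ ⊝ (α ̃) ⊗ ζ₂ j
          y-log : Log y
          y-log = log (Restricts-0 {ζ = y} {λ j → linear β ⊗ (linear α ⊗ s ⊗ ξ j) ⊕ ⊝ linear α ⊗ (linear β ⊗ s ⊗ ξ j)}
              (Restricts-combine {ζ₁} {ζ₂} (linear β) (⊝ linear α) R₁ R₂)
              (λ j → solve 4 (λ a b s x → b :* (a :* s :* x) :+ (:- a) :* (b :* s :* x) := :0) ≈-refl (linear α) (linear β) s (ξ j)))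
            (Log′-⊕ (Log′-⊗ (β ̃) l₁) (Log′-⊗ (⊝ (α ̃)) l₂))
          division : ∃₂ λ u v → Log u × Log v × (∀ j → var zero ⊗ ζ₁ j ≈ₚ (α ̃) ⊗ u j ⊕ var zero ⊗ v j)
          division = divide α β α≉0 α∤β (λ j → var zero ⊗ ζ₁ j) (λ j → var zero ⊗ ζ₂ j) y (Log′⇒Log l₁) (Log′⇒Log l₂) y-log
            (λ j → solve 5 (λ b x z a w → b :* (x :* z) :+ (:- a) :* (x :* w) := x :* (b :* z :+ (:- a) :* w)) ≈-refl (β ̃) (var zero) (ζ₁ j) (α ̃) (ζ₂ j))
          u = proj₁ division
          v = proj₁ (proj₂ division)
          u-log = proj₁ (proj₂ (proj₂ division))
          v-log = proj₁ (proj₂ (proj₂ (proj₂ division)))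
          eq = proj₂ (proj₂ (proj₂ (proj₂ division)))
          bar-u≈0 : bar (u zero) ≈ₚ 0ₚ
          bar-u≈0 = domain (linear α) _ (begin
            linear α ⊗ bar (u zero)                           ≈⟨ ⊗-cong (bar-̃ α) ≈-refl ⟨
            bar (α ̃) ⊗ bar (u zero)                           ≈⟨ solve 3 (λ a u v → a :* u := a :* u :+ :0 :* v) ≈-refl (bar (α ̃)) (bar (u zero)) (bar (v zero)) ⟩
            bar ((α ̃) ⊗ u zero ⊕ var zero ⊗ v zero)           ≈⟨ bar-cong (eq zero) ⟨
            0ₚ ⊗ bar (ζ₁ zero)                                ≈⟨ SR.zeroˡ _ ⟩
            0ₚ                                                ∎) (linear-nonZero α≉0)
          u-log′ : ∃ λ ζ → Log′ ζ × (∀ j → u j ≈ₚ var zero ⊗ ζ j)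
          u-log′ = Log⇒Log′ u-log bar-u≈0
          ζ = proj₁ u-log′
          ζ₁≈ : ∀ j → ζ₁ j ≈ₚ (α ̃) ⊗ ζ j ⊕ v j
          ζ₁≈ j = cancelˡ (var zero) (var≉0 zero) (≈-trans (eq j) (≈-trans (⊕-cong (⊗-cong ≈-refl (proj₂ (proj₂ u-log′) j)) ≈-refl)
            (solve 4 (λ a x z v → a :* (x :* z) :+ x :* v := x :* (a :* z :+ v)) ≈-refl (α ̃) (var zero) (ζ j) (v j))))

        1∈image : Image ξ 1ₚ
        1∈image = dne λ 1∉ → contradict 1∉ (annihilators (image ξ) 1∉ traces)
          where
          contradict : ¬ Image ξ 1ₚ → (∃ λ s → ¬ Image ξ s ×
            (∀ ys → (∀ y → y ∈ₗ ys → y ∈ₗ traces) → Image ξ (product ys) → ∃ λ y → y ∈ₗ ys × Image ξ (linear y ⊗ s))) → ⊥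
          contradict _ (s , s∉ , killed) = second (killed traces (λ y y∈ → y∈) Q̄∈image)
            where
            second : (∃ λ y → y ∈ₗ traces × Image ξ (linear y ⊗ s)) → ⊥
            second (α , α∈ , αs∈) = third (extract traces traces-distinct α α∈)
              where
              third : (∃ λ ys → Q̄ ≈ₚ linear α ⊗ product ys × (∀ y → y ∈ₗ ys → y ∈ₗ traces × ¬ SameHyperplane α y) ×
                       (∀ y → y ∈ₗ traces → y ≡ α ⊎ y ∈ₗ ys)) → ⊥
              third (ys , Q̄≈ , sub , _) = fourth (killed ys (λ y y∈ → proj₁ (sub y y∈)) (cofactor∈image α α∈ (trace-form α α∈) ys Q̄≈))
                where
                fourth : (∃ λ y → y ∈ₗ ys × Image ξ (linear y ⊗ s)) → ⊥
                fourth (β , β∈ , βs∈) = s∉ (two-traces α β s (trace-nonZero α α∈)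
                  (λ α∣β → proj₂ (sub β β∈) (∣⇒same {α = α} {β} (trace-nonZero α α∈) (trace-nonZero β (proj₁ (sub β β∈))) α∣β)) αs∈ βs∈)

      extension-exists : ∃ λ ζ → Log′ ζ × Restricts ζ ξ
      extension-exists = proj₁ 1∈image , proj₁ (proj₂ 1∈image) , λ j →
        ≈-trans (⊗-cong ≈-refl (≈-sym (⊗-identityˡ _))) (proj₂ (proj₂ 1∈image) j)

    module Koszul {k′} (F : Vector (Vector (Poly m) m) k′) (F-basis : SLin.IsBasis LogH F) where
      private
        module FB = SLin.IsBasis F-basis

      -- The residue ideal has a free resolution of length one, so it is not
      -- changed by adding elements that three independent forms multiply into it.
      three-forms : ∀ α β γ → NonZero α → ¬ linear α ∣ linear β →
                    ∀ v → α · v K.≈ K.0# → β · v K.≈ K.0# → ¬ γ · v K.≈ K.0# →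
                    ∀ r → InResidueIdeal (linear α ⊗ r) → InResidueIdeal (linear β ⊗ r) → InResidueIdeal (linear γ ⊗ r) →
                    InResidueIdeal r
      three-forms α β γ α≉0 α∤β v αv≈0 βv≈0 γv≉0 r
        (in-residue-ideal u₁ l₁ r₁) (in-residue-ideal u₂ l₂ r₂) (in-residue-ideal u₃ l₃ r₃) =
        in-residue-ideal u u-log (cancelˡ (linear α) (linear-nonZero α≉0) (begin
          linear α ⊗ (Q̄ ⊗ r)                          ≈⟨ solve 3 (λ a q r → a :* (q :* r) := q :* (a :* r)) ≈-refl (linear α) Q̄ r ⟩
          Q̄ ⊗ (linear α ⊗ r)                          ≈⟨ r₁ ⟩
          bar (u₁ zero)                               ≈⟨ solve 2 (λ u y → u := u :+ (:- :0) :* y) ≈-refl (bar (u₁ zero)) (bar (y₂ zero)) ⟩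
          bar (u₁′ zero)                              ≈⟨ bar-cong (eq zero) ⟩
          bar (α ̃) ⊗ bar (u zero) ⊕ 0ₚ ⊗ bar (w zero) ≈⟨ ⊕-cong (⊗-cong (bar-̃ α) ≈-refl) (SR.zeroˡ _) ⟩
          linear α ⊗ bar (u zero) ⊕ 0ₚ                ≈⟨ SR.+-identityʳ _ ⟩
          linear α ⊗ bar (u zero)                     ∎))
        where
        syzygy : ∀ φ ψ u u′ → Log u → Log u′ → Q̄ ⊗ (linear φ ⊗ r) ≈ₚ bar (u zero) → Q̄ ⊗ (linear ψ ⊗ r) ≈ₚ bar (u′ zero) →
                 ∃ λ ζ → Log′ ζ × (∀ j → (ψ ̃) ⊗ u j ⊕ ⊝ (φ ̃) ⊗ u′ j ≈ₚ var zero ⊗ ζ j)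
        syzygy φ ψ u u′ l l′ e e′ = Log⇒Log′ (Log-⊕ (Log-⊗ (ψ ̃) l) (Log-⊗ (⊝ (φ ̃)) l′)) (begin
          bar (ψ ̃) ⊗ bar (u zero) ⊕ ⊝ bar (φ ̃) ⊗ bar (u′ zero)
            ≈⟨ ⊕-cong (⊗-cong (bar-̃ ψ) (≈-sym e)) (⊗-cong (⊝-cong (bar-̃ φ)) (≈-sym e′)) ⟩
          linear ψ ⊗ (Q̄ ⊗ (linear φ ⊗ r)) ⊕ ⊝ linear φ ⊗ (Q̄ ⊗ (linear ψ ⊗ r))
            ≈⟨ solve 4 (λ a b q r → b :* (q :* (a :* r)) :+ (:- a) :* (q :* (b :* r)) := :0) ≈-refl (linear φ) (linear ψ) Q̄ r ⟩
          0ₚ ∎)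
        s₁₂ = syzygy α β u₁ u₂ l₁ l₂ r₁ r₂
        s₁₃ = syzygy α γ u₁ u₃ l₁ l₃ r₁ r₃
        s₂₃ = syzygy β γ u₂ u₃ l₂ l₃ r₂ r₃
        z₁₂ = proj₁ s₁₂
        z₁₃ = proj₁ s₁₃
        z₂₃ = proj₁ s₂₃
        z-relation : ∀ j → ((γ ̃) ⊗ z₁₂ j ⊕ ⊝ (β ̃) ⊗ z₁₃ j) ⊕ (α ̃) ⊗ z₂₃ j ≈ₚ 0ₚ
        z-relation j = domain (var zero) _ (begin
          var zero ⊗ (((γ ̃) ⊗ z₁₂ j ⊕ ⊝ (β ̃) ⊗ z₁₃ j) ⊕ (α ̃) ⊗ z₂₃ j)
            ≈⟨ solve 7 (λ x a b c z y w → x :* ((c :* z :+ (:- b) :* y) :+ a :* w) := (c :* (x :* z) :+ (:- b) :* (x :* y)) :+ a :* (x :* w)) ≈-refl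
                 (var zero) (α ̃) (β ̃) (γ ̃) (z₁₂ j) (z₁₃ j) (z₂₃ j) ⟩
          ((γ ̃) ⊗ (var zero ⊗ z₁₂ j) ⊕ ⊝ (β ̃) ⊗ (var zero ⊗ z₁₃ j)) ⊕ (α ̃) ⊗ (var zero ⊗ z₂₃ j)
            ≈⟨ ⊕-cong (⊕-cong (⊗-cong ≈-refl (proj₂ (proj₂ s₁₂) j)) (⊗-cong ≈-refl (proj₂ (proj₂ s₁₃) j))) (⊗-cong ≈-refl (proj₂ (proj₂ s₂₃) j)) ⟨
          ((γ ̃) ⊗ ((β ̃) ⊗ u₁ j ⊕ ⊝ (α ̃) ⊗ u₂ j) ⊕ ⊝ (β ̃) ⊗ ((γ ̃) ⊗ u₁ j ⊕ ⊝ (α ̃) ⊗ u₃ j)) ⊕ (α ̃) ⊗ ((γ ̃) ⊗ u₂ j ⊕ ⊝ (β ̃) ⊗ u₃ j)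
            ≈⟨ solve 6 (λ a b c u v w → (c :* (b :* u :+ (:- a) :* v) :+ (:- b) :* (c :* u :+ (:- a) :* w)) :+ a :* (c :* v :+ (:- b) :* w) := :0) ≈-refl
                 (α ̃) (β ̃) (γ ̃) (u₁ j) (u₂ j) (u₃ j) ⟩
          0ₚ ∎) (var≉0 zero)
        e₁₂ = restriction-exists (proj₁ (proj₂ s₁₂))
        e₁₃ = restriction-exists (proj₁ (proj₂ s₁₃))
        e₂₃ = restriction-exists (proj₁ (proj₂ s₂₃))
        ξ₁₂ = proj₁ e₁₂
        ξ₁₃ = proj₁ e₁₃
        ξ₂₃ = proj₁ e₂₃
        ξ-relation : ∀ j → (linear γ ⊗ ξ₁₂ j ⊕ ⊝ linear β ⊗ ξ₁₃ j) ⊕ linear α ⊗ ξ₂₃ j ≈ₚ 0ₚ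
        ξ-relation j = domain P̄ _ (begin
          P̄ ⊗ ((linear γ ⊗ ξ₁₂ j ⊕ ⊝ linear β ⊗ ξ₁₃ j) ⊕ linear α ⊗ ξ₂₃ j)
            ≈⟨ solve 7 (λ x a b c z y w → x :* ((c :* z :+ (:- b) :* y) :+ a :* w) := (c :* (x :* z) :+ (:- b) :* (x :* y)) :+ a :* (x :* w)) ≈-refl
                 P̄ (linear α) (linear β) (linear γ) (ξ₁₂ j) (ξ₁₃ j) (ξ₂₃ j) ⟩
          (linear γ ⊗ (P̄ ⊗ ξ₁₂ j) ⊕ ⊝ linear β ⊗ (P̄ ⊗ ξ₁₃ j)) ⊕ linear α ⊗ (P̄ ⊗ ξ₂₃ j)
            ≈⟨ ⊕-cong (⊕-cong (⊗-cong (≈-sym (bar-̃ γ)) (proj₁ (proj₂ e₁₂) j)) (⊗-cong (⊝-cong (≈-sym (bar-̃ β))) (proj₁ (proj₂ e₁₃) j)))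
                 (⊗-cong (≈-sym (bar-̃ α)) (proj₁ (proj₂ e₂₃) j)) ⟩
          (bar (γ ̃) ⊗ (Q̄ ⊗ bar (z₁₂ (suc j))) ⊕ ⊝ bar (β ̃) ⊗ (Q̄ ⊗ bar (z₁₃ (suc j)))) ⊕ bar (α ̃) ⊗ (Q̄ ⊗ bar (z₂₃ (suc j)))
            ≈⟨ solve 7 (λ x a b c z y w → (c :* (x :* z) :+ (:- b) :* (x :* y)) :+ a :* (x :* w) := x :* ((c :* z :+ (:- b) :* y) :+ a :* w)) ≈-refl
                 Q̄ (bar (α ̃)) (bar (β ̃)) (bar (γ ̃)) (bar (z₁₂ (suc j))) (bar (z₁₃ (suc j))) (bar (z₂₃ (suc j))) ⟩
          Q̄ ⊗ bar (((γ ̃) ⊗ z₁₂ (suc j) ⊕ ⊝ (β ̃) ⊗ z₁₃ (suc j)) ⊕ (α ̃) ⊗ z₂₃ (suc j))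
            ≈⟨ ⊗-cong ≈-refl (bar-cong (z-relation (suc j))) ⟩
          Q̄ ⊗ 0ₚ
            ≈⟨ SR.zeroʳ _ ⟩
          0ₚ ∎) P̄≉0
        f₁₂ f₁₃ f₂₃ : Vector (Poly m) k′
        f₁₂ = proj₁ (FB.spanning ξ₁₂ (proj₂ (proj₂ e₁₂)))
        f₁₃ = proj₁ (FB.spanning ξ₁₃ (proj₂ (proj₂ e₁₃)))
        f₂₃ = proj₁ (FB.spanning ξ₂₃ (proj₂ (proj₂ e₂₃)))
        f-relation : ∀ i → (linear γ ⊗ f₁₂ i ⊕ ⊝ linear β ⊗ f₁₃ i) ⊕ linear α ⊗ f₂₃ i ≈ₚ 0ₚ
        f-relation = FB.independent (λ i → (linear γ ⊗ f₁₂ i ⊕ ⊝ linear β ⊗ f₁₃ i) ⊕ linear α ⊗ f₂₃ i) λ j → begin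
          SLin.lincomb (λ i → (linear γ ⊗ f₁₂ i ⊕ ⊝ linear β ⊗ f₁₃ i) ⊕ linear α ⊗ f₂₃ i) F j
            ≈⟨ SLin.lincomb-+ (λ i → linear γ ⊗ f₁₂ i ⊕ ⊝ linear β ⊗ f₁₃ i) (λ i → linear α ⊗ f₂₃ i) F j ⟩
          SLin.lincomb (λ i → linear γ ⊗ f₁₂ i ⊕ ⊝ linear β ⊗ f₁₃ i) F j ⊕ SLin.lincomb (λ i → linear α ⊗ f₂₃ i) F j
            ≈⟨ ⊕-cong (lincomb-combine (linear γ) f₁₂ (⊝ linear β) f₁₃ F j) (SLin.lincomb-* (linear α) f₂₃ F j) ⟩
          (linear γ ⊗ SLin.lincomb f₁₂ F j ⊕ ⊝ linear β ⊗ SLin.lincomb f₁₃ F j) ⊕ linear α ⊗ SLin.lincomb f₂₃ F j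
            ≈⟨ ⊕-cong (⊕-cong (⊗-cong ≈-refl (proj₂ (FB.spanning ξ₁₂ (proj₂ (proj₂ e₁₂))) j)) (⊗-cong ≈-refl (proj₂ (FB.spanning ξ₁₃ (proj₂ (proj₂ e₁₃))) j)))
                 (⊗-cong ≈-refl (proj₂ (FB.spanning ξ₂₃ (proj₂ (proj₂ e₂₃))) j)) ⟨
          (linear γ ⊗ ξ₁₂ j ⊕ ⊝ linear β ⊗ ξ₁₃ j) ⊕ linear α ⊗ ξ₂₃ j
            ≈⟨ ξ-relation j ⟩
          0ₚ ∎
        f₁₂∈ : ∀ i → member ⟪ linear α , linear β ⟫ (f₁₂ i)
        f₁₂∈ i = regular-sequence α β γ α≉0 α∤β v αv≈0 βv≈0 γv≉0 (f₁₂ i) (⊝ f₂₃ i) (f₁₃ i) (begin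
          linear γ ⊗ f₁₂ i
            ≈⟨ solve 6 (λ a b c x y z → c :* x := ((c :* x :+ (:- b) :* y) :+ a :* z) :+ ((:- z) :* a :+ y :* b)) ≈-refl
                 (linear α) (linear β) (linear γ) (f₁₂ i) (f₁₃ i) (f₂₃ i) ⟩
          ((linear γ ⊗ f₁₂ i ⊕ ⊝ linear β ⊗ f₁₃ i) ⊕ linear α ⊗ f₂₃ i) ⊕ (⊝ f₂₃ i ⊗ linear α ⊕ f₁₃ i ⊗ linear β)
            ≈⟨ ⊕-cong (f-relation i) ≈-refl ⟩
          0ₚ ⊕ (⊝ f₂₃ i ⊗ linear α ⊕ f₁₃ i ⊗ linear β)
            ≈⟨ ⊕-identityˡ _ ⟩
          ⊝ f₂₃ i ⊗ linear α ⊕ f₁₃ i ⊗ linear β ∎)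
        g₁ g₂ : Vector (Poly m) k′
        g₁ i = proj₁ (f₁₂∈ i)
        g₂ i = proj₁ (proj₂ (f₁₂∈ i))
        W₁ W₂ : Vector (Poly m) m
        W₁ = SLin.lincomb g₁ F
        W₂ = SLin.lincomb g₂ F
        x₁ = extension-exists W₁ (LogH-lincomb g₁ F FB.inside)
        x₂ = extension-exists W₂ (LogH-lincomb g₂ F FB.inside)
        y₁ = proj₁ x₁
        y₂ = proj₁ x₂
        ξ₁₂≈ : ∀ j → ξ₁₂ j ≈ₚ linear α ⊗ W₁ j ⊕ linear β ⊗ W₂ j
        ξ₁₂≈ j = ≈-trans (proj₂ (FB.spanning ξ₁₂ (proj₂ (proj₂ e₁₂))) j)
          (≈-trans (SLin.lincomb-congˡ f₁₂ (λ i → linear α ⊗ g₁ i ⊕ linear β ⊗ g₂ i) F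
            (λ i → ≈-trans (proj₂ (proj₂ (f₁₂∈ i))) (⊕-cong (⊗-comm _ _) (⊗-comm _ _))) j)
          (lincomb-combine (linear α) g₁ (linear β) g₂ F j))
        n : Vector (Poly (suc m)) (suc m)
        n j = weaken 1ₚ ⊗ z₁₂ j ⊕ weaken (⊝ 1ₚ) ⊗ ((α ̃) ⊗ y₁ j ⊕ (β ̃) ⊗ y₂ j)
        n-log : Log n
        n-log = log (Restricts-0 {ζ = n} {λ j → 1ₚ ⊗ ξ₁₂ j ⊕ ⊝ 1ₚ ⊗ (linear α ⊗ W₁ j ⊕ linear β ⊗ W₂ j)}
            (Restricts-combine {z₁₂} {λ j → (α ̃) ⊗ y₁ j ⊕ (β ̃) ⊗ y₂ j} 1ₚ (⊝ 1ₚ) (proj₁ (proj₂ e₁₂))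
              (Restricts-combine {y₁} {y₂} (linear α) (linear β) (proj₂ (proj₂ x₁)) (proj₂ (proj₂ x₂))))
            (λ j → ≈-trans (⊕-cong (⊗-cong ≈-refl (ξ₁₂≈ j)) ≈-refl)
              (solve 1 (λ x → :1 :* x :+ (:- :1) :* x := :0) ≈-refl (linear α ⊗ W₁ j ⊕ linear β ⊗ W₂ j))))
          (Log′-⊕ (Log′-⊗ (weaken 1ₚ) (proj₁ (proj₂ s₁₂))) (Log′-⊗ (weaken (⊝ 1ₚ)) (Log′-⊕ (Log′-⊗ (α ̃) (proj₁ (proj₂ x₁))) (Log′-⊗ (β ̃) (proj₁ (proj₂ x₂))))))
        u₁′ u₂′ : Vector (Poly (suc m)) (suc m)
        u₁′ j = u₁ j ⊕ ⊝ var zero ⊗ y₂ j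
        u₂′ j = u₂ j ⊕ var zero ⊗ y₁ j
        x⊗Log′ : ∀ {ζ} → Log′ ζ → Log (λ j → ⊝ var zero ⊗ ζ j)
        x⊗Log′ {ζ} l = Log-resp (λ j → solve 2 (λ x z → (:- :1) :* (x :* z) := (:- x) :* z) ≈-refl (var zero) (ζ j)) (Log-⊗ (⊝ 1ₚ) (Log′⇒Log l))
        division : ∃₂ λ u w → Log u × Log w × (∀ j → u₁′ j ≈ₚ (α ̃) ⊗ u j ⊕ var zero ⊗ w j)
        division = divide α β α≉0 α∤β u₁′ u₂′ n
          (Log-⊕ l₁ (x⊗Log′ (proj₁ (proj₂ x₂)))) (Log-⊕ l₂ (Log′⇒Log (proj₁ (proj₂ x₁)))) n-log λ j → begin
            (β ̃) ⊗ u₁′ j ⊕ ⊝ (α ̃) ⊗ u₂′ j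
              ≈⟨ solve 7 (λ a b x u v y z → b :* (u :+ (:- x) :* z) :+ (:- a) :* (v :+ x :* y) := (b :* u :+ (:- a) :* v) :+ x :* ((:- :1) :* (a :* y :+ b :* z))) ≈-refl
                   (α ̃) (β ̃) (var zero) (u₁ j) (u₂ j) (y₁ j) (y₂ j) ⟩
            ((β ̃) ⊗ u₁ j ⊕ ⊝ (α ̃) ⊗ u₂ j) ⊕ var zero ⊗ (⊝ 1ₚ ⊗ ((α ̃) ⊗ y₁ j ⊕ (β ̃) ⊗ y₂ j))
              ≈⟨ ⊕-cong (proj₂ (proj₂ s₁₂) j) ≈-refl ⟩
            var zero ⊗ z₁₂ j ⊕ var zero ⊗ (⊝ 1ₚ ⊗ ((α ̃) ⊗ y₁ j ⊕ (β ̃) ⊗ y₂ j))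
              ≈⟨ solve 3 (λ x z y → x :* z :+ x :* y := x :* (:1 :* z :+ y)) ≈-refl (var zero) (z₁₂ j) (⊝ 1ₚ ⊗ ((α ̃) ⊗ y₁ j ⊕ (β ̃) ⊗ y₂ j)) ⟩
            var zero ⊗ n j ∎
        u = proj₁ division
        w = proj₁ (proj₂ division)
        u-log = proj₁ (proj₂ (proj₂ division))
        eq = proj₂ (proj₂ (proj₂ (proj₂ division)))

  contains? : ∀ {m} (X : Pred (Point m) (c ⊔ ℓ₁)) (α : Form m) → Dec (X ⊆ hyperplane α)
  contains? X α = em

  -- Localization

  record IsLocalization {m} (A B : Configuration m) (X : Pred (Point m) (c ⊔ ℓ₁)) : Set (c ⊔ ℓ₁) where
    private
      module A = Configuration A
      module B = Configuration B
    field
      included : ∀ b → b ∈ₗ B.hyperplanes → b ∈ₗ A.hyperplanes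
      contains : ∀ b → b ∈ₗ B.hyperplanes → X ⊆ hyperplane (tail b)
      complete : ∀ a → a ∈ₗ A.hyperplanes → X ⊆ hyperplane (tail a) → a ∈ₗ B.hyperplanes

  module Localized {m} {A B : Configuration m} {X : Pred (Point m) (c ⊔ ℓ₁)} (loc : IsLocalization A B X) where
    open IsLocalization loc
    private
      module A = Configurations A
      module B = Configurations B

      q′ q : Poly m
      q′ = product (filter (contains? X) A.traces)
      q = product (filter (¬? ∘ contains? X) A.traces)

      Q̄≈ : A.Q̄ ≈ₚ q′ ⊗ q
      Q̄≈ = product-filter (contains? X) A.traces

      B∣q′ : B.Q̄ ∣ q′
      B∣q′ = product-∣ B.traces B.traces-nonZero B.traces-distinct λ λ′ λ∈ → at-trace λ′ (B.trace-form λ′ λ∈)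
        where
        at-trace : ∀ λ′ → (∃ λ b → b ∈ₗ B.hyperplanes × λ′ ≡ tail b) → linear λ′ ∣ q′
        at-trace λ′ (b , b∈ , ≡.refl) = ∣-trans
          (same⇒∣ {α = tail b} {μ} (B.transversal b b∈) (same-sym {α = μ} {tail b} μ~b))
          (∈⇒∣product (∈-filter⁺ (contains? X) (proj₁ (proj₂ μ-trace)) (λ {x} x∈X → Equivalence.from (μ~b x) (contains b b∈ x∈X))))
          where
          μ-trace = A.form-trace b (included b b∈)
          μ = proj₁ μ-trace
          μ~b = proj₂ (proj₂ μ-trace)

      q′∣B : q′ ∣ B.Q̄
      q′∣B = product-∣ (filter (contains? X) A.traces)
        (All.filter⁺ (contains? X) A.traces-nonZero) (AllPairs.filter⁺ (contains? X) A.traces-distinct) each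
        where
        at-trace : ∀ μ → X ⊆ hyperplane μ → (∃ λ a → a ∈ₗ A.hyperplanes × μ ≡ tail a) → linear μ ∣ B.Q̄
        at-trace μ X⊆μ (a , a∈ , ≡.refl) = ∣-trans
          (same⇒∣ {α = tail a} {λ′} (A.transversal a a∈) (same-sym {α = λ′} {tail a} (proj₂ (proj₂ λ-trace))))
          (∈⇒∣product (proj₁ (proj₂ λ-trace)))
          where
          λ-trace = B.form-trace a (complete a a∈ X⊆μ)
          λ′ = proj₁ λ-trace
        each : ∀ μ → μ ∈ₗ filter (contains? X) A.traces → linear μ ∣ B.Q̄
        each μ μ∈ = at-trace μ (proj₂ (∈-filter⁻ (contains? X) {xs = A.traces} μ∈))
          (A.trace-form μ (proj₁ (∈-filter⁻ (contains? X) μ∈)))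

      q′≉0 : ¬ q′ ≈ₚ 0ₚ
      q′≉0 = product-nonZero (All.filter⁺ (contains? X) A.traces-nonZero)

    outside : List (Form (suc m))
    outside = filter (¬? ∘ contains? X ∘ tail) A.hyperplanes

    Log-included : ∀ {η} → A.Log η → B.Log η
    Log-included (A.log h l) = B.log h (λ b b∈ → l b (included b b∈))

    Log-extended : ∀ {η} → B.Log η → A.Log (λ j → product outside ⊗ η j)
    Log-extended {η} (B.log h l) = A.log (λ j → ∣-⊗ˡ (product outside) (h j)) λ a a∈ → at-a a a∈ em
      where
      at-a : ∀ a → a ∈ₗ A.hyperplanes → Dec (X ⊆ hyperplane (tail a)) → Parallel a (λ j → product outside ⊗ η j)
      at-a a a∈ (yes X⊆a) = parallel-⊗ a (product outside) (l a (complete a a∈ X⊆a))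
      at-a a a∈ (no  X⊈a) = parallel-∣ a (λ j → ∣-⊗ʳ (η j) (∈⇒∣product (∈-filter⁺ (¬? ∘ contains? X ∘ tail) a∈ X⊈a)))

    localize : ∀ {r} → A.InResidueIdeal r → B.InResidueIdeal (product (filter (¬? ∘ contains? X) A.traces) ⊗ r)
    localize {r} (A.in-residue-ideal η l e) = Ideal.resp B.J (cancelˡ q′ q′≉0 (begin
        q′ ⊗ (quotient q′∣B ⊗ r′)    ≈⟨ ⊗-assoc _ _ _ ⟨
        q′ ⊗ quotient q′∣B ⊗ r′      ≈⟨ ⊗-cong (equality q′∣B) ≈-refl ⟨
        B.Q̄ ⊗ r′                     ≈⟨ equality (B.residue-exists (Log-included l)) ⟨
        bar (η zero)                 ≈⟨ e ⟨
        A.Q̄ ⊗ r                      ≈⟨ ⊗-cong Q̄≈ ≈-refl ⟩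
        q′ ⊗ q ⊗ r                   ≈⟨ ⊗-assoc _ _ _ ⟩
        q′ ⊗ (q ⊗ r)                 ∎))
      (Ideal.*-closed B.J (quotient q′∣B) (B.residue∈J (Log-included l)))
      where
      r′ = quotient (B.residue-exists (Log-included l))

    globalize : ∀ {r} → B.InResidueIdeal r → A.InResidueIdeal (product (filter (¬? ∘ contains? X) A.tails) ⊗ r)
    globalize {r} (B.in-residue-ideal η l e) = Ideal.resp A.J (cancelˡ B.Q̄ B.Q̄≉0 (begin
        B.Q̄ ⊗ (quotient B∣q′ ⊗ q ⊗ r′)
          ≈⟨ solve 4 (λ b w q r → b :* (w :* q :* r) := b :* w :* q :* r) ≈-refl B.Q̄ (quotient B∣q′) q r′ ⟩
        B.Q̄ ⊗ quotient B∣q′ ⊗ q ⊗ r′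
          ≈⟨ ⊗-cong (≈-trans Q̄≈ (⊗-cong (equality B∣q′) ≈-refl)) ≈-refl ⟨
        A.Q̄ ⊗ r′
          ≈⟨ equality (A.residue-exists (Log-extended l)) ⟨
        bar (product outside) ⊗ bar (η zero)
          ≈⟨ ⊗-cong (bar-product-filter (¬? ∘ contains? X) A.hyperplanes) (≈-sym e) ⟩
        product (filter (¬? ∘ contains? X) A.tails) ⊗ (B.Q̄ ⊗ r)
          ≈⟨ solve 3 (λ o b r → o :* (b :* r) := b :* (o :* r)) ≈-refl (product (filter (¬? ∘ contains? X) A.tails)) B.Q̄ r ⟩
        B.Q̄ ⊗ (product (filter (¬? ∘ contains? X) A.tails) ⊗ r) ∎))
      (Ideal.*-closed A.J (quotient B∣q′ ⊗ q) (A.residue∈J (Log-extended l)))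
      where
      r′ = quotient (A.residue-exists (Log-extended l))

  ext : ∀ {n m} → (Fin n → Poly m) → Fin (suc n) → Poly (suc m)
  ext σ = var zero ◂ (weaken ∘ σ)

  ext-weaken : ∀ {n m} (σ : Fin n → Poly m) f → substitute (ext σ) (weaken f) ≈ₚ weaken (substitute σ f)
  ext-weaken σ f = ≈-trans (substitute-substitute (ext σ) (var ∘ suc) f) (≈-sym (substitute-substitute (var ∘ suc) σ f))

  module _ {n m} (σ : Fin n → Poly m) where
    open PowerSeries (S m) using () renaming (_*ˢ_ to _*ᵐ_; *ˢ-cong to *ᵐ-cong; const to constᵐ)
    open PowerSeries (S n) using () renaming (_*ˢ_ to _*ⁿ_; const to constⁿ; tail to tailⁿ)

    substitute-*ˢ : ∀ p q d → substitute σ ((p *ⁿ q) d) ≈ₚ ((substitute σ ∘ p) *ᵐ (substitute σ ∘ q)) d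
    substitute-*ˢ p q zero    = ≈-refl
    substitute-*ˢ p q (suc d) = ⊕-cong ≈-refl (substitute-*ˢ (tailⁿ p) q d)

    private
      substitute-const : ∀ f d → substitute σ (constⁿ f d) ≈ₚ constᵐ (substitute σ f) d
      substitute-const f zero    = ≈-refl
      substitute-const f (suc d) = ≈-refl

    coeff-ext : ∀ d f → coeff d (substitute (ext σ) f) ≈ₚ substitute σ (coeff d f)
    coeff-ext d (con a) = ≈-sym (substitute-const (con a) d)
    coeff-ext zero    (var zero) = ≈-refl
    coeff-ext (suc d) (var zero) = ≈-sym (substitute-const 1ₚ d)
    coeff-ext d (var (suc i)) = ≈-trans (series-weaken (σ i) d) (≈-sym (substitute-const (var i) d))
    coeff-ext d (f ⊕ g) = ⊕-cong (coeff-ext d f) (coeff-ext d g)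
    coeff-ext d (f ⊗ g) = ≈-trans (*ᵐ-cong (λ i → coeff-ext i f) (λ i → coeff-ext i g) d) (≈-sym (substitute-*ˢ (series f) (series g) d))
    coeff-ext d (⊝ f) = ⊝-cong (coeff-ext d f)

  module _ {m} (B : Configuration m) where
    open Configurations B

    record StableOperator (F : Poly m → Poly m) : Set (c ⊔ ℓ₁) where
      field
        F₁ F₀   : Poly (suc m) → Poly (suc m)
        F̄₁      : Poly m → Poly m
        F₁-cong : ∀ {f g} → f ≈ₚ g → F₁ f ≈ₚ F₁ g
        F₁-⊕    : ∀ f g → F₁ (f ⊕ g) ≈ₚ F₁ f ⊕ F₁ g
        F₁-con  : ∀ a f → F₁ (con a ⊗ f) ≈ₚ con a ⊗ F₁ f
        F₁-H    : ∀ f → F₁ (var zero ⊗ f) ≈ₚ var zero ⊗ F₀ f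
        F₁-a    : ∀ a → a ∈ₗ hyperplanes → ∀ f → F₁ (linear a ⊗ f) ≈ₚ linear a ⊗ F₀ f
        F̄₁-cong : ∀ {f g} → f ≈ₚ g → F̄₁ f ≈ₚ F̄₁ g
        F₁-bar  : ∀ f → bar (F₁ f) ≈ₚ F̄₁ (bar f)
        F̄₁-Q̄    : ∀ f → F̄₁ (Q̄ ⊗ f) ≈ₚ Q̄ ⊗ F f

      stable : ∀ {r} → InResidueIdeal r → InResidueIdeal (F r)
      stable {r} (in-residue-ideal η (log h l) e) = in-residue-ideal (λ j → F₁ (η j))
        (log (λ j → F₀ (quotient (h j)) , ≈-trans (F₁-cong (equality (h j))) (F₁-H _)) (λ a a∈ → at-a a a∈ (l a a∈)))
        (≈-trans (≈-sym (F̄₁-Q̄ r)) (≈-trans (F̄₁-cong e) (≈-sym (F₁-bar (η zero)))))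
        where
        at-a : ∀ a → a ∈ₗ hyperplanes → Parallel a η → Parallel a (λ j → F₁ (η j))
        at-a a a∈ (parallel k z eq) = parallel (F₁ k) (λ j → F₀ (z j)) λ j → ≈-trans (F₁-cong (≈-trans (eq j) (⊕-cong (⊗-comm _ _) ≈-refl)))
          (≈-trans (F₁-⊕ _ _) (⊕-cong (≈-trans (F₁-con (a j) k) (⊗-comm _ _)) (F₁-a a a∈ (z j))))

  -- For a point v with α(v) = 1: f is expanded in powers of α, with
  -- coefficients that are constant in the direction v.
  module Direction {n} (α : Form n) (v : Point n) (αv≈1 : α · v K.≈ K.1#) where
    shift : Fin n → Poly (suc n)
    shift i = weaken (var i) ⊕ con (v i) ⊗ (var zero ⊕ ⊝ weaken (linear α))

    component : ℕ → Poly n → Poly n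
    component d f = coeff d (substitute shift f)

    component-cong : ∀ d {f g} → f ≈ₚ g → component d f ≈ₚ component d g
    component-cong d e = coeff-cong d (substitute-cong shift e)

    shift-linear : ∀ β → substitute shift (linear β) ≈ₚ weaken (linear β) ⊕ con (β · v) ⊗ (var zero ⊕ ⊝ weaken (linear α))
    shift-linear β = begin
      substitute shift (linear β)
        ≈⟨ substitute-linear shift β ⟩
      sum (λ i → con (β i) ⊗ (weaken (var i) ⊕ con (v i) ⊗ t))
        ≈⟨ SLin.sum-cong (λ i → con (β i) ⊗ (weaken (var i) ⊕ con (v i) ⊗ t)) (λ i → con (β i) ⊗ weaken (var i) ⊕ con (β i K.* v i) ⊗ t) (λ i → ≈-trans
             (solve 4 (λ b x v t → b :* (x :+ v :* t) := b :* x :+ b :* v :* t) ≈-refl (con (β i)) (weaken (var i)) (con (v i)) t)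
             (⊕-cong ≈-refl (⊗-cong (≈-sym (con-* _ _)) ≈-refl))) ⟩
      sum (λ i → con (β i) ⊗ weaken (var i) ⊕ con (β i K.* v i) ⊗ t)
        ≈⟨ SLin.∑-distrib-+ (λ i → con (β i) ⊗ weaken (var i)) (λ i → con (β i K.* v i) ⊗ t) ⟩
      sum (λ i → con (β i) ⊗ weaken (var i)) ⊕ sum (λ i → con (β i K.* v i) ⊗ t)
        ≈⟨ ⊕-cong (≈-sym (substitute-linear (var ∘ suc) β)) (≈-trans (≈-sym (SLin.*-distribʳ-sum t (λ i → con (β i K.* v i))))
             (⊗-cong (≈-sym (con-sum (λ i → β i K.* v i))) ≈-refl)) ⟩
      weaken (linear β) ⊕ con (β · v) ⊗ t ∎
      where
      t = var zero ⊕ ⊝ weaken (linear α)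

    shift-constant : ∀ {β} → β · v K.≈ K.0# → substitute shift (linear β) ≈ₚ weaken (linear β)
    shift-constant {β} βv≈0 = ≈-trans (shift-linear β) (≈-trans (⊕-cong ≈-refl (≈-trans (⊗-cong (con-cong βv≈0) ≈-refl) (SR.zeroˡ _))) (SR.+-identityʳ _))

    shift-α : substitute shift (linear α) ≈ₚ var zero
    shift-α = ≈-trans (shift-linear α) (≈-trans (⊕-cong ≈-refl (≈-trans (⊗-cong (con-cong αv≈1) ≈-refl) (⊗-identityˡ _)))
      (solve 2 (λ a x → a :+ (x :- a) := x) ≈-refl (weaken (linear α)) (var zero)))

    component-constant : ∀ {g} d f → substitute shift g ≈ₚ weaken g → component d (g ⊗ f) ≈ₚ g ⊗ component d f
    component-constant {g} d f e = ≈-trans (coeff-cong d (⊗-cong e (≈-refl {f = substitute shift f}))) (coeff-weaken-⊗ d g (substitute shift f))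

    component-linear : ∀ {β} d f → β · v K.≈ K.0# → component d (linear β ⊗ f) ≈ₚ linear β ⊗ component d f
    component-linear {β} d f βv≈0 = component-constant d f (shift-constant {β} βv≈0)

    component-product : ∀ xs d f → (∀ x → x ∈ₗ xs → x · v K.≈ K.0#) → component d (product xs ⊗ f) ≈ₚ product xs ⊗ component d f
    component-product []       d f _   = ≈-trans (component-cong d {1ₚ ⊗ f} {f} (⊗-identityˡ f)) (≈-sym (⊗-identityˡ _))
    component-product (x ∷ xs) d f xsv = ≈-trans (component-cong d (⊗-assoc (linear x) (product xs) f))
      (≈-trans (component-linear {x} d (product xs ⊗ f) (xsv x (here ≡.refl)))
      (≈-trans (⊗-cong (≈-refl {f = linear x}) (component-product xs d f (λ y y∈ → xsv y (there y∈)))) (≈-sym (⊗-assoc _ _ _))))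

    component-α : ∀ d f → component (suc d) (linear α ⊗ f) ≈ₚ component d f
    component-α d f = ≈-trans (coeff-cong (suc d) (⊗-cong shift-α (≈-refl {f = substitute shift f}))) (coeff-suc-⊗ d (substitute shift f))

    components-in-ideal : (I : Ideal (S n) (c ⊔ ℓ₁)) → ∀ f → (∀ d → member I (component d f)) → member I f
    components-in-ideal I f p = Ideal.resp I (≈-trans (substitute-substitute (linear α ◂ var) shift f)
        (≈-trans (substitute-≈ at-var f) (substitute-var f)))
      (coeffs-in-ideal I (linear α) (substitute shift f) p)
      where
      at-var : ∀ i → shift i [ linear α ] ≈ₚ var i
      at-var i = ≈-trans (⊕-cong ≈-refl (⊗-cong ≈-refl (⊕-cong ≈-refl (⊝-cong (weaken-[] (linear α) (linear α))))))
        (solve 3 (λ x v a → x :+ v :* (a :- a) := x) ≈-refl (var i) (con (v i)) (linear α))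

  module _ {m} (α : Form m) (v : Point m) (αv≈1 : α · v K.≈ K.1#) where
    private
      α̃ : Form (suc m)
      α̃ = K.0# ◂ α
      ṽ : Point (suc m)
      ṽ = K.0# ◂ v
      α̃ṽ≈1 : α̃ · ṽ K.≈ K.1#
      α̃ṽ≈1 = K.trans (K.+-cong (K.zeroˡ _) αv≈1) (K.+-identityˡ _)
      module D = Direction α v αv≈1
      module D̃ = Direction α̃ ṽ α̃ṽ≈1

      ·ṽ : ∀ (a : Form (suc m)) → tail a · v K.≈ K.0# → a · ṽ K.≈ K.0#
      ·ṽ a e = K.trans (K.+-cong (K.zeroʳ _) e) (K.+-identityˡ _)

    bar-component : ∀ d f → bar (D̃.component d f) ≈ₚ D.component d (bar f)
    bar-component d f = ≈-trans (≈-sym (coeff-ext (0ₚ ◂ var) d (substitute D̃.shift f)))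
      (coeff-cong d (substitute-agree (ext (0ₚ ◂ var)) D̃.shift D.shift (0ₚ ◂ var) at-var f))
      where
      at-var : ∀ i → substitute (ext (0ₚ ◂ var)) (D̃.shift i) ≈ₚ substitute D.shift ((0ₚ ◂ var) i)
      at-var zero    = ≈-trans (⊕-cong ≈-refl (SR.zeroˡ _)) (⊕-identityˡ _)
      at-var (suc i) = ⊕-cong ≈-refl (⊗-cong ≈-refl (⊕-cong ≈-refl (⊝-cong
        (≈-trans (ext-weaken (0ₚ ◂ var) (linear α̃)) (weaken-cong (bar-linear α̃))))))

    component-stable : (B : Configuration m) → (∀ a → a ∈ₗ Configuration.hyperplanes B → tail a · v K.≈ K.0#) →
                       ∀ d → StableOperator B (D.component d)
    component-stable B B-v d = record
      { F₁ = D̃.component d ; F₀ = D̃.component d ; F̄₁ = D.component d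
      ; F₁-cong = D̃.component-cong d
      ; F₁-⊕ = λ f g → ≈-refl
      ; F₁-con = λ a f → coeff-con-⊗ d a (substitute D̃.shift f)
      ; F₁-H = λ f → ≈-trans (D̃.component-cong d {var zero ⊗ f} (⊗-cong (≈-sym (linear-δ zero)) ≈-refl))
          (≈-trans (D̃.component-linear {δ zero} d f (·ṽ (δ zero) (KLin.sum-0 (λ i → K.0# K.* v i) (λ i → K.zeroˡ _))))
            (⊗-cong (linear-δ zero) (≈-refl {f = D̃.component d f})))
      ; F₁-a = λ a a∈ f → D̃.component-linear {a} d f (·ṽ a (B-v a a∈))
      ; F̄₁-cong = D.component-cong d
      ; F₁-bar = bar-component d
      ; F̄₁-Q̄ = λ f → D.component-product (Configuration.traces B) d f
          (λ λ′ λ∈ → at-trace λ′ (Configuration.trace-form B λ′ λ∈))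
      }
      where
      at-trace : ∀ λ′ → (∃ λ b → b ∈ₗ Configuration.hyperplanes B × λ′ ≡ tail b) → λ′ · v K.≈ K.0#
      at-trace λ′ (b , b∈ , ≡.refl) = B-v b b∈

  saturated : ∀ {m} (B : Configuration m) α v → ¬ α · v K.≈ K.0# →
              (∀ a → a ∈ₗ Configuration.hyperplanes B → tail a · v K.≈ K.0#) →
              ∀ r → Configurations.InResidueIdeal B (linear α ⊗ r) → Configurations.InResidueIdeal B r
  saturated {m} B α v αv≉0 B-v r αr∈J = D.components-in-ideal J r λ d → Ideal.resp J (D.component-α d r)
    (StableOperator.stable (component-stable α w αw≈1 B B-w (suc d)) αr∈J)
    where
    open Configurations B using (J)
    s = proj₁ (inverse αv≉0)
    w : Point m
    w i = s K.* v i K.+ K.0# K.* v i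
    ·w : ∀ β → β · w K.≈ s K.* (β · v)
    ·w β = K.trans (·-combineʳ β s v K.0# v) (K.trans (K.+-congˡ (K.zeroˡ _)) (K.+-identityʳ _))
    αw≈1 : α · w K.≈ K.1#
    αw≈1 = K.trans (·w α) (proj₂ (inverse αv≉0))
    B-w : ∀ a → a ∈ₗ Configuration.hyperplanes B → tail a · w K.≈ K.0#
    B-w a a∈ = K.trans (·w (tail a)) (K.trans (K.*-congˡ (B-v a a∈)) (K.zeroʳ _))
    module D = Direction α w αw≈1

  module _ {n : ℕ} where
    homogenize : Fin n → Poly (suc n)
    homogenize i = var zero ⊗ var (suc i)

    degree-part : ℕ → Poly n → Poly n
    degree-part d f = coeff d (substitute homogenize f)

    degree-part-cong : ∀ d {f g} → f ≈ₚ g → degree-part d f ≈ₚ degree-part d g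
    degree-part-cong d e = coeff-cong d (substitute-cong homogenize e)

    homogenize-linear : ∀ α → substitute homogenize (linear α) ≈ₚ var zero ⊗ weaken (linear α)
    homogenize-linear α = begin
      substitute homogenize (linear α)
        ≈⟨ substitute-linear homogenize α ⟩
      sum (λ i → con (α i) ⊗ (var zero ⊗ var (suc i)))
        ≈⟨ SLin.sum-cong (λ i → con (α i) ⊗ (var zero ⊗ var (suc i))) (λ i → var zero ⊗ (con (α i) ⊗ var (suc i)))
             (λ i → solve 3 (λ a x y → a :* (x :* y) := x :* (a :* y)) ≈-refl (con (α i)) (var zero) (var (suc i))) ⟩
      sum (λ i → var zero ⊗ (con (α i) ⊗ var (suc i)))
        ≈⟨ SLin.*-distribˡ-sum (var zero) (λ i → con (α i) ⊗ var (suc i)) ⟨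
      var zero ⊗ sum (λ i → con (α i) ⊗ var (suc i))
        ≈⟨ ⊗-cong ≈-refl (substitute-linear (var ∘ suc) α) ⟨
      var zero ⊗ weaken (linear α) ∎

    -- The part of degree d − 1.
    degree-part-pred : ℕ → Poly n → Poly n
    degree-part-pred zero    f = 0ₚ
    degree-part-pred (suc d) f = degree-part d f

    degree-part-linear : ∀ d α f → degree-part d (linear α ⊗ f) ≈ₚ linear α ⊗ degree-part-pred d f
    degree-part-linear d α f = ≈-trans (coeff-cong d (≈-trans (⊗-cong (homogenize-linear α) (≈-refl {f = substitute homogenize f})) (⊗-assoc _ _ _))) (by-degree d)
      where
      by-degree : ∀ d → coeff d (var zero ⊗ (weaken (linear α) ⊗ substitute homogenize f)) ≈ₚ linear α ⊗ degree-part-pred d f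
      by-degree zero    = ≈-trans (coeff-zero-⊗ (weaken (linear α) ⊗ substitute homogenize f)) (≈-sym (SR.zeroʳ _))
      by-degree (suc d) = ≈-trans (coeff-suc-⊗ d (weaken (linear α) ⊗ substitute homogenize f)) (coeff-weaken-⊗ d (linear α) (substitute homogenize f))

    degree-part-product : ∀ xs d f → degree-part (length xs ℕ.+ d) (product xs ⊗ f) ≈ₚ product xs ⊗ degree-part d f
    degree-part-product []       d f = ≈-trans (degree-part-cong d {1ₚ ⊗ f} {f} (⊗-identityˡ f)) (≈-sym (⊗-identityˡ _))
    degree-part-product (x ∷ xs) d f = ≈-trans (degree-part-cong (suc (length xs ℕ.+ d)) (⊗-assoc (linear x) (product xs) f))
      (≈-trans (degree-part-linear (suc (length xs ℕ.+ d)) x (product xs ⊗ f))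
      (≈-trans (⊗-cong (≈-refl {f = linear x}) (degree-part-product xs d f)) (≈-sym (⊗-assoc _ _ _))))

    degree-parts-in-ideal : (I : Ideal (S n) (c ⊔ ℓ₁)) → ∀ f → (∀ d → member I (degree-part d f)) → member I f
    degree-parts-in-ideal I f p = Ideal.resp I (≈-trans (substitute-substitute (1ₚ ◂ var) homogenize f)
        (≈-trans (substitute-≈ (λ i → ⊗-identityˡ _) f) (substitute-var f)))
      (coeffs-in-ideal I 1ₚ (substitute homogenize f) p)

  degree-part-substitute : ∀ {n m} (σ : Fin n → Poly m) → (∀ i → substitute homogenize (σ i) ≈ₚ var zero ⊗ weaken (σ i)) →
                           ∀ d f → degree-part d (substitute σ f) ≈ₚ substitute σ (degree-part d f)
  degree-part-substitute σ e d f = ≈-trans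
    (coeff-cong d (substitute-agree homogenize σ (ext σ) homogenize e f)) (coeff-ext σ d (substitute homogenize f))

  degree-part-stable : ∀ {m} (B : Configuration m) d → StableOperator B (degree-part d)
  degree-part-stable {m} B d = record
    { F₁ = degree-part e ; F₀ = degree-part-pred e ; F̄₁ = degree-part e
    ; F₁-cong = degree-part-cong e
    ; F₁-⊕ = λ f g → ≈-refl
    ; F₁-con = λ a f → coeff-con-⊗ e a (substitute homogenize f)
    ; F₁-H = λ f → ≈-trans (degree-part-cong e {var zero ⊗ f} (⊗-cong (≈-sym (linear-δ zero)) ≈-refl))
        (≈-trans (degree-part-linear e (δ zero) f) (⊗-cong (linear-δ zero) (≈-refl {f = degree-part-pred e f})))
    ; F₁-a = λ a a∈ f → degree-part-linear e a f
    ; F̄₁-cong = degree-part-cong e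
    ; F₁-bar = λ f → ≈-sym (degree-part-substitute (0ₚ ◂ var) (λ { zero → ≈-sym (SR.zeroʳ _) ; (suc i) → ≈-refl }) e f)
    ; F̄₁-Q̄ = degree-part-product traces d
    }
    where
    open Configuration B
    e = length traces ℕ.+ d

  module _ {m} {A B : Configuration m} {X : Pred (Point m) (c ⊔ ℓ₁)} (loc : IsLocalization A B X) where
    private
      module A = Configurations A
      module B = Configurations B

    J⊆localization : ∀ r → A.InResidueIdeal r → B.InResidueIdeal r
    J⊆localization r r∈J = cancel-all (filter (¬? ∘ contains? X) A.traces)
      (λ y y∈ → proj₂ (∈-filter⁻ (¬? ∘ contains? X) {xs = A.traces} y∈)) (Localized.localize loc r∈J)
      where
      cancel : ∀ y → ¬ (X ⊆ hyperplane y) → ∀ f → B.InResidueIdeal (linear y ⊗ f) → B.InResidueIdeal f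
      cancel y X⊈y f yf∈J = dne λ f∉J → X⊈y λ {v} v∈X → dne λ yv≉0 →
        f∉J (saturated B y v yv≉0 (λ a a∈ → IsLocalization.contains loc a a∈ v∈X) f yf∈J)
      cancel-all : ∀ ys → (∀ y → y ∈ₗ ys → ¬ (X ⊆ hyperplane y)) → B.InResidueIdeal (product ys ⊗ r) → B.InResidueIdeal r
      cancel-all []       _  p = Ideal.resp B.J (⊗-identityˡ r) p
      cancel-all (y ∷ ys) ne p = cancel-all ys (λ z z∈ → ne z (there z∈))
        (cancel y (ne y (here ≡.refl)) (product ys ⊗ r) (Ideal.resp B.J (⊗-assoc _ _ _) p))

  colon : ∀ {m} → Ideal (S m) (c ⊔ ℓ₁) → Poly m → Ideal (S m) (c ⊔ ℓ₁)
  colon I r = record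
    { member   = λ s → member I (s ⊗ r)
    ; resp     = λ e → Ideal.resp I (⊗-cong e ≈-refl)
    ; 0-closed = Ideal.resp I (≈-sym (SR.zeroˡ r)) (Ideal.0-closed I)
    ; +-closed = λ p q → Ideal.resp I (≈-sym (SR.distribʳ r _ _)) (Ideal.+-closed I p q)
    ; *-closed = λ s p → Ideal.resp I (≈-sym (⊗-assoc _ _ _)) (Ideal.*-closed I s p)
    }

  module _ {m} (A : Configuration m) {k} (G : Vector (Vector (Poly (suc m)) (suc m)) k)
           (G-basis : SLin.IsBasis (Configurations.Log A) G)
           {k′} (F : Vector (Vector (Poly m) m) k′) (F-basis : SLin.IsBasis (Configurations.LogH A) F) where
    open Configurations A
    open ResidueElements A
    open FreeConfigurations.Koszul A G G-basis F F-basis using (three-forms)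

    private
      Codim2 : Form m → Form m → Poly m → Set _
      Codim2 α β r = ∃ λ X → ∃ λ B → IsLocalization A B X ×
        (∀ v → v ∈ X → α · v K.≈ K.0# × β · v K.≈ K.0#) × Configurations.InResidueIdeal B r

    -- J is unmixed of codimension two: a zero divisor modulo J would be
    -- annihilated by two traces α and β, and by a third one not containing α = β = 0.
    localizations⇒J : ∀ r → (∀ a b → a ∈ₗ hyperplanes → b ∈ₗ hyperplanes → ¬ SameHyperplane (tail a) (tail b) →
                             Codim2 (tail a) (tail b) r) → InResidueIdeal r
    localizations⇒J r local = dne λ r∉J → first (annihilators (colon J r) (λ 1r∈J → r∉J (Ideal.resp J (⊗-identityˡ r) 1r∈J)) tails)
      where
      D = colon J r

      multiple∈D : ∀ {f} → InResidueIdeal f → member D f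
      multiple∈D {f} f∈J = Ideal.resp J (⊗-comm r f) (Ideal.*-closed J r f∈J)

      first : (∃ λ s → ¬ member D s × (∀ ys → (∀ y → y ∈ₗ ys → y ∈ₗ tails) → member D (product ys) →
               ∃ λ y → y ∈ₗ ys × member D (linear y ⊗ s))) → ⊥
      first (s , s∉D , killed) = second (killed tails (λ y y∈ → y∈) (multiple∈D (Ideal.resp J (bar-product hyperplanes) P̄∈J)))
        where
        third : ∀ a b → a ∈ₗ hyperplanes → b ∈ₗ hyperplanes → ¬ SameHyperplane (tail a) (tail b) →
                member D (linear (tail a) ⊗ s) → member D (linear (tail b) ⊗ s) → Codim2 (tail a) (tail b) r → ⊥
        third a b a∈ b∈ a≁b as∈D bs∈D (X , B , loc , X⊆ , r∈J_X) = fourth (killed (filter (¬? ∘ contains? X) tails)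
            (λ y y∈ → proj₁ (∈-filter⁻ (¬? ∘ contains? X) y∈)) (Localized.globalize loc r∈J_X))
          where
          fourth : (∃ λ γ → γ ∈ₗ filter (¬? ∘ contains? X) tails × member D (linear γ ⊗ s)) → ⊥
          fourth (γ , γ∈ , γs∈D) = proj₂ (∈-filter⁻ (¬? ∘ contains? X) {xs = tails} γ∈) λ {v} v∈X → dne λ γv≉0 →
            s∉D (three-forms (tail a) (tail b) γ (transversal a a∈)
              (λ a∣b → a≁b (∣⇒same {α = tail a} {tail b} (transversal a a∈) (transversal b b∈) a∣b))
              v (proj₁ (X⊆ v v∈X)) (proj₂ (X⊆ v v∈X)) γv≉0 (s ⊗ r)
              (Ideal.resp J (⊗-assoc _ _ _) as∈D) (Ideal.resp J (⊗-assoc _ _ _) bs∈D) (Ideal.resp J (⊗-assoc _ _ _) γs∈D))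

        second : (∃ λ α → α ∈ₗ tails × member D (linear α ⊗ s)) → ⊥
        second (α , α∈ , αs∈D) = with-a (∈-map⁻ tail α∈) αs∈D
          where
          with-b : ∀ a → a ∈ₗ hyperplanes → member D (linear (tail a) ⊗ s) → ∀ β → ¬ SameHyperplane (tail a) β →
                   member D (linear β ⊗ s) → (∃ λ b → b ∈ₗ hyperplanes × β ≡ tail b) → ⊥
          with-b a a∈ as∈D .(tail b) a≁b bs∈D (b , b∈ , ≡.refl) = third a b a∈ b∈ a≁b as∈D bs∈D (local a b a∈ b∈ a≁b)
          others : ∀ a → List (Form m)
          others a = filter (¬? ∘ sameHyperplane? (tail a)) tails
          next : ∀ a → a ∈ₗ hyperplanes → member D (linear (tail a) ⊗ s) → (∃ λ β → β ∈ₗ others a × member D (linear β ⊗ s)) → ⊥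
          next a a∈ as∈D (β , β∈ , βs∈D) = with-b a a∈ as∈D β
            (proj₂ (∈-filter⁻ (¬? ∘ sameHyperplane? (tail a)) {xs = tails} β∈)) βs∈D
            (∈-map⁻ tail (proj₁ (∈-filter⁻ (¬? ∘ sameHyperplane? (tail a)) β∈)))
          with-a : (∃ λ a → a ∈ₗ hyperplanes × α ≡ tail a) → member D (linear α ⊗ s) → ⊥
          with-a (a , a∈ , ≡.refl) as∈D = next a a∈ as∈D (killed (others a)
            (λ y y∈ → proj₁ (∈-filter⁻ (¬? ∘ sameHyperplane? (tail a)) y∈)) (multiple∈D (pair∈J a a∈)))

  module Flattening {n} (α : Form n) (v : Point n) where
    flatten : Fin n → Poly n
    flatten i = var i ⊕ ⊝ (con (v i) ⊗ linear α)

    flatten-linear : ∀ β → substitute flatten (linear β) ≈ₚ linear β ⊕ ⊝ (con (β · v) ⊗ linear α)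
    flatten-linear β = begin
      substitute flatten (linear β)
        ≈⟨ substitute-linear flatten β ⟩
      sum (λ i → con (β i) ⊗ (var i ⊕ ⊝ (con (v i) ⊗ linear α)))
        ≈⟨ SLin.sum-cong (λ i → con (β i) ⊗ flatten i) (λ i → con (β i) ⊗ var i ⊕ con (β i K.* v i) ⊗ ⊝ linear α) (λ i → ≈-trans
             (solve 4 (λ b x v a → b :* (x :- v :* a) := b :* x :+ b :* v :* (:- a)) ≈-refl (con (β i)) (var i) (con (v i)) (linear α))
             (⊕-cong ≈-refl (⊗-cong (≈-sym (con-* _ _)) ≈-refl))) ⟩
      sum (λ i → con (β i) ⊗ var i ⊕ con (β i K.* v i) ⊗ ⊝ linear α)
        ≈⟨ SLin.∑-distrib-+ (λ i → con (β i) ⊗ var i) (λ i → con (β i K.* v i) ⊗ ⊝ linear α) ⟩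
      linear β ⊕ sum (λ i → con (β i K.* v i) ⊗ ⊝ linear α)
        ≈⟨ ⊕-cong ≈-refl (≈-trans (≈-sym (SLin.*-distribʳ-sum (⊝ linear α) (λ i → con (β i K.* v i))))
             (⊗-cong (≈-sym (con-sum (λ i → β i K.* v i))) ≈-refl)) ⟩
      linear β ⊕ con (β · v) ⊗ ⊝ linear α
        ≈⟨ solve 3 (λ b c a → b :+ c :* (:- a) := b :- c :* a) ≈-refl (linear β) (con (β · v)) (linear α) ⟩
      linear β ⊕ ⊝ (con (β · v) ⊗ linear α) ∎

    flatten-fixes : ∀ β → β · v K.≈ K.0# → substitute flatten (linear β) ≈ₚ linear β
    flatten-fixes β βv≈0 = ≈-trans (flatten-linear β) (≈-trans (⊕-cong ≈-refl (⊝-cong (⊗-cong (con-cong βv≈0) ≈-refl)))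
      (solve 2 (λ b a → b :- :0 :* a := b) ≈-refl (linear β) (linear α)))

    Flat : Poly n → Set (c ⊔ ℓ₁)
    Flat f = substitute flatten f ≈ₚ f

    degree-part-flat : ∀ d {f} → Flat f → Flat (degree-part d f)
    degree-part-flat d {f} flat = ≈-trans (≈-sym (degree-part-substitute flatten
        (λ i → ≈-trans (⊕-cong ≈-refl (⊝-cong (⊗-cong ≈-refl (homogenize-linear α))))
          (solve 4 (λ x y v a → x :* y :- v :* (x :* a) := x :* (y :- v :* a)) ≈-refl (var zero) (var (suc i)) (con (v i)) (weaken (linear α)))) d f))
      (degree-part-cong d flat)

    module _ (αv≈1 : α · v K.≈ K.1#) where
      open Direction α v αv≈1

      private
        flatten-α : substitute flatten (linear α) ≈ₚ 0ₚ
        flatten-α = ≈-trans (flatten-linear α) (≈-trans (⊕-cong ≈-refl (⊝-cong (⊗-cong (con-cong αv≈1) ≈-refl)))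
          (solve 1 (λ a → a :- :1 :* a := :0) ≈-refl (linear α)))

      component-flat : ∀ d f → Flat (component d f)
      component-flat d f = ≈-trans (≈-sym (coeff-ext flatten d (substitute shift f))) (coeff-cong d
        (≈-trans (substitute-substitute (ext flatten) shift f) (substitute-≈ at-var f)))
        where
        at-var : ∀ i → substitute (ext flatten) (shift i) ≈ₚ shift i
        at-var i = ≈-trans (⊕-cong ≈-refl (⊗-cong ≈-refl (⊕-cong ≈-refl (⊝-cong (≈-trans (ext-weaken flatten (linear α)) (weaken-cong flatten-α))))))
          (solve 4 (λ x v a t → (x :- v :* a) :+ v :* (t :- :0) := x :+ v :* (t :- a)) ≈-refl (var (suc i)) (con (v i)) (weaken (linear α)) (var zero))

      flat⇒constant : ∀ {g} → Flat g → substitute shift g ≈ₚ weaken g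
      flat⇒constant {g} flat = ≈-trans (substitute-cong shift (≈-sym flat)) (≈-trans
        (substitute-agree shift flatten (var ∘ suc) flatten at-var g) (weaken-cong flat))
        where
        at-var : ∀ i → substitute shift (flatten i) ≈ₚ weaken (flatten i)
        at-var i = ≈-trans (⊕-cong ≈-refl (⊝-cong (⊗-cong ≈-refl shift-α)))
          (solve 4 (λ x v t a → (x :+ v :* (t :- a)) :- v :* t := x :- v :* a) ≈-refl (var (suc i)) (con (v i)) (var zero) (weaken (linear α)))

  component-preserves-flat : ∀ {n} (α : Form n) v (αv≈1 : α · v K.≈ K.1#) (β : Form n) w → β · v K.≈ K.0# → α · w K.≈ K.0# →
    ∀ d f → Flattening.Flat β w f → Flattening.Flat β w (Direction.component α v αv≈1 d f)
  component-preserves-flat α v αv≈1 β w βv≈0 αw≈0 d f flat = ≈-trans (≈-sym (coeff-ext flatten d (substitute shift f)))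
    (coeff-cong d (≈-trans (substitute-agree (ext flatten) shift shift flatten at-var f) (substitute-cong shift flat)))
    where
    open Flattening β w
    open Direction α v αv≈1
    at-var : ∀ i → substitute (ext flatten) (shift i) ≈ₚ substitute shift (flatten i)
    at-var i = ≈-trans (⊕-cong ≈-refl (⊗-cong ≈-refl (⊕-cong ≈-refl (⊝-cong (≈-trans (ext-weaken flatten (linear α)) (weaken-cong (flatten-fixes α αw≈0)))))))
      (≈-trans (solve 6 (λ x w b v t a → (x :- w :* b) :+ v :* (t :- a) := (x :+ v :* (t :- a)) :- w :* b) ≈-refl
        (var (suc i)) (con (w i)) (weaken (linear β)) (con (v i)) (var zero) (weaken (linear α)))
      (⊕-cong ≈-refl (⊝-cong (⊗-cong ≈-refl (≈-sym (shift-constant {β} βv≈0))))))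

  component* : ∀ {n r} (x : Vector (Form n) r) (b : Vector (Point n) r) → (∀ j → x j · b j K.≈ K.1#) → (Fin r → ℕ) → Poly n → Poly n
  component* {r = zero}  x b e ν f = f
  component* {r = suc r} x b e ν f =
    component* (x ∘ suc) (b ∘ suc) (e ∘ suc) (ν ∘ suc) (Direction.component (x zero) (b zero) (e zero) (ν zero) f)

  module _ {n : ℕ} where
    component*-cong : ∀ {r} (x : Vector (Form n) r) b e ν {f g} → f ≈ₚ g → component* x b e ν f ≈ₚ component* x b e ν g
    component*-cong {zero}  x b e ν eq = eq
    component*-cong {suc r} x b e ν eq = component*-cong (x ∘ suc) (b ∘ suc) (e ∘ suc) (ν ∘ suc)
      (Direction.component-cong (x zero) (b zero) (e zero) (ν zero) eq)

    component*-⊕ : ∀ {r} (x : Vector (Form n) r) b e ν f g → component* x b e ν (f ⊕ g) ≈ₚ component* x b e ν f ⊕ component* x b e ν g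
    component*-⊕ {zero}  x b e ν f g = ≈-refl
    component*-⊕ {suc r} x b e ν f g = component*-⊕ (x ∘ suc) (b ∘ suc) (e ∘ suc) (ν ∘ suc) _ _

    component*-constant : ∀ {r} (x : Vector (Form n) r) b e ν g f → (∀ j → substitute (Direction.shift (x j) (b j) (e j)) g ≈ₚ weaken g) →
                          component* x b e ν (g ⊗ f) ≈ₚ g ⊗ component* x b e ν f
    component*-constant {zero}  x b e ν g f inv = ≈-refl
    component*-constant {suc r} x b e ν g f inv = ≈-trans
      (component*-cong (x ∘ suc) (b ∘ suc) (e ∘ suc) (ν ∘ suc) (Direction.component-constant (x zero) (b zero) (e zero) (ν zero) f (inv zero)))
      (component*-constant (x ∘ suc) (b ∘ suc) (e ∘ suc) (ν ∘ suc) g _ (inv ∘ suc))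

    component*-in-ideal : ∀ {r} (x : Vector (Form n) r) b e (I : Ideal (S n) (c ⊔ ℓ₁)) f →
                          (∀ ν → member I (component* x b e ν f)) → member I f
    component*-in-ideal {zero}  x b e I f p = p (λ ())
    component*-in-ideal {suc r} x b e I f p = Direction.components-in-ideal (x zero) (b zero) (e zero) I f λ d →
      component*-in-ideal (x ∘ suc) (b ∘ suc) (e ∘ suc) I _ λ ν → p (d ◂ ν)

    component*-preserves-flat : ∀ {r} (x : Vector (Form n) r) b e (β : Form n) w → (∀ j → β · b j K.≈ K.0#) → (∀ j → x j · w K.≈ K.0#) →
      ∀ ν f → Flattening.Flat β w f → Flattening.Flat β w (component* x b e ν f)
    component*-preserves-flat {zero}  x b e β w βb xw ν f flat = flat
    component*-preserves-flat {suc r} x b e β w βb xw ν f flat =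
      component*-preserves-flat (x ∘ suc) (b ∘ suc) (e ∘ suc) β w (βb ∘ suc) (xw ∘ suc) (ν ∘ suc) _
        (component-preserves-flat (x zero) (b zero) (e zero) β w (βb zero) (xw zero) (ν zero) f flat)

    component*-flat : ∀ {r} (x : Vector (Form n) r) b → (dual : ∀ i j → x i · b j K.≈ δ i j) → ∀ e ν f j →
                      Flattening.Flat (x j) (b j) (component* x b e ν f)
    component*-flat {suc r} x b dual e ν f zero = component*-preserves-flat (x ∘ suc) (b ∘ suc) (e ∘ suc) (x zero) (b zero)
      (λ j → dual zero (suc j)) (λ j → dual (suc j) zero) (ν ∘ suc) _ (Flattening.component-flat (x zero) (b zero) (e zero) (ν zero) f)
    component*-flat {suc r} x b dual e ν f (suc j) =
      component*-flat (x ∘ suc) (b ∘ suc) (λ i j → dual (suc i) (suc j)) (e ∘ suc) (ν ∘ suc) _ j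

  component*-stable : ∀ {m r} (x : Vector (Form m) r) b e (B : Configuration m) →
    (∀ j a → a ∈ₗ Configuration.hyperplanes B → tail a · b j K.≈ K.0#) → ∀ ν f →
    Configurations.InResidueIdeal B f → Configurations.InResidueIdeal B (component* x b e ν f)
  component*-stable {r = zero}  x b e B B-b ν f p = p
  component*-stable {r = suc r} x b e B B-b ν f p = component*-stable (x ∘ suc) (b ∘ suc) (e ∘ suc) B (B-b ∘ suc) (ν ∘ suc) _
    (StableOperator.stable (component-stable (x zero) (b zero) (e zero) B (B-b zero) (ν zero)) p)

  δ-diagonal : ∀ {n} (i : Fin n) → δ i i K.≈ K.1#
  δ-diagonal zero    = K.refl
  δ-diagonal (suc i) = δ-diagonal i

  linear-0 : ∀ {n} {α : Form n} → (∀ i → α i K.≈ K.0#) → linear α ≈ₚ 0ₚ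
  linear-0 {α = α} e = SLin.sum-0 (λ i → con (α i) ⊗ var i) (λ i → ≈-trans (⊗-cong (con-cong (e i)) ≈-refl) (SR.zeroˡ _))

  origin : ∀ {n} → Point n
  origin _ = K.0#

  degree-part-0 : ∀ {n} (f : Poly n) → degree-part 0 f ≈ₚ con (value origin f)
  degree-part-0 (con a) = ≈-refl
  degree-part-0 (var i) = SR.zeroˡ _
  degree-part-0 (f ⊕ g) = ≈-trans (⊕-cong (degree-part-0 f) (degree-part-0 g)) (≈-sym (con-+ _ _))
  degree-part-0 (f ⊗ g) = ≈-trans (⊗-cong (degree-part-0 f) (degree-part-0 g)) (≈-sym (con-* _ _))
  degree-part-0 (⊝ f)   = ≈-trans (⊝-cong (degree-part-0 f)) (≈-sym (con-⊝ _))

  substitute-0 : ∀ {n m} (f : Poly n) → substitute {m = m} (λ _ → 0ₚ) f ≈ₚ con (value origin f)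
  substitute-0 (con a) = ≈-refl
  substitute-0 (var i) = ≈-refl
  substitute-0 (f ⊕ g) = ≈-trans (⊕-cong (substitute-0 f) (substitute-0 g)) (≈-sym (con-+ _ _))
  substitute-0 (f ⊗ g) = ≈-trans (⊗-cong (substitute-0 f) (substitute-0 g)) (≈-sym (con-* _ _))
  substitute-0 (⊝ f)   = ≈-trans (⊝-cong (substitute-0 f)) (≈-sym (con-⊝ _))

  kernel : ∀ {n m} → (Fin n → Poly m) → Ideal (S n) (c ⊔ ℓ₁)
  kernel σ = record
    { member   = λ f → substitute σ f ≈ₚ 0ₚ
    ; resp     = λ e p → ≈-trans (substitute-cong σ (≈-sym e)) p
    ; 0-closed = ≈-refl
    ; +-closed = λ p q → ≈-trans (⊕-cong p q) (⊕-identityˡ _)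
    ; *-closed = λ s p → ≈-trans (⊗-cong ≈-refl p) (SR.zeroʳ _)
    }

  -- Localization at a subspace of codimension two

  mask : ∀ {r} → ℕ → Fin r → K.Carrier
  mask zero    j       = K.1#
  mask (suc k) zero    = K.0#
  mask (suc k) (suc j) = mask k j

  mask-≥ : ∀ {r} k (j : Fin r) → k ℕ.≤ Fin.toℕ j → mask k j K.≈ K.1#
  mask-≥ zero    j       _         = K.refl
  mask-≥ (suc k) (suc j) (ℕ.s≤s k≤j) = mask-≥ k j k≤j

  mask-< : ∀ {r} k (j : Fin r) → Fin.toℕ j ℕ.< k → mask k j K.≈ K.0#
  mask-< (suc k) zero    _         = K.refl
  mask-< (suc k) (suc j) (ℕ.s≤s j<k) = mask-< k j j<k

  mask-≤ : ∀ {r} k k′ (j : Fin r) → k ℕ.≤ k′ → mask k j K.* mask k′ j K.≈ mask k′ j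
  mask-≤ zero    k′       j       _         = K.*-identityˡ _
  mask-≤ (suc k) (suc k′) zero    _         = K.zeroˡ _
  mask-≤ (suc k) (suc k′) (suc j) (ℕ.s≤s k≤k′) = mask-≤ k k′ j k≤k′

  -- The center is the subspace of Kᵐ with basis b; its ideal is the kernel of ρ 0.
  module Center {m r} (b : Vector (Point m) r) (x : Vector (Form m) r) (dual : ∀ i j → x i · b j K.≈ δ i j) where
    x·b≈1 : ∀ j → x j · b j K.≈ K.1#
    x·b≈1 j = K.trans (dual j j) (δ-diagonal j)

    -- Restriction to the span of b j for j ≥ k.
    ρ-var : ℕ → Fin m → Poly r
    ρ-var k i = linear (λ j → mask k j K.* b j i)

    ρ : ℕ → Poly m → Poly r
    ρ k = substitute (ρ-var k)

    ρ-cong : ∀ k {f g} → f ≈ₚ g → ρ k f ≈ₚ ρ k g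
    ρ-cong k = substitute-cong (ρ-var k)

    ρ-linear : ∀ k β → ρ k (linear β) ≈ₚ linear (λ j → mask k j K.* (β · b j))
    ρ-linear k β = ≈-trans (substitute-linear-linear (ρ-var k) (λ i j → mask k j K.* b j i) (λ _ → ≈-refl) β)
      (linear-cong λ j → K.trans (KLin.sum-cong (λ i → β i K.* (mask k j K.* b j i)) (λ i → mask k j K.* (β i K.* b j i))
          (λ i → solveᴷ 3 (λ x y z → x ⊠ (y ⊠ z) ≔ y ⊠ (x ⊠ z)) K.refl (β i) (mask k j) (b j i)))
        (K.sym (KLin.*-distribˡ-sum (mask k j) (λ i → β i K.* b j i))))

    ρ-vanishing : ∀ k β → (∀ j → β · b j K.≈ K.0#) → ρ k (linear β) ≈ₚ 0ₚ
    ρ-vanishing k β βb≈0 = ≈-trans (ρ-linear k β) (linear-0 (λ j → K.trans (K.*-congˡ (βb≈0 j)) (K.zeroʳ _)))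

    ρ-0-vanishing : ∀ β → ρ 0 (linear β) ≈ₚ 0ₚ → ∀ j → β · b j K.≈ K.0#
    ρ-0-vanishing β e j = K.trans (K.sym (K.*-identityˡ _)) (dne λ ≉0 →
      linear-nonZero {α = λ j → K.1# K.* (β · b j)} (λ all≈0 → ≉0 (all≈0 j)) (≈-trans (≈-sym (ρ-linear 0 β)) e))

    AllFlat : Poly m → Set (c ⊔ ℓ₁)
    AllFlat f = ∀ j → Flattening.Flat (x j) (b j) f

    private
      mask-step : ∀ {r} (j l : Fin r) (β : Fin r → K.Carrier) →
                  mask (Fin.toℕ j) l K.* (β l K.- β j K.* δ j l) K.≈ mask (suc (Fin.toℕ j)) l K.* β l
      mask-step zero    zero    β = solveᴷ 1 (λ x → 1ᴷ ⊠ (x ⊟ x ⊠ 1ᴷ) ≔ 0ᴷ ⊠ x) K.refl (β zero)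
      mask-step zero    (suc l) β = solveᴷ 2 (λ x y → 1ᴷ ⊠ (x ⊟ y ⊠ 0ᴷ) ≔ 1ᴷ ⊠ x) K.refl (β (suc l)) (β zero)
      mask-step (suc j) zero    β = solveᴷ 2 (λ x y → 0ᴷ ⊠ y ≔ 0ᴷ ⊠ x) K.refl (β zero) (β zero K.- β (suc j) K.* K.0#)
      mask-step (suc j) (suc l) β = mask-step j l (β ∘ suc)

      ρ-flatten : ∀ j f → ρ (Fin.toℕ j) (substitute (Flattening.flatten (x j) (b j)) f) ≈ₚ ρ (suc (Fin.toℕ j)) f
      ρ-flatten j f = ≈-trans (substitute-substitute (ρ-var (Fin.toℕ j)) (Flattening.flatten (x j) (b j)) f) (substitute-≈ at-var f)
        where
        k = Fin.toℕ j
        at-var : ∀ i → ρ k (Flattening.flatten (x j) (b j) i) ≈ₚ ρ-var (suc k) i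
        at-var i = begin
          linear (λ l → mask k l K.* b l i) ⊕ ⊝ (con (b j i) ⊗ ρ k (linear (x j)))
            ≈⟨ ⊕-cong ≈-refl (⊝-cong (⊗-cong ≈-refl (≈-trans (ρ-linear k (x j)) (linear-cong (λ l → K.*-congˡ (dual j l)))))) ⟩
          linear (λ l → mask k l K.* b l i) ⊕ ⊝ (con (b j i) ⊗ linear (λ l → mask k l K.* δ j l))
            ≈⟨ solve 3 (λ u c w → u :- c :* w := :1 :* u :+ (:- c) :* w) ≈-refl (linear (λ l → mask k l K.* b l i)) (con (b j i)) (linear (λ l → mask k l K.* δ j l)) ⟩
          1ₚ ⊗ linear (λ l → mask k l K.* b l i) ⊕ ⊝ con (b j i) ⊗ linear (λ l → mask k l K.* δ j l)
            ≈⟨ ⊕-cong ≈-refl (⊗-cong (≈-sym (con-⊝ (b j i))) ≈-refl) ⟩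
          1ₚ ⊗ linear (λ l → mask k l K.* b l i) ⊕ con (K.- b j i) ⊗ linear (λ l → mask k l K.* δ j l)
            ≈⟨ linear-combine K.1# (λ l → mask k l K.* b l i) (K.- b j i) (λ l → mask k l K.* δ j l) ⟨
          linear (λ l → K.1# K.* (mask k l K.* b l i) K.+ K.- b j i K.* (mask k l K.* δ j l))
            ≈⟨ linear-cong (λ l → K.trans (solveᴷ 4 (λ m u w d → 1ᴷ ⊠ (m ⊠ u) ⊞ (⊟ w) ⊠ (m ⊠ d) ≔ m ⊠ (u ⊟ w ⊠ d)) K.refl (mask k l) (b l i) (b j i) (δ j l))
                 (mask-step j l (λ l → b l i))) ⟩
          linear (λ l → mask (suc k) l K.* b l i) ∎

    ρ-flat : ∀ {f} → AllFlat f → ρ 0 f ≈ₚ con (value origin f)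
    ρ-flat {f} flat = ≈-trans (all-steps r ℕ.≤-refl) (≈-trans (substitute-≈ ρ-r f) (substitute-0 f))
      where
      one-step : ∀ j → ρ (Fin.toℕ j) f ≈ₚ ρ (suc (Fin.toℕ j)) f
      one-step j = ≈-trans (ρ-cong (Fin.toℕ j) (≈-sym (flat j))) (ρ-flatten j f)
      all-steps : ∀ k → k ℕ.≤ r → ρ 0 f ≈ₚ ρ k f
      all-steps zero    _   = ≈-refl
      all-steps (suc k) k<r = ≈-trans (all-steps k (ℕ.<⇒≤ k<r))
        (≡.subst (λ k → ρ k f ≈ₚ ρ (suc k) f) (Fin.toℕ-fromℕ< k<r) (one-step (Fin.fromℕ< k<r)))
      ρ-r : ∀ i → ρ-var r i ≈ₚ 0ₚ
      ρ-r i = linear-0 (λ j → K.trans (K.*-congʳ (mask-< r j (Fin.toℕ<n j))) (K.zeroˡ _))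

    section : Poly r → Poly m
    section = substitute (λ j → linear (x j))

    ρ-section : ∀ f → ρ 0 (section f) ≈ₚ f
    ρ-section f = ≈-trans (substitute-substitute (ρ-var 0) (λ j → linear (x j)) f) (≈-trans (substitute-≈ (λ j →
      ≈-trans (ρ-linear 0 (x j)) (≈-trans (linear-cong (λ l → K.trans (K.*-identityˡ _) (dual j l))) (linear-δ j))) f) (substitute-var f))

    Λ : (Fin r → ℕ) → Poly m → Poly m
    Λ = component* x b x·b≈1

    Λ-flat : ∀ ν f → AllFlat (Λ ν f)
    Λ-flat ν f j = component*-flat x b dual x·b≈1 ν f j

    Λ-constant : ∀ ν {g} f → AllFlat g → Λ ν (g ⊗ f) ≈ₚ g ⊗ Λ ν f
    Λ-constant ν {g} f flat = component*-constant x b x·b≈1 ν g f (λ j → Flattening.flat⇒constant (x j) (b j) (x·b≈1 j) (flat j))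

    Λ-in-ideal : (I : Ideal (S m) (c ⊔ ℓ₁)) → ∀ f → (∀ ν → member I (Λ ν f)) → member I f
    Λ-in-ideal = component*-in-ideal x b x·b≈1

    nonVanishing : ∀ f → ¬ ρ 0 f ≈ₚ 0ₚ → ∃ λ ν → ¬ value origin (Λ ν f) K.≈ K.0#
    nonVanishing f ρf≉0 = dne λ none → ρf≉0 (Λ-in-ideal (kernel (ρ-var 0)) f
      (λ ν → ≈-trans (ρ-flat (Λ-flat ν f)) (con-cong (dne λ ≉0 → none (ν , ≉0)))))

    module _ (B : Configuration m) (B-b : ∀ j a → a ∈ₗ Configuration.hyperplanes B → tail a · b j K.≈ K.0#) where
      open Configurations B

      Λ-stable : ∀ ν {f} → InResidueIdeal f → InResidueIdeal (Λ ν f)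
      Λ-stable ν {f} = component*-stable x b x·b≈1 B B-b ν f

      J⊆kernel : ¬ InResidueIdeal 1ₚ → ∀ f → InResidueIdeal f → ρ 0 f ≈ₚ 0ₚ
      J⊆kernel 1∉J f f∈J = dne λ ρf≉0 → contradict (nonVanishing f ρf≉0)
        where
        contradict : (∃ λ ν → ¬ value origin (Λ ν f) K.≈ K.0#) → ⊥
        contradict (ν , c≉0) = 1∉J (Ideal.resp J (≈-trans (≈-sym (con-* _ _)) (con-cong (proj₂ (inverse c≉0))))
          (Ideal.*-closed J (con (proj₁ (inverse c≉0))) (Ideal.resp J (degree-part-0 (Λ ν f))
            (StableOperator.stable (degree-part-stable B 0) (Λ-stable ν f∈J)))))

      two-hyperplanes : ¬ InResidueIdeal 1ₚ → ∃₂ λ a a′ → a ∈ₗ hyperplanes × a′ ∈ₗ hyperplanes × ¬ SameHyperplane (tail a) (tail a′)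
      two-hyperplanes 1∉J = first hyperplanes (λ a a∈ → a∈) (Ideal.resp J (bar-product hyperplanes) P̄∈J)
        where
        open ResidueElements B
        second : ∀ a → a ∈ₗ hyperplanes → (ys : List (Form m)) → (∀ y → y ∈ₗ ys → y ∈ₗ tails × ¬ SameHyperplane (tail a) y) →
                 InResidueIdeal (product ys) → ∃₂ λ a a′ → a ∈ₗ hyperplanes × a′ ∈ₗ hyperplanes × ¬ SameHyperplane (tail a) (tail a′)
        second a a∈ []       _  1∈J = contradiction 1∈J 1∉J
        second a a∈ (y ∷ ys) ys⊆ _  = from-tail (∈-map⁻ tail (proj₁ (ys⊆ y (here ≡.refl)))) (proj₂ (ys⊆ y (here ≡.refl)))
          where
          from-tail : (∃ λ a′ → a′ ∈ₗ hyperplanes × y ≡ tail a′) → ¬ SameHyperplane (tail a) y →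
                      ∃₂ λ a a′ → a ∈ₗ hyperplanes × a′ ∈ₗ hyperplanes × ¬ SameHyperplane (tail a) (tail a′)
          from-tail (a′ , a′∈ , ≡.refl) a≁a′ = a , a′ , a∈ , a′∈ , a≁a′
        first : ∀ xs → (∀ a → a ∈ₗ xs → a ∈ₗ hyperplanes) → InResidueIdeal (product (map tail xs)) →
                ∃₂ λ a a′ → a ∈ₗ hyperplanes × a′ ∈ₗ hyperplanes × ¬ SameHyperplane (tail a) (tail a′)
        first []       _   1∈J = contradiction 1∈J 1∉J
        first (a ∷ xs) xs⊆ _   = second a (xs⊆ a (here ≡.refl)) (filter (¬? ∘ sameHyperplane? (tail a)) tails)
          (λ y y∈ → ∈-filter⁻ (¬? ∘ sameHyperplane? (tail a)) y∈) (pair∈J a (xs⊆ a (here ≡.refl)))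

    module Codimension2 (m≡ : m ≡ suc (suc r)) (α β : Form m) (α≉0 : NonZero α) (β≉0 : NonZero β) (α≁β : ¬ SameHyperplane α β)
                        (αb : ∀ j → α · b j K.≈ K.0#) (βb : ∀ j → β · b j K.≈ K.0#) where
      private
        frame : Vector (Form m) (suc (suc r))
        frame = α ◂ (β ◂ x)

        frame-independent : Independent frame
        frame-independent a rel = λ { zero → a₀≈0 ; (suc zero) → a₁≈0 ; (suc (suc j)) → a₂≈0 j }
          where
          a₂ : Vector K.Carrier r
          a₂ j = a (suc (suc j))
          at-b : ∀ j → KLin.lincomb a frame · b j K.≈ a₂ j
          at-b j = K.trans (·-lincombˡ a frame (b j)) (K.trans (K.+-cong (K.trans (K.*-congˡ (αb j)) (K.zeroʳ _))
            (K.+-cong (K.trans (K.*-congˡ (βb j)) (K.zeroʳ _))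
              (K.trans (KLin.sum-cong (λ i → a₂ i K.* (x i · b j)) (λ i → a₂ i K.* δ i j) (λ i → K.*-congˡ (dual i j))) (KLin.sum-δʳ j a₂))))
            (K.trans (K.+-identityˡ _) (K.+-identityˡ _)))
          a₂≈0 : ∀ j → a₂ j K.≈ K.0#
          a₂≈0 j = K.trans (K.sym (at-b j)) (K.trans (·-congˡ {α = KLin.lincomb a frame} {λ _ → K.0#} (b j) rel) (KLin.sum-0 (λ i → K.0# K.* b j i) (λ i → K.zeroˡ _)))
          two-term : ∀ i → a zero K.* α i K.+ a (suc zero) K.* β i K.≈ K.0#
          two-term i = K.trans (K.+-congˡ (K.trans (K.sym (K.+-identityʳ _)) (K.+-congˡ (K.sym (KLin.lincomb-0 a₂ x a₂≈0 i))))) (rel i)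
          a₀≈0 : a zero K.≈ K.0#
          a₀≈0 = dne λ a₀≉0 → α≁β (same-sym {α = β} {α} (⊆⇒same {α = β} {α} β≉0 α≉0 λ {v} βv≈0 → K-domain (a zero) (α · v)
            (K.trans (K.sym (K.trans (·-combineˡ (a zero) α (a (suc zero)) β v) (K.trans (K.+-congˡ (K.trans (K.*-congˡ βv≈0) (K.zeroʳ _))) (K.+-identityʳ _))))
              (K.trans (·-congˡ {α = λ i → a zero K.* α i K.+ a (suc zero) K.* β i} {λ _ → K.0#} v two-term) (KLin.sum-0 (λ i → K.0# K.* v i) (λ i → K.zeroˡ _)))) a₀≉0))
          a₁≈0 : a (suc zero) K.≈ K.0#
          a₁≈0 = dne λ a₁≉0 → β≉0 λ i → K-domain (a (suc zero)) (β i)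
            (K.trans (K.sym (K.trans (K.+-congʳ (K.trans (K.*-congʳ a₀≈0) (K.zeroˡ _))) (K.+-identityˡ _))) (two-term i)) a₁≉0

      vanishing⇒combination : ∀ γ → (∀ j → γ · b j K.≈ K.0#) → ∃₂ λ s t → ∀ i → γ i K.≈ s K.* α i K.+ t K.* β i
      vanishing⇒combination γ γb = a zero , a (suc zero) , λ i → K.trans (eq i) (K.+-congˡ (K.trans (K.+-congˡ
          (KLin.lincomb-0 a₂ x a₂≈0 i)) (K.+-identityʳ _)))
        where
        spanning : ∀ {k} → k ≡ suc (suc r) → (frame′ : Vector (Vector K.Carrier k) (suc (suc r))) → Independent frame′ →
                   (v : Vector K.Carrier k) → ∃ λ a → v ≋ₖ KLin.lincomb a frame′
        spanning ≡.refl frame′ ind v = independent⇒spanning frame′ ind v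
        a = proj₁ (spanning m≡ frame frame-independent γ)
        eq = proj₂ (spanning m≡ frame frame-independent γ)
        a₂ : Vector K.Carrier r
        a₂ j = a (suc (suc j))
        a₂≈0 : ∀ j → a₂ j K.≈ K.0#
        a₂≈0 j = K.trans (K.sym (K.trans (·-lincombˡ a frame (b j)) (K.trans (K.+-cong (K.trans (K.*-congˡ (αb j)) (K.zeroʳ _))
            (K.+-cong (K.trans (K.*-congˡ (βb j)) (K.zeroʳ _))
              (K.trans (KLin.sum-cong (λ i → a₂ i K.* (x i · b j)) (λ i → a₂ i K.* δ i j) (λ i → K.*-congˡ (dual i j))) (KLin.sum-δʳ j a₂))))
            (K.trans (K.+-identityˡ _) (K.+-identityˡ _)))))
          (K.trans (K.sym (·-congˡ {α = γ} {KLin.lincomb a frame} (b j) eq)) (γb j))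

      kernel⊆ : ∀ f → ρ 0 f ≈ₚ 0ₚ → member ⟪ linear α , linear β ⟫ f
      kernel⊆ f ρf≈0 = Ideal.resp I (≈-trans (⊕-cong (substitute-var f) (⊝-cong (≈-trans (≈-sym (substitute-substitute (λ j → linear (x j)) (ρ-var 0) f))
          (substitute-cong (λ j → linear (x j)) ρf≈0)))) (solve 1 (λ f → f :- :0 := f) ≈-refl f))
        (substitute-mod I var (λ i → section (ρ-var 0 i)) at-var f)
        where
        I = ⟪ linear α , linear β ⟫
        at-var : ∀ i → member I (var i ⊕ ⊝ section (ρ-var 0 i))
        at-var i = con s , con t , (begin
          var i ⊕ ⊝ section (ρ-var 0 i)
            ≈⟨ ⊕-cong (≈-sym (linear-δ i)) (⊝-cong (substitute-linear-linear (λ j → linear (x j)) x (λ _ → ≈-refl) (λ j → K.1# K.* b j i))) ⟩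
          linear (δ i) ⊕ ⊝ linear w
            ≈⟨ ⊕-cong (≈-sym (⊗-identityˡ _)) (solve 1 (λ y → :- y := (:- :1) :* y) ≈-refl (linear w)) ⟩
          1ₚ ⊗ linear (δ i) ⊕ ⊝ 1ₚ ⊗ linear w
            ≈⟨ ⊕-cong ≈-refl (⊗-cong (≈-sym (con-⊝ K.1#)) ≈-refl) ⟩
          1ₚ ⊗ linear (δ i) ⊕ con (K.- K.1#) ⊗ linear w
            ≈⟨ linear-combine K.1# (δ i) (K.- K.1#) w ⟨
          linear γ
            ≈⟨ linear-cong (proj₂ (proj₂ combination)) ⟩
          linear (λ k → s K.* α k K.+ t K.* β k)
            ≈⟨ linear-combine s α t β ⟩
          con s ⊗ linear α ⊕ con t ⊗ linear β ∎)
          where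
          w γ : Form m
          w = KLin.lincomb (λ j → K.1# K.* b j i) x
          γ k = K.1# K.* δ i k K.+ K.- K.1# K.* w k
          γb : ∀ j → γ · b j K.≈ K.0#
          γb j = K.trans (·-combineˡ K.1# (δ i) (K.- K.1#) w (b j)) (K.trans (K.+-cong (K.*-congˡ (KLin.sum-δˡ i (b j)))
            (K.*-congˡ (K.trans (·-lincombˡ (λ j → K.1# K.* b j i) x (b j))
              (K.trans (KLin.sum-cong (λ l → K.1# K.* b l i K.* (x l · b j)) (λ l → b l i K.* δ l j) (λ l → K.*-cong (K.*-identityˡ _) (dual l j)))
                (KLin.sum-δʳ j (λ l → b l i))))))
            (solveᴷ 1 (λ y → 1ᴷ ⊠ y ⊞ (⊟ 1ᴷ) ⊠ y ≔ 0ᴷ) K.refl (b j i)))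
          combination = vanishing⇒combination γ γb
          s = proj₁ combination
          t = proj₁ (proj₂ combination)

  contract : ∀ {n} → Vector (Poly n) n → Vector (Poly n) n → Poly n
  contract w η = sum (λ t → η t ⊗ w t)

  contract-lincomb : ∀ {n k} (w : Vector (Poly n) n) (a : Vector (Poly n) k) η →
                     contract w (SLin.lincomb a η) ≈ₚ sum (λ i → a i ⊗ contract w (η i))
  contract-lincomb w a η = ≈-sym (SLin.lincomb-assoc a η (λ t (_ : Fin 1) → w t) zero)

  contract-cong : ∀ {n} (w : Vector (Poly n) n) η ζ → η ≋ₛ ζ → contract w η ≈ₚ contract w ζ
  contract-cong w η ζ e = SLin.sum-cong (λ t → η t ⊗ w t) (λ t → ζ t ⊗ w t) (λ t → ⊗-cong (e t) ≈-refl)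

  contract-⊕ : ∀ {n} (w : Vector (Poly n) n) η ζ → contract w (λ t → η t ⊕ ζ t) ≈ₚ contract w η ⊕ contract w ζ
  contract-⊕ w η ζ = SLin.lincomb-+ η ζ (λ t (_ : Fin 1) → w t) zero

  contract-⊗ : ∀ {n} (w : Vector (Poly n) n) s η → contract w (λ t → s ⊗ η t) ≈ₚ s ⊗ contract w η
  contract-⊗ w s η = SLin.lincomb-* s η (λ t (_ : Fin 1) → w t) zero

  lincomb-remove : ∀ {n k} (i : Fin (suc k)) (a : Vector (Poly n) (suc k)) (η : Vector (Vector (Poly n) n) (suc k)) t →
                   SLin.lincomb a η t ≈ₚ a i ⊗ η i t ⊕ SLin.lincomb (a ∘ punchIn i) (η ∘ punchIn i) t
  lincomb-remove i a η t = SLin.sum-remove {i = i} (λ j → a j ⊗ η j t)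

  module Exchange {m r} (A B : Configuration m) (X : Pred (Point m) (c ⊔ ℓ₁)) (loc : IsLocalization A B X)
                  {k} (G : Vector (Vector (Poly (suc m)) (suc m)) k) (G-basis : SLin.IsBasis (Configurations.Log A) G)
                  (b : Vector (Point m) r) (b-basis : KLin.IsBasis X b)
                  (x : Vector (Form m) r) (dual : ∀ i j → x i · b j K.≈ δ i j) where
    open Center b x dual
    open Localized loc
    private
      module A = Configurations A
      module B = Configurations B

    B-b : ∀ j a → a ∈ₗ B.hyperplanes → tail a · b j K.≈ K.0#
    B-b j a a∈ = IsLocalization.contains loc a a∈ (KLin.IsBasis.inside b-basis j)

    Qᴮ : Poly (suc m)
    Qᴮ = var zero ⊗ B.P

    P≉0 : ¬ B.P ≈ₚ 0ₚ
    P≉0 = product-nonZero B.forms-nonZero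

    Qᴮ≉0 : ¬ Qᴮ ≈ₚ 0ₚ
    Qᴮ≉0 e = P≉0 (domain (var zero) B.P e (var≉0 zero))

    E : Poly (suc m)
    E = product outside

    reduce : Poly (suc m) → Poly r
    reduce f = ρ 0 (bar f)

    reduce-cong : ∀ {f g} → f ≈ₚ g → reduce f ≈ₚ reduce g
    reduce-cong e = ρ-cong 0 (bar-cong e)

    E∉ : ¬ reduce E ≈ₚ 0ₚ
    E∉ e = product∉ outside (λ a a∈ → proj₂ (∈-filter⁻ (¬? ∘ contains? X ∘ tail) {xs = A.hyperplanes} a∈)) e
      where
      X⊆ : ∀ a → reduce (linear a) ≈ₚ 0ₚ → X ⊆ hyperplane (tail a)
      X⊆ a e {v} v∈X = K.trans (K.trans (·-comm (tail a) v) (·-congˡ {α = v} {KLin.lincomb s b} (tail a) (proj₂ (KLin.IsBasis.spanning b-basis v v∈X))))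
        (K.trans (·-lincombˡ s b (tail a)) (KLin.sum-0 (λ j → s j K.* (b j · tail a)) (λ j →
          K.trans (K.*-congˡ (K.trans (·-comm (b j) (tail a)) (ρ-0-vanishing (tail a) (≈-trans (ρ-cong 0 (≈-sym (bar-linear a))) e) j))) (K.zeroʳ _))))
        where
        s = proj₁ (KLin.IsBasis.spanning b-basis v v∈X)
      product∉ : ∀ xs → (∀ a → a ∈ₗ xs → ¬ (X ⊆ hyperplane (tail a))) → ¬ reduce (product xs) ≈ₚ 0ₚ
      product∉ []       _  e = 1ₚ≉0ₚ e
      product∉ (a ∷ xs) X⊈ e = product∉ xs (λ a a∈ → X⊈ a (there a∈))
        (domain (reduce (linear a)) _ e (λ e′ → X⊈ a (here ≡.refl) (λ {v} → X⊆ a e′ {v})))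

    Qᴮ∣ : ∀ {f} → var zero ∣ f → (∀ a → a ∈ₗ B.hyperplanes → linear a ∣ f) → Qᴮ ∣ f
    Qᴮ∣ {f} x∣f a∣f = quotient x∣h , ≈-trans (equality P∣f) (≈-trans (⊗-cong ≈-refl (equality x∣h))
        (solve 3 (λ p x q → p :* (x :* q) := x :* p :* q) ≈-refl B.P (var zero) (quotient x∣h)))
      where
      P∣f : B.P ∣ f
      P∣f = product-∣ B.hyperplanes B.forms-nonZero B.hyperplanes-distinct a∣f
      x∣h : var zero ∣ quotient P∣f
      x∣h = bar-0⇒∣ (domain B.P̄ (bar (quotient P∣f)) (≈-trans (≈-sym (bar-cong (equality P∣f))) (∣⇒bar-0 x∣f)) B.P̄≉0)

    contraction-∣ : ∀ (w : Vector (Poly (suc m)) (suc m)) → var zero ∣ w zero →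
                    (∀ a → a ∈ₗ B.hyperplanes → linear a ∣ sum (λ t → con (a t) ⊗ w t)) →
                    ∀ η → B.Log η → Qᴮ ∣ contract w η
    contraction-∣ w x∣w a∣w η l = Qᴮ∣
      (∣-sum (λ t → η t ⊗ w t) (λ { zero → ∣-⊗ˡ (η zero) x∣w ; (suc j) → ∣-⊗ʳ (w (suc j)) (B.at-H l j) }))
      (λ a a∈ → parallel-contract a w (a∣w a a∈) (B.at l a a∈))

    direction : Fin r → Vector (Poly (suc m)) (suc m)
    direction l = 0ₚ ◂ λ j → con (b l j)

    direction-form : ∀ l (a : Form (suc m)) → sum (λ t → con (a t) ⊗ direction l t) ≈ₚ con (tail a · b l)
    direction-form l a = ≈-trans (⊕-cong (SR.zeroʳ _) ≈-refl) (≈-trans (⊕-identityˡ _)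
      (≈-trans (SLin.sum-cong (λ j → con (a (suc j)) ⊗ con (b l j)) (λ j → con (a (suc j) K.* b l j)) (λ j → ≈-sym (con-* _ _)))
        (≈-sym (con-sum (λ j → a (suc j) K.* b l j)))))

    direction-∣ : ∀ l η → B.Log η → Qᴮ ∣ contract (direction l) η
    direction-∣ l = contraction-∣ (direction l) (∣-0 ≈-refl)
      (λ a a∈ → ∣-0 (≈-trans (direction-form l a) (con-cong (B-b l a a∈))))

    euler-∣ : ∀ η → B.Log η → Qᴮ ∣ contract var η
    euler-∣ = contraction-∣ var (1ₚ , solve 1 (λ x → x := x :* :1) ≈-refl (var zero))
      (λ a a∈ → 1ₚ , solve 1 (λ x → x := x :* :1) ≈-refl (linear a))

    -- Steinitz exchange: q · Log A lies in the span of the j new elements s and of k′ elements of the basis.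
    record State (j k′ : ℕ) : Set (c ⊔ ℓ₁) where
      field
        s       : Vector (Vector (Poly (suc m)) (suc m)) j
        g       : Vector (Vector (Poly (suc m)) (suc m)) k′
        g-log   : ∀ i → A.Log (g i)
        q       : Poly (suc m)
        q∉      : ¬ reduce q ≈ₚ 0ₚ
        spans   : ∀ u → A.Log u → ∃₂ λ d e → ∀ t → q ⊗ u t ≈ₚ SLin.lincomb d s t ⊕ SLin.lincomb e g t

    initial : State 0 k
    initial = record
      { s = λ () ; g = G ; g-log = SLin.IsBasis.inside G-basis ; q = 1ₚ ; q∉ = 1ₚ≉0ₚ
      ; spans = λ u l → (λ ()) , proj₁ (SLin.IsBasis.spanning G-basis u l) , λ t →
          ≈-trans (⊗-identityˡ _) (≈-trans (proj₂ (SLin.IsBasis.spanning G-basis u l) t) (≈-sym (⊕-identityˡ _))) }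

    exchange : ∀ {j k′} (Σ : State j k′) (σ w : Vector (Poly (suc m)) (suc m)) → B.Log σ →
               (∀ η → B.Log η → Qᴮ ∣ contract w η) → (∀ i → contract w (State.s Σ i) ≈ₚ 0ₚ) → contract w σ ≈ₚ Qᴮ →
               ∃ λ k″ → k′ ≡ suc k″ × ∃ λ (Σ′ : State (suc j) k″) → State.s Σ′ ≡ σ ◂ State.s Σ
    exchange {j} {k′} Σ σ w σ-log w-∣ w-s w-σ = finish g e g-log (proj₁ i-e) (proj₂ i-e) spans (proj₂ (proj₂ (spans (λ t → E ⊗ σ t) (Log-extended σ-log))))
      where
      open State Σ
      d₀ = proj₁ (spans (λ t → E ⊗ σ t) (Log-extended σ-log))
      e = proj₁ (proj₂ (spans (λ t → E ⊗ σ t) (Log-extended σ-log)))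
      eq = proj₂ (proj₂ (spans (λ t → E ⊗ σ t) (Log-extended σ-log)))
      ψ : Fin k′ → Poly (suc m)
      ψ i = quotient (w-∣ (g i) (Log-included (g-log i)))
      qE≈ : q ⊗ E ≈ₚ sum (λ i → e i ⊗ ψ i)
      qE≈ = cancelˡ Qᴮ Qᴮ≉0 (begin
        Qᴮ ⊗ (q ⊗ E)
          ≈⟨ solve 3 (λ Qᴮ q E → Qᴮ :* (q :* E) := q :* (E :* Qᴮ)) ≈-refl Qᴮ q E ⟩
        q ⊗ (E ⊗ Qᴮ)
          ≈⟨ ⊗-cong ≈-refl (⊗-cong ≈-refl (≈-sym w-σ)) ⟩
        q ⊗ (E ⊗ contract w σ)
          ≈⟨ ⊗-cong ≈-refl (contract-⊗ w E σ) ⟨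
        q ⊗ contract w (λ t → E ⊗ σ t)
          ≈⟨ contract-⊗ w q (λ t → E ⊗ σ t) ⟨
        contract w (λ t → q ⊗ (E ⊗ σ t))
          ≈⟨ contract-cong w (λ t → q ⊗ (E ⊗ σ t)) (λ t → SLin.lincomb d₀ s t ⊕ SLin.lincomb e g t) eq ⟩
        contract w (λ t → SLin.lincomb d₀ s t ⊕ SLin.lincomb e g t)
          ≈⟨ contract-⊕ w (SLin.lincomb d₀ s) (SLin.lincomb e g) ⟩
        contract w (SLin.lincomb d₀ s) ⊕ contract w (SLin.lincomb e g)
          ≈⟨ ⊕-cong (≈-trans (contract-lincomb w d₀ s) (SLin.sum-0 (λ i → d₀ i ⊗ contract w (s i)) (λ i → ≈-trans (⊗-cong ≈-refl (w-s i)) (SR.zeroʳ _))))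
               (contract-lincomb w e g) ⟩
        0ₚ ⊕ sum (λ i → e i ⊗ contract w (g i))
          ≈⟨ ⊕-identityˡ _ ⟩
        sum (λ i → e i ⊗ contract w (g i))
          ≈⟨ SLin.sum-cong (λ i → e i ⊗ contract w (g i)) (λ i → Qᴮ ⊗ (e i ⊗ ψ i)) (λ i →
               ≈-trans (⊗-cong ≈-refl (equality (w-∣ (g i) (Log-included (g-log i)))))
                 (solve 3 (λ e Qᴮ p → e :* (Qᴮ :* p) := Qᴮ :* (e :* p)) ≈-refl (e i) Qᴮ (ψ i))) ⟩
        sum (λ i → Qᴮ ⊗ (e i ⊗ ψ i))
          ≈⟨ SLin.*-distribˡ-sum Qᴮ (λ i → e i ⊗ ψ i) ⟨
        Qᴮ ⊗ sum (λ i → e i ⊗ ψ i) ∎)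
      I : Ideal (S (suc m)) (c ⊔ ℓ₁)
      I = record
        { member = λ f → reduce f ≈ₚ 0ₚ
        ; resp = λ e p → ≈-trans (reduce-cong (≈-sym e)) p
        ; 0-closed = ≈-refl
        ; +-closed = λ p q → ≈-trans (⊕-cong p q) (⊕-identityˡ _)
        ; *-closed = λ s p → ≈-trans (⊗-cong ≈-refl p) (SR.zeroʳ _) }
      i-e : ∃ λ i → ¬ reduce (e i) ≈ₚ 0ₚ
      i-e = dne λ none → E∉ (domain (reduce q) (reduce E) (≈-trans (reduce-cong {q ⊗ E} qE≈)
        (ideal-sum I (λ i → e i ⊗ ψ i) (λ i → ideal-*ʳ I {e i} (ψ i) (dne λ eᵢ∉ → none (i , eᵢ∉))))) q∉)
      finish : ∀ {k′} (g : Vector (Vector (Poly (suc m)) (suc m)) k′) (e : Vector (Poly (suc m)) k′) (g-log : ∀ i → A.Log (g i))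
               (i : Fin k′) → ¬ reduce (e i) ≈ₚ 0ₚ →
               (∀ u → A.Log u → ∃₂ λ d″ e″ → ∀ t → q ⊗ u t ≈ₚ SLin.lincomb d″ s t ⊕ SLin.lincomb e″ g t) →
               (∀ t → q ⊗ (E ⊗ σ t) ≈ₚ SLin.lincomb d₀ s t ⊕ SLin.lincomb e g t) →
               ∃ λ k″ → k′ ≡ suc k″ × ∃ λ (Σ′ : State (suc j) k″) → State.s Σ′ ≡ σ ◂ s
      finish {suc k″} g e g-log i eᵢ∉ spans eq = k″ , ≡.refl , record
        { s = σ ◂ s ; g = g ∘ punchIn i ; g-log = λ l → g-log (punchIn i l)
        ; q = e i ⊗ q ; q∉ = λ eq∈ → q∉ (domain (reduce (e i)) (reduce q) eq∈ eᵢ∉)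
        ; spans = λ u l → new-spans u (spans u l) } , ≡.refl
        where
        new-spans : ∀ u → (∃₂ λ d″ e″ → ∀ t → q ⊗ u t ≈ₚ SLin.lincomb d″ s t ⊕ SLin.lincomb e″ g t) →
                    ∃₂ λ d′ e′ → ∀ t → e i ⊗ q ⊗ u t ≈ₚ SLin.lincomb d′ (σ ◂ s) t ⊕ SLin.lincomb e′ (g ∘ punchIn i) t
        new-spans u (d′ , e′ , eq′) =
          (e′ i ⊗ (q ⊗ E)) ◂ (λ l → e i ⊗ d′ l ⊕ ⊝ e′ i ⊗ d₀ l) ,
          (λ l → e i ⊗ e′ (punchIn i l) ⊕ ⊝ e′ i ⊗ e (punchIn i l)) , λ t → begin
            e i ⊗ q ⊗ u t
              ≈⟨ ⊗-assoc _ _ _ ⟩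
            e i ⊗ (q ⊗ u t)
              ≈⟨ ⊗-cong ≈-refl (≈-trans (eq′ t) (⊕-cong ≈-refl (lincomb-remove i e′ g t))) ⟩
            e i ⊗ (SLin.lincomb d′ s t ⊕ (e′ i ⊗ g i t ⊕ SLin.lincomb (e′ ∘ punchIn i) (g ∘ punchIn i) t))
              ≈⟨ solve 7 (λ e D f y L D₀ L₀ → e :* (D :+ (f :* y :+ L)) := f :* (D₀ :+ (e :* y :+ L₀)) :+ (e :* D :+ (:- f) :* D₀) :+ (e :* L :+ (:- f) :* L₀)) ≈-refl
                   (e i) (SLin.lincomb d′ s t) (e′ i) (g i t) (SLin.lincomb (e′ ∘ punchIn i) (g ∘ punchIn i) t)
                   (SLin.lincomb d₀ s t) (SLin.lincomb (e ∘ punchIn i) (g ∘ punchIn i) t) ⟩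
            e′ i ⊗ (SLin.lincomb d₀ s t ⊕ (e i ⊗ g i t ⊕ SLin.lincomb (e ∘ punchIn i) (g ∘ punchIn i) t))
              ⊕ (e i ⊗ SLin.lincomb d′ s t ⊕ ⊝ e′ i ⊗ SLin.lincomb d₀ s t)
              ⊕ (e i ⊗ SLin.lincomb (e′ ∘ punchIn i) (g ∘ punchIn i) t ⊕ ⊝ e′ i ⊗ SLin.lincomb (e ∘ punchIn i) (g ∘ punchIn i) t)
              ≈⟨ ⊕-cong (⊕-cong (≈-trans (⊗-cong ≈-refl (≈-sym (≈-trans (eq t) (⊕-cong ≈-refl (lincomb-remove i e g t)))))
                     (solve 4 (λ f q E y → f :* (q :* (E :* y)) := f :* (q :* E) :* y) ≈-refl (e′ i) q E (σ t)))
                   (≈-sym (lincomb-combine (e i) d′ (⊝ e′ i) d₀ s t)))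
                   (≈-sym (lincomb-combine (e i) (e′ ∘ punchIn i) (⊝ e′ i) (e ∘ punchIn i) (g ∘ punchIn i) t)) ⟩
            e′ i ⊗ (q ⊗ E) ⊗ σ t ⊕ SLin.lincomb (λ l → e i ⊗ d′ l ⊕ ⊝ e′ i ⊗ d₀ l) s t
              ⊕ SLin.lincomb (λ l → e i ⊗ e′ (punchIn i l) ⊕ ⊝ e′ i ⊗ e (punchIn i l)) (g ∘ punchIn i) t ∎

    module _ (a : Form (suc m)) (a∈ : a ∈ₗ B.hyperplanes) where
      private
        ext-a = extract B.hyperplanes B.hyperplanes-distinct a a∈
        C = product (proj₁ ext-a)

      pole : Vector (Poly (suc m)) (suc m)
      pole t = var zero ⊗ C ⊗ con (a t)

      pole-log : B.Log pole
      pole-log = B.log (λ j → ∣-⊗ʳ (con (a (suc j))) (∣-factorˡ (var zero) C)) λ a′ a′∈ → at-a′ a′ (proj₂ (proj₂ (proj₂ ext-a)) a′ a′∈)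
        where
        at-a′ : ∀ a′ → a′ ≡ a ⊎ a′ ∈ₗ proj₁ ext-a → Parallel a′ pole
        at-a′ .a (inj₁ ≡.refl) = parallel (var zero ⊗ C) (λ _ → 0ₚ) (λ t → solve 2 (λ x l → x := x :+ l :* :0) ≈-refl (var zero ⊗ C ⊗ con (a t)) (linear a))
        at-a′ a′ (inj₂ a′∈) = parallel-∣ a′ (λ t → ∣-⊗ʳ (con (a t)) (∣-⊗ˡ (var zero) (∈⇒∣product a′∈)))

      contract-pole : ∀ w → contract w pole ≈ₚ var zero ⊗ C ⊗ sum (λ t → con (a t) ⊗ w t)
      contract-pole w = contract-⊗ w (var zero ⊗ C) (con ∘ a)

      euler-pole : contract var pole ≈ₚ Qᴮ
      euler-pole = ≈-trans (contract-pole var) (≈-trans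
        (solve 3 (λ x C l → x :* C :* l := x :* (l :* C)) ≈-refl (var zero) C (linear a)) (⊗-cong ≈-refl (≈-sym (proj₁ (proj₂ ext-a)))))

      direction-pole : ∀ l → contract (direction l) pole ≈ₚ 0ₚ
      direction-pole l = ≈-trans (contract-pole (direction l)) (≈-trans (⊗-cong ≈-refl (≈-trans (direction-form l a) (con-cong (B-b l a a∈)))) (SR.zeroʳ _))

    regular : Fin r → Vector (Poly (suc m)) (suc m)
    regular l t = Qᴮ ⊗ con ((K.0# ◂ x l) t)

    regular-log : ∀ l → B.Log (regular l)
    regular-log l = B.log (λ j → ∣-⊗ʳ _ (∣-factorˡ (var zero) B.P))
      (λ a a∈ → parallel-∣ a (λ t → ∣-⊗ʳ _ (∣-⊗ˡ (var zero) (∈⇒∣product a∈))))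

    direction-regular : ∀ l l′ → contract (direction l′) (regular l) ≈ₚ Qᴮ ⊗ con (δ l l′)
    direction-regular l l′ = ≈-trans (contract-⊗ (direction l′) Qᴮ (λ t → con ((K.0# ◂ x l) t)))
      (⊗-cong ≈-refl (≈-trans (direction-form l′ (K.0# ◂ x l)) (con-cong (dual l l′))))

    record Exchanged (n : ℕ) : Set (c ⊔ ℓ₁) where
      field
        {remaining} : ℕ
        state     : State (suc n) remaining
        count     : remaining ℕ.+ suc n ≡ k
        s-bar     : ∀ i → bar (State.s state i zero) ≈ₚ 0ₚ
        s-regular : ∀ l → n ℕ.≤ Fin.toℕ l → ∀ i → contract (direction l) (State.s state i) ≈ₚ 0ₚ

    exchanged : ∀ a → a ∈ₗ B.hyperplanes → ∀ n → n ℕ.≤ r → Exchanged n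
    exchanged a a∈ zero _ = from (exchange initial (pole a a∈) var (pole-log a a∈) euler-∣ (λ ()) (euler-pole a a∈))
      where
      from : (∃ λ k″ → k ≡ suc k″ × ∃ λ (Σ′ : State 1 k″) → State.s Σ′ ≡ pole a a∈ ◂ State.s initial) → Exchanged 0
      from (k″ , k≡ , Σ′ , s≡) = record
        { state = Σ′ ; count = ≡.trans (ℕ.+-comm k″ 1) (≡.sym k≡)
        ; s-bar = ≡.subst (λ s → ∀ i → bar (s i zero) ≈ₚ 0ₚ) (≡.sym s≡)
            (λ { zero → ≈-trans (⊗-assoc _ _ _) (SR.zeroˡ _) })
        ; s-regular = λ l _ → ≡.subst (λ s → ∀ i → contract (direction l) (s i) ≈ₚ 0ₚ) (≡.sym s≡)
            (λ { zero → direction-pole a a∈ l }) }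
    exchanged a a∈ (suc n) n<r = from (exchange (state prev) (regular l₀) (direction l₀) (regular-log l₀) (direction-∣ l₀)
        (s-regular prev l₀ (ℕ.≤-reflexive (≡.sym (Fin.toℕ-fromℕ< n<r))))
        (≈-trans (direction-regular l₀ l₀) (≈-trans (⊗-cong ≈-refl (con-cong (δ-diagonal l₀))) (SR.*-identityʳ Qᴮ))))
      where
      open Exchanged
      prev : Exchanged n
      prev = exchanged a a∈ n (ℕ.<⇒≤ n<r)
      l₀ : Fin r
      l₀ = Fin.fromℕ< n<r
      off-diagonal : ∀ {r} (i j : Fin r) → Fin.toℕ i ℕ.< Fin.toℕ j → δ i j K.≈ K.0#
      off-diagonal zero    (suc j) _         = K.refl
      off-diagonal (suc i) (suc j) (ℕ.s≤s i<j) = off-diagonal i j i<j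
      from : (∃ λ k″ → remaining prev ≡ suc k″ × ∃ λ (Σ′ : State (suc (suc n)) k″) → State.s Σ′ ≡ regular l₀ ◂ State.s (state prev)) → Exchanged (suc n)
      from (k″ , k≡ , Σ′ , s≡) = record
        { state = Σ′ ; count = ≡.trans (ℕ.+-suc k″ (suc n)) (≡.trans (≡.cong (ℕ._+ suc n) (≡.sym k≡)) (count prev))
        ; s-bar = ≡.subst (λ s → ∀ i → bar (s i zero) ≈ₚ 0ₚ) (≡.sym s≡)
            (λ { zero → SR.zeroʳ _ ; (suc i) → s-bar prev i })
        ; s-regular = λ l n<l → ≡.subst (λ s → ∀ i → contract (direction l) (s i) ≈ₚ 0ₚ) (≡.sym s≡)
            (λ { zero → ≈-trans (direction-regular l₀ l) (≈-trans (⊗-cong ≈-refl (con-cong (off-diagonal l₀ l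
                   (≡.subst (ℕ._< Fin.toℕ l) (≡.sym (Fin.toℕ-fromℕ< n<r)) n<l)))) (SR.zeroʳ Qᴮ))
               ; (suc i) → s-regular prev l (ℕ.<⇒≤ n<l) i }) }

    record GenericGenerators : Set (c ⊔ ℓ₁) where
      field
        {number}  : ℕ
        number≤2  : number ℕ.< 3
        generator : Vector (Poly m) number
        inJ       : ∀ i → B.InResidueIdeal (generator i)
        q         : Poly m
        q∉        : ¬ ρ 0 q ≈ₚ 0ₚ
        generates : ∀ f → B.InResidueIdeal f → ∃ λ (t : Vector (Poly m) number) → q ⊗ f ≈ₚ sum (λ i → t i ⊗ generator i)

    k≤ : k ℕ.≤ suc m
    k≤ = ℕ.≮⇒≥ λ m<k → impossible m<k (DomainLinearAlgebra.dependent em (S (suc m)) 1ₚ≉0ₚ domain m<k G)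
      where
      impossible : suc m ℕ.< k → (∃ λ a → SLin.lincomb a G ≋ₛ (λ _ → 0ₚ) × ∃ λ i → ¬ a i ≈ₚ 0ₚ) → ⊥
      impossible _ (a , rel , i , aᵢ≉0) = aᵢ≉0 (SLin.IsBasis.independent G-basis a rel i)

    generic-generators : m ≡ suc (suc r) → ∀ a → a ∈ₗ B.hyperplanes → GenericGenerators
    generic-generators m≡ a a∈ = record
      { number = remaining ; number≤2 = ℕ.+-cancelʳ-≤ (suc r) (suc remaining) 3 (≡.subst₂ ℕ._≤_ (≡.cong suc (≡.sym count)) (≡.cong (λ n → suc (suc n)) m≡) (ℕ.s≤s k≤))
      ; generator = λ i → quotient (residue i)
      ; inJ = λ i → B.residue∈J (Log-included (g-log i))
      ; q = bar (q ⊗ E)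
      ; q∉ = λ e → E∉ (domain (reduce q) (reduce E) e q∉)
      ; generates = generates
      }
      where
      open Exchanged (exchanged a a∈ r ℕ.≤-refl)
      open State state
      residue : ∀ i → B.Q̄ ∣ bar (g i zero)
      residue i = B.residue-exists (Log-included (g-log i))
      generates : ∀ f → B.InResidueIdeal f → ∃ λ (t : Vector (Poly m) remaining) → bar (q ⊗ E) ⊗ f ≈ₚ sum (λ i → t i ⊗ quotient (residue i))
      generates f (B.in-residue-ideal η l e) = (λ i → bar (d₂ i)) , cancelˡ B.Q̄ B.Q̄≉0 (begin
        B.Q̄ ⊗ (bar (q ⊗ E) ⊗ f)
          ≈⟨ solve 4 (λ Qᴮ q E f → Qᴮ :* (q :* E :* f) := q :* (E :* (Qᴮ :* f))) ≈-refl B.Q̄ (bar q) (bar E) f ⟩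
        bar q ⊗ (bar E ⊗ (B.Q̄ ⊗ f))
          ≈⟨ ⊗-cong ≈-refl (⊗-cong ≈-refl e) ⟩
        bar (q ⊗ (E ⊗ η zero))
          ≈⟨ bar-cong (proj₂ (proj₂ (spans (λ t → E ⊗ η t) (Log-extended l))) zero) ⟩
        bar (SLin.lincomb d₁ s zero) ⊕ bar (SLin.lincomb d₂ g zero)
          ≈⟨ ⊕-cong (≈-trans (bar-sum (λ i → d₁ i ⊗ s i zero)) (SLin.sum-0 (λ i → bar (d₁ i) ⊗ bar (s i zero)) (λ i → ≈-trans (⊗-cong ≈-refl (s-bar i)) (SR.zeroʳ _))))
               (bar-sum (λ i → d₂ i ⊗ g i zero)) ⟩
        0ₚ ⊕ sum (λ i → bar (d₂ i) ⊗ bar (g i zero))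
          ≈⟨ ⊕-identityˡ _ ⟩
        sum (λ i → bar (d₂ i) ⊗ bar (g i zero))
          ≈⟨ SLin.sum-cong (λ i → bar (d₂ i) ⊗ bar (g i zero)) (λ i → B.Q̄ ⊗ (bar (d₂ i) ⊗ quotient (residue i))) (λ i →
               ≈-trans (⊗-cong ≈-refl (equality (residue i))) (solve 3 (λ d Qᴮ r → d :* (Qᴮ :* r) := Qᴮ :* (d :* r)) ≈-refl (bar (d₂ i)) B.Q̄ (quotient (residue i)))) ⟩
        sum (λ i → B.Q̄ ⊗ (bar (d₂ i) ⊗ quotient (residue i)))
          ≈⟨ SLin.*-distribˡ-sum B.Q̄ (λ i → bar (d₂ i) ⊗ quotient (residue i)) ⟨
        B.Q̄ ⊗ sum (λ i → bar (d₂ i) ⊗ quotient (residue i)) ∎)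
        where
        d₁ = proj₁ (spans (λ t → E ⊗ η t) (Log-extended l))
        d₂ = proj₁ (proj₂ (spans (λ t → E ⊗ η t) (Log-extended l)))

  monomial : ∀ {n} → ℕ → Poly (suc n) → Poly (suc n)
  monomial zero    f = f
  monomial (suc d) f = var zero ⊗ monomial d f

  module _ {n : ℕ} where
    monomial-cong : ∀ d {f g : Poly (suc n)} → f ≈ₚ g → monomial d f ≈ₚ monomial d g
    monomial-cong zero    e = e
    monomial-cong (suc d) e = ⊗-cong ≈-refl (monomial-cong d e)

    monomial-⊕ : ∀ d (f g : Poly (suc n)) → monomial d (f ⊕ g) ≈ₚ monomial d f ⊕ monomial d g
    monomial-⊕ zero    f g = ≈-refl
    monomial-⊕ (suc d) f g = ≈-trans (⊗-cong ≈-refl (monomial-⊕ d f g)) (distribˡ _ _ _)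

    monomial-⊗ : ∀ d (f g : Poly (suc n)) → monomial d (f ⊗ g) ≈ₚ f ⊗ monomial d g
    monomial-⊗ zero    f g = ≈-refl
    monomial-⊗ (suc d) f g = ≈-trans (⊗-cong ≈-refl (monomial-⊗ d f g))
      (solve 3 (λ x f g → x :* (f :* g) := f :* (x :* g)) ≈-refl (var zero) f (monomial d g))

    monomial-0 : ∀ d {f : Poly (suc n)} → f ≈ₚ 0ₚ → monomial d f ≈ₚ 0ₚ
    monomial-0 zero    e = e
    monomial-0 (suc d) e = ≈-trans (⊗-cong ≈-refl (monomial-0 d e)) (SR.zeroʳ _)

    coeff-monomial : ∀ d (g : Poly n) → coeff d (monomial d (weaken g)) ≈ₚ g
    coeff-monomial zero    g = series-weaken g 0
    coeff-monomial (suc d) g = ≈-trans (coeff-suc-⊗ d (monomial d (weaken g))) (coeff-monomial d g)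

    coeff-monomial-≢ : ∀ e d (g : Poly n) → ¬ e ≡ d → coeff e (monomial d (weaken g)) ≈ₚ 0ₚ
    coeff-monomial-≢ zero    zero    g ne = contradiction ≡.refl ne
    coeff-monomial-≢ (suc e) zero    g ne = series-weaken g (suc e)
    coeff-monomial-≢ zero    (suc d) g ne = coeff-zero-⊗ (monomial d (weaken g))
    coeff-monomial-≢ (suc e) (suc d) g ne = ≈-trans (coeff-suc-⊗ e (monomial d (weaken g))) (coeff-monomial-≢ e d g (ne ∘ ≡.cong suc))

    private
      module T = PowerSeries (S (suc n))
      module Serⁿ = PowerSeries (S n)

      monomial-*ˢ : ∀ p q d → ((λ i → monomial i (p i)) T.*ˢ (λ i → monomial i (q i))) d ≈ₚ monomial d ((p T.*ˢ q) d)
      monomial-*ˢ p q zero    = ≈-refl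
      monomial-*ˢ p q (suc d) = ≈-trans (⊕-cong (≈-sym (monomial-⊗ (suc d) (p 0) (q (suc d))))
          (≈-trans (T.·ˢ-*ˢ (var zero) (λ i → monomial i (p (suc i))) (λ i → monomial i (q i)) d)
            (⊗-cong ≈-refl (monomial-*ˢ (p ∘ suc) q d))))
        (≈-sym (monomial-⊕ (suc d) (p 0 ⊗ q (suc d)) ((T.tail p T.*ˢ q) d)))

      scale : Fin (suc n) → Poly (suc (suc n))
      scale = (var zero ⊗ var (suc zero)) ◂ λ i → var (suc (suc i))

      monomial-const : ∀ (f : Poly n) d → T.const (weaken f) d ≈ₚ monomial d (weaken (Serⁿ.const f d))
      monomial-const f zero    = ≈-refl
      monomial-const f (suc d) = ≈-sym (monomial-0 (suc d) {0ₚ} ≈-refl)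

      coeff-scale : ∀ d f → coeff d (substitute scale f) ≈ₚ monomial d (weaken (coeff d f))
      coeff-scale d (con a) = monomial-const (con a) d
      coeff-scale zero (var zero) = coeff-zero-⊗ (var (suc zero))
      coeff-scale (suc zero) (var zero) = ≈-trans (coeff-suc-⊗ 0 (var (suc zero))) (solve 1 (λ x → x := x :* :1) ≈-refl (var zero))
      coeff-scale (suc (suc d)) (var zero) = ≈-trans (coeff-suc-⊗ (suc d) (var (suc zero))) (≈-sym (monomial-0 (suc (suc d)) {0ₚ} ≈-refl))
      coeff-scale d (var (suc i)) = monomial-const (var i) d
      coeff-scale d (f ⊕ g) = ≈-trans (⊕-cong (coeff-scale d f) (coeff-scale d g)) (≈-sym (monomial-⊕ d _ _))
      coeff-scale d (f ⊗ g) = ≈-trans (T.*ˢ-cong (λ i → coeff-scale i f) (λ i → coeff-scale i g) d)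
        (≈-trans (monomial-*ˢ (λ i → weaken (coeff i f)) (λ i → weaken (coeff i g)) d)
          (monomial-cong d (≈-sym (substitute-*ˢ (var ∘ suc) (series f) (series g) d))))
      coeff-scale d (⊝ f) = ≈-trans (⊝-cong (coeff-scale d f)) (≈-trans (solve 1 (λ x → :- x := (:- :1) :* x) ≈-refl _)
        (≈-trans (≈-sym (monomial-⊗ d (⊝ 1ₚ) (weaken (coeff d f)))) (monomial-cong d (solve 1 (λ x → (:- :1) :* x := :- x) ≈-refl _))))

    homogenize-degree-part : ∀ d (f : Poly n) → substitute homogenize (degree-part d f) ≈ₚ monomial d (weaken (degree-part d f))
    homogenize-degree-part d f = ≈-trans (≈-sym (coeff-ext homogenize d (substitute homogenize f)))
      (≈-trans (coeff-cong d (substitute-agree (ext homogenize) homogenize scale homogenize (λ i → ≈-sym (⊗-assoc _ _ _)) f))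
        (coeff-scale d (substitute homogenize f)))

    degree-part-idem : ∀ d (f : Poly n) → degree-part d (degree-part d f) ≈ₚ degree-part d f
    degree-part-idem d f = ≈-trans (coeff-cong d (homogenize-degree-part d f)) (coeff-monomial d (degree-part d f))

    degree-part-≢ : ∀ e d (f : Poly n) → ¬ e ≡ d → degree-part e (degree-part d f) ≈ₚ 0ₚ
    degree-part-≢ e d f ne = ≈-trans (coeff-cong e (homogenize-degree-part d f)) (coeff-monomial-≢ e d (degree-part d f) ne)

  component*-1 : ∀ {n r} (x : Vector (Form n) r) b e → component* x b e (λ _ → 0) 1ₚ ≈ₚ 1ₚ
  component*-1 {r = zero}  x b e = ≈-refl
  component*-1 {r = suc r} x b e = component*-1 (x ∘ suc) (b ∘ suc) (e ∘ suc)

  -- J is homogeneous and invariant under translation along the center, so generators can be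
  -- chosen among its elements that are constant along the center, in two variables.
  module Generators {m r} (b : Vector (Point m) r) (x : Vector (Form m) r) (dual : ∀ i j → x i · b j K.≈ δ i j)
                    (α β : Form m) (αb : ∀ j → α · b j K.≈ K.0#) (βb : ∀ j → β · b j K.≈ K.0#)
                    (kernel⊆ : ∀ f → Center.ρ b x dual 0 f ≈ₚ 0ₚ → member ⟪ linear α , linear β ⟫ f)
                    (B : Configuration m) (B-b : ∀ j a → a ∈ₗ Configuration.hyperplanes B → tail a · b j K.≈ K.0#)
                    {number : ℕ} (number<3 : number ℕ.< 3) (g : Vector (Poly m) number)
                    (g∈J : ∀ i → Configurations.InResidueIdeal B (g i)) (q : Poly m) (q∉ : ¬ Center.ρ b x dual 0 q ≈ₚ 0ₚ)
                    (generates : ∀ f → Configurations.InResidueIdeal B f → ∃ λ (t : Vector (Poly m) number) → q ⊗ f ≈ₚ sum (λ i → t i ⊗ g i)) where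
    open Center b x dual
    open Configurations B using (InResidueIdeal; J)

    𝔪J : Ideal (S m) (c ⊔ ℓ₁)
    𝔪J = record
      { member = λ f → ∃₂ λ u v → InResidueIdeal u × InResidueIdeal v × f ≈ₚ linear α ⊗ u ⊕ linear β ⊗ v
      ; resp = λ { e (u , v , u∈ , v∈ , eq) → u , v , u∈ , v∈ , ≈-trans (≈-sym e) eq }
      ; 0-closed = 0ₚ , 0ₚ , Ideal.0-closed J , Ideal.0-closed J , solve 2 (λ a b → :0 := a :* :0 :+ b :* :0) ≈-refl (linear α) (linear β)
      ; +-closed = λ { (u , v , u∈ , v∈ , eq) (u′ , v′ , u′∈ , v′∈ , eq′) → u ⊕ u′ , v ⊕ v′ , Ideal.+-closed J u∈ u′∈ , Ideal.+-closed J v∈ v′∈ ,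
          ≈-trans (⊕-cong eq eq′) (solve 6 (λ a b u v w y → (a :* u :+ b :* v) :+ (a :* w :+ b :* y) := a :* (u :+ w) :+ b :* (v :+ y)) ≈-refl
            (linear α) (linear β) u v u′ v′) }
      ; *-closed = λ { s (u , v , u∈ , v∈ , eq) → s ⊗ u , s ⊗ v , Ideal.*-closed J s u∈ , Ideal.*-closed J s v∈ ,
          ≈-trans (⊗-cong ≈-refl eq) (solve 5 (λ s a b u v → s :* (a :* u :+ b :* v) := a :* (s :* u) :+ b :* (s :* v)) ≈-refl s (linear α) (linear β) u v) }
      }

    kernel⊗J : ∀ {f} h → ρ 0 f ≈ₚ 0ₚ → InResidueIdeal h → member 𝔪J (f ⊗ h)
    kernel⊗J {f} h ρf≈0 h∈J = from (kernel⊆ f ρf≈0)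
      where
      from : member ⟪ linear α , linear β ⟫ f → member 𝔪J (f ⊗ h)
      from (s , t , eq) = s ⊗ h , t ⊗ h , Ideal.*-closed J s h∈J , Ideal.*-closed J t h∈J , ≈-trans (⊗-cong eq ≈-refl)
        (solve 5 (λ s t a b h → (s :* a :+ t :* b) :* h := a :* (s :* h) :+ b :* (t :* h)) ≈-refl s t (linear α) (linear β) h)

    linear-flat : ∀ γ → (∀ j → γ · b j K.≈ K.0#) → AllFlat (linear γ)
    linear-flat γ γb j = Flattening.flatten-fixes (x j) (b j) γ (γb j)

    Λ-𝔪J : ∀ ν f → member 𝔪J f → member 𝔪J (Λ ν f)
    Λ-𝔪J ν f (u , v , u∈ , v∈ , eq) = Λ ν u , Λ ν v , Λ-stable B B-b ν u∈ , Λ-stable B B-b ν v∈ , (begin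
      Λ ν f                                         ≈⟨ component*-cong x b x·b≈1 ν eq ⟩
      Λ ν (linear α ⊗ u ⊕ linear β ⊗ v)             ≈⟨ component*-⊕ x b x·b≈1 ν (linear α ⊗ u) (linear β ⊗ v) ⟩
      Λ ν (linear α ⊗ u) ⊕ Λ ν (linear β ⊗ v)       ≈⟨ ⊕-cong (Λ-constant ν u (linear-flat α αb)) (Λ-constant ν v (linear-flat β βb)) ⟩
      linear α ⊗ Λ ν u ⊕ linear β ⊗ Λ ν v           ∎)

    Λ-sum : ∀ ν {k} (f : Vector (Poly m) k) → Λ ν (sum f) ≈ₚ sum (λ i → Λ ν (f i))
    Λ-sum ν {zero}  f = ≈-trans (component*-cong x b x·b≈1 ν (≈-sym (SR.zeroˡ 1ₚ))) (≈-trans (Λ-constant ν 1ₚ (λ j → ≈-refl)) (SR.zeroˡ _))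
    Λ-sum ν {suc k} f = ≈-trans (component*-⊕ x b x·b≈1 ν (f zero) (sum (f ∘ suc))) (⊕-cong ≈-refl (Λ-sum ν (f ∘ suc)))

    -- Nakayama: J / 𝔪J has at most two generators that are constant along the center.
    relation : ∀ (f : Vector (Poly m) 3) → (∀ i → InResidueIdeal (f i)) → (∀ i → AllFlat (f i)) →
               ∃ λ (a : Vector K.Carrier 3) → (∃ λ i → ¬ a i K.≈ K.0#) × member 𝔪J (sum (λ i → con (a i) ⊗ f i))
    relation f f∈J f-flat = from (DomainLinearAlgebra.dependent em (S r) 1ₚ≉0ₚ domain number<3 (λ i l → ρ 0 (t i l)))
      where
      t : Vector (Vector (Poly m) number) 3
      t i = proj₁ (generates (f i) (f∈J i))
      from : (∃ λ p → SLin.lincomb p (λ i l → ρ 0 (t i l)) ≋ₛ (λ _ → 0ₚ) × ∃ λ i → ¬ p i ≈ₚ 0ₚ) →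
             ∃ λ (a : Vector K.Carrier 3) → (∃ λ i → ¬ a i K.≈ K.0#) × member 𝔪J (sum (λ i → con (a i) ⊗ f i))
      from (p , rel , i₀ , p≉0) = from-ν (nonVanishing (u i₀) (λ e → p≉0 (domain (ρ 0 q) (p i₀)
          (≈-trans (⊗-cong ≈-refl (≈-sym (ρ-section (p i₀)))) e) q∉)))
        where
        u : Vector (Poly m) 3
        u i = q ⊗ section (p i)
        u-relation : member 𝔪J (sum (λ i → u i ⊗ f i))
        u-relation = Ideal.resp 𝔪J (≈-sym (begin
          sum (λ i → u i ⊗ f i)
            ≈⟨ SLin.sum-cong (λ i → u i ⊗ f i) (λ i → section (p i) ⊗ sum (λ l → t i l ⊗ g l)) (λ i → ≈-trans
                 (solve 3 (λ q s f → q :* s :* f := s :* (q :* f)) ≈-refl q (section (p i)) (f i))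
                 (⊗-cong ≈-refl (proj₂ (generates (f i) (f∈J i))))) ⟩
          sum (λ i → section (p i) ⊗ sum (λ l → t i l ⊗ g l))
            ≈⟨ SLin.lincomb-assoc (λ i → section (p i)) t (λ l (_ : Fin 1) → g l) zero ⟩
          sum (λ l → SLin.lincomb (λ i → section (p i)) t l ⊗ g l) ∎))
          (ideal-sum 𝔪J (λ l → SLin.lincomb (λ i → section (p i)) t l ⊗ g l) λ l → kernel⊗J (g l) (begin
            ρ 0 (SLin.lincomb (λ i → section (p i)) t l)
              ≈⟨ substitute-sum (ρ-var 0) (λ i → section (p i) ⊗ t i l) ⟩
            sum (λ i → ρ 0 (section (p i)) ⊗ ρ 0 (t i l))
              ≈⟨ SLin.sum-cong (λ i → ρ 0 (section (p i)) ⊗ ρ 0 (t i l)) (λ i → p i ⊗ ρ 0 (t i l)) (λ i → ⊗-cong (ρ-section (p i)) ≈-refl) ⟩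
            sum (λ i → p i ⊗ ρ 0 (t i l))
              ≈⟨ rel l ⟩
            0ₚ ∎) (g∈J l))
        from-ν : (∃ λ ν → ¬ value origin (Λ ν (u i₀)) K.≈ K.0#) →
                 ∃ λ (a : Vector K.Carrier 3) → (∃ λ i → ¬ a i K.≈ K.0#) × member 𝔪J (sum (λ i → con (a i) ⊗ f i))
        from-ν (ν , a≉0) = a , (i₀ , a≉0) , Ideal.resp 𝔪J (begin
            sum (λ i → w i ⊗ f i) ⊕ ⊝ sum (λ i → (w i ⊕ ⊝ con (a i)) ⊗ f i)
              ≈⟨ ⊕-cong (≈-trans (SLin.sum-cong (λ i → w i ⊗ f i) (λ i → con (a i) ⊗ f i ⊕ (w i ⊕ ⊝ con (a i)) ⊗ f i) (λ i →
                   solve 3 (λ w a f → w :* f := a :* f :+ (w :- a) :* f) ≈-refl (w i) (con (a i)) (f i)))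
                   (SLin.∑-distrib-+ (λ i → con (a i) ⊗ f i) (λ i → (w i ⊕ ⊝ con (a i)) ⊗ f i))) ≈-refl ⟩
            (sum (λ i → con (a i) ⊗ f i) ⊕ sum (λ i → (w i ⊕ ⊝ con (a i)) ⊗ f i)) ⊕ ⊝ sum (λ i → (w i ⊕ ⊝ con (a i)) ⊗ f i)
              ≈⟨ solve 2 (λ x y → (x :+ y) :- y := x) ≈-refl (sum (λ i → con (a i) ⊗ f i)) (sum (λ i → (w i ⊕ ⊝ con (a i)) ⊗ f i)) ⟩
            sum (λ i → con (a i) ⊗ f i) ∎)
          (ideal-⊖ 𝔪J {sum (λ i → w i ⊗ f i)} {sum (λ i → (w i ⊕ ⊝ con (a i)) ⊗ f i)}
            (Ideal.resp 𝔪J (≈-trans (Λ-sum ν (λ i → u i ⊗ f i)) (SLin.sum-cong (λ i → Λ ν (u i ⊗ f i)) (λ i → w i ⊗ f i) (λ i →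
                ≈-trans (component*-cong x b x·b≈1 ν (⊗-comm (u i) (f i))) (≈-trans (Λ-constant ν (u i) (f-flat i)) (⊗-comm _ _)))))
              (Λ-𝔪J ν (sum (λ i → u i ⊗ f i)) u-relation))
            (ideal-sum 𝔪J (λ i → (w i ⊕ ⊝ con (a i)) ⊗ f i) (λ i → kernel⊗J (f i)
              (≈-trans (⊕-cong (ρ-flat (Λ-flat ν (u i))) ≈-refl) (SR.-‿inverseʳ _)) (f∈J i))))
          where
          w : Vector (Poly m) 3
          w i = Λ ν (u i)
          a : Vector K.Carrier 3
          a i = value origin (w i)

    record Homogeneous (f : Poly m) : Set (c ⊔ ℓ₁) where
      constructor homogeneous
      field
        inJ  : InResidueIdeal f
        flat : AllFlat f
        part : ∀ e → degree-part e f ≈ₚ f ⊎ degree-part e f ≈ₚ 0ₚ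

    open Homogeneous

    private
      0-homogeneous : Homogeneous 0ₚ
      0-homogeneous = homogeneous (Ideal.0-closed J) (λ j → ≈-refl) (λ { zero → inj₁ ≈-refl ; (suc e) → inj₂ ≈-refl })

      Spanned : Poly m → Poly m → Set (c ⊔ ℓ₁)
      Spanned f₁ f₂ = ∀ f → Homogeneous f → ∃₂ λ s t → member 𝔪J (f ⊕ ⊝ (con s ⊗ f₁ ⊕ con t ⊗ f₂))

      divide-by : ∀ {a} → ¬ a K.≈ K.0# → ∀ {f} → member 𝔪J (con a ⊗ f) → member 𝔪J f
      divide-by {a} a≉0 {f} p = Ideal.resp 𝔪J (≈-trans (≈-sym (⊗-assoc _ _ _)) (≈-trans (⊗-cong (≈-trans (≈-sym (con-* _ _)) (con-cong (proj₂ (inverse a≉0)))) ≈-refl) (⊗-identityˡ f)))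
        (Ideal.*-closed 𝔪J (con (proj₁ (inverse a≉0))) p)

      generators : ∃₂ λ f₁ f₂ → Homogeneous f₁ × Homogeneous f₂ × Spanned f₁ f₂
      generators = first em
        where
        first : Dec (∃ λ f → Homogeneous f × ¬ member 𝔪J f) → ∃₂ λ f₁ f₂ → Homogeneous f₁ × Homogeneous f₂ × Spanned f₁ f₂
        first (no none) = 0ₚ , 0ₚ , 0-homogeneous , 0-homogeneous , λ f hf → K.0# , K.0# ,
          Ideal.resp 𝔪J (solve 1 (λ f → f := f :- (:0 :* :0 :+ :0 :* :0)) ≈-refl f) (dne λ f∉ → none (f , hf , f∉))
        first (yes (f₁ , h₁ , f₁∉)) = second em
          where
          second : Dec (∃ λ f → Homogeneous f × ¬ (∃ λ s → member 𝔪J (f ⊕ ⊝ (con s ⊗ f₁)))) →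
                   ∃₂ λ f₁ f₂ → Homogeneous f₁ × Homogeneous f₂ × Spanned f₁ f₂
          second (no none) = f₁ , 0ₚ , h₁ , 0-homogeneous , λ f hf → one f (dne λ f∉ → none (f , hf , f∉))
            where
            one : ∀ f → (∃ λ s → member 𝔪J (f ⊕ ⊝ (con s ⊗ f₁))) → ∃₂ λ s t → member 𝔪J (f ⊕ ⊝ (con s ⊗ f₁ ⊕ con t ⊗ 0ₚ))
            one f (s , p) = s , K.0# , Ideal.resp 𝔪J (solve 3 (λ f s g → f :- s :* g := f :- (s :* g :+ :0 :* :0)) ≈-refl f (con s) f₁) p
          second (yes (f₂ , h₂ , f₂∉)) = f₁ , f₂ , h₁ , h₂ , λ f hf → two f (relation (fs f)
              (λ { zero → inJ hf ; (suc zero) → inJ h₁ ; (suc (suc zero)) → inJ h₂ })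
              (λ { zero → flat hf ; (suc zero) → flat h₁ ; (suc (suc zero)) → flat h₂ }))
            where
            fs : Poly m → Vector (Poly m) 3
            fs f = f ◂ (f₁ ◂ λ _ → f₂)
            two : ∀ f → (∃ λ (a : Vector K.Carrier 3) → (∃ λ i → ¬ a i K.≈ K.0#) × member 𝔪J (sum (λ i → con (a i) ⊗ fs f i))) →
                  ∃₂ λ s t → member 𝔪J (f ⊕ ⊝ (con s ⊗ f₁ ⊕ con t ⊗ f₂))
            two f (a , (i , aᵢ≉0) , p) = s , t , divide-by a₀≉0 (Ideal.resp 𝔪J (begin
                sum (λ i → con (a i) ⊗ fs f i)
                  ≈⟨ solve 6 (λ a b c f g h → a :* f :+ (b :* g :+ (c :* h :+ :0)) := a :* f :- ((:- b) :* g :+ (:- c) :* h)) ≈-refl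
                       (con a₀) (con a₁) (con a₂) f f₁ f₂ ⟩
                con a₀ ⊗ f ⊕ ⊝ (⊝ con a₁ ⊗ f₁ ⊕ ⊝ con a₂ ⊗ f₂)
                  ≈⟨ ⊕-cong ≈-refl (⊝-cong (⊕-cong (⊗-cong (undo a₁) ≈-refl) (⊗-cong (undo a₂) ≈-refl))) ⟩
                con a₀ ⊗ f ⊕ ⊝ (con a₀ ⊗ con s ⊗ f₁ ⊕ con a₀ ⊗ con t ⊗ f₂)
                  ≈⟨ solve 6 (λ a s t f g h → a :* f :- (a :* s :* g :+ a :* t :* h) := a :* (f :- (s :* g :+ t :* h))) ≈-refl (con a₀) (con s) (con t) f f₁ f₂ ⟩
                con a₀ ⊗ (f ⊕ ⊝ (con s ⊗ f₁ ⊕ con t ⊗ f₂)) ∎) p)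
              where
              a₀ = a zero
              a₁ = a (suc zero)
              a₂ = a (suc (suc zero))
              a₀≉0 : ¬ a₀ K.≈ K.0#
              a₀≉0 a₀≈0 = a₂-case em
                where
                p′ : member 𝔪J (con a₁ ⊗ f₁ ⊕ con a₂ ⊗ f₂)
                p′ = Ideal.resp 𝔪J (≈-trans (⊕-cong (⊗-cong (con-cong a₀≈0) ≈-refl) ≈-refl)
                  (solve 5 (λ b c f g h → :0 :* f :+ (b :* g :+ (c :* h :+ :0)) := b :* g :+ c :* h) ≈-refl (con a₁) (con a₂) f f₁ f₂)) p
                a₂-case : Dec (a₂ K.≈ K.0#) → ⊥
                a₂-case (no a₂≉0) = f₂∉ (K.- (proj₁ (inverse a₂≉0) K.* a₁) , divide-by a₂≉0 (Ideal.resp 𝔪J (begin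
                    con a₁ ⊗ f₁ ⊕ con a₂ ⊗ f₂
                      ≈⟨ solve 4 (λ x g y h → x :* g :+ y :* h := y :* h :- (:- x) :* g) ≈-refl (con a₁) f₁ (con a₂) f₂ ⟩
                    con a₂ ⊗ f₂ ⊕ ⊝ (⊝ con a₁ ⊗ f₁)
                      ≈⟨ ⊕-cong ≈-refl (⊝-cong (⊗-cong (≈-trans (≈-sym (con-⊝ a₁)) (≈-trans (con-cong (K.trans
                           (K.-‿cong (K.sym (K.trans (K.*-congʳ (proj₂ (inverse a₂≉0))) (K.*-identityˡ a₁))))
                           (solveᴷ 3 (λ i a b → ⊟ (i ⊠ a ⊠ b) ≔ a ⊠ (⊟ (i ⊠ b))) K.refl (proj₁ (inverse a₂≉0)) a₂ a₁))) (con-* _ _))) ≈-refl)) ⟩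
                    con a₂ ⊗ f₂ ⊕ ⊝ (con a₂ ⊗ con (K.- (proj₁ (inverse a₂≉0) K.* a₁)) ⊗ f₁)
                      ≈⟨ solve 4 (λ y h s g → y :* h :- y :* s :* g := y :* (h :- s :* g)) ≈-refl (con a₂) f₂ (con (K.- (proj₁ (inverse a₂≉0) K.* a₁))) f₁ ⟩
                    con a₂ ⊗ (f₂ ⊕ ⊝ (con (K.- (proj₁ (inverse a₂≉0) K.* a₁)) ⊗ f₁)) ∎) p′))
                a₂-case (yes a₂≈0) = f₁∉ (divide-by a₁≉0 (Ideal.resp 𝔪J (≈-trans (⊕-cong ≈-refl (⊗-cong (con-cong a₂≈0) ≈-refl))
                    (solve 3 (λ b g h → b :* g :+ :0 :* h := b :* g) ≈-refl (con a₁) f₁ f₂)) p′))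
                  where
                  nonzero-index : ∀ i → ¬ a i K.≈ K.0# → ¬ a₁ K.≈ K.0#
                  nonzero-index zero             ≉0 = contradiction a₀≈0 ≉0
                  nonzero-index (suc zero)       ≉0 = ≉0
                  nonzero-index (suc (suc zero)) ≉0 = contradiction a₂≈0 ≉0
                  a₁≉0 = nonzero-index i aᵢ≉0
              a₀⁻¹ = proj₁ (inverse a₀≉0)
              s t : K.Carrier
              s = K.- (a₀⁻¹ K.* a₁)
              t = K.- (a₀⁻¹ K.* a₂)
              undo : ∀ y → ⊝ con y ≈ₚ con a₀ ⊗ con (K.- (a₀⁻¹ K.* y))
              undo y = ≈-trans (≈-sym (con-⊝ y)) (≈-trans (con-cong (K.trans
                (K.-‿cong (K.sym (K.trans (K.*-congʳ (proj₂ (inverse a₀≉0))) (K.*-identityˡ y))))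
                (solveᴷ 3 (λ i a b → ⊟ (i ⊠ a ⊠ b) ≔ a ⊠ (⊟ (i ⊠ b))) K.refl a₀⁻¹ a₀ y))) (con-* _ _))

    two-generators : ∃₂ λ f₁ f₂ → InResidueIdeal f₁ × InResidueIdeal f₂ × (∀ f → InResidueIdeal f → member ⟪ f₁ , f₂ ⟫ f)
    two-generators = from generators
      where
      from : (∃₂ λ f₁ f₂ → Homogeneous f₁ × Homogeneous f₂ × Spanned f₁ f₂) →
             ∃₂ λ f₁ f₂ → InResidueIdeal f₁ × InResidueIdeal f₂ × (∀ f → InResidueIdeal f → member ⟪ f₁ , f₂ ⟫ f)
      from (f₁ , f₂ , h₁ , h₂ , spanned) = f₁ , f₂ , inJ h₁ , inJ h₂ , λ f f∈J →
          Λ-in-ideal I f λ ν → degree-parts-in-ideal I (Λ ν f) λ d → graded d (Λ ν f) (Λ-stable B B-b ν f∈J) (Λ-flat ν f)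
        where
        I = ⟪ f₁ , f₂ ⟫
        f₁∈I : member I f₁
        f₁∈I = 1ₚ , 0ₚ , solve 2 (λ f g → f := :1 :* f :+ :0 :* g) ≈-refl f₁ f₂
        f₂∈I : member I f₂
        f₂∈I = 0ₚ , 1ₚ , solve 2 (λ f g → g := :0 :* f :+ :1 :* g) ≈-refl f₁ f₂
        part∈I : ∀ d {f} → member I f → degree-part d f ≈ₚ f ⊎ degree-part d f ≈ₚ 0ₚ → member I (degree-part d f)
        part∈I d {f} f∈I (inj₁ e) = Ideal.resp I {f} (≈-sym e) f∈I
        part∈I d     f∈I (inj₂ e) = Ideal.resp I {0ₚ} (≈-sym e) (Ideal.0-closed I)

        graded : ∀ d f → InResidueIdeal f → AllFlat f → member I (degree-part d f)
        graded-pred : ∀ d f → InResidueIdeal f → AllFlat f → member I (degree-part-pred d f)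
        graded-pred zero    f f∈J flat = Ideal.0-closed I
        graded-pred (suc d) f f∈J flat = graded d f f∈J flat
        graded d f f∈J f-flat = conclude (spanned h h-homogeneous)
          where
          h = degree-part d f
          part-h : ∀ e → Dec (e ≡ d) → degree-part e h ≈ₚ h ⊎ degree-part e h ≈ₚ 0ₚ
          part-h .d (yes ≡.refl) = inj₁ (degree-part-idem d f)
          part-h e  (no e≢d)     = inj₂ (degree-part-≢ e d f e≢d)
          h-homogeneous : Homogeneous h
          h-homogeneous = homogeneous (StableOperator.stable (degree-part-stable B d) f∈J)
            (λ j → Flattening.degree-part-flat (x j) (b j) d (f-flat j)) (λ e → part-h e (e ℕ.≟ d))
          Λ₀ : Poly m → Poly m
          Λ₀ = Λ (λ _ → 0)
          conclude : (∃₂ λ s t → member 𝔪J (h ⊕ ⊝ (con s ⊗ f₁ ⊕ con t ⊗ f₂))) → member I h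
          conclude (s , t , u , v , u∈ , v∈ , eq) = Ideal.resp I h≈
            (Ideal.+-closed I (Ideal.+-closed I (Ideal.*-closed I (con s) (part∈I d f₁∈I (part h₁ d)))
                                                (Ideal.*-closed I (con t) (part∈I d f₂∈I (part h₂ d))))
              (Ideal.+-closed I (Ideal.*-closed I (linear α) (graded-pred d (Λ₀ u) (Λ-stable B B-b (λ _ → 0) u∈) (Λ-flat (λ _ → 0) u)))
                                (Ideal.*-closed I (linear β) (graded-pred d (Λ₀ v) (Λ-stable B B-b (λ _ → 0) v∈) (Λ-flat (λ _ → 0) v)))))
            where
            rest = con s ⊗ f₁ ⊕ con t ⊗ f₂
            rest-flat : AllFlat (h ⊕ ⊝ rest)
            rest-flat j = ⊕-cong (flat h-homogeneous j) (⊝-cong (⊕-cong (⊗-cong ≈-refl (flat h₁ j)) (⊗-cong ≈-refl (flat h₂ j))))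
            eq₀ : h ⊕ ⊝ rest ≈ₚ linear α ⊗ Λ₀ u ⊕ linear β ⊗ Λ₀ v
            eq₀ = begin
              h ⊕ ⊝ rest
                ≈⟨ solve 1 (λ x → x := x :* :1) ≈-refl (h ⊕ ⊝ rest) ⟩
              (h ⊕ ⊝ rest) ⊗ 1ₚ
                ≈⟨ ⊗-cong ≈-refl (component*-1 x b x·b≈1) ⟨
              (h ⊕ ⊝ rest) ⊗ Λ₀ 1ₚ
                ≈⟨ Λ-constant (λ _ → 0) 1ₚ rest-flat ⟨
              Λ₀ ((h ⊕ ⊝ rest) ⊗ 1ₚ)
                ≈⟨ component*-cong x b x·b≈1 (λ _ → 0) (≈-trans (solve 1 (λ x → x :* :1 := x) ≈-refl (h ⊕ ⊝ rest)) eq) ⟩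
              Λ₀ (linear α ⊗ u ⊕ linear β ⊗ v)
                ≈⟨ component*-⊕ x b x·b≈1 (λ _ → 0) (linear α ⊗ u) (linear β ⊗ v) ⟩
              Λ₀ (linear α ⊗ u) ⊕ Λ₀ (linear β ⊗ v)
                ≈⟨ ⊕-cong (Λ-constant (λ _ → 0) u (linear-flat α αb)) (Λ-constant (λ _ → 0) v (linear-flat β βb)) ⟩
              linear α ⊗ Λ₀ u ⊕ linear β ⊗ Λ₀ v ∎
            h≈ : (con s ⊗ degree-part d f₁ ⊕ con t ⊗ degree-part d f₂) ⊕ (linear α ⊗ degree-part-pred d (Λ₀ u) ⊕ linear β ⊗ degree-part-pred d (Λ₀ v)) ≈ₚ h
            h≈ = ≈-sym (begin
              h
                ≈⟨ degree-part-idem d f ⟨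
              degree-part d h
                ≈⟨ degree-part-cong d {h} {rest ⊕ (linear α ⊗ Λ₀ u ⊕ linear β ⊗ Λ₀ v)} (≈-trans (solve 2 (λ h r → h := r :+ (h :- r)) ≈-refl h rest) (⊕-cong (≈-refl {f = rest}) eq₀)) ⟩
              (degree-part d (con s ⊗ f₁) ⊕ degree-part d (con t ⊗ f₂)) ⊕ (degree-part d (linear α ⊗ Λ₀ u) ⊕ degree-part d (linear β ⊗ Λ₀ v))
                ≈⟨ ⊕-cong (⊕-cong (coeff-con-⊗ d s (substitute homogenize f₁)) (coeff-con-⊗ d t (substitute homogenize f₂)))
                     (⊕-cong (degree-part-linear d α (Λ₀ u)) (degree-part-linear d β (Λ₀ v))) ⟩
              (con s ⊗ degree-part d f₁ ⊕ con t ⊗ degree-part d f₂) ⊕ (linear α ⊗ degree-part-pred d (Λ₀ u) ⊕ linear β ⊗ degree-part-pred d (Λ₀ v)) ∎)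

  InBox : ∀ n → ℕ → Poly n → Set (c ⊔ ℓ₁)
  InBox zero    D f = Lift _ ⊤
  InBox (suc n) D f = Bounded D (series f) × (∀ d → InBox n D (coeff d f))

  box-resp : ∀ {n} D {f g : Poly n} → f ≈ₚ g → InBox n D f → InBox n D g
  box-resp {zero}  D e p       = p
  box-resp {suc n} D {f} {g} e (b , p) = (λ d → ≈-trans (≈-sym (coeff-cong (D ℕ.+ d) e)) (b d)) , λ d → box-resp D (coeff-cong d e) (p d)

  box-0 : ∀ n D → InBox n D 0ₚ
  box-0 zero    D = lift tt
  box-0 (suc n) D = (λ d → const-0 (D ℕ.+ d)) , λ d → box-resp D (≈-sym (const-0 d)) (box-0 n D)
    where
    const-0 : ∀ d → const {n} 0ₚ d ≈ₚ 0ₚ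
    const-0 zero    = ≈-refl
    const-0 (suc d) = ≈-refl

  box-≤ : ∀ {n D E} {f : Poly n} → D ℕ.≤ E → InBox n D f → InBox n E f
  box-≤ {zero}  D≤E p       = p
  box-≤ {suc n} {f = f} D≤E (b , p) = Bounded-≤ {p = series f} D≤E b , λ d → box-≤ D≤E (p d)

  box-⊕ : ∀ {n D} {f g : Poly n} → InBox n D f → InBox n D g → InBox n D (f ⊕ g)
  box-⊕ {zero}  _ _ = lift tt
  box-⊕ {suc n} (b , p) (b′ , p′) = (λ d → ≈-trans (⊕-cong (b d) (b′ d)) (⊕-identityˡ _)) , λ d → box-⊕ (p d) (p′ d)

  box-⊝ : ∀ {n D} {f : Poly n} → InBox n D f → InBox n D (⊝ f)
  box-⊝ {zero}  _ = lift tt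
  box-⊝ {suc n} (b , p) = (λ d → ≈-trans (⊝-cong (b d)) -0#≈0#) , λ d → box-⊝ (p d)

  box-⊗ : ∀ {n D E} {f g : Poly n} → InBox n D f → InBox n E g → InBox n (D ℕ.+ E) (f ⊗ g)
  box-⊗ {zero}  _ _ = lift tt
  box-⊗ {suc n} {D} {E} {f} {g} (b , p) (b′ , p′) = PowerSeries.Bounded-* (S n) D E (series f) (series g) b b′ , coeffs (series f) (series g) p p′
    where
    coeffs : ∀ u v → (∀ d → InBox n D (u d)) → (∀ d → InBox n E (v d)) → ∀ d → InBox n (D ℕ.+ E) ((u *ˢ v) d)
    coeffs u v p p′ zero    = box-⊗ (p 0) (p′ 0)
    coeffs u v p p′ (suc d) = box-⊕ (box-⊗ (p 0) (p′ (suc d))) (coeffs (u ∘ suc) v (p ∘ suc) p′ d)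

  box-con : ∀ n a → InBox n 1 (con a)
  box-con zero    a = lift tt
  box-con (suc n) a = (λ d → ≈-refl) , λ { zero → box-con n a ; (suc d) → box-0 n 1 }

  box-var : ∀ {n} (i : Fin n) → InBox n 2 (var i)
  box-var {suc n} zero    = (λ d → ≈-refl) ,
    λ { zero → box-0 n 2 ; (suc zero) → box-≤ (ℕ.s≤s ℕ.z≤n) (box-con n K.1#) ; (suc (suc d)) → box-0 n 2 }
  box-var {suc n} (suc i) = (λ d → ≈-refl) , λ { zero → box-var i ; (suc d) → box-0 n 2 }

  box-exists : ∀ {n} (f : Poly n) → ∃ λ D → InBox n D f
  box-exists {n} (con a) = 1 , box-con n a
  box-exists (var i) = 2 , box-var i
  box-exists (f ⊕ g) = proj₁ (box-exists f) ℕ.+ proj₁ (box-exists g) ,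
    box-⊕ (box-≤ (ℕ.m≤m+n _ _) (proj₂ (box-exists f))) (box-≤ (ℕ.m≤n+m _ _) (proj₂ (box-exists g)))
  box-exists (f ⊗ g) = proj₁ (box-exists f) ℕ.+ proj₁ (box-exists g) , box-⊗ (proj₂ (box-exists f)) (proj₂ (box-exists g))
  box-exists (⊝ f)   = proj₁ (box-exists f) , box-⊝ (proj₂ (box-exists f))

  box-coordinates : ∀ n D → Poly n → Fin (D ℕ.^ n) → K.Carrier
  box-coordinates zero    D f _ = value origin f
  box-coordinates (suc n) D f j = box-coordinates n D (coeff (Fin.toℕ (proj₁ (Fin.remQuot {D} (D ℕ.^ n) j))) f) (proj₂ (Fin.remQuot {D} (D ℕ.^ n) j))

  module _ (D : ℕ) where
    box-coordinates-cong : ∀ n {f g : Poly n} → f ≈ₚ g → ∀ j → box-coordinates n D f j K.≈ box-coordinates n D g j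
    box-coordinates-cong zero    e j = value-cong origin e
    box-coordinates-cong (suc n) e j = box-coordinates-cong n (coeff-cong (Fin.toℕ (proj₁ (Fin.remQuot {D} (D ℕ.^ n) j))) e) (proj₂ (Fin.remQuot {D} (D ℕ.^ n) j))

    box-coordinates-combination : ∀ n {k} (a : Vector K.Carrier k) (f : Vector (Poly n) k) j →
      box-coordinates n D (sum (λ i → con (a i) ⊗ f i)) j K.≈ KLin.sum (λ i → a i K.* box-coordinates n D (f i) j)
    box-coordinates-combination zero a f j = value-combination a f
      where
      value-combination : ∀ {k} (a : Vector K.Carrier k) (f : Vector (Poly 0) k) →
        value origin (sum (λ i → con (a i) ⊗ f i)) K.≈ KLin.sum (λ i → a i K.* value origin (f i))
      value-combination {zero}  a f = K.refl
      value-combination {suc k} a f = K.+-congˡ (value-combination (a ∘ suc) (f ∘ suc))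
    box-coordinates-combination (suc n) a f j = K.trans
      (box-coordinates-cong n (coeff-combination (Fin.toℕ (proj₁ (Fin.remQuot {D} (D ℕ.^ n) j))) a f) (proj₂ (Fin.remQuot {D} (D ℕ.^ n) j)))
      (box-coordinates-combination n a (λ i → coeff (Fin.toℕ (proj₁ (Fin.remQuot {D} (D ℕ.^ n) j))) (f i)) (proj₂ (Fin.remQuot {D} (D ℕ.^ n) j)))
      where
      coeff-combination : ∀ d {k} (a : Vector K.Carrier k) (f : Vector (Poly (suc n)) k) →
        coeff d (sum (λ i → con (a i) ⊗ f i)) ≈ₚ sum (λ i → con (a i) ⊗ coeff d (f i))
      coeff-combination d {zero}  a f = const-0 d
        where
        const-0 : ∀ d → const {n} 0ₚ d ≈ₚ 0ₚ
        const-0 zero    = ≈-refl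
        const-0 (suc d) = ≈-refl
      coeff-combination d {suc k} a f = ⊕-cong (coeff-con-⊗ d (a zero) (f zero)) (coeff-combination d (a ∘ suc) (f ∘ suc))

    box-coordinates-injective : ∀ n {f : Poly n} → InBox n D f → (∀ j → box-coordinates n D f j K.≈ K.0#) → f ≈ₚ 0ₚ
    box-coordinates-injective zero {f} _ e = ≈-trans (con-value origin f) (con-cong (e zero))
    box-coordinates-injective (suc n) {f} (b , p) e = coeff-injective f λ d → by-size d (d ℕ.<? D)
      where
      by-size : ∀ d → Dec (d ℕ.< D) → coeff d f ≈ₚ 0ₚ
      by-size d (yes d<D) = box-coordinates-injective n (p d) λ j → ≡.subst₂ (λ d j → box-coordinates n D (coeff d f) j K.≈ K.0#)
        (≡.trans (≡.cong (Fin.toℕ ∘ proj₁) (Fin.remQuot-combine (Fin.fromℕ< d<D) j)) (Fin.toℕ-fromℕ< d<D))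
        (≡.cong proj₂ (Fin.remQuot-combine (Fin.fromℕ< d<D) j))
        (e (Fin.combine (Fin.fromℕ< d<D) j))
      by-size d (no d≮D) = ≡.subst (λ d → coeff d f ≈ₚ 0ₚ) (ℕ.m+[n∸m]≡n (ℕ.≮⇒≥ d≮D)) (b (d ℕ.∸ D))

  box-monomial : ∀ N k → Fin (N ℕ.^ k) → Poly k
  box-monomial N zero    j = 1ₚ
  box-monomial N (suc k) j = monomial (Fin.toℕ (proj₁ (Fin.remQuot {N} (N ℕ.^ k) j))) (weaken (box-monomial N k (proj₂ (Fin.remQuot {N} (N ℕ.^ k) j))))

  box-coordinates-0 : ∀ D n j → box-coordinates n D 0ₚ j K.≈ K.0#
  box-coordinates-0 D n = box-coordinates-combination D n {0} (λ ()) (λ ())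

  box-monomial-coordinates : ∀ N k i j → (i ≡ j → box-coordinates k N (box-monomial N k i) j K.≈ K.1#) ×
                                         (¬ i ≡ j → box-coordinates k N (box-monomial N k i) j K.≈ K.0#)
  box-monomial-coordinates N zero zero zero = (λ _ → K.refl) , λ ne → contradiction ≡.refl ne
  box-monomial-coordinates N (suc k) i j = same , different
    where
    rq : Fin (N ℕ.* N ℕ.^ k) → Fin N × Fin (N ℕ.^ k)
    rq = Fin.remQuot {N} (N ℕ.^ k)
    M = box-monomial N k (proj₂ (rq i))
    same : i ≡ j → box-coordinates k N (coeff (Fin.toℕ (proj₁ (rq j))) (monomial (Fin.toℕ (proj₁ (rq i))) (weaken M))) (proj₂ (rq j)) K.≈ K.1#
    same ≡.refl = K.trans (box-coordinates-cong N k (coeff-monomial (Fin.toℕ (proj₁ (rq i))) M) (proj₂ (rq i)))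
      (proj₁ (box-monomial-coordinates N k (proj₂ (rq i)) (proj₂ (rq i))) ≡.refl)
    different : ¬ i ≡ j → box-coordinates k N (coeff (Fin.toℕ (proj₁ (rq j))) (monomial (Fin.toℕ (proj₁ (rq i))) (weaken M))) (proj₂ (rq j)) K.≈ K.0#
    different i≢j = by-exponent (proj₁ (rq j) Fin.≟ proj₁ (rq i))
      where
      by-exponent : Dec (proj₁ (rq j) ≡ proj₁ (rq i)) →
        box-coordinates k N (coeff (Fin.toℕ (proj₁ (rq j))) (monomial (Fin.toℕ (proj₁ (rq i))) (weaken M))) (proj₂ (rq j)) K.≈ K.0#
      by-exponent (yes e) = K.trans (box-coordinates-cong N k (≡.subst (λ t → coeff (Fin.toℕ t) (monomial (Fin.toℕ (proj₁ (rq i))) (weaken M)) ≈ₚ M) (≡.sym e)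
          (coeff-monomial (Fin.toℕ (proj₁ (rq i))) M)) (proj₂ (rq j)))
        (proj₂ (box-monomial-coordinates N k (proj₂ (rq i)) (proj₂ (rq j))) λ e′ → i≢j (≡.trans (≡.sym (Fin.combine-remQuot {N} (N ℕ.^ k) i))
          (≡.trans (≡.cong₂ Fin.combine (≡.sym e) e′) (Fin.combine-remQuot {N} (N ℕ.^ k) j))))
      by-exponent (no ne) = K.trans (box-coordinates-cong N k (coeff-monomial-≢ (Fin.toℕ (proj₁ (rq j))) (Fin.toℕ (proj₁ (rq i))) M (ne ∘ Fin.toℕ-injective)) (proj₂ (rq j)))
        (box-coordinates-0 N k (proj₂ (rq j)))

  δ-≡ : ∀ {k} {i j : Fin k} → i ≡ j → δ i j K.≈ K.1#
  δ-≡ {i = i} ≡.refl = δ-diagonal i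

  δ-≢ : ∀ {k} {i j : Fin k} → ¬ i ≡ j → δ i j K.≈ K.0#
  δ-≢ {i = zero}  {zero}  ne = contradiction ≡.refl ne
  δ-≢ {i = zero}  {suc j} ne = K.refl
  δ-≢ {i = suc i} {zero}  ne = K.refl
  δ-≢ {i = suc i} {suc j} ne = δ-≢ (ne ∘ ≡.cong suc)

  box-monomials-independent : ∀ N k (a : Vector K.Carrier (N ℕ.^ k)) → sum (λ i → con (a i) ⊗ box-monomial N k i) ≈ₚ 0ₚ → ∀ i → a i K.≈ K.0#
  box-monomials-independent N k a e j = K.trans (K.sym (KLin.sum-δʳ j a)) (K.trans
    (KLin.sum-cong (λ i → a i K.* δ i j) (λ i → a i K.* box-coordinates k N (box-monomial N k i) j) (λ i → K.*-congˡ (K.sym (δ-coordinates i (i Fin.≟ j)))))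
    (K.trans (K.sym (box-coordinates-combination N k a (box-monomial N k) j)) (K.trans (box-coordinates-cong N k e j) (box-coordinates-0 N k j))))
    where
    δ-coordinates : ∀ i → Dec (i ≡ j) → box-coordinates k N (box-monomial N k i) j K.≈ δ i j
    δ-coordinates i (yes e) = K.trans (proj₁ (box-monomial-coordinates N k i j) e) (K.sym (δ-≡ e))
    δ-coordinates i (no ne) = K.trans (proj₂ (box-monomial-coordinates N k i j) ne) (K.sym (δ-≢ ne))

  substitute-monomial : ∀ {n k} (σ : Fin (suc k) → Poly n) D E d f → InBox n D (σ zero) → InBox n E (substitute σ f) →
                        InBox n (d ℕ.* D ℕ.+ E) (substitute σ (monomial d f))
  substitute-monomial σ D E zero    f p q = q
  substitute-monomial {n} σ D E (suc d) f p q = ≡.subst (λ W → InBox n W (substitute σ (monomial (suc d) f))) (≡.sym (ℕ.+-assoc D (d ℕ.* D) E))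
    (box-⊗ p (substitute-monomial σ D E d f p q))

  box-substituted : ∀ {n} D N k (σ : Fin k → Poly n) → (∀ i → InBox n D (σ i)) → ∀ j →
                    InBox n (k ℕ.* (N ℕ.* D) ℕ.+ 1) (substitute σ (box-monomial N k j))
  box-substituted {n} D N zero    σ p j = box-con n K.1#
  box-substituted {n} D N (suc k) σ p j = box-≤
      (ℕ.≤-trans (ℕ.+-monoˡ-≤ W (ℕ.*-monoˡ-≤ D (ℕ.<⇒≤ (Fin.toℕ<n (proj₁ rq))))) (ℕ.≤-reflexive (≡.sym (ℕ.+-assoc (N ℕ.* D) (k ℕ.* (N ℕ.* D)) 1))))
    (substitute-monomial σ D W (Fin.toℕ (proj₁ rq)) (weaken M) (p zero)
      (box-resp W (≈-sym (substitute-substitute σ (var ∘ suc) M)) (box-substituted D N k (σ ∘ suc) (p ∘ suc) (proj₂ rq))))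
    where
    rq = Fin.remQuot {N} (N ℕ.^ k) j
    M = box-monomial N k (proj₂ rq)
    W = k ℕ.* (N ℕ.* D) ℕ.+ 1

  common-box : ∀ {n k} (σ : Fin k → Poly n) → ∃ λ D → ∀ i → InBox n D (σ i)
  common-box {k = zero}  σ = 0 , λ ()
  common-box {k = suc k} σ = proj₁ (box-exists (σ zero)) ℕ.+ proj₁ (common-box (σ ∘ suc)) , λ
    { zero    → box-≤ (ℕ.m≤m+n _ _) (proj₂ (box-exists (σ zero)))
    ; (suc i) → box-≤ (ℕ.m≤n+m _ _) (proj₂ (common-box (σ ∘ suc)) i) }

  AlgebraicallyIndependent : ∀ {n k} → (Fin k → Poly n) → Set (c ⊔ ℓ₁)
  AlgebraicallyIndependent σ = ∀ f → substitute σ f ≈ₚ 0ₚ → f ≈ₚ 0ₚ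

  -- There are Nᵏ monomials of degree less than N in k elements, and they lie
  -- in a space of dimension at most (N C)ⁿ, which is smaller than Nᵏ if n < k and Cⁿ < N.
  transcendence-degree : ∀ {n k} (σ : Fin k → Poly n) → AlgebraicallyIndependent σ → k ℕ.≤ n
  transcendence-degree {n} {k} σ independent = ℕ.≮⇒≥ λ n<k → contradict n<k (DomainLinearAlgebra.dependent em K 1≉0 K-domain (count n<k)
      (λ j → box-coordinates n W (substitute σ (box-monomial N k j))))
    where
    D = proj₁ (common-box σ)
    C N W : ℕ
    C = k ℕ.* D ℕ.+ 1
    N = suc (C ℕ.^ n)
    W = k ℕ.* (N ℕ.* D) ℕ.+ 1
    W≤ : W ℕ.≤ N ℕ.* C
    W≤ = ℕ.≤-trans (ℕ.+-mono-≤ (ℕ.≤-reflexive (≡.trans (≡.sym (ℕ.*-assoc k N D)) (≡.trans (≡.cong (ℕ._* D) (ℕ.*-comm k N)) (ℕ.*-assoc N k D)))) (ℕ.s≤s ℕ.z≤n))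
      (ℕ.≤-trans (ℕ.+-monoʳ-≤ (N ℕ.* (k ℕ.* D)) (ℕ.≤-reflexive (≡.sym (ℕ.*-identityʳ N)))) (ℕ.≤-reflexive (≡.sym (ℕ.*-distribˡ-+ N (k ℕ.* D) 1))))
    ^-* : ∀ n → (N ℕ.* C) ℕ.^ n ≡ N ℕ.^ n ℕ.* C ℕ.^ n
    ^-* zero    = ≡.refl
    ^-* (suc n) = ≡.trans (≡.cong (N ℕ.* C ℕ.*_) (^-* n)) (ℕ.[m*n]*[o*p]≡[m*o]*[n*p] N C (N ℕ.^ n) (C ℕ.^ n))
    count : n ℕ.< k → W ℕ.^ n ℕ.< N ℕ.^ k
    count n<k = ℕ.≤-<-trans (ℕ.^-monoˡ-≤ n W≤) (ℕ.<-≤-trans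
      (≡.subst₂ ℕ._<_ (≡.sym (^-* n)) (ℕ.*-comm (N ℕ.^ n) N) (ℕ.*-monoʳ-< (N ℕ.^ n) {{ℕ.m^n≢0 N n}} (ℕ.n<1+n (C ℕ.^ n))))
      (ℕ.^-monoʳ-≤ N n<k))
    contradict : n ℕ.< k → (∃ λ a → KLin.lincomb a (λ j → box-coordinates n W (substitute σ (box-monomial N k j))) ≋ₖ (λ _ → K.0#) × ∃ λ i → ¬ a i K.≈ K.0#) → ⊥
    contradict _ (a , rel , i , aᵢ≉0) = aᵢ≉0 (box-monomials-independent N k a (independent _
        (≈-trans (substitute-sum σ (λ j → con (a j) ⊗ box-monomial N k j)) (box-coordinates-injective W n (in-box a (λ j → substitute σ (box-monomial N k j))
          (box-substituted D N k σ (proj₂ (common-box σ))))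
          (λ j → K.trans (box-coordinates-combination W n a (λ j → substitute σ (box-monomial N k j)) j) (rel j))))) i)
      where
      in-box : ∀ {l} (a : Vector K.Carrier l) (f : Vector (Poly n) l) → (∀ j → InBox n W (f j)) → InBox n W (sum (λ j → con (a j) ⊗ f j))
      in-box {zero}  a f p = box-0 n W
      in-box {suc l} a f p = box-⊕ (scaled n (f zero) (p zero)) (in-box (a ∘ suc) (f ∘ suc) (p ∘ suc))
        where
        scaled : ∀ n f → InBox n W f → InBox n W (con (a zero) ⊗ f)
        scaled zero    f p       = lift tt
        scaled (suc n) f (b , p) =
          (λ d → ≈-trans (coeff-con-⊗ (W ℕ.+ d) (a zero) f) (≈-trans (⊗-cong ≈-refl (b d)) (SR.zeroʳ _))) ,
          λ d → box-resp W (≈-sym (coeff-con-⊗ d (a zero) f)) (scaled n (coeff d f) (p d))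

  module _ {n : ℕ} where
    open Dimension (S n) using (PrimeIdeal)
    open PrimeIdeal using (carrier)

    append : ∀ {k r} → (Fin k → Poly n) → (Fin r → Poly n) → Fin (k ℕ.+ r) → Poly n
    append {zero}  σ τ = τ
    append {suc k} σ τ = σ zero ◂ append (σ ∘ suc) τ

    module _ {r} (τ : Fin r → Poly n) where
      chain-independent : ∀ {k} (P : Fin (suc k) → PrimeIdeal) → (∀ i → carrier (P (Fin.inject₁ i)) ⊆ carrier (P (suc i))) →
        (σ : Fin k → Poly n) → (∀ i → σ i ∈ carrier (P (suc i))) → (∀ i → ¬ σ i ∈ carrier (P (Fin.inject₁ i))) →
        (∀ f → substitute τ f ∈ carrier (P (Fin.fromℕ k)) → f ≈ₚ 0ₚ) →
        ∀ f → substitute (append σ τ) f ∈ carrier (P zero) → f ≈ₚ 0ₚ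
      chain-independent {zero}  P P⊆ σ σ∈ σ∉ base f p = base f p
      chain-independent {suc k} P P⊆ σ σ∈ σ∉ base f p = coeff-injective f λ d → coefficients d f p
        where
        x = σ zero
        ρ′ = append (σ ∘ suc) τ
        IH : ∀ g → substitute ρ′ g ∈ carrier (P (suc zero)) → g ≈ₚ 0ₚ
        IH = chain-independent (P ∘ suc) (P⊆ ∘ suc) (σ ∘ suc) (σ∈ ∘ suc) (σ∉ ∘ suc) base
        module P₀ = PrimeIdeal (P zero)
        module P₁ = PrimeIdeal (P (suc zero))
        split : ∀ f → ∃ λ g → f ≈ₚ weaken (coeff 0 f) ⊕ var zero ⊗ g
        split f = horner N (λ d → series f (suc d)) , ≈-trans (proj₂ (proj₂ e)) (≈-sym (horner-bounded N (suc N) (ℕ.n≤1+n N) (proj₁ (proj₂ e))))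
          where
          e = expansion f
          N = proj₁ e
        module _ (f : Poly (suc (k ℕ.+ r))) (p : substitute (x ◂ ρ′) f ∈ carrier (P zero)) where
          g = proj₁ (split f)
          f≈ : substitute (x ◂ ρ′) f ≈ₚ substitute ρ′ (coeff 0 f) ⊕ x ⊗ substitute (x ◂ ρ′) g
          f≈ = ≈-trans (substitute-cong (x ◂ ρ′) (proj₂ (split f))) (⊕-cong (substitute-substitute (x ◂ ρ′) (var ∘ suc) (coeff 0 f)) ≈-refl)
          coeff-0 : coeff 0 f ≈ₚ 0ₚ
          coeff-0 = IH (coeff 0 f) (Ideal.resp P₁.ideal (solve 2 (λ u v → (u :+ v) :- v := u) ≈-refl (substitute ρ′ (coeff 0 f)) (x ⊗ substitute (x ◂ ρ′) g))
            (ideal-⊖ P₁.ideal (P⊆ zero (Ideal.resp P₀.ideal f≈ p)) (ideal-*ʳ P₁.ideal (substitute (x ◂ ρ′) g) (σ∈ zero))))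
          f≈xg : f ≈ₚ var zero ⊗ g
          f≈xg = ≈-trans (proj₂ (split f)) (≈-trans (⊕-cong (weaken-cong coeff-0) ≈-refl) (⊕-identityˡ _))
          g∈ : substitute (x ◂ ρ′) g ∈ carrier (P zero)
          g∈ = [ (λ x∈ → contradiction x∈ (σ∉ zero)) , id ]′ (P₀.prime x _ (Ideal.resp P₀.ideal (substitute-cong (x ◂ ρ′) f≈xg) p))
        coefficients : ∀ d f → substitute (x ◂ ρ′) f ∈ carrier (P zero) → coeff d f ≈ₚ 0ₚ
        coefficients zero    f p = coeff-0 f p
        coefficients (suc d) f p = ≈-trans (coeff-cong (suc d) (f≈xg f p)) (≈-trans (coeff-suc-⊗ d (g f p)) (coefficients d (g f p) (g∈ f p)))

      strict-chain : ∀ {k} (P : Fin (suc k) → PrimeIdeal) → (∀ i → carrier (P (Fin.inject₁ i)) ⊂ carrier (P (suc i))) →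
        (∀ f → substitute τ f ∈ carrier (P (Fin.fromℕ k)) → f ≈ₚ 0ₚ) → k ℕ.+ r ℕ.≤ n
      strict-chain {k} P P⊂ base = transcendence-degree (append σ τ) λ f e →
          chain-independent P (λ i → proj₁ (P⊂ i)) σ (λ i → proj₁ (proj₂ (witness i))) (λ i → proj₂ (proj₂ (witness i))) base f
            (Ideal.resp (PrimeIdeal.ideal (P zero)) (≈-sym e) (Ideal.0-closed (PrimeIdeal.ideal (P zero))))
        where
        witness : ∀ i → ∃ λ f → f ∈ carrier (P (suc i)) × ¬ f ∈ carrier (P (Fin.inject₁ i))
        witness i = dne λ none → proj₂ (P⊂ i) λ {f} f∈ → dne λ f∉ → none (f , f∈ , f∉)
        σ : Fin k → Poly n
        σ i = proj₁ (witness i)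

    constants-base : ∀ (P : PrimeIdeal) f → substitute {m = n} (λ ()) f ∈ carrier P → f ≈ₚ 0ₚ
    constants-base P f p = ≈-trans (con-value origin f) (con-cong (dne λ a≉0 → PrimeIdeal.proper P
      (Ideal.resp (PrimeIdeal.ideal P) (≈-trans (≈-sym (con-* _ _)) (con-cong (proj₂ (inverse a≉0))))
        (Ideal.*-closed (PrimeIdeal.ideal P) (con (proj₁ (inverse a≉0))) (Ideal.resp (PrimeIdeal.ideal P) (substitute-cong (λ ()) (con-value origin f)) p)))))

    chain-length : ∀ {k} (P : Fin (suc k) → PrimeIdeal) → (∀ i → carrier (P (Fin.inject₁ i)) ⊂ carrier (P (suc i))) → k ℕ.≤ n
    chain-length {k} P P⊂ = ≡.subst (ℕ._≤ n) (ℕ.+-identityʳ k) (strict-chain (λ ()) P P⊂ (constants-base (P (Fin.fromℕ k))))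

  module _ {n : ℕ} where
    open Dimension (S n)
    open PrimeIdeal using (carrier)

    kernelPrime : ∀ {m} → (Fin n → Poly m) → PrimeIdeal
    kernelPrime σ = record
      { ideal  = kernel σ
      ; proper = 1ₚ≉0ₚ
      ; prime  = λ f g fg≈0 → by-cases f g fg≈0 em
      }
      where
      by-cases : ∀ f g → substitute σ (f ⊗ g) ≈ₚ 0ₚ → Dec (substitute σ f ≈ₚ 0ₚ) → substitute σ f ≈ₚ 0ₚ ⊎ substitute σ g ≈ₚ 0ₚ
      by-cases f g fg≈0 (yes f≈0) = inj₁ f≈0
      by-cases f g fg≈0 (no f≉0)  = inj₂ (domain (substitute σ f) (substitute σ g) fg≈0 f≉0)

    zeroPrime : PrimeIdeal
    zeroPrime = kernelPrime var

    linear∤1 : ∀ {α : Form n} → ¬ linear α ∣ 1ₚ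
    linear∤1 {α} (q , eq) = 1≉0 (K.trans (value-cong origin eq) (K.trans (K.*-congʳ (K.trans (value-linear α origin)
      (K.trans (·-comm α origin) (KLin.sum-0 (λ i → K.0# K.* α i) (λ i → K.zeroˡ _))))) (K.zeroˡ _)))

    linearPrime : (α : Form n) → NonZero α → PrimeIdeal
    linearPrime α α≉0 = record
      { ideal  = ⟨ linear α ⟩
      ; proper = linear∤1 {α}
      ; prime  = λ f g d → by-cases f g d em
      }
      where
      by-cases : ∀ f g → linear α ∣ f ⊗ g → Dec (linear α ∣ f) → linear α ∣ f ⊎ linear α ∣ g
      by-cases f g d (yes α∣f) = inj₁ α∣f
      by-cases f g d (no α∤f)  = inj₂ (linear-prime {α = α} {f} {g} α≉0 α∤f d)

    zero⊂linear : ∀ α (α≉0 : NonZero α) → carrier zeroPrime ⊂ carrier (linearPrime α α≉0)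
    zero⊂linear α α≉0 = (λ {f} f≈0 → ∣-0 (≈-trans (≈-sym (substitute-var f)) f≈0)) ,
      λ α⊆0 → linear-nonZero α≉0 (≈-trans (≈-sym (substitute-var (linear α))) (α⊆0 {linear α} (1ₚ , solve 1 (λ x → x := x :* :1) ≈-refl (linear α))))

    linear⊂ : ∀ α β (α≉0 : NonZero α) → ¬ linear α ∣ linear β → (P : PrimeIdeal) → linear α ∈ carrier P → linear β ∈ carrier P →
              carrier (linearPrime α α≉0) ⊂ carrier P
    linear⊂ α β α≉0 α∤β P α∈ β∈ = (λ {f} d → Ideal.resp (PrimeIdeal.ideal P) (≈-sym (equality d)) (ideal-*ʳ (PrimeIdeal.ideal P) {linear α} (quotient d) α∈)) ,
      λ P⊆ → α∤β (P⊆ β∈)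

    consecutive⇒chain : ∀ {k} (P : Fin (suc k) → PrimeIdeal) → (∀ i → carrier (P (Fin.inject₁ i)) ⊂ carrier (P (suc i))) →
                        ∀ i j → i Fin.< j → carrier (P i) ⊂ carrier (P j)
    consecutive⇒chain {suc k} P s zero    (suc zero)    _         = s zero
    consecutive⇒chain {suc k} P s zero    (suc (suc j)) _         =
      ⊂-trans {i = carrier (P zero)} {carrier (P (suc zero))} {carrier (P (suc (suc j)))} (s zero) (consecutive⇒chain (P ∘ suc) (s ∘ suc) zero (suc j) (ℕ.s≤s ℕ.z≤n))
    consecutive⇒chain {suc k} P s (suc i) (suc j) (ℕ.s≤s i<j) = consecutive⇒chain (P ∘ suc) (s ∘ suc) i j i<j

    chain⇒consecutive : ∀ {k} (P : PrimeChain k) → ∀ i → carrier (proj₁ P (Fin.inject₁ i)) ⊂ carrier (proj₁ P (suc i))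
    chain⇒consecutive P i = proj₂ P (Fin.inject₁ i) (suc i) (ℕ.s≤s (ℕ.≤-reflexive (Fin.toℕ-inject₁ i)))

  module _ {m r} (b : Vector (Point m) r) (x : Vector (Form m) r) (dual : ∀ i j → x i · b j K.≈ δ i j) (m≡ : m ≡ suc (suc r))
           (α β : Form m) (α≉0 : NonZero α) (α∤β : ¬ linear α ∣ linear β)
           (αb : ∀ j → α · b j K.≈ K.0#) (βb : ∀ j → β · b j K.≈ K.0#)
           (I : Ideal (S m) (c ⊔ ℓ₁))
           (I⊆ : ∀ f → member I f → Center.ρ b x dual 0 f ≈ₚ 0ₚ)
           (primes : ∀ (P : Dimension.PrimeIdeal (S m)) → member I ⊆ Dimension.PrimeIdeal.carrier P →
                     ∀ f → Center.ρ b x dual 0 f ≈ₚ 0ₚ → Dimension.PrimeIdeal.carrier P f) where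
    open Center b x dual
    open Dimension (S m)
    open PrimeIdeal using (carrier)
    private
      center : ℕ → PrimeIdeal
      center k = kernelPrime (ρ-var k)

      center-⊆ : ∀ k k′ → k ℕ.≤ k′ → ∀ f → ρ k f ≈ₚ 0ₚ → ρ k′ f ≈ₚ 0ₚ
      center-⊆ k k′ k≤k′ f e = ≈-trans (≈-sym (≈-trans (substitute-substitute τ (ρ-var k) f) (substitute-≈ at-var f))) (substitute-cong τ e)
        where
        τ : Fin r → Poly r
        τ j = con (mask k′ j) ⊗ var j
        at-var : ∀ i → substitute τ (ρ-var k i) ≈ₚ ρ-var k′ i
        at-var i = ≈-trans (substitute-linear τ (λ j → mask k j K.* b j i))
          (SLin.sum-cong (λ j → con (mask k j K.* b j i) ⊗ τ j) (λ j → con (mask k′ j K.* b j i) ⊗ var j) (λ j →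
            ≈-trans (≈-sym (⊗-assoc _ _ _)) (⊗-cong (≈-trans (≈-sym (con-* _ _)) (con-cong (K.trans
              (solveᴷ 3 (λ u v w → u ⊠ v ⊠ w ≔ u ⊠ w ⊠ v) K.refl (mask k j) (b j i) (mask k′ j)) (K.*-congʳ (mask-≤ k k′ j k≤k′))))) ≈-refl)))

      center-⊂ : ∀ k k′ → k ℕ.< k′ → k′ ℕ.≤ r → carrier (center k) ⊂ carrier (center k′)
      center-⊂ k k′ k<k′ k′≤r = (λ {f} → center-⊆ k k′ (ℕ.<⇒≤ k<k′) f) , λ ⊆ → 1≉0 (K.trans (K.sym value-at-j) (K.trans
          (value-cong (δ j) (≈-trans (≈-sym (ρ-linear k (x j))) (⊆ {linear (x j)} at-k′))) K.refl))
        where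
        j : Fin r
        j = Fin.fromℕ< (ℕ.<-≤-trans k<k′ k′≤r)
        toℕ-j : Fin.toℕ j ≡ k
        toℕ-j = Fin.toℕ-fromℕ< (ℕ.<-≤-trans k<k′ k′≤r)
        at-k′ : ρ k′ (linear (x j)) ≈ₚ 0ₚ
        at-k′ = ≈-trans (ρ-linear k′ (x j)) (linear-0 (λ l → K.trans (K.*-congˡ (dual j l)) (masked l (j Fin.≟ l))))
          where
          masked : ∀ l → Dec (j ≡ l) → mask k′ l K.* δ j l K.≈ K.0#
          masked l (yes ≡.refl) = K.trans (K.*-congʳ (mask-< k′ j (≡.subst (ℕ._< k′) (≡.sym toℕ-j) k<k′))) (K.zeroˡ _)
          masked l (no j≢l)     = K.trans (K.*-congˡ (δ-≢ j≢l)) (K.zeroʳ _)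
        value-at-j : value (δ j) (linear (λ l → mask k l K.* (x j · b l))) K.≈ K.1#
        value-at-j = K.trans (value-linear (λ l → mask k l K.* (x j · b l)) (δ j)) (K.trans (·-δ (λ l → mask k l K.* (x j · b l)) j)
          (K.trans (K.*-cong (mask-≥ k j (ℕ.≤-reflexive (≡.sym toℕ-j))) (x·b≈1 j)) (K.*-identityˡ _)))

      m-2≤ : ∀ {k} → suc (suc k) ℕ.≤ m → k ℕ.≤ r
      m-2≤ le = ℕ.≤-pred (ℕ.≤-pred (≡.subst (_ ℕ.≤_) m≡ le))

      chain-below : (P : PrimeIdeal) → linear α ∈ carrier P → linear β ∈ carrier P → PrimeChainBelow P 2
      chain-below P α∈ β∈ = (chain , consecutive⇒chain chain
          (λ { zero → zero⊂linear α α≉0 ; (suc zero) → linear⊂ α β α≉0 α∤β P α∈ β∈ })) , (λ p → p) , (λ p → p)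
        where
        chain : Fin 3 → PrimeIdeal
        chain = zeroPrime ◂ (linearPrime α α≉0 ◂ λ _ → P)

      α∈ : ∀ P → member I ⊆ carrier P → linear α ∈ carrier P
      α∈ P I⊆P = primes P I⊆P (linear α) (ρ-vanishing 0 α αb)

      β∈ : ∀ P → member I ⊆ carrier P → linear β ∈ carrier P
      β∈ P I⊆P = primes P I⊆P (linear β) (ρ-vanishing 0 β βb)

    height-two : HasHeight I 2
    height-two = (center 0 , (λ {f} → I⊆ f) , chain-below (center 0) (ρ-vanishing 0 α αb) (ρ-vanishing 0 β βb) , bound) ,
      λ P k I⊆P h → proj₂ h 2 (chain-below P (α∈ P I⊆P) (β∈ P I⊆P))
      where
      bound : ∀ k → PrimeChainBelow (center 0) k → k ℕ.≤ 2
      bound k (P , last⊆ , _) = ℕ.+-cancelʳ-≤ r k 2 (≡.subst (k ℕ.+ r ℕ.≤_) m≡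
        (strict-chain (λ j → linear (x j)) (proj₁ P) (chain⇒consecutive P) (λ f p → ≈-trans (≈-sym (ρ-section f)) (last⊆ {section f} p))))

    -- The quotient ring enters only through its congruence, so that no proofs of
    -- the ring laws are compared when the ring is instantiated with quotientRing.
    module _ {_~_ : Poly m → Poly m → Set (c ⊔ ℓ₁)} (isCommutativeRing : IsCommutativeRing _~_ _⊕_ _⊗_ ⊝_ 0ₚ 1ₚ)
             (~⇒∈ : ∀ {f g} → f ~ g → member I (f ⊕ ⊝ g)) (∈⇒~ : ∀ {f g} → member I (f ⊕ ⊝ g) → f ~ g) where
      private
        quotient-ring : CommutativeRing c (c ⊔ ℓ₁)
        quotient-ring = record { isCommutativeRing = isCommutativeRing }
        module Quot = Dimension quotient-ring

        toQuotient : (P : PrimeIdeal) → member I ⊆ carrier P → Quot.PrimeIdeal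
        toQuotient P I⊆P = record
          { ideal  = record
            { member   = carrier P
            ; resp     = λ {f} {g} f~g f∈ → Ideal.resp P.ideal (solve 2 (λ f g → f :- (f :- g) := g) ≈-refl f g) (ideal-⊖ P.ideal f∈ (I⊆P (~⇒∈ f~g)))
            ; 0-closed = Ideal.0-closed P.ideal
            ; +-closed = Ideal.+-closed P.ideal
            ; *-closed = Ideal.*-closed P.ideal }
          ; proper = P.proper
          ; prime  = P.prime }
          where module P = PrimeIdeal P

        fromQuotient : Quot.PrimeIdeal → PrimeIdeal
        fromQuotient P = record
          { ideal  = record
            { member   = Quot.PrimeIdeal.carrier P
            ; resp     = λ f≈g → Ideal.resp P.ideal (∈⇒~ (Ideal.resp I (≈-sym (≈-trans (⊕-cong f≈g ≈-refl) (SR.-‿inverseʳ _))) (Ideal.0-closed I)))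
            ; 0-closed = Ideal.0-closed P.ideal
            ; +-closed = Ideal.+-closed P.ideal
            ; *-closed = Ideal.*-closed P.ideal }
          ; proper = P.proper
          ; prime  = P.prime }
          where module P = Quot.PrimeIdeal P

        I⊆fromQuotient : ∀ P → member I ⊆ carrier (fromQuotient P)
        I⊆fromQuotient P {f} f∈I = Ideal.resp (Quot.PrimeIdeal.ideal P) {0ₚ} {f}
          (∈⇒~ (Ideal.resp I (solve 1 (λ f → (:- :1) :* f := :0 :- f) ≈-refl f) (Ideal.*-closed I (⊝ 1ₚ) f∈I))) (Ideal.0-closed (Quot.PrimeIdeal.ideal P))

      quotient-dimension : Quot.HasKrullDimension r
      quotient-dimension = ((λ i → toQuotient (center (Fin.toℕ i)) (λ {f} f∈I → center-⊆ 0 (Fin.toℕ i) ℕ.z≤n f (I⊆ f f∈I))) ,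
          λ i j i<j → center-⊂ (Fin.toℕ i) (Fin.toℕ j) i<j (ℕ.≤-pred (Fin.toℕ<n j))) ,
        λ k P → m-2≤ (chain-length (chain P) (strict P))
        where
        chain : ∀ {k} → Quot.PrimeChain k → Fin (suc (suc (suc k))) → PrimeIdeal
        chain P = zeroPrime ◂ (linearPrime α α≉0 ◂ (fromQuotient ∘ proj₁ P))
        strict : ∀ {k} (P : Quot.PrimeChain k) i → carrier (chain P (Fin.inject₁ i)) ⊂ carrier (chain P (suc i))
        strict P zero          = zero⊂linear α α≉0
        strict P (suc zero)    = linear⊂ α β α≉0 α∤β (fromQuotient (proj₁ P zero))
          (α∈ (fromQuotient (proj₁ P zero)) (I⊆fromQuotient (proj₁ P zero))) (β∈ (fromQuotient (proj₁ P zero)) (I⊆fromQuotient (proj₁ P zero)))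
        strict P (suc (suc i)) = proj₂ P (Fin.inject₁ i) (suc i) (ℕ.s≤s (ℕ.≤-reflexive (Fin.toℕ-inject₁ i)))

  con-δ : ∀ {n k} (i j : Fin k) → con {n} (δ i j) ≈ₚ SLin.δ i j
  con-δ zero    zero    = ≈-refl
  con-δ zero    (suc j) = ≈-refl
  con-δ (suc i) zero    = ≈-refl
  con-δ (suc i) (suc j) = con-δ i j

  con-lincomb : ∀ {p k n} (a : Vector K.Carrier k) (b : Vector (Vector K.Carrier n) k) j →
                SLin.lincomb {p} (con ∘ a) (λ i → con ∘ b i) j ≈ₚ con (KLin.lincomb a b j)
  con-lincomb a b j = ≈-sym (≈-trans (con-sum (λ i → a i K.* b i j))
    (SLin.sum-cong (λ i → con (a i K.* b i j)) (λ i → con (a i) ⊗ con (b i j)) (λ i → con-* _ _)))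

  wedge⇒parallel : ∀ {n} {α : Form n} {η} → NonZero α → (η ∧ d α) ∈ linear α Ω² → Parallel α η
  wedge⇒parallel {α = α} {η} α≉0 (τ , eq) = minor-parallel α p αₚ≉0 λ j → at-j j (Fin.<-cmp p j)
    where
    p = proj₁ (nonZero-coordinate {α = α} α≉0)
    αₚ≉0 = proj₂ (nonZero-coordinate {α = α} α≉0)
    at-j : ∀ j → Tri (p Fin.< j) (p ≡ j) (j Fin.< p) → linear α ∣ minor α η p j
    at-j j (tri< p<j _ _) = ⊝ τ p j p<j , (begin
      con (α p) ⊗ η j ⊕ ⊝ (con (α j) ⊗ η p)
        ≈⟨ solve 4 (λ a b x y → a :* x :- b :* y := :- (y :* b :- x :* a)) ≈-refl (con (α p)) (con (α j)) (η j) (η p) ⟩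
      ⊝ (η p ⊗ con (α j) ⊕ ⊝ (η j ⊗ con (α p)))
        ≈⟨ ⊝-cong (eq p j p<j) ⟩
      ⊝ (linear α ⊗ τ p j p<j)
        ≈⟨ solve 2 (λ l t → :- (l :* t) := l :* (:- t)) ≈-refl (linear α) (τ p j p<j) ⟩
      linear α ⊗ ⊝ τ p j p<j ∎)
    at-j j (tri≈ _ ≡.refl _) = ∣-0 (SR.-‿inverseʳ _)
    at-j j (tri> _ _ j<p) = τ j p j<p , ≈-trans
      (solve 4 (λ a b x y → a :* x :- b :* y := x :* a :- y :* b) ≈-refl (con (α p)) (con (α j)) (η j) (η p)) (eq j p j<p)

  parallel⇒wedge : ∀ {n} {α : Form n} {η} → Parallel α η → (η ∧ d α) ∈ linear α Ω²
  parallel⇒wedge {α = α} {η} η∥α = (λ i j _ → quotient (parallel-minor α η∥α j i)) , λ i j _ → ≈-trans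
    (solve 4 (λ a b x y → x :* a :- y :* b := a :* x :- b :* y) ≈-refl (con (α j)) (con (α i)) (η i) (η j)) (equality (parallel-minor α η∥α j i))

  -- Coordinates adapted to H

  -- σ substitutes linear forms for the variables, and M expresses the old differentials in the new ones.
  module Change {n} (σ : Fin n → Poly n) (M : Vector (Vector K.Carrier n) n) where
    change : Vector (Poly n) n → Vector (Poly n) n
    change η j = substitute σ (SLin.lincomb η (λ i → con ∘ M i) j)

    change-cong : ∀ {η ζ} → η ≋ₛ ζ → change η ≋ₛ change ζ
    change-cong {η} {ζ} e j = substitute-cong σ (SLin.lincomb-congˡ η ζ (λ i → con ∘ M i) e j)

    change-expand : ∀ η → change η ≋ₛ SLin.lincomb (substitute σ ∘ η) (λ i → con ∘ M i)
    change-expand η j = substitute-sum σ (λ i → η i ⊗ con (M i j))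

    change-lincomb : ∀ {k} (a : Vector (Poly n) k) b → change (SLin.lincomb a b) ≋ₛ SLin.lincomb (substitute σ ∘ a) (change ∘ b)
    change-lincomb a b j = ≈-trans (substitute-cong σ (≈-sym (SLin.lincomb-assoc a b (λ i → con ∘ M i) j)))
      (substitute-sum σ (λ i → a i ⊗ SLin.lincomb (b i) (λ i → con ∘ M i) j))

    change-parallel : ∀ {α α′ η} → substitute σ (linear α) ≈ₚ linear α′ → α′ ≋ₖ KLin.lincomb α M → Parallel α η → Parallel α′ (change η)
    change-parallel {α} {α′} {η} σα≈ α′≈ (parallel k z eq) = parallel (substitute σ k) (change z) λ j → begin
      change η j
        ≈⟨ change-cong eq j ⟩
      substitute σ (SLin.lincomb (λ i → k ⊗ con (α i) ⊕ linear α ⊗ z i) (λ i → con ∘ M i) j)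
        ≈⟨ substitute-cong σ (lincomb-combine k (con ∘ α) (linear α) z (λ i → con ∘ M i) j) ⟩
      substitute σ k ⊗ substitute σ (SLin.lincomb (con ∘ α) (λ i → con ∘ M i) j) ⊕ substitute σ (linear α) ⊗ change z j
        ≈⟨ ⊕-cong (⊗-cong ≈-refl (substitute-cong σ (≈-trans (con-lincomb α M j) (con-cong (K.sym (α′≈ j)))))) (⊗-cong σα≈ ≈-refl) ⟩
      substitute σ k ⊗ con (α′ j) ⊕ linear α′ ⊗ change z j ∎

  change-inverse : ∀ {n} (σ τ : Fin n → Poly n) (M N : Vector (Vector K.Carrier n) n) →
    (∀ f → substitute σ (substitute τ f) ≈ₚ f) → (∀ k → KLin.lincomb (N k) M ≋ₖ δ k) →
    ∀ η → Change.change σ M (Change.change τ N η) ≋ₛ η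
  change-inverse σ τ M N στ NM η j = begin
    substitute σ (SLin.lincomb (Change.change τ N η) (λ i → con ∘ M i) j)
      ≈⟨ Change.change-cong σ M (Change.change-expand τ N η) j ⟩
    substitute σ (SLin.lincomb (SLin.lincomb (substitute τ ∘ η) (λ i → con ∘ N i)) (λ i → con ∘ M i) j)
      ≈⟨ substitute-cong σ (SLin.lincomb-assoc (substitute τ ∘ η) (λ i → con ∘ N i) (λ i → con ∘ M i) j) ⟨
    substitute σ (SLin.lincomb (substitute τ ∘ η) (λ k → SLin.lincomb (con ∘ N k) (λ i → con ∘ M i)) j)
      ≈⟨ substitute-cong σ (SLin.lincomb-congʳ (substitute τ ∘ η) (λ k → SLin.lincomb (con ∘ N k) (λ i → con ∘ M i)) SLin.δ
           (λ k j → ≈-trans (con-lincomb (N k) M j) (≈-trans (con-cong (NM k j)) (con-δ k j))) j) ⟩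
    substitute σ (sum (λ k → substitute τ (η k) ⊗ SLin.δ k j))
      ≈⟨ substitute-cong σ (SLin.sum-δʳ j (substitute τ ∘ η)) ⟩
    substitute σ (substitute τ (η j))
      ≈⟨ στ (η j) ⟩
    η j ∎

  module _ {n} (σ τ : Fin n → Poly n) (M N : Vector (Vector K.Carrier n) n)
           (στ : ∀ f → substitute σ (substitute τ f) ≈ₚ f) (τσ : ∀ f → substitute τ (substitute σ f) ≈ₚ f)
           (NM : ∀ k → KLin.lincomb (N k) M ≋ₖ δ k) (MN : ∀ k → KLin.lincomb (M k) N ≋ₖ δ k)
           {p q} {P : Pred (Vector (Poly n) n) p} {P′ : Pred (Vector (Poly n) n) q} where
    private
      module To = Change σ M
      module From = Change τ N

    change-basis : (∀ {η} → P η → P′ (To.change η)) → (∀ {η} → P′ η → P (From.change η)) →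
                   ∀ {k} {b : Vector (Vector (Poly n) n) k} → SLin.IsBasis P b → SLin.IsBasis P′ (To.change ∘ b)
    change-basis to from {b = b} B = record
      { inside      = λ i → to (B.inside i)
      ; independent = λ a rel i → ≈-trans (≈-sym (στ (a i))) (substitute-cong σ (B.independent (substitute τ ∘ a) (λ j → begin
          SLin.lincomb (substitute τ ∘ a) b j
            ≈⟨ SLin.lincomb-congʳ (substitute τ ∘ a) (From.change ∘ To.change ∘ b) b (λ i → change-inverse τ σ N M τσ MN (b i)) j ⟨
          SLin.lincomb (substitute τ ∘ a) (From.change ∘ To.change ∘ b) j
            ≈⟨ From.change-lincomb a (To.change ∘ b) j ⟨
          From.change (SLin.lincomb a (To.change ∘ b)) j
            ≈⟨ From.change-cong {SLin.lincomb a (To.change ∘ b)} {λ _ → 0ₚ} rel j ⟩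
          From.change (λ _ → 0ₚ) j
            ≈⟨ ≈-trans (From.change-expand (λ _ → 0ₚ) j) (SLin.lincomb-0 (λ _ → 0ₚ) (λ i → con ∘ N i) (λ _ → ≈-refl) j) ⟩
          0ₚ ∎) i))
      ; spanning    = λ v v∈ → substitute σ ∘ proj₁ (B.spanning (From.change v) (from v∈)) , λ j → begin
          v j
            ≈⟨ change-inverse σ τ M N στ NM v j ⟨
          To.change (From.change v) j
            ≈⟨ To.change-cong (proj₂ (B.spanning (From.change v) (from v∈))) j ⟩
          To.change (SLin.lincomb (proj₁ (B.spanning (From.change v) (from v∈))) b) j
            ≈⟨ To.change-lincomb (proj₁ (B.spanning (From.change v) (from v∈))) b j ⟩
          SLin.lincomb (substitute σ ∘ proj₁ (B.spanning (From.change v) (from v∈))) (To.change ∘ b) j ∎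
      }
      where module B = SLin.IsBasis B

  basis-≐ : ∀ {n k p q} {P : Pred (Vector (Poly n) n) p} {P′ : Pred (Vector (Poly n) n) q} {b : Vector (Vector (Poly n) n) k} →
            (∀ {η} → P η → P′ η) → (∀ {η} → P′ η → P η) → SLin.IsBasis P b → SLin.IsBasis P′ b
  basis-≐ to from B = record { inside = λ i → to (B.inside i) ; independent = B.independent ; spanning = λ v v∈ → B.spanning v (from v∈) }
    where module B = SLin.IsBasis B

  -- The coordinates of Kᵐ⁺¹ in which α_H is the first coordinate.
  module Coordinates {m} (αH : Form (suc m)) (α′ : Vector (Form (suc m)) m) (basis : KLin.IsBasis U (αH ◂ α′)) where
    module R = Restriction αH α′ basis
    open R using (β; coordinates; restrict)

    cδ : Vector (Form (suc m)) (suc m)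
    cδ i = coordinates (δ i)

    coordinates-spec : ∀ α → α ≋ₖ KLin.lincomb (coordinates α) β
    coordinates-spec α = proj₂ (KLin.IsBasis.spanning basis α tt)

    unique : ∀ a a′ → KLin.lincomb a β ≋ₖ KLin.lincomb a′ β → a ≋ₖ a′
    unique = KLin.coordinates-unique basis

    lincomb-cδ : ∀ α → coordinates α ≋ₖ KLin.lincomb α cδ
    lincomb-cδ α = unique _ _ λ j → K.trans (K.sym (coordinates-spec α j)) (K.sym
      (K.trans (K.sym (KLin.lincomb-assoc α cδ β j)) (K.trans
        (KLin.lincomb-congʳ α (λ i → KLin.lincomb (cδ i) β) δ (λ i j → K.sym (coordinates-spec (δ i) j)) j) (KLin.sum-δʳ j α))))

    coordinates-β : ∀ k → coordinates (β k) ≋ₖ δ k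
    coordinates-β k = unique _ _ λ j → K.trans (K.sym (coordinates-spec (β k) j)) (K.sym (KLin.sum-δˡ k (λ i → β i j)))

    Φ-var Ψ-var : Fin (suc m) → Poly (suc m)
    Φ-var i = linear (cδ i)
    Ψ-var j = linear (β j)

    Φ Ψ : Poly (suc m) → Poly (suc m)
    Φ = substitute Φ-var
    Ψ = substitute Ψ-var

    Φ-linear : ∀ α → Φ (linear α) ≈ₚ linear (coordinates α)
    Φ-linear α = ≈-trans (substitute-linear-linear Φ-var cδ (λ _ → ≈-refl) α) (linear-cong (λ j → K.sym (lincomb-cδ α j)))

    Ψ-linear : ∀ a → Ψ (linear a) ≈ₚ linear (KLin.lincomb a β)
    Ψ-linear = substitute-linear-linear Ψ-var β (λ _ → ≈-refl)

    Ψ-coordinates : ∀ α → Ψ (linear (coordinates α)) ≈ₚ linear α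
    Ψ-coordinates α = ≈-trans (Ψ-linear (coordinates α)) (linear-cong (λ j → K.sym (coordinates-spec α j)))

    ΦΨ : ∀ f → Φ (Ψ f) ≈ₚ f
    ΦΨ f = ≈-trans (substitute-substitute Φ-var Ψ-var f) (≈-trans (substitute-≈ (λ j →
      ≈-trans (Φ-linear (β j)) (≈-trans (linear-cong (coordinates-β j)) (linear-δ j))) f) (substitute-var f))

    ΨΦ : ∀ f → Ψ (Φ f) ≈ₚ f
    ΨΦ f = ≈-trans (substitute-substitute Ψ-var Φ-var f) (≈-trans (substitute-≈ (λ i →
      ≈-trans (Ψ-coordinates (δ i)) (linear-δ i)) f) (substitute-var f))

    βcδ : ∀ k → KLin.lincomb (β k) cδ ≋ₖ δ k
    βcδ k j = K.trans (K.sym (lincomb-cδ (β k) j)) (coordinates-β k j)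

    cδβ : ∀ k → KLin.lincomb (cδ k) β ≋ₖ δ k
    cδβ k j = K.sym (coordinates-spec (δ k) j)

    bar-Φ : ∀ f → bar (Φ f) ≈ₚ R.bar f
    bar-Φ f = ≈-trans (substitute-substitute (0ₚ ◂ var) Φ-var f) (substitute-≈ (λ i → bar-linear (cδ i)) f)

    module To = Change Φ-var cδ
    module From = Change Ψ-var β

    same-coordinates : ∀ α α₁ → SameHyperplane (coordinates α) (coordinates α₁) → SameHyperplane α α₁
    same-coordinates α α₁ e v = mk⇔
      (λ αv≈0 → K.trans (at v α₁) (Equivalence.to (e (λ k → β k · v)) (K.trans (K.sym (at v α)) αv≈0)))
      (λ α₁v≈0 → K.trans (at v α) (Equivalence.from (e (λ k → β k · v)) (K.trans (K.sym (at v α₁)) α₁v≈0)))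
      where
      at : ∀ v α → α · v K.≈ coordinates α · (λ k → β k · v)
      at v α = K.trans (·-congˡ {α = α} {KLin.lincomb (coordinates α) β} v (coordinates-spec α)) (·-lincombˡ (coordinates α) β v)

    other? : ∀ α → Dec (¬ SameHyperplane α αH)
    other? α = ¬? (sameHyperplane? α αH)

    configuration : Arrangement (suc m) → Configuration m
    configuration A = record
      { hyperplanes          = map coordinates others
      ; transversal          = λ a a∈ → transversal a (∈-map⁻ coordinates a∈)
      ; hyperplanes-distinct = AllPairs.map⁺ (AllPairs.map (λ {α} {α₁} α≁α₁ e → α≁α₁ (same-coordinates α α₁ e))
                                 (AllPairs.filter⁺ other? (Arrangement.distinct A)))
      ; traces               = Arrangement.forms (R.restriction A)
      ; traces-distinct      = Arrangement.distinct (R.restriction A)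
      ; trace-form           = λ λ′ λ∈ → trace-form λ′ (∈-map⁻ restrict (∈-deduplicate⁻ sameHyperplane? (map restrict others) λ∈))
      ; form-trace           = λ a a∈ → form-trace a (∈-map⁻ coordinates a∈)
      }
      where
      others = filter other? (Arrangement.forms A)
      transversal : ∀ a → (∃ λ α → α ∈ₗ others × a ≡ coordinates α) → NonZero (tail a)
      transversal .(coordinates α) (α , α∈ , ≡.refl) = R.restrict-nonZero
        (All.lookup (Arrangement.nonZero A) (proj₁ (∈-filter⁻ other? α∈))) (proj₂ (∈-filter⁻ other? {xs = Arrangement.forms A} α∈))
      trace-form : ∀ λ′ → (∃ λ α → α ∈ₗ others × λ′ ≡ restrict α) → ∃ λ a → a ∈ₗ map coordinates others × λ′ ≡ tail a
      trace-form .(restrict α) (α , α∈ , ≡.refl) = coordinates α , ∈-map⁺ coordinates α∈ , ≡.refl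
      form-trace : ∀ a → (∃ λ α → α ∈ₗ others × a ≡ coordinates α) → ∃ λ λ′ → λ′ ∈ₗ Arrangement.forms (R.restriction A) × SameHyperplane λ′ (tail a)
      form-trace .(coordinates α) (α , α∈ , ≡.refl) = find (Any.deduplicate⁺ sameHyperplane?
        {P = λ λ′ → SameHyperplane λ′ (restrict α)} (λ {x} {y} y~x x~α → same-trans {α = y} {x} {restrict α} y~x x~α)
        (lose (∈-map⁺ restrict α∈) (same-refl {α = restrict α})))

    module _ (A : Arrangement (suc m)) (αH∈ : αH ∈ₗ Arrangement.forms A) where
      open Configurations (configuration A)

      Ω¹⇒Log : ∀ {η} → η ∈ Ω¹ A → Log (To.change η)
      Ω¹⇒Log {η} η∈ = log at-H′ λ a a∈ → at-a a (∈-map⁻ coordinates a∈)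
        where
        at-form : ∀ α → α ∈ₗ Arrangement.forms A → Parallel (coordinates α) (To.change η)
        at-form α α∈ = To.change-parallel {α} {coordinates α} (Φ-linear α) (lincomb-cδ α)
          (wedge⇒parallel (All.lookup (Arrangement.nonZero A) α∈) (All.lookup η∈ α∈))
        at-a : ∀ a → (∃ λ α → α ∈ₗ filter other? (Arrangement.forms A) × a ≡ coordinates α) → Parallel a (To.change η)
        at-a .(coordinates α) (α , α∈ , ≡.refl) = at-form α (proj₁ (∈-filter⁻ other? α∈))
        open Parallel (at-form αH αH∈)
        at-H′ : ∀ j → var zero ∣ To.change η (suc j)
        at-H′ j = remainder (suc j) , (begin
          To.change η (suc j)
            ≈⟨ congruence (suc j) ⟩
          multiplier ⊗ con (coordinates αH (suc j)) ⊕ linear (coordinates αH) ⊗ remainder (suc j)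
            ≈⟨ ⊕-cong (⊗-cong ≈-refl (con-cong (coordinates-β zero (suc j)))) (⊗-cong (≈-trans (linear-cong (coordinates-β zero)) (linear-δ zero)) ≈-refl) ⟩
          multiplier ⊗ 0ₚ ⊕ var zero ⊗ remainder (suc j)
            ≈⟨ solve 3 (λ k x z → k :* :0 :+ x :* z := x :* z) ≈-refl multiplier (var zero) (remainder (suc j)) ⟩
          var zero ⊗ remainder (suc j) ∎)

      Log⇒Ω¹ : ∀ {η} → Log η → From.change η ∈ Ω¹ A
      Log⇒Ω¹ {η} (log h l) = All.tabulate λ {α} α∈ → parallel⇒wedge (at-form α α∈ em)
        where
        at-αH : Parallel αH (From.change η)
        at-αH = From.change-parallel {δ zero} {αH} {η} (≈-trans (Ψ-linear (δ zero)) (linear-cong (λ j → KLin.sum-δˡ zero (λ i → β i j))))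
          (λ j → K.sym (KLin.sum-δˡ zero (λ i → β i j)))
          (parallel (η zero) (0ₚ ◂ λ j → quotient (h j)) λ
            { zero → solve 2 (λ y l → y := y :* :1 :+ l :* :0) ≈-refl (η zero) (linear (δ zero))
            ; (suc j) → ≈-trans (equality (h j)) (≈-trans (⊗-cong (≈-sym (linear-δ zero)) ≈-refl)
                (solve 3 (λ y l q → l :* q := y :* :0 :+ l :* q) ≈-refl (η zero) (linear (δ zero)) (quotient (h j)))) })
        extraction = extract (Arrangement.forms A) (Arrangement.distinct A) αH αH∈
        at-form : ∀ α → α ∈ₗ Arrangement.forms A → Dec (SameHyperplane α αH) → Parallel α (From.change η)
        at-form α α∈ (no α≁αH) = From.change-parallel {coordinates α} {α} (Ψ-coordinates α) (coordinates-spec α)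
          (l (coordinates α) (∈-map⁺ coordinates (∈-filter⁺ other? α∈ α≁αH)))
        at-form α α∈ (yes α~αH) = is-αH (proj₂ (proj₂ (proj₂ extraction)) α α∈)
          where
          is-αH : α ≡ αH ⊎ α ∈ₗ proj₁ extraction → Parallel α (From.change η)
          is-αH (inj₁ ≡.refl) = at-αH
          is-αH (inj₂ α∈ys)   = contradiction (same-sym {α = α} {αH} α~αH) (proj₂ (proj₁ (proj₂ (proj₂ extraction)) α α∈ys))

      residue⇒ : ∀ {r} → member (R.residueIdeal A) r → InResidueIdeal r
      residue⇒ {r} (η , η∈ , g , η≈ , res) = in-residue-ideal (To.change η) (Ω¹⇒Log η∈) (≈-trans res (≈-sym (begin
        bar (To.change η zero)
          ≈⟨ bar-cong (To.change-cong η≈ zero) ⟩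
        bar (To.change (SLin.lincomb g (λ j → d (β j))) zero)
          ≈⟨ bar-Φ (SLin.lincomb (SLin.lincomb g (λ j → con ∘ β j)) (λ i → con ∘ cδ i) zero) ⟩
        R.bar (SLin.lincomb (SLin.lincomb g (λ j → con ∘ β j)) (λ i → con ∘ cδ i) zero)
          ≈⟨ substitute-cong _ (SLin.lincomb-assoc g (λ j → con ∘ β j) (λ i → con ∘ cδ i) zero) ⟨
        R.bar (SLin.lincomb g (λ k → SLin.lincomb (con ∘ β k) (λ i → con ∘ cδ i)) zero)
          ≈⟨ substitute-cong _ (SLin.lincomb-congʳ g (λ k → SLin.lincomb (con ∘ β k) (λ i → con ∘ cδ i)) SLin.δ
               (λ k j → ≈-trans (con-lincomb (β k) cδ j) (≈-trans (con-cong (βcδ k j)) (con-δ k j))) zero) ⟩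
        R.bar (sum (λ k → g k ⊗ SLin.δ k zero))
          ≈⟨ substitute-cong _ (SLin.sum-δʳ zero g) ⟩
        R.bar (g zero) ∎)))

      ⇒residue : ∀ {r} → InResidueIdeal r → member (R.residueIdeal A) r
      ⇒residue {r} (in-residue-ideal η l res) = From.change η , Log⇒Ω¹ l , (λ j → Ψ (η j)) , From.change-expand η ,
        ≈-trans res (≈-trans (bar-cong (≈-sym (ΦΨ (η zero)))) (bar-Φ (Ψ (η zero))))

      free⇒basis : ∀ {k} {b : Vector (Ω¹V (suc m)) k} → SLin.IsBasis (Ω¹ A) b → SLin.IsBasis Log (To.change ∘ b)
      free⇒basis = change-basis Φ-var Ψ-var cδ β ΦΨ ΨΦ βcδ cδβ Ω¹⇒Log Log⇒Ω¹

    restriction-basis : ∀ A {k} {b : Vector (Ω¹V m) k} → SLin.IsBasis (Ω¹ (R.restriction A)) b → SLin.IsBasis (Configurations.LogH (configuration A)) b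
    restriction-basis A = basis-≐
      (λ ξ∈ λ′ λ∈ → wedge⇒parallel (All.lookup (Arrangement.nonZero (R.restriction A)) λ∈) (All.lookup ξ∈ λ∈))
      (λ l → All.tabulate λ {λ′} λ∈ → parallel⇒wedge (l λ′ λ∈))

    module _ (A : Arrangement (suc m)) (αH∈ : αH ∈ₗ Arrangement.forms A) (X : Pred (Point m) (c ⊔ ℓ₁)) where
      vanishes? : ∀ α → Dec (X ⊆ hyperplane (restrict α))
      vanishes? α = em

      αH∈localization : αH ∈ₗ Arrangement.forms (R.localization A X)
      αH∈localization = ∈-filter⁺ vanishes? αH∈ λ {v} _ → KLin.sum-0 (λ i → restrict αH i K.* v i)
        (λ i → K.trans (K.*-congʳ (coordinates-β zero (suc i))) (K.zeroˡ _))

      isLocalization : IsLocalization (configuration A) (configuration (R.localization A X)) X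
      isLocalization = record
        { included = λ b b∈ → included b (∈-map⁻ coordinates b∈)
        ; contains = λ b b∈ → contains b (∈-map⁻ coordinates b∈)
        ; complete = λ a a∈ X⊆a → complete a X⊆a (∈-map⁻ coordinates a∈)
        }
        where
        others = filter other? (Arrangement.forms (R.localization A X))
        included : ∀ b → (∃ λ α → α ∈ₗ others × b ≡ coordinates α) → b ∈ₗ map coordinates (filter other? (Arrangement.forms A))
        included .(coordinates α) (α , α∈ , ≡.refl) = ∈-map⁺ coordinates (∈-filter⁺ other?
          (proj₁ (∈-filter⁻ vanishes? {xs = Arrangement.forms A} (proj₁ (∈-filter⁻ other? α∈)))) (proj₂ (∈-filter⁻ other? {xs = Arrangement.forms (R.localization A X)} α∈)))
        contains : ∀ b → (∃ λ α → α ∈ₗ others × b ≡ coordinates α) → X ⊆ hyperplane (tail b)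
        contains .(coordinates α) (α , α∈ , ≡.refl) = proj₂ (∈-filter⁻ vanishes? {xs = Arrangement.forms A} (proj₁ (∈-filter⁻ other? α∈)))
        complete : ∀ a → X ⊆ hyperplane (tail a) → (∃ λ α → α ∈ₗ filter other? (Arrangement.forms A) × a ≡ coordinates α) → a ∈ₗ map coordinates others
        complete .(coordinates α) X⊆α (α , α∈ , ≡.refl) = ∈-map⁺ coordinates (∈-filter⁺ other?
          (∈-filter⁺ vanishes? {xs = Arrangement.forms A} (proj₁ (∈-filter⁻ other? α∈)) X⊆α) (proj₂ (∈-filter⁻ other? {xs = Arrangement.forms A} α∈)))

  codimension-two-basis : ∀ {m} (α β : Form m) → NonZero α → NonZero β → ¬ SameHyperplane α β →
    ∃ λ r → m ≡ suc (suc r) × ∃ λ (b : Vector (Point m) r) → KLin.IsBasis (λ v → α · v K.≈ K.0# × β · v K.≈ K.0#) b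
  codimension-two-basis {zero}  α β α≉0 _ _ = contradiction (λ ()) α≉0
  codimension-two-basis {suc m} α β α≉0 β≉0 α≁β = by-dimension m ≡.refl basis isBasis pullβ≉0
    where
    open HyperplaneRestriction α α≉0
    pullβ≉0 : NonZero (pull β)
    pullβ≉0 e = α≁β (⊆⇒same {α = α} {β} α≉0 β≉0 λ {v} αv≈0 →
      K.trans (·-comm β v) (K.trans (·-congˡ {α = v} {KLin.lincomb (coordinate v) basis} β (proj₂ (KLin.IsBasis.spanning isBasis v αv≈0)))
        (K.trans (·-lincombˡ (coordinate v) basis β) (KLin.sum-0 (λ j → coordinate v j K.* (basis j · β)) (λ j → K.trans (K.*-congˡ (K.trans (·-comm (basis j) β) (e j))) (K.zeroʳ _))))))
    by-dimension : ∀ m′ → m ≡ m′ → (B : Vector (Point (suc m)) m′) → KLin.IsBasis (hyperplane α) B → NonZero (λ j → β · B j) →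
      ∃ λ r → suc m ≡ suc (suc r) × ∃ λ (b : Vector (Point (suc m)) r) → KLin.IsBasis (λ v → α · v K.≈ K.0# × β · v K.≈ K.0#) b
    by-dimension zero    _  B B-basis ≉0 = contradiction (λ ()) ≉0
    by-dimension (suc r) m≡ B B-basis ≉0 = r , ≡.cong suc m≡ , b , record
      { inside = λ i → inside-α i , inside-β i
      ; independent = λ a rel → H.independent a (independent (KLin.lincomb a H.basisᴴ) λ j →
          K.trans (K.sym (KLin.lincomb-assoc a H.basisᴴ B j)) (rel j))
      ; spanning = λ v (αv≈0 , βv≈0) → spanning′ v αv≈0 βv≈0 }
      where
      open KLin.IsBasis B-basis
      module H where
        open HyperplaneRestriction (λ j → β · B j) ≉0 using () renaming (basis to basisᴴ; isBasis to isBasisᴴ) public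
        open KLin.IsBasis isBasisᴴ public
      b : Vector (Point (suc m)) r
      b i = KLin.lincomb (H.basisᴴ i) B
      value-lincomb : ∀ (γ : Form (suc m)) a → γ · KLin.lincomb a B K.≈ (λ j → γ · B j) · a
      value-lincomb γ a = ·-lincombʳ γ a B
      inside-α : ∀ i → α · b i K.≈ K.0#
      inside-α i = K.trans (value-lincomb α (H.basisᴴ i)) (KLin.sum-0 (λ j → (α · B j) K.* H.basisᴴ i j) (λ j → K.trans (K.*-congʳ (inside j)) (K.zeroˡ _)))
      inside-β : ∀ i → β · b i K.≈ K.0#
      inside-β i = K.trans (value-lincomb β (H.basisᴴ i)) (H.inside i)
      spanning′ : ∀ v → α · v K.≈ K.0# → β · v K.≈ K.0# → ∃ λ a → v ≋ₖ KLin.lincomb a b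
      spanning′ v αv≈0 βv≈0 = proj₁ second , λ j → K.trans (proj₂ first j)
        (K.trans (KLin.lincomb-congˡ (proj₁ first) (KLin.lincomb (proj₁ second) H.basisᴴ) B (proj₂ second) j) (K.sym (KLin.lincomb-assoc (proj₁ second) H.basisᴴ B j)))
        where
        first = spanning v αv≈0
        second = H.spanning (proj₁ first) (K.trans (K.sym (value-lincomb β (proj₁ first)))
          (K.trans (·-comm β (KLin.lincomb (proj₁ first) B)) (K.trans (·-congˡ {α = KLin.lincomb (proj₁ first) B} {v} β (λ j → K.sym (proj₂ first j))) (K.trans (·-comm v β) βv≈0))))

  module _ {m r} (A B : Configuration m) (X : Pred (Point m) (c ⊔ ℓ₁)) (loc : IsLocalization A B X) (m≡ : m ≡ suc (suc r))
           {k} (G : Vector (Vector (Poly (suc m)) (suc m)) k) (G-basis : SLin.IsBasis (Configurations.Log A) G)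
           (b : Vector (Point m) r) (b-basis : KLin.IsBasis X b) where
    open Configurations B

    complete-intersection : ¬ InResidueIdeal 1ₚ → (I : Ideal (S m) (c ⊔ ℓ₁)) →
      (∀ {f} → member I f → InResidueIdeal f) → (∀ {f} → InResidueIdeal f → member I f) →
      (∃ λ (g : Vector (Poly m) 2) → Dimension.GeneratedBy (S m) I g) ×
      (∀ {_~_ : Poly m → Poly m → Set (c ⊔ ℓ₁)} (isCommutativeRing : IsCommutativeRing _~_ _⊕_ _⊗_ ⊝_ 0ₚ 1ₚ) →
        (∀ {f g} → f ~ g → member I (f ⊕ ⊝ g)) → (∀ {f g} → member I (f ⊕ ⊝ g) → f ~ g) →
        Dimension.HasKrullDimension (record { isCommutativeRing = isCommutativeRing }) r) ×
      Dimension.HasHeight (S m) I 2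
    complete-intersection 1∉J I I⇒J J⇒I = from (two-hyperplanes 1∉J)
      where
      x = proj₁ (dualForms b (KLin.IsBasis.independent b-basis))
      dual = proj₂ (dualForms b (KLin.IsBasis.independent b-basis))
      open Center b x dual using (J⊆kernel; ρ)
      open Exchange A B X loc G G-basis b b-basis x dual using (B-b; generic-generators; module GenericGenerators)
      two-hyperplanes = Center.two-hyperplanes b x dual B B-b
      from : (∃₂ λ a a′ → a ∈ₗ hyperplanes × a′ ∈ₗ hyperplanes × ¬ SameHyperplane (tail a) (tail a′)) →
             (∃ λ (g : Vector (Poly m) 2) → Dimension.GeneratedBy (S m) I g) ×
             (∀ {_~_ : Poly m → Poly m → Set (c ⊔ ℓ₁)} (isCommutativeRing : IsCommutativeRing _~_ _⊕_ _⊗_ ⊝_ 0ₚ 1ₚ) →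
               (∀ {f g} → f ~ g → member I (f ⊕ ⊝ g)) → (∀ {f g} → member I (f ⊕ ⊝ g) → f ~ g) →
               Dimension.HasKrullDimension (record { isCommutativeRing = isCommutativeRing }) r) ×
             Dimension.HasHeight (S m) I 2
      from (a , a′ , a∈ , a′∈ , a≁a′) =
        (f₁ ◂ (λ _ → f₂) , generated) ,
        (λ isCommutativeRing → quotient-dimension b x dual m≡ α β α≉0 α∤β αb βb I I⊆ primes isCommutativeRing) ,
        height-two b x dual m≡ α β α≉0 α∤β αb βb I I⊆ primes
        where
        α β : Form m
        α = tail a
        β = tail a′
        α≉0 = transversal a a∈
        β≉0 = transversal a′ a′∈
        αb : ∀ j → α · b j K.≈ K.0#
        αb j = B-b j a a∈
        βb : ∀ j → β · b j K.≈ K.0#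
        βb j = B-b j a′ a′∈
        α∤β : ¬ linear α ∣ linear β
        α∤β α∣β = a≁a′ (∣⇒same {α = α} {β} α≉0 β≉0 α∣β)
        open GenericGenerators (generic-generators m≡ a a∈)
        gens = Generators.two-generators b x dual α β αb βb
          (Center.Codimension2.kernel⊆ b x dual m≡ α β α≉0 β≉0 a≁a′ αb βb) B B-b number≤2 generator inJ q q∉ generates
        f₁ = proj₁ gens
        f₂ = proj₁ (proj₂ gens)
        generated : Dimension.GeneratedBy (S m) I (f₁ ◂ (λ (_ : Fin 1) → f₂))
        generated = (λ {f} f∈I → combination f (proj₂ (proj₂ (proj₂ (proj₂ gens))) f (I⇒J f∈I))) ,
          λ { (s , eq) → Ideal.resp I (≈-sym eq) (Ideal.+-closed I (Ideal.*-closed I (s zero) (J⇒I (proj₁ (proj₂ (proj₂ gens)))))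
            (Ideal.+-closed I (Ideal.*-closed I (s (suc zero)) (J⇒I (proj₁ (proj₂ (proj₂ (proj₂ gens)))))) (Ideal.0-closed I))) }
          where
          combination : ∀ f → member ⟪ f₁ , f₂ ⟫ f → ∃ λ (s : Vector (Poly m) 2) → f ≈ₚ sum (λ i → s i ⊗ (f₁ ◂ (λ (_ : Fin 1) → f₂)) i)
          combination f (s , t , eq) = s ◂ (λ _ → t) , ≈-trans eq (⊕-cong ≈-refl (≈-sym (SR.+-identityʳ _)))
        I⊆ : ∀ f → member I f → ρ 0 f ≈ₚ 0ₚ
        I⊆ f f∈I = J⊆kernel B B-b 1∉J f (I⇒J f∈I)
        primes : ∀ (P : Dimension.PrimeIdeal (S m)) → member I ⊆ Dimension.PrimeIdeal.carrier P →
                 ∀ f → ρ 0 f ≈ₚ 0ₚ → Dimension.PrimeIdeal.carrier P f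
        primes P I⊆P f ρf≈0 = first (product-form tails (Ideal.resp P.ideal (bar-product hyperplanes) (I⊆P (J⇒I (ResidueElements.P̄∈J B)))))
          where
          module P = Dimension.PrimeIdeal P
          product-form : ∀ xs → P.carrier (product xs) → ∃ λ y → y ∈ₗ xs × P.carrier (linear y)
          product-form []       1∈P = contradiction 1∈P P.proper
          product-form (y ∷ ys) p   = [ (λ y∈P → y , here ≡.refl , y∈P) , later ]′ (P.prime (linear y) (product ys) p)
            where
            later : P.carrier (product ys) → ∃ λ z → z ∈ₗ y ∷ ys × P.carrier (linear z)
            later q = let z , z∈ , z∈P = product-form ys q in z , there z∈ , z∈P
          third : ∀ {φ ψ} (a₁ a₂ : Form (suc m)) → a₁ ∈ₗ hyperplanes → a₂ ∈ₗ hyperplanes → φ ≡ tail a₁ → ψ ≡ tail a₂ →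
                  ¬ SameHyperplane φ ψ → P.carrier (linear φ) → P.carrier (linear ψ) → P.carrier f
          third a₁ a₂ a₁∈ a₂∈ ≡.refl ≡.refl φ≁ψ φ∈P ψ∈P = combine (Center.Codimension2.kernel⊆ b x dual m≡ (tail a₁) (tail a₂)
              (transversal a₁ a₁∈) (transversal a₂ a₂∈) φ≁ψ (λ j → B-b j a₁ a₁∈) (λ j → B-b j a₂ a₂∈) f ρf≈0)
            where
            combine : member ⟪ linear (tail a₁) , linear (tail a₂) ⟫ f → P.carrier f
            combine (s , t , eq) = Ideal.resp P.ideal (≈-sym eq) (Ideal.+-closed P.ideal (Ideal.*-closed P.ideal s φ∈P) (Ideal.*-closed P.ideal t ψ∈P))
          first : (∃ λ y → y ∈ₗ tails × P.carrier (linear y)) → P.carrier f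
          first (φ , φ∈ , φ∈P) = second (∈-map⁻ tail φ∈)
            where
            second : (∃ λ a₁ → a₁ ∈ₗ hyperplanes × φ ≡ tail a₁) → P.carrier f
            second (a₁ , a₁∈ , ≡.refl) = next (product-form (filter (¬? ∘ sameHyperplane? (tail a₁)) tails) (I⊆P (J⇒I (ResidueElements.pair∈J B a₁ a₁∈))))
              where
              next : (∃ λ ψ → ψ ∈ₗ filter (¬? ∘ sameHyperplane? (tail a₁)) tails × P.carrier (linear ψ)) → P.carrier f
              next (ψ , ψ∈ , ψ∈P) = last (∈-map⁻ tail (proj₁ (∈-filter⁻ (¬? ∘ sameHyperplane? (tail a₁)) ψ∈)))
                where
                last : (∃ λ a₂ → a₂ ∈ₗ hyperplanes × ψ ≡ tail a₂) → P.carrier f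
                last (a₂ , a₂∈ , e) = third a₁ a₂ a₁∈ a₂∈ ≡.refl e (proj₂ (∈-filter⁻ (¬? ∘ sameHyperplane? (tail a₁)) {xs = tails} ψ∈)) φ∈P ψ∈P

  module _ {m} (A : Arrangement (suc m)) (αH : Form (suc m)) (αH∈ : αH ∈ₗ Arrangement.forms A)
           (α′ : Vector (Form (suc m)) m) (basis : KLin.IsBasis U (αH ◂ α′)) where
    open Coordinates αH α′ basis
    private
      module A = Configurations (configuration A)
      module A_ (X : Pred (Point m) (c ⊔ ℓ₁)) = Configurations (configuration (R.localization A X))

    module _ (A-free : IsFree A) (A^H-free : IsFree (R.restriction A)) where
      private
        G : Vector (Vector (Poly (suc m)) (suc m)) (proj₁ A-free)
        G = To.change ∘ proj₁ (proj₂ A-free)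
        G-basis : SLin.IsBasis A.Log G
        G-basis = free⇒basis A αH∈ (proj₂ (proj₂ A-free))

        module _ (X : Pred (Point m) (c ⊔ ℓ₁)) where
          localized⇒ : ∀ {r} → member (R.residueIdeal (R.localization A X)) r → A_.InResidueIdeal X r
          localized⇒ = residue⇒ (R.localization A X) (αH∈localization A αH∈ X)
          ⇒localized : ∀ {r} → A_.InResidueIdeal X r → member (R.residueIdeal (R.localization A X)) r
          ⇒localized = ⇒residue (R.localization A X) (αH∈localization A αH∈ X)

      forward : ∀ {f} → member (R.residueIdeal A) f → ∀ (X : ∃ (R.Ξ₃ A)) → member (R.residueIdeal (R.localization A (proj₁ X))) f
      forward {f} f∈ (X , _) = ⇒localized X (J⊆localization (isLocalization A αH∈ X) f (residue⇒ A αH∈ f∈))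

      backward : ∀ {f} → (∀ (X : ∃ (R.Ξ₃ A)) → member (R.residueIdeal (R.localization A (proj₁ X))) f) → member (R.residueIdeal A) f
      backward {f} f∈ = ⇒residue A αH∈ (localizations⇒J (configuration A) G G-basis (proj₁ (proj₂ A^H-free)) (restriction-basis A (proj₂ (proj₂ A^H-free))) f local)
        where
        local : ∀ a b → a ∈ₗ A.hyperplanes → b ∈ₗ A.hyperplanes → ¬ SameHyperplane (tail a) (tail b) →
                ∃ λ X → ∃ λ B → IsLocalization (configuration A) B X ×
                  (∀ v → v ∈ X → tail a · v K.≈ K.0# × tail b · v K.≈ K.0#) × Configurations.InResidueIdeal B f
        local a b a∈ b∈ a≁b = X , configuration (R.localization A X) , isLocalization A αH∈ X , X⊆ ,
            localized⇒ X (by-cases em)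
          where
          λ₁ λ₂ : Form m
          λ₁ = proj₁ (A.form-trace a a∈)
          λ₂ = proj₁ (A.form-trace b b∈)
          λ₁∈ = proj₁ (proj₂ (A.form-trace a a∈))
          λ₂∈ = proj₁ (proj₂ (A.form-trace b b∈))
          λ₁~a : SameHyperplane λ₁ (tail a)
          λ₁~a = proj₂ (proj₂ (A.form-trace a a∈))
          λ₂~b : SameHyperplane λ₂ (tail b)
          λ₂~b = proj₂ (proj₂ (A.form-trace b b∈))
          X : Pred (Point m) (c ⊔ ℓ₁)
          X = intersection (λ₁ ∷ λ₂ ∷ [])
          X⊆ : ∀ v → v ∈ X → tail a · v K.≈ K.0# × tail b · v K.≈ K.0#
          X⊆ v (p ∷ q ∷ []) = Equivalence.to (λ₁~a v) p , Equivalence.to (λ₂~b v) q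
          X∈L : L (R.restriction A) X
          X∈L = λ₁ ∷ λ₂ ∷ [] , (λ { (here ≡.refl) → λ₁∈ ; (there (here ≡.refl)) → λ₂∈ }) , (λ p → p) , (λ p → p)
          X-basis = codimension-two-basis (tail a) (tail b) (A.transversal a a∈) (A.transversal b b∈) a≁b
          r = proj₁ X-basis
          X-dimension : HasDimension X r
          X-dimension = proj₁ (proj₂ (proj₂ X-basis)) , record
            { inside = λ i → Equivalence.from (λ₁~a _) (proj₁ (inside i)) ∷ Equivalence.from (λ₂~b _) (proj₂ (inside i)) ∷ []
            ; independent = independent
            ; spanning = λ v v∈X → spanning v (X⊆ v v∈X) }
            where open KLin.IsBasis (proj₂ (proj₂ (proj₂ X-basis)))
          by-cases : Dec (member (R.residueIdeal (R.localization A X)) ≐ U) → member (R.residueIdeal (R.localization A X)) f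
          by-cases (yes J≐U) = proj₂ J≐U tt
          by-cases (no J≭U)  = f∈ (X , (X∈L , J≭U) , r , X-dimension ,
            ≡.trans (ℕ.+-comm r 3) (≡.cong suc (≡.sym (proj₁ (proj₂ X-basis)))))

      localization-residue-ideal : ∀ X (X∈Ξ₃ : X ∈ R.Ξ₃ A) →
           (∃ λ (g : Vector (Poly m) 2) → Dimension.GeneratedBy (S m) (R.residueIdeal (R.localization A X)) g) ×
           (∀ {_~_ : Poly m → Poly m → Set (c ⊔ ℓ₁)} (isCommutativeRing : IsCommutativeRing _~_ _⊕_ _⊗_ ⊝_ 0ₚ 1ₚ) →
             (∀ {f g} → f ~ g → member (R.residueIdeal (R.localization A X)) (f ⊕ ⊝ g)) → (∀ {f g} → member (R.residueIdeal (R.localization A X)) (f ⊕ ⊝ g) → f ~ g) →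
             Dimension.HasKrullDimension (record { isCommutativeRing = isCommutativeRing }) (proj₁ (proj₂ X∈Ξ₃))) ×
           Dimension.HasHeight (S m) (R.residueIdeal (R.localization A X)) 2
      localization-residue-ideal X ((_ , J≭U) , r , (b , b-basis) , r+3≡) = complete-intersection (configuration A) (configuration (R.localization A X)) X
        (isLocalization A αH∈ X) (ℕ.suc-injective (≡.sym (≡.trans (ℕ.+-comm 3 r) r+3≡))) G G-basis b b-basis
        (λ 1∈J → J≭U ((λ _ → tt) , λ {f} _ → Ideal.resp (R.residueIdeal (R.localization A X)) (SR.*-identityʳ f)
          (Ideal.*-closed (R.residueIdeal (R.localization A X)) f (⇒localized X 1∈J))))
        (R.residueIdeal (R.localization A X)) (localized⇒ X) (⇒localized X)

open import Data.Vec.Functional using (_∷_)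

corollary5p4 : ∀ {c ℓ₁ ℓ₂} (em : ∀ {a} → ExcludedMiddle a) (𝕂 : HeytingField c ℓ₁ ℓ₂) →
    let open Arrangements em 𝕂 in
    ∀ {m} (A : Arrangement (suc m)) (αH : Form (suc m)) → αH ∈ₗ forms A →
    (α′ : Vector (Form (suc m)) m) (basis : KLin.IsBasis U (αH ∷ α′)) →
    let open Restriction αH α′ basis in
    IsFree A → IsFree (restriction A) →
    (member (residueIdeal A) ≐ ⋂ (∃ (Ξ₃ A)) (λ X → member (residueIdeal (localization A (proj₁ X))))) ×
    (∀ X → X ∈ Ξ₃ A →
      IsCompleteIntersection (residueIdeal (localization A X)) ×
      Dimension.HasHeight S̄ (residueIdeal (localization A X)) 2)
corollary5p4 em 𝕂 A αH αH∈A α′ basis A-free A^H-free =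
  ((λ {f} f∈J X → Main.forward A αH αH∈A α′ basis A-free A^H-free {f} f∈J X) ,
   (λ {f} f∈ → Main.backward A αH αH∈A α′ basis A-free A^H-free {f} f∈)) ,
  λ X X∈Ξ₃ →
    let J = Main.localization-residue-ideal A αH αH∈A α′ basis A-free A^H-free X X∈Ξ₃ in
    (2 , proj₁ (proj₂ X∈Ξ₃) , (proj₁ (proj₁ J) , (λ {f} → proj₁ (proj₂ (proj₁ J)) {f}) , (λ {f} → proj₂ (proj₂ (proj₁ J)) {f})) ,
      proj₁ (proj₂ J) _ (λ p → p) (λ p → p) , ℕ.suc-injective (≡.trans (≡.sym (ℕ.+-suc (proj₁ (proj₂ X∈Ξ₃)) 2)) (proj₂ (proj₂ (proj₂ X∈Ξ₃))))) ,
    proj₂ (proj₂ J)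
  where
  module Main = Residues em 𝕂
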